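{- Let $p(n)$ denote the number of partitions of the positive integer $n$, and for $n\geq 1$ let $$u_n=\frac{p(n+1)\,p(n-1)}{p(n)^2}.$$ Then for every integer $n\geq 95$, $$4(1-u_n)(1-u_{n+1})-(1-u_n u_{n+1})^2>0.$$
   Context: A partition of a positive integer $n$ is a nonincreasing sequence of positive integers summing to $n$; $p(n)$ is the number of such partitions, with $p(0)=1$. -}

module Defs where

open import Data.Nat using (ℕ; zero; suc; _≤_; _<_; _∸_; _≤?_; _^_; _≥_)
open import Data.Nat.ListAction using (sum)
import Data.Nat as ℕ
open import Data.List using (List; []; _∷_; length; map; concatMap; upTo)
open import Data.List.Relation.Unary.All using (All)
open import Data.List.Relation.Unary.Linked using (Linked)
open import Data.Integer using (ℤ; +_)
open import Data.Rational using (ℚ; _/_)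
open import Relation.Nullary using (yes; no; Dec)
open import Relation.Binary.PropositionalEquality using (_≡_)

record IsPartition (n : ℕ) (λs : List ℕ) : Set where
  field
    positive    : All (1 ≤_) λs
    nonincr     : Linked (λ a b → b ≤ a) λs
    sums        : sum λs ≡ n

-- partsBounded n k : the list of all nonincreasing lists of positive
-- integers summing to n whose parts are all ≤ k.
-- Recursion: choose first part j ∈ {1..min(n,k)}, then the rest is a
-- partition of n ∸ j with parts ≤ j.  Defined by recursion on a fuel
-- argument (fuel = n suffices).
partsFuel : ℕ → ℕ → ℕ → List (List ℕ)
partsFuel _        zero    _ = [] ∷ []
partsFuel zero     (suc n) _ = []
partsFuel (suc f)  (suc n) k =
  concatMap (λ i → let j = suc i in
                   choose j (j ≤? k))
            (upTo (suc n))
  where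
  choose : (j : ℕ) → Dec (j ≤ k) → List (List ℕ)
  choose j (yes _) = map (j ∷_) (partsFuel f (suc n ∸ j) j)
  choose j (no  _) = []

p : ℕ → ℕ
p n = length (partsFuel n n n)

-- Division of naturals into ℚ; the denominator is always nonzero in use
-- (p n ≥ 1); the zero case is a dummy value 0.
_÷ℕ_ : ℕ → ℕ → ℚ
a ÷ℕ zero  = + 0 / 1
a ÷ℕ suc d = + a / suc d

u : ℕ → ℚ
u n = (p (suc n) ℕ.* p (n ∸ 1)) ÷ℕ (p n ^ 2)

-- Let ρ n = p(n-1) / p(n), with differences δ n = ρ n - ρ(n-1) and ε n = δ n - δ(n-1). As u n = ρ n / ρ(n+1),
-- multiplying the claim by ρ(n+1) ρ(n+2)² turns it into 4 δ(n+1) δ(n+2)² > ε(n+2)² ρ(n+1). For large n this holds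
-- because δ n is of the order y³ and ε n at most of the order y⁵, where y = 1 - ρ n is small.
--
-- These bounds come from n p(n) = Σ σ(k) p(n-k), that is n = Σ σ(k) R n k, where R n k = p(n-k) / p(n) is the product
-- ρ n ρ(n-1) ⋯ ρ(n-k+1). The partial sums of σ are within constant factors of x², and R n k is squeezed between
-- geometric weights, so all moments Σ k^a σ(k) R n k are known up to constants. Differencing the identity once and twice
-- yields weighted averages of δ and ε, and the bounds on δ and ε propagate by strong induction on n.
--
-- For n up to 20200 the bounds that start the induction, and the claim itself, are checked on a table of p.
module Submission where

-- The obstacle is the bound on ε. Up to small terms, ε n is the mean of the earlier ε(n-k) with
-- weights σ(k) R n k of total mass n, so a hypothesis |ε| ≤ C y⁵ returns slightly more than C y⁵
-- and the induction does not close by itself. The gain comes from the identity for δ: it bounds a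
-- second linear combination of earlier ε, with weights `W i`, by a smaller multiple of y² than the
-- hypothesis alone would give. Subtracting a multiple of it lowers the total weight of the mean.
-- Only σ(k) ≥ k is available to keep the remaining coefficients essentially nonnegative, so the
-- second relation is taken at an index about 1/(2y) further back, where k is comparable to 1/y. The
-- final comparison is y⁹ against y¹⁰: 4 · 0.2487³ = 0.0615 against 2.6² y. This forces y ≤ 0.009,
-- hence n near 20000, and decides how far the table must reach. The asymptotic formula for p
-- predicts δ ≈ 0.304 y³ and ε ≈ -0.277 y⁵, so the constants 0.2487, 0.38 and 2.6 leave ample room.

-- Ordered commutative rings: identities by normalisation, inequalities by certificates

module OrderedRings where
  open import Algebra.Structures using (IsCommutativeRing)
  open import Data.Bool using (Bool; true; _∧_; if_then_else_; T)
  open import Data.List using (List; []; _∷_)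
  open import Data.Nat as ℕ using (ℕ; zero; suc)
  import Data.Nat.Properties as ℕₚ
  open import Data.Product using (_×_; _,_)
  open import Data.Sum using (_⊎_)
  open import Data.Unit using (⊤; tt)
  open import Relation.Nullary using (¬_; yes; no)
  open import Relation.Binary.PropositionalEquality
  open ≡-Reasoning

  -- The only instance will be ℚ; arguing over a record keeps the arithmetic of fractions opaque.
  -- Strict positivity is expressed throughout as `¬ (x ≤ 0#)`, which is why cancellation has this
  -- form.
  record OrderedRing : Set₁ where
    infixl 6 _+_
    infixl 7 _*_
    infix  8 -_
    infix  4 _≤_
    field
      A : Set
      _+_ _*_ : A → A → A
      -_ : A → A
      0# 1# : A
      isCommutativeRing : IsCommutativeRing _≡_ _+_ _*_ -_ 0# 1#
      _≤_ : A → A → Set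
      ≤-refl : ∀ {x} → x ≤ x
      ≤-trans : ∀ {x y z} → x ≤ y → y ≤ z → x ≤ z
      ≤-antisym : ∀ {x y} → x ≤ y → y ≤ x → x ≡ y
      ≤-total : ∀ x y → x ≤ y ⊎ y ≤ x
      +-mono-≤ : ∀ {x y u v} → x ≤ y → u ≤ v → x + u ≤ y + v
      *-nonneg : ∀ {x y} → 0# ≤ x → 0# ≤ y → 0# ≤ x * y
      0≤1 : 0# ≤ 1#
      *-cancel : ∀ {x y} → ¬ (x ≤ 0#) → 0# ≤ x * y → 0# ≤ y
      1≰0 : ¬ (1# ≤ 0#)

  module Ordered (𝓡 : OrderedRing) where
    open OrderedRing 𝓡 public
    open IsCommutativeRing isCommutativeRing public
      using (+-assoc; +-comm; +-identityˡ; +-identityʳ; -‿inverseˡ; -‿inverseʳ;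
             *-assoc; *-comm; *-identityˡ; *-identityʳ; distribˡ; distribʳ; zeroˡ; zeroʳ)

    infixl 6 _-_
    _-_ : A → A → A
    x - y = x + - y

    infixr 8 _^_
    _^_ : A → ℕ → A
    x ^ zero = 1#
    x ^ suc n = x * x ^ n

    reflexive : ∀ {x y} → x ≡ y → x ≤ y
    reflexive refl = ≤-refl

    +-interchange : ∀ a b c d → (a + b) + (c + d) ≡ (a + c) + (b + d)
    +-interchange a b c d = begin
      (a + b) + (c + d)  ≡⟨ +-assoc a b (c + d) ⟩
      a + (b + (c + d))  ≡⟨ cong (a +_) (sym (+-assoc b c d)) ⟩
      a + ((b + c) + d)  ≡⟨ cong (λ v → a + (v + d)) (+-comm b c) ⟩
      a + ((c + b) + d)  ≡⟨ cong (a +_) (+-assoc c b d) ⟩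
      a + (c + (b + d))  ≡⟨ sym (+-assoc a c (b + d)) ⟩
      (a + c) + (b + d)  ∎

    *-interchange : ∀ a b c d → (a * b) * (c * d) ≡ (a * c) * (b * d)
    *-interchange a b c d = begin
      (a * b) * (c * d)  ≡⟨ *-assoc a b (c * d) ⟩
      a * (b * (c * d))  ≡⟨ cong (a *_) (sym (*-assoc b c d)) ⟩
      a * ((b * c) * d)  ≡⟨ cong (λ v → a * (v * d)) (*-comm b c) ⟩
      a * ((c * b) * d)  ≡⟨ cong (a *_) (*-assoc c b d) ⟩
      a * (c * (b * d))  ≡⟨ sym (*-assoc a c (b * d)) ⟩
      (a * c) * (b * d)  ∎

    inverse-unique : ∀ a b → a + b ≡ 0# → b ≡ - a
    inverse-unique a b e = begin
      b                ≡⟨ sym (+-identityˡ b) ⟩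
      0# + b           ≡⟨ cong (_+ b) (sym (-‿inverseˡ a)) ⟩
      (- a + a) + b    ≡⟨ +-assoc (- a) a b ⟩
      - a + (a + b)    ≡⟨ cong (- a +_) e ⟩
      - a + 0#         ≡⟨ +-identityʳ (- a) ⟩
      - a              ∎

    -distrib-+ : ∀ a b → - a + - b ≡ - (a + b)
    -distrib-+ a b = inverse-unique (a + b) (- a + - b)
      (trans (+-interchange a b (- a) (- b)) (trans (cong₂ _+_ (-‿inverseʳ a) (-‿inverseʳ b)) (+-identityˡ 0#)))

    -‿*ˡ : ∀ a b → - a * b ≡ - (a * b)
    -‿*ˡ a b = inverse-unique (a * b) (- a * b)
      (trans (sym (distribʳ b a (- a))) (trans (cong (_* b) (-‿inverseʳ a)) (zeroˡ b)))

    -‿*ʳ : ∀ a b → a * - b ≡ - (a * b)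
    -‿*ʳ a b = trans (*-comm a (- b)) (trans (-‿*ˡ b a) (cong -_ (*-comm b a)))

    -‿invol : ∀ a → - - a ≡ a
    -‿invol a = sym (inverse-unique (- a) a (-‿inverseˡ a))

    abstract
      -- Abstract, so that a numeral of the ring never unfolds into a sum of ones; the normaliser
      -- calculates with the natural numbers behind it.
      # : ℕ → A
      # zero = 0#
      # (suc n) = 1# + # n

      #-0 : # 0 ≡ 0#
      #-0 = refl

      #-suc : ∀ n → # (suc n) ≡ 1# + # n
      #-suc n = refl

      #-+ : ∀ m n → # (m ℕ.+ n) ≡ # m + # n
      #-+ zero n = sym (+-identityˡ (# n))
      #-+ (suc m) n = trans (cong (1# +_) (#-+ m n)) (sym (+-assoc 1# (# m) (# n)))

      #-* : ∀ m n → # (m ℕ.* n) ≡ # m * # n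
      #-* zero n = sym (zeroˡ (# n))
      #-* (suc m) n = begin
        # (n ℕ.+ m ℕ.* n)        ≡⟨ #-+ n (m ℕ.* n) ⟩
        # n + # (m ℕ.* n)        ≡⟨ cong₂ _+_ (sym (*-identityˡ (# n))) (#-* m n) ⟩
        1# * # n + # m * # n     ≡⟨ sym (distribʳ (# n) 1# (# m)) ⟩
        (1# + # m) * # n         ∎

      #-nonneg : ∀ n → 0# ≤ # n
      #-nonneg zero = ≤-refl
      #-nonneg (suc n) = ≤-trans (reflexive (sym (+-identityˡ 0#))) (+-mono-≤ 0≤1 (#-nonneg n))

      #-1 : # 1 ≡ 1#
      #-1 = +-identityʳ 1#

    ≤⇒0≤ : ∀ {x y} → x ≤ y → 0# ≤ y - x
    ≤⇒0≤ {x} {y} h = ≤-trans (reflexive (sym (-‿inverseʳ x))) (+-mono-≤ h ≤-refl)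

    0≤⇒≤ : ∀ {x y} → 0# ≤ y - x → x ≤ y
    0≤⇒≤ {x} {y} h = ≤-trans (reflexive (sym (+-identityˡ x)))
      (≤-trans (+-mono-≤ h ≤-refl)
        (reflexive (trans (+-assoc y (- x) x) (trans (cong (y +_) (-‿inverseˡ x)) (+-identityʳ y)))))

    #-pos : ∀ n → ¬ (# (suc n) ≤ 0#)
    #-pos n h = 1≰0 (≤-trans (≤-trans (reflexive (sym (+-identityʳ 1#))) (+-mono-≤ ≤-refl (#-nonneg n)))
                       (≤-trans (reflexive (sym (#-suc n))) h))

    infixl 6 _:+_ _:-_
    infixl 7 _:*_
    infixr 8 _:^_
    data Expr : Set where
      var con : ℕ → Expr
      _:+_ _:-_ _:*_ : Expr → Expr → Expr
      _:^_ : Expr → ℕ → Expr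

    Env : Set
    Env = List A

    lookupE : Env → ℕ → A
    -- The default 1 agrees with `⟦_⟧ᵐ`, where variables missing from the environment contribute the
    -- factor 1; so soundness needs no hypothesis on scoping.
    lookupE [] _ = 1#
    lookupE (x ∷ env) zero = x
    lookupE (x ∷ env) (suc i) = lookupE env i

    ⟦_⟧ : Expr → Env → A
    ⟦ var i ⟧ ξ = lookupE ξ i
    ⟦ con n ⟧ ξ = # n
    ⟦ e :+ f ⟧ ξ = ⟦ e ⟧ ξ + ⟦ f ⟧ ξ
    ⟦ e :- f ⟧ ξ = ⟦ e ⟧ ξ - ⟦ f ⟧ ξ
    ⟦ e :* f ⟧ ξ = ⟦ e ⟧ ξ * ⟦ f ⟧ ξ
    ⟦ e :^ n ⟧ ξ = ⟦ e ⟧ ξ ^ n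

    Mono : Set
    Mono = List ℕ

    -- The coefficient (a , b) stands for a - b.
    Poly : Set
    Poly = List (Mono × ℕ × ℕ)

    -- Only `same` carries evidence. Soundness of the merge needs equality of monomials when
    -- coefficients are added, and never that the lists are sorted: an unsorted list could at worst
    -- leave like terms apart.
    data Cmp (m n : Mono) : Set where
      before after : Cmp m n
      same : m ≡ n → Cmp m n

    cmp : ∀ m n → Cmp m n
    cmp [] [] = same refl
    cmp [] (_ ∷ _) = before
    cmp (_ ∷ _) [] = after
    cmp (a ∷ m) (b ∷ n) with a ℕ.≟ b
    ... | no _ = if a ℕ.<ᵇ b then before else after
    ... | yes refl with cmp m n
    ...   | before = before
    ...   | after = after
    ...   | same refl = same refl

    mutual
      _⊞_ : Poly → Poly → Poly
      [] ⊞ q = q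
      (t ∷ p) ⊞ q = insert t p q

      insert : Mono × ℕ × ℕ → Poly → Poly → Poly
      insert t p [] = t ∷ p
      insert (m , a , b) p ((n , c , d) ∷ q) with cmp m n
      ... | before = (m , a , b) ∷ (p ⊞ ((n , c , d) ∷ q))
      ... | after = (n , c , d) ∷ insert (m , a , b) p q
      ... | same _ = (m , a ℕ.+ c , b ℕ.+ d) ∷ (p ⊞ q)

    ⊟_ : Poly → Poly
    ⊟ [] = []
    ⊟ ((m , a , b) ∷ p) = (m , b , a) ∷ ⊟ p

    _·_ : Mono → Mono → Mono
    [] · n = n
    (a ∷ m) · [] = a ∷ m
    (a ∷ m) · (b ∷ n) = (a ℕ.+ b) ∷ (m · n)

    scale : Mono × ℕ × ℕ → Poly → Poly
    scale _ [] = []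
    scale (m , a , b) ((n , c , d) ∷ p) =
      (m · n , a ℕ.* c ℕ.+ b ℕ.* d , a ℕ.* d ℕ.+ b ℕ.* c) ∷ scale (m , a , b) p

    _⊠_ : Poly → Poly → Poly
    [] ⊠ q = []
    (t ∷ p) ⊠ q = scale t q ⊞ (p ⊠ q)

    _⊠^_ : Poly → ℕ → Poly
    p ⊠^ zero = ([] , 1 , 0) ∷ []
    p ⊠^ suc n = p ⊠ (p ⊠^ n)

    varMono : ℕ → Mono
    varMono zero = 1 ∷ []
    varMono (suc i) = 0 ∷ varMono i

    norm : Expr → Poly
    norm (var i) = (varMono i , 1 , 0) ∷ []
    norm (con n) = ([] , n , 0) ∷ []
    norm (e :+ f) = norm e ⊞ norm f
    norm (e :- f) = norm e ⊞ (⊟ norm f)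
    norm (e :* f) = norm e ⊠ norm f
    norm (e :^ n) = norm e ⊠^ n

    isZero : Poly → Bool
    isZero [] = true
    isZero ((_ , a , b) ∷ p) = (a ℕ.≡ᵇ b) ∧ isZero p

    ⟦_⟧ᵐ : Mono → Env → A
    ⟦ [] ⟧ᵐ ξ = 1#
    ⟦ _ ∷ _ ⟧ᵐ [] = 1#
    ⟦ a ∷ m ⟧ᵐ (x ∷ ξ) = x ^ a * ⟦ m ⟧ᵐ ξ

    ⟦_⟧ᵖ : Poly → Env → A
    ⟦ [] ⟧ᵖ ξ = 0#
    ⟦ (m , a , b) ∷ p ⟧ᵖ ξ = (# a - # b) * ⟦ m ⟧ᵐ ξ + ⟦ p ⟧ᵖ ξ

    ^-+ : ∀ x a b → x ^ (a ℕ.+ b) ≡ x ^ a * x ^ b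
    ^-+ x zero b = sym (*-identityˡ _)
    ^-+ x (suc a) b = trans (cong (x *_) (^-+ x a b)) (sym (*-assoc x _ _))

    diff-+ : ∀ a b c d → (# a - # b) + (# c - # d) ≡ # (a ℕ.+ c) - # (b ℕ.+ d)
    diff-+ a b c d = trans (+-interchange (# a) (- # b) (# c) (- # d))
      (cong₂ _+_ (sym (#-+ a c)) (trans (-distrib-+ (# b) (# d)) (cong -_ (sym (#-+ b d)))))

    diff-* : ∀ a b c d → (# a - # b) * (# c - # d)
                       ≡ # (a ℕ.* c ℕ.+ b ℕ.* d) - # (a ℕ.* d ℕ.+ b ℕ.* c)
    diff-* a b c d = begin
      (# a - # b) * (# c - # d)
        ≡⟨ distribʳ (# c - # d) (# a) (- # b) ⟩
      # a * (# c - # d) + - # b * (# c - # d)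
        ≡⟨ cong₂ _+_ (distribˡ (# a) (# c) (- # d)) (distribˡ (- # b) (# c) (- # d)) ⟩
      (# a * # c + # a * - # d) + (- # b * # c + - # b * - # d)
        ≡⟨ cong ((# a * # c + # a * - # d) +_) (+-comm (- # b * # c) (- # b * - # d)) ⟩
      (# a * # c + # a * - # d) + (- # b * - # d + - # b * # c)
        ≡⟨ +-interchange (# a * # c) (# a * - # d) (- # b * - # d) (- # b * # c) ⟩
      (# a * # c + - # b * - # d) + (# a * - # d + - # b * # c)
        ≡⟨ cong₂ _+_ left right ⟩
      # (a ℕ.* c ℕ.+ b ℕ.* d) - # (a ℕ.* d ℕ.+ b ℕ.* c) ∎
      where
      left : # a * # c + - # b * - # d ≡ # (a ℕ.* c ℕ.+ b ℕ.* d)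
      left = trans (cong₂ _+_ (sym (#-* a c))
               (trans (-‿*ˡ (# b) (- # d)) (trans (cong -_ (-‿*ʳ (# b) (# d)))
                 (trans (-‿invol (# b * # d)) (sym (#-* b d))))))
             (sym (#-+ (a ℕ.* c) (b ℕ.* d)))
      right : # a * - # d + - # b * # c ≡ - # (a ℕ.* d ℕ.+ b ℕ.* c)
      right = trans (cong₂ _+_ (trans (-‿*ʳ (# a) (# d)) (cong -_ (sym (#-* a d))))
                               (trans (-‿*ˡ (# b) (# c)) (cong -_ (sym (#-* b c)))))
              (trans (-distrib-+ (# (a ℕ.* d)) (# (b ℕ.* c)))
                     (cong -_ (sym (#-+ (a ℕ.* d) (b ℕ.* c)))))

    mutual
      ⊞-sound : ∀ ξ p q → ⟦ p ⊞ q ⟧ᵖ ξ ≡ ⟦ p ⟧ᵖ ξ + ⟦ q ⟧ᵖ ξ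
      ⊞-sound ξ [] q = sym (+-identityˡ _)
      ⊞-sound ξ (t ∷ p) q = insert-sound ξ t p q

      insert-sound : ∀ ξ t p q → ⟦ insert t p q ⟧ᵖ ξ ≡ ⟦ t ∷ p ⟧ᵖ ξ + ⟦ q ⟧ᵖ ξ
      insert-sound ξ t p [] = sym (+-identityʳ _)
      insert-sound ξ (m , a , b) p ((n , c , d) ∷ q) with cmp m n
      ... | before = trans (cong ((# a - # b) * ⟦ m ⟧ᵐ ξ +_) (⊞-sound ξ p ((n , c , d) ∷ q))) (sym (+-assoc _ _ _))
      ... | after = trans (cong ((# c - # d) * ⟦ n ⟧ᵐ ξ +_) (insert-sound ξ (m , a , b) p q))
                 (trans (sym (+-assoc _ _ _)) (trans (cong (_+ ⟦ q ⟧ᵖ ξ) (+-comm _ _)) (+-assoc _ _ _)))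
      ... | same refl = begin
        (# (a ℕ.+ c) - # (b ℕ.+ d)) * M + ⟦ p ⊞ q ⟧ᵖ ξ
          ≡⟨ cong₂ _+_ (trans (cong (_* M) (sym (diff-+ a b c d))) (distribʳ M _ _)) (⊞-sound ξ p q) ⟩
        ((# a - # b) * M + (# c - # d) * M) + (⟦ p ⟧ᵖ ξ + ⟦ q ⟧ᵖ ξ)
          ≡⟨ +-interchange _ _ _ _ ⟩
        ((# a - # b) * M + ⟦ p ⟧ᵖ ξ) + ((# c - # d) * M + ⟦ q ⟧ᵖ ξ) ∎
        where M = ⟦ m ⟧ᵐ ξ

    ⊟-sound : ∀ ξ p → ⟦ ⊟ p ⟧ᵖ ξ ≡ - ⟦ p ⟧ᵖ ξ
    ⊟-sound ξ [] = inverse-unique 0# 0# (+-identityˡ 0#)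
    ⊟-sound ξ ((m , a , b) ∷ p) = trans (cong₂ _+_ flip (⊟-sound ξ p)) (-distrib-+ _ _)
      where
      flip : (# b - # a) * ⟦ m ⟧ᵐ ξ ≡ - ((# a - # b) * ⟦ m ⟧ᵐ ξ)
      flip = trans (cong (_* ⟦ m ⟧ᵐ ξ)
               (trans (+-comm (# b) (- # a)) (trans (cong (- # a +_) (sym (-‿invol (# b)))) (-distrib-+ (# a) (- # b)))))
             (-‿*ˡ _ _)

    ·-sound : ∀ ξ m n → ⟦ m · n ⟧ᵐ ξ ≡ ⟦ m ⟧ᵐ ξ * ⟦ n ⟧ᵐ ξ
    ·-sound ξ [] n = sym (*-identityˡ _)
    ·-sound [] (a ∷ m) [] = sym (*-identityʳ _)
    ·-sound (x ∷ ξ) (a ∷ m) [] = sym (*-identityʳ _)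
    ·-sound [] (a ∷ m) (b ∷ n) = sym (*-identityˡ _)
    ·-sound (x ∷ ξ) (a ∷ m) (b ∷ n) =
      trans (cong₂ _*_ (^-+ x a b) (·-sound ξ m n)) (*-interchange _ _ _ _)

    scale-sound : ∀ ξ m a b p → ⟦ scale (m , a , b) p ⟧ᵖ ξ ≡ (# a - # b) * ⟦ m ⟧ᵐ ξ * ⟦ p ⟧ᵖ ξ
    scale-sound ξ m a b [] = sym (zeroʳ _)
    scale-sound ξ m a b ((n , c , d) ∷ p) =
      trans (cong₂ _+_ (trans (cong₂ _*_ (sym (diff-* a b c d)) (·-sound ξ m n)) (*-interchange _ _ _ _))
                       (scale-sound ξ m a b p))
            (sym (distribˡ _ _ _))

    ⊠-sound : ∀ ξ p q → ⟦ p ⊠ q ⟧ᵖ ξ ≡ ⟦ p ⟧ᵖ ξ * ⟦ q ⟧ᵖ ξ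
    ⊠-sound ξ [] q = sym (zeroˡ _)
    ⊠-sound ξ ((m , a , b) ∷ p) q =
      trans (⊞-sound ξ (scale (m , a , b) q) (p ⊠ q))
        (trans (cong₂ _+_ (scale-sound ξ m a b q) (⊠-sound ξ p q)) (sym (distribʳ _ _ _)))

    const-sound : ∀ ξ n → ⟦ ([] , n , 0) ∷ [] ⟧ᵖ ξ ≡ # n
    const-sound ξ n = trans (+-identityʳ _) (trans (*-identityʳ _)
      (trans (cong (λ v → # n + - v) #-0) (trans (cong (# n +_) (sym (inverse-unique 0# 0# (+-identityˡ 0#)))) (+-identityʳ _))))

    ⊠^-sound : ∀ ξ p n → ⟦ p ⊠^ n ⟧ᵖ ξ ≡ ⟦ p ⟧ᵖ ξ ^ n
    ⊠^-sound ξ p zero = trans (const-sound ξ 1) #-1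
    ⊠^-sound ξ p (suc n) = trans (⊠-sound ξ p (p ⊠^ n)) (cong (⟦ p ⟧ᵖ ξ *_) (⊠^-sound ξ p n))

    varMono-sound : ∀ ξ i → ⟦ varMono i ⟧ᵐ ξ ≡ lookupE ξ i
    varMono-sound [] zero = refl
    varMono-sound [] (suc i) = refl
    varMono-sound (x ∷ ξ) zero = trans (*-identityʳ _) (*-identityʳ x)
    varMono-sound (x ∷ ξ) (suc i) = trans (*-identityˡ _) (varMono-sound ξ i)

    norm-sound : ∀ ξ e → ⟦ norm e ⟧ᵖ ξ ≡ ⟦ e ⟧ ξ
    norm-sound ξ (var i) = trans (+-identityʳ _)
      (trans (cong (_* ⟦ varMono i ⟧ᵐ ξ) (trans (sym (+-identityʳ _)) (trans (cong (_+ 0#) (sym (*-identityʳ _))) (trans (const-sound ξ 1) #-1))))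
        (trans (*-identityˡ _) (varMono-sound ξ i)))
    norm-sound ξ (con n) = const-sound ξ n
    norm-sound ξ (e :+ f) = trans (⊞-sound ξ (norm e) (norm f)) (cong₂ _+_ (norm-sound ξ e) (norm-sound ξ f))
    norm-sound ξ (e :- f) = trans (⊞-sound ξ (norm e) (⊟ norm f))
      (cong₂ _+_ (norm-sound ξ e) (trans (⊟-sound ξ (norm f)) (cong -_ (norm-sound ξ f))))
    norm-sound ξ (e :* f) = trans (⊠-sound ξ (norm e) (norm f)) (cong₂ _*_ (norm-sound ξ e) (norm-sound ξ f))
    norm-sound ξ (e :^ n) = trans (⊠^-sound ξ (norm e) n) (cong (_^ n) (norm-sound ξ e))

    isZero-sound : ∀ ξ p → isZero p ≡ true → ⟦ p ⟧ᵖ ξ ≡ 0#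
    isZero-sound ξ [] _ = refl
    isZero-sound ξ ((m , a , b) ∷ p) h with a ℕ.≡ᵇ b in e
    ... | true = trans (cong₂ _+_
                   (trans (cong (λ v → (# v - # b) * ⟦ m ⟧ᵐ ξ) (ℕₚ.≡ᵇ⇒≡ a b (subst T (sym e) tt)))
                     (trans (cong (_* ⟦ m ⟧ᵐ ξ) (-‿inverseʳ (# b))) (zeroˡ _)))
                   (isZero-sound ξ p h)) (+-identityˡ 0#)

    vanishes : ∀ ξ e → isZero (norm e) ≡ true → ⟦ e ⟧ ξ ≡ 0#
    vanishes ξ e h = trans (sym (norm-sound ξ e)) (isZero-sound ξ (norm e) h)

    x-y≡0⇒x≡y : ∀ {x y} → x - y ≡ 0# → x ≡ y
    x-y≡0⇒x≡y {x} {y} e = trans (sym (-‿invol x)) (trans (cong -_ (sym (inverse-unique x (- y) e))) (-‿invol y))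

    ring : ∀ ξ e f → isZero (norm (e :- f)) ≡ true → ⟦ e ⟧ ξ ≡ ⟦ f ⟧ ξ
    ring ξ e f h = x-y≡0⇒x≡y (vanishes ξ (e :- f) h)

    infix 4 _:≤_
    data Ineq : Set where
      _:≤_ : Expr → Expr → Ineq

    Holds : Env → Ineq → Set
    Holds ξ (e :≤ f) = ⟦ e ⟧ ξ ≤ ⟦ f ⟧ ξ

    Hyps : Env → List Ineq → Set
    Hyps ξ [] = ⊤
    Hyps ξ (h ∷ hs) = Holds ξ h × Hyps ξ hs

    infix  3 ⊢_
    infixr 2 _⇒_
    data Sequent : Set where
      ⊢_ : Ineq → Sequent
      _⇒_ : Ineq → Sequent → Sequent

    premises : Sequent → List Ineq
    premises (⊢ g) = []
    premises (h ⇒ s) = h ∷ premises s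

    consequent : Sequent → Ineq
    consequent (⊢ g) = g
    consequent (h ⇒ s) = consequent s

    Valid : Env → Sequent → Set
    Valid ξ (⊢ g) = Holds ξ g
    Valid ξ (h ⇒ s) = Holds ξ h → Valid ξ s

    -- A sequent with its variables bound by Agda functions, so that certificates can be stated with
    -- named variables; `instantiate` turns them into `var 0`, `var 1`, ....
    Scheme : ℕ → Set
    Scheme zero = Sequent
    Scheme (suc n) = Expr → Scheme n

    instantiate : ∀ n → Scheme n → ℕ → Sequent
    instantiate zero s i = s
    instantiate (suc n) s i = instantiate n (s (var i)) (suc i)

    Forall : ℕ → (Env → Set) → Set
    Forall zero Q = Q []
    Forall (suc n) Q = ∀ {x} → Forall n (λ ξ → Q (x ∷ ξ))

    gap : Ineq → Expr
    gap (e :≤ f) = f :- e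

    pick : List Ineq → ℕ → Expr
    pick [] _ = con 0
    pick (h ∷ hs) zero = gap h
    pick (h ∷ hs) (suc i) = pick hs i

    factor : List Ineq → List ℕ → Expr
    factor hs [] = con 1
    factor hs (i ∷ is) = pick hs i :* factor hs is

    combination : List Ineq → List (ℕ × List ℕ) → Expr
    combination hs [] = con 0
    combination hs ((c , is) ∷ cs) = con c :* factor hs is :+ combination hs cs

    +-nonneg : ∀ {x y} → 0# ≤ x → 0# ≤ y → 0# ≤ x + y
    +-nonneg hx hy = ≤-trans (reflexive (sym (+-identityˡ 0#))) (+-mono-≤ hx hy)

    gap-nonneg : ∀ ξ h → Holds ξ h → 0# ≤ ⟦ gap h ⟧ ξ
    gap-nonneg ξ (e :≤ f) h = ≤⇒0≤ h

    pick-nonneg : ∀ ξ hs → Hyps ξ hs → ∀ i → 0# ≤ ⟦ pick hs i ⟧ ξ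
    pick-nonneg ξ [] _ i = #-nonneg 0
    pick-nonneg ξ (h ∷ hs) (p , ps) zero = gap-nonneg ξ h p
    pick-nonneg ξ (h ∷ hs) (p , ps) (suc i) = pick-nonneg ξ hs ps i

    factor-nonneg : ∀ ξ hs → Hyps ξ hs → ∀ is → 0# ≤ ⟦ factor hs is ⟧ ξ
    factor-nonneg ξ hs ps [] = #-nonneg 1
    factor-nonneg ξ hs ps (i ∷ is) = *-nonneg (pick-nonneg ξ hs ps i) (factor-nonneg ξ hs ps is)

    combination-nonneg : ∀ ξ hs → Hyps ξ hs → ∀ cs → 0# ≤ ⟦ combination hs cs ⟧ ξ
    combination-nonneg ξ hs ps [] = #-nonneg 0
    combination-nonneg ξ hs ps ((c , is) ∷ cs) =
      +-nonneg (*-nonneg (#-nonneg c) (factor-nonneg ξ hs ps is)) (combination-nonneg ξ hs ps cs)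

    -- A certificate (c , cs) exhibits (1 + c) times the goal as a nonnegative combination of products of
    -- premises, given by their indices; the ones below were found by linear programming.
    arith : ∀ ξ (hs : List Ineq) (g : Ineq) (c : ℕ) (cs : List (ℕ × List ℕ)) →
            isZero (norm (con (suc c) :* gap g :- combination hs cs)) ≡ true →
            Hyps ξ hs → Holds ξ g
    arith ξ hs (e :≤ f) c cs z ps = 0≤⇒≤ (*-cancel (#-pos c)
      (≤-trans (combination-nonneg ξ hs ps cs) (reflexive (sym (x-y≡0⇒x≡y (vanishes ξ (con (suc c) :* gap (e :≤ f) :- combination hs cs) z))))))

    certificate-for : Sequent → ℕ → List (ℕ × List ℕ) → Bool
    certificate-for s c cs = isZero (norm (con (suc c) :* gap (consequent s) :- combination (premises s) cs))

    record Certificate (n : ℕ) (s : Scheme n) : Set where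
      constructor cert
      field
        scale-pred : ℕ
        terms : List (ℕ × List ℕ)
        exact : certificate-for (instantiate n s 0) scale-pred terms ≡ true

    private
      curry-valid : ∀ ξ s → (Hyps ξ (premises s) → Holds ξ (consequent s)) → Valid ξ s
      curry-valid ξ (⊢ g) f = f tt
      curry-valid ξ (h ⇒ s) f p = curry-valid ξ s (λ ps → f (p , ps))

      forall-valid : ∀ (n : ℕ) (Q : Env → Set) → (∀ ξ → Q ξ) → Forall n Q
      forall-valid zero Q f = f []
      forall-valid (suc n) Q f {x} = forall-valid n (λ ξ → Q (x ∷ ξ)) (λ ξ → f (x ∷ ξ))

    -- The certificate is verified once, on the closed sequent, and then holds for all values of the
    -- variables.
    use : ∀ {n s} → Certificate n s → Forall n (λ ξ → Valid ξ (instantiate n s 0))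
    use {n} {s} (cert c cs z) = forall-valid n _ (λ ξ →
      curry-valid ξ (instantiate n s 0) (arith ξ (premises (instantiate n s 0)) (consequent (instantiate n s 0)) c cs z))

open OrderedRings using (OrderedRing; module Ordered)

-- Power series with natural coefficients and the recurrence for restricted partitions

module Series where
  open import Data.Nat
  open import Data.Nat.Properties
  open import Data.Nat.Induction using (<-rec)
  open import Data.Sum using (inj₁; inj₂)
  open import Function using (_∘_)
  open import Relation.Nullary using (yes; no)
  open import Relation.Binary.PropositionalEquality
  open ≡-Reasoning
  import Data.Nat.Solver
  open Data.Nat.Solver.+-*-Solver using (solve; _:=_; _:+_; _:*_)

  infixl 6 _⊕_
  _⊕_ : (ℕ → ℕ) → (ℕ → ℕ) → ℕ → ℕ
  (f ⊕ g) n = f n + g n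

  -- Multiplication of the generating series by q^k.
  shift : ℕ → (ℕ → ℕ) → ℕ → ℕ
  shift zero f n = f n
  shift (suc k) f zero = 0
  shift (suc k) f (suc n) = shift k f n

  shift-≥ : ∀ k f n → shift k f (k + n) ≡ f n
  shift-≥ zero f n = refl
  shift-≥ (suc k) f n = shift-≥ k f n

  shift-< : ∀ k f n → n < k → shift k f n ≡ 0
  shift-< (suc k) f zero _ = refl
  shift-< (suc k) f (suc n) (s≤s l) = shift-< k f n l

  shift-∸ : ∀ k f n → k ≤ n → shift k f n ≡ f (n ∸ k)
  shift-∸ k f n l = trans (cong (shift k f) (sym (m+[n∸m]≡n l))) (shift-≥ k f (n ∸ k))

  shift-local : ∀ k f g n → (∀ m → m + k ≤ n → f m ≡ g m) → shift k f n ≡ shift k g n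
  shift-local zero f g n h = h n (≤-reflexive (+-identityʳ n))
  shift-local (suc k) f g zero h = refl
  shift-local (suc k) f g (suc n) h = shift-local k f g n (λ m l → h m (≤-trans (≤-reflexive (+-suc m k)) (s≤s l)))

  shift-cong : ∀ k {f g} → f ≗ g → shift k f ≗ shift k g
  shift-cong k h n = shift-local k _ _ n (λ m _ → h m)

  shift-⊕ : ∀ k f g → shift k (f ⊕ g) ≗ shift k f ⊕ shift k g
  shift-⊕ zero f g n = refl
  shift-⊕ (suc k) f g zero = refl
  shift-⊕ (suc k) f g (suc n) = shift-⊕ k f g n

  shift-shift : ∀ j k f → shift j (shift k f) ≗ shift (j + k) f
  shift-shift zero k f n = refl
  shift-shift (suc j) k f zero = refl
  shift-shift (suc j) k f (suc n) = shift-shift j k f n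

  -- Multiplication of a power series by 1 / (1 - q^(k+1)).
  geoFuel : ℕ → ℕ → (ℕ → ℕ) → ℕ → ℕ
  geoFuel zero k f n = 0
  geoFuel (suc g) k f n = f n + shift (suc k) (geoFuel g k f) n

  geo : ℕ → (ℕ → ℕ) → ℕ → ℕ
  geo k f n = geoFuel (suc n) k f n

  below : ∀ {m k n} → m + suc k ≤ n → m < n
  below {m} {k} l = ≤-trans (≤-trans (s≤s (m≤m+n m k)) (≤-reflexive (sym (+-suc m k)))) l

  -- The coefficient at n depends only on coefficients at smaller indices, so any fuel above n gives
  -- the same value.
  geoFuel-stable : ∀ g h k f n → n < g → n < h → geoFuel g k f n ≡ geoFuel h k f n
  geoFuel-stable (suc g) (suc h) k f n (s≤s lg) (s≤s lh) = cong (f n +_)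
    (shift-local (suc k) _ _ n (λ m l → geoFuel-stable g h k f m (<-≤-trans (below l) lg) (<-≤-trans (below l) lh)))

  geo-step : ∀ k f → geo k f ≗ f ⊕ shift (suc k) (geo k f)
  geo-step k f n = cong (f n +_) (shift-local (suc k) _ _ n (λ m l → geoFuel-stable n (suc m) k f m (below l) ≤-refl))

  geo-unique : ∀ k f h → h ≗ f ⊕ shift (suc k) h → h ≗ geo k f
  geo-unique k f h e = <-rec (λ n → h n ≡ geo k f n) (λ n rec →
    trans (e n) (trans (cong (f n +_) (shift-local (suc k) _ _ n (λ m l → rec (below l)))) (sym (geo-step k f n))))

  -- In `geo-step` at n and n + 1 the shifted terms compare by induction when k + 1 ≤ n; otherwise
  -- the one at n is 0.
  geo-mono : ∀ k f → (∀ n → f n ≤ f (suc n)) → ∀ n → geo k f n ≤ geo k f (suc n)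
  geo-mono k f h = <-rec (λ n → geo k f n ≤ geo k f (suc n)) step
    where
    step : ∀ n → (∀ {m} → m < n → geo k f m ≤ geo k f (suc m)) → geo k f n ≤ geo k f (suc n)
    step n rec = subst₂ _≤_ (sym (geo-step k f n)) (sym (geo-step k f (suc n))) (+-mono-≤ (h n) shifted)
      where
      shifted : shift (suc k) (geo k f) n ≤ shift k (geo k f) n
      shifted with suc k ≤? n
      ... | no ¬l = subst (_≤ shift k (geo k f) n) (sym (shift-< (suc k) _ n (≰⇒> ¬l))) z≤n
      ... | yes l = subst₂ _≤_ (sym (shift-∸ (suc k) _ n l)) (trans (cong (geo k f) (sym (+-∸-assoc 1 l))) (sym (shift-∸ k _ n (≤-trans (n≤1+n k) l))))
                      (rec (∸-monoʳ-< {n} {suc k} {0} (s≤s z≤n) l))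

  one : ℕ → ℕ
  one zero = 1
  one (suc n) = 0

  -- parts k n counts the partitions of n with all parts at most k.
  parts : ℕ → ℕ → ℕ
  parts zero = one
  parts (suc k) = geo k (parts k)

  parts-step : ∀ k → parts (suc k) ≗ parts k ⊕ shift (suc k) (parts (suc k))
  parts-step k = geo-step k (parts k)

  parts-stable : ∀ k n → n ≤ k → parts k n ≡ parts n n
  parts-stable k n l with m≤n⇒m<n∨m≡n l
  ... | inj₂ refl = refl
  parts-stable (suc k) n l | inj₁ (s≤s l′) = trans (parts-step k n)
    (trans (cong (parts k n +_) (shift-< (suc k) _ n (s≤s l′))) (trans (+-identityʳ _) (parts-stable k n l′)))

  conv : (ℕ → ℕ) → (ℕ → ℕ) → ℕ → ℕ
  conv f g zero = f 0 * g 0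
  conv f g (suc n) = f 0 * g (suc n) + conv (f ∘ suc) g n

  conv-cong : ∀ {f f′ g g′} → f ≗ f′ → g ≗ g′ → conv f g ≗ conv f′ g′
  conv-cong ef eg zero = cong₂ _*_ (ef 0) (eg 0)
  conv-cong ef eg (suc n) = cong₂ _+_ (cong₂ _*_ (ef 0) (eg (suc n))) (conv-cong (ef ∘ suc) eg n)

  conv-zeroˡ : ∀ g n → conv (λ _ → 0) g n ≡ 0
  conv-zeroˡ g zero = refl
  conv-zeroˡ g (suc n) = conv-zeroˡ g n

  conv-one : ∀ g → conv one g ≗ g
  conv-one g zero = +-identityʳ _
  conv-one g (suc n) = trans (cong₂ _+_ (+-identityʳ _) (conv-zeroˡ g n)) (+-identityʳ _)

  conv-⊕ˡ : ∀ f g h → conv (f ⊕ g) h ≗ conv f h ⊕ conv g h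
  conv-⊕ˡ f g h zero = *-distribʳ-+ (h 0) (f 0) (g 0)
  conv-⊕ˡ f g h (suc n) = trans (cong₂ _+_ (*-distribʳ-+ (h (suc n)) (f 0) (g 0)) (conv-⊕ˡ (f ∘ suc) (g ∘ suc) h n))
    (solve 4 (λ a b c d → a :+ b :+ (c :+ d) := a :+ c :+ (b :+ d)) refl (f 0 * h (suc n)) (g 0 * h (suc n)) _ _)

  conv-⊕ʳ : ∀ f g h → conv f (g ⊕ h) ≗ conv f g ⊕ conv f h
  conv-⊕ʳ f g h zero = *-distribˡ-+ (f 0) (g 0) (h 0)
  conv-⊕ʳ f g h (suc n) = trans (cong₂ _+_ (*-distribˡ-+ (f 0) (g (suc n)) (h (suc n))) (conv-⊕ʳ (f ∘ suc) g h n))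
    (solve 4 (λ a b c d → a :+ b :+ (c :+ d) := a :+ c :+ (b :+ d)) refl (f 0 * g (suc n)) (f 0 * h (suc n)) _ _)

  conv-*ˡ : ∀ c f g n → conv (λ i → c * f i) g n ≡ c * conv f g n
  conv-*ˡ c f g zero = *-assoc c (f 0) (g 0)
  conv-*ˡ c f g (suc n) = trans (cong₂ _+_ (*-assoc c (f 0) _) (conv-*ˡ c (f ∘ suc) g n)) (sym (*-distribˡ-+ c _ _))

  conv-shiftˡ : ∀ k f g → conv (shift k f) g ≗ shift k (conv f g)
  conv-shiftˡ zero f g n = refl
  conv-shiftˡ (suc k) f g zero = refl
  conv-shiftˡ (suc k) f g (suc n) = conv-shiftˡ k f g n

  conv-suc : ∀ f g n → conv f g (suc n) ≡ conv f (g ∘ suc) n + f (suc n) * g 0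
  conv-suc f g zero = refl
  conv-suc f g (suc n) = trans (cong (f 0 * g (suc (suc n)) +_) (conv-suc (f ∘ suc) g n)) (sym (+-assoc (f 0 * g (suc (suc n))) _ _))

  conv-shift1 : ∀ f g → conv f (shift 1 g) ≗ shift 1 (conv f g)
  conv-shift1 f g zero = *-zeroʳ (f 0)
  conv-shift1 f g (suc n) = trans (conv-suc f (shift 1 g) n) (trans (cong (conv f g n +_) (*-zeroʳ (f (suc n)))) (+-identityʳ _))

  conv-shiftʳ : ∀ k f g → conv f (shift k g) ≗ shift k (conv f g)
  conv-shiftʳ zero f g n = refl
  conv-shiftʳ (suc k) f g n = begin
    conv f (shift (suc k) g) n          ≡⟨ conv-cong (λ _ → refl) (λ m → sym (shift-shift 1 k g m)) n ⟩
    conv f (shift 1 (shift k g)) n      ≡⟨ conv-shift1 f (shift k g) n ⟩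
    shift 1 (conv f (shift k g)) n      ≡⟨ shift-cong 1 (conv-shiftʳ k f g) n ⟩
    shift 1 (shift k (conv f g)) n      ≡⟨ shift-shift 1 k (conv f g) n ⟩
    shift (suc k) (conv f g) n          ∎

  -- multiples k is the indicator of the positive multiples of k + 1.
  multiples : ℕ → ℕ → ℕ
  multiples k = shift (suc k) (geo k one)

  -- The sum of the divisors of n that are at most k. Its series Σ j q^j / (1 - q^j), over j ≤ k, is
  -- the logarithmic derivative (with q d/dq) of that of `parts k`.
  divisorSum : ℕ → ℕ → ℕ
  divisorSum zero n = 0
  divisorSum (suc k) n = divisorSum k n + suc k * multiples k n

  multiples-conv : ∀ k f → conv (multiples k) f ≗ shift (suc k) (f ⊕ conv (multiples k) f)
  multiples-conv k f n = begin
    conv (multiples k) f n                      ≡⟨ conv-shiftˡ (suc k) (geo k one) f n ⟩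
    shift (suc k) (conv (geo k one) f) n        ≡⟨ shift-cong (suc k) expand n ⟩
    shift (suc k) (f ⊕ conv (multiples k) f) n  ∎
    where
    expand : conv (geo k one) f ≗ f ⊕ conv (multiples k) f
    expand m = trans (conv-cong (geo-step k one) (λ _ → refl) m)
      (trans (conv-⊕ˡ one (multiples k) f m) (cong (_+ conv (multiples k) f m) (conv-one f m)))

  -- The product rule: q d/dq (q^k f) = q^k (k f + q d/dq f).
  shift-weight : ∀ k f n → n * shift k f n ≡ shift k (λ m → (m + k) * f m) n
  shift-weight zero f n = cong (_* f n) (sym (+-identityʳ n))
  shift-weight (suc k) f zero = refl
  shift-weight (suc k) f (suc n) = begin
    shift k f n + n * shift k f n                                  ≡⟨ cong (shift k f n +_) (shift-weight k f n) ⟩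
    shift k f n + shift k (λ m → (m + k) * f m) n                  ≡⟨ sym (shift-⊕ k f (λ m → (m + k) * f m) n) ⟩
    shift k (λ m → f m + (m + k) * f m) n                          ≡⟨ shift-cong k (λ m → cong (_* f m) (sym (+-suc m k))) n ⟩
    shift k (λ m → (m + suc k) * f m) n                            ∎

  -- Logarithmic differentiation of Π 1 / (1 - q^j), one factor at a time. The new series satisfies
  -- P = `parts k` + q^K P; weighting this equation by n leaves `recurrence k` for the first summand
  -- and, by strong induction on n, the statement itself at smaller indices for the second.
  recurrence : ∀ k n → n * parts k n ≡ conv (divisorSum k) (parts k) n
  recurrence zero zero = refl
  recurrence zero (suc n) = trans (*-zeroʳ n) (sym (conv-zeroˡ one (suc n)))
  recurrence (suc k) = <-rec (λ n → n * P n ≡ conv (divisorSum (suc k)) P n) step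
    where
    K = suc k
    P = parts (suc k)
    σP = conv (divisorSum k) P
    χP = conv (multiples k) P
    unfold : conv (divisorSum (suc k)) P ≗ λ n → conv (divisorSum k) (parts k) n + shift K (λ m → σP m + K * (P m + χP m)) n
    unfold n = begin
      conv (divisorSum (suc k)) P n
        ≡⟨ conv-⊕ˡ (divisorSum k) (λ i → K * multiples k i) P n ⟩
      σP n + conv (λ i → K * multiples k i) P n
        ≡⟨ cong₂ _+_ (trans (conv-cong (λ _ → refl) (parts-step k) n) (trans (conv-⊕ʳ (divisorSum k) (parts k) (shift K P) n)
             (cong (conv (divisorSum k) (parts k) n +_) (conv-shiftʳ K (divisorSum k) P n))))
             (trans (conv-*ˡ K (multiples k) P n) (cong (K *_) (multiples-conv k P n))) ⟩
      conv (divisorSum k) (parts k) n + shift K σP n + K * shift K (P ⊕ χP) n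
        ≡⟨ +-assoc (conv (divisorSum k) (parts k) n) _ _ ⟩
      conv (divisorSum k) (parts k) n + (shift K σP n + K * shift K (P ⊕ χP) n)
        ≡⟨ cong (λ v → conv (divisorSum k) (parts k) n + (shift K σP n + v)) (scale K K (P ⊕ χP) n) ⟩
      conv (divisorSum k) (parts k) n + (shift K σP n + shift K (λ m → K * (P m + χP m)) n)
        ≡⟨ cong (conv (divisorSum k) (parts k) n +_) (sym (shift-⊕ K σP (λ m → K * (P m + χP m)) n)) ⟩
      conv (divisorSum k) (parts k) n + shift K (λ m → σP m + K * (P m + χP m)) n ∎
      where
      scale : ∀ c j f n → c * shift j f n ≡ shift j (λ m → c * f m) n
      scale c zero f n = refl
      scale c (suc j) f zero = *-zeroʳ c
      scale c (suc j) f (suc n) = scale c j f n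
    step : ∀ n → (∀ {m} → m < n → m * P m ≡ conv (divisorSum (suc k)) P m) → n * P n ≡ conv (divisorSum (suc k)) P n
    step n rec = begin
      n * P n
        ≡⟨ cong (n *_) (parts-step k n) ⟩
      n * (parts k n + shift K P n)
        ≡⟨ *-distribˡ-+ n (parts k n) (shift K P n) ⟩
      n * parts k n + n * shift K P n
        ≡⟨ cong₂ _+_ (recurrence k n) (trans (shift-weight K P n) (shift-local K _ _ n value)) ⟩
      conv (divisorSum k) (parts k) n + shift K (λ m → σP m + K * (P m + χP m)) n
        ≡⟨ sym (unfold n) ⟩
      conv (divisorSum (suc k)) P n ∎
      where
      value : ∀ m → m + K ≤ n → (m + K) * P m ≡ σP m + K * (P m + χP m)
      value m l = begin
        (m + K) * P m                              ≡⟨ *-distribʳ-+ (P m) m K ⟩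
        m * P m + K * P m                          ≡⟨ cong (_+ K * P m) (trans (rec (below l)) (trans (conv-⊕ˡ (divisorSum k) (λ i → K * multiples k i) P m) (cong (σP m +_) (conv-*ˡ K (multiples k) P m)))) ⟩
        σP m + K * χP m + K * P m                  ≡⟨ solve 4 (λ s c x p → s :+ c :* x :+ c :* p := s :+ c :* (p :+ x)) refl (σP m) K (χP m) (P m) ⟩
        σP m + K * (P m + χP m)                    ∎

-- The partitions of the definition, and divisor sums

module Partitions where
  open import Defs
  open import Data.List using (List; []; _∷_; length; map; concatMap; upTo; applyUpTo)
  import Data.List.Properties as Listₚ
  import Data.Nat.ListAction as ListAction
  open import Data.Nat
  open import Data.Nat.Properties
  open import Data.Nat.DivMod using (_/_; m/n≡1+[m∸n]/n; m<n⇒m/n≡0)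
  open import Data.Nat.Induction using (<-rec)
  open import Data.Product using (_,_; proj₁; ∃)
  open import Data.Sum using (inj₁; inj₂)
  open import Data.Empty using (⊥-elim)
  open import Function using (_∘_; id)
  open import Relation.Nullary using (Dec; yes; no)
  open import Relation.Binary.PropositionalEquality
  open ≡-Reasoning
  open Series

  sumTo : ℕ → (ℕ → ℕ) → ℕ
  sumTo zero f = 0
  sumTo (suc n) f = f 0 + sumTo n (f ∘ suc)

  sumTo-cong : ∀ n {f g} → (∀ k → k < n → f k ≡ g k) → sumTo n f ≡ sumTo n g
  sumTo-cong zero h = refl
  sumTo-cong (suc n) h = cong₂ _+_ (h 0 (s≤s z≤n)) (sumTo-cong n (λ k l → h (suc k) (s≤s l)))

  sumTo-last : ∀ n f → sumTo (suc n) f ≡ sumTo n f + f n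
  sumTo-last zero f = +-identityʳ (f 0)
  sumTo-last (suc n) f = trans (cong (f 0 +_) (sumTo-last n (f ∘ suc))) (sym (+-assoc (f 0) _ _))

  sumTo-⊕ : ∀ n f g → sumTo n (f ⊕ g) ≡ sumTo n f + sumTo n g
  sumTo-⊕ zero f g = refl
  sumTo-⊕ (suc n) f g = trans (cong (f 0 + g 0 +_) (sumTo-⊕ n (f ∘ suc) (g ∘ suc)))
    (trans (+-assoc (f 0) _ _) (trans (cong (f 0 +_) (trans (sym (+-assoc (g 0) _ _))
      (trans (cong (_+ sumTo n (g ∘ suc)) (+-comm (g 0) (sumTo n (f ∘ suc)))) (+-assoc (sumTo n (f ∘ suc)) _ _)))) (sym (+-assoc (f 0) _ _))))

  sumTo-* : ∀ n c f → sumTo n (λ k → c * f k) ≡ c * sumTo n f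
  sumTo-* zero c f = sym (*-zeroʳ c)
  sumTo-* (suc n) c f = trans (cong (c * f 0 +_) (sumTo-* n c (f ∘ suc))) (sym (*-distribˡ-+ c _ _))

  sumTo-zero : ∀ n f → (∀ k → k < n → f k ≡ 0) → sumTo n f ≡ 0
  sumTo-zero zero f h = refl
  sumTo-zero (suc n) f h = cong₂ _+_ (h 0 (s≤s z≤n)) (sumTo-zero n (f ∘ suc) (λ k l → h (suc k) (s≤s l)))

  length-concatMap : ∀ {A B : Set} (g : A → List B) xs → length (concatMap g xs) ≡ ListAction.sum (map (length ∘ g) xs)
  length-concatMap g [] = refl
  length-concatMap g (x ∷ xs) = trans (Listₚ.length-++ (g x)) (cong (length (g x) +_) (length-concatMap g xs))

  sum-upTo : ∀ (c h : ℕ → ℕ) n → ListAction.sum (map c (applyUpTo h n)) ≡ sumTo n (c ∘ h)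
  sum-upTo c h zero = refl
  sum-upTo c h (suc n) = cong (c (h 0) +_) (sum-upTo c (h ∘ suc) n)

  -- Mirrors the case distinction `choose` inside `partsFuel`, so that both sides reduce together.
  restrict : ℕ → (ℕ → ℕ) → ℕ → ℕ
  restrict k f i = keep (suc i ≤? k)
    where
    keep : Dec (suc i ≤ k) → ℕ
    keep (yes _) = f i
    keep (no _) = 0

  sumTo-restrict : ∀ N k f → (∀ i → N ≤ i → f i ≡ 0) → sumTo N (restrict k f) ≡ sumTo k f
  sumTo-restrict zero k f h = sym (sumTo-zero k f (λ i _ → h i z≤n))
  sumTo-restrict (suc N) zero f h = sumTo-zero (suc N) _ (λ _ _ → refl)
  sumTo-restrict (suc N) (suc k) f h = cong (f 0 +_) (trans (sumTo-cong N (λ i _ → step i)) (sumTo-restrict N k (f ∘ suc) (λ i l → h (suc i) (s≤s l))))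
    where
    step : ∀ i → restrict (suc k) f (suc i) ≡ restrict k (f ∘ suc) i
    step i with suc (suc i) ≤? suc k | suc i ≤? k
    ... | yes _ | yes _ = refl
    ... | no _ | no _ = refl
    ... | yes a | no b = ⊥-elim (b (≤-pred a))
    ... | no a | yes b = ⊥-elim (a (s≤s b))

  -- Partitions of n + 1 with first part i + 1: the rest sums to n - i and has parts at most i + 1.
  firstPart : ℕ → ℕ → ℕ
  firstPart n i = shift i (parts (suc i)) n

  parts-zero : ∀ k → parts k 0 ≡ 1
  parts-zero zero = refl
  parts-zero (suc k) = trans (parts-step k 0) (trans (+-identityʳ _) (parts-zero k))

  parts-unroll : ∀ k n → parts k (suc n) ≡ sumTo k (firstPart n)
  parts-unroll zero n = refl
  parts-unroll (suc k) n = trans (parts-step k (suc n)) (trans (cong (_+ firstPart n k) (parts-unroll k n)) (sym (sumTo-last k (firstPart n))))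

  -- Names the local branching function of partsFuel.
  branches : ∀ f n k → ∃ λ g → partsFuel (suc f) (suc n) k ≡ concatMap g (upTo (suc n))
  branches f n k = _ , refl

  branch : ℕ → ℕ → ℕ → ℕ → List (List ℕ)
  branch f n k = proj₁ (branches f n k)

  count : ∀ f n k → n ≤ f → length (partsFuel f n k) ≡ parts k n
  count zero zero k _ = sym (parts-zero k)
  count (suc f) zero k _ = sym (parts-zero k)
  count (suc f) (suc n) k (s≤s n≤f) = begin
    length (partsFuel (suc f) (suc n) k)
      ≡⟨ length-concatMap (branch f n k) (upTo (suc n)) ⟩
    ListAction.sum (map (length ∘ branch f n k) (upTo (suc n)))
      ≡⟨ sum-upTo (length ∘ branch f n k) id (suc n) ⟩
    sumTo (suc n) (length ∘ branch f n k)
      ≡⟨ sumTo-cong (suc n) term ⟩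
    sumTo (suc n) (restrict k (firstPart n))
      ≡⟨ sumTo-restrict (suc n) k (firstPart n) (λ i l → shift-< i (parts (suc i)) n l) ⟩
    sumTo k (firstPart n)
      ≡⟨ sym (parts-unroll k n) ⟩
    parts k (suc n) ∎
    where
    term : ∀ i → i < suc n → length (branch f n k i) ≡ restrict k (firstPart n) i
    term i (s≤s i≤n) with suc i ≤? k
    ... | no _ = refl
    ... | yes _ = trans (Listₚ.length-map (suc i ∷_) (partsFuel f (n ∸ i) (suc i)))
            (trans (count f (n ∸ i) (suc i) (≤-trans (m∸n≤m n i) n≤f)) (sym (shift-∸ i (parts (suc i)) n i≤n)))

  p≡parts : ∀ n → p n ≡ parts n n
  p≡parts n = count n n n ≤-refl

  p≡parts-≤ : ∀ K n → n ≤ K → p n ≡ parts K n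
  p≡parts-≤ K n l = trans (p≡parts n) (sym (parts-stable K n l))

  one-parts : ∀ n → parts 1 n ≡ 1
  one-parts zero = parts-zero 1
  one-parts (suc n) = trans (parts-step 0 (suc n)) (one-parts n)

  -- Division by 1 - q^j preserves monotonicity. The start is `parts 1`, constantly 1, since the
  -- series `one` for k = 0 is not monotone.
  parts-mono : ∀ k n → parts (suc k) n ≤ parts (suc k) (suc n)
  parts-mono zero n = ≤-reflexive (trans (one-parts n) (sym (one-parts (suc n))))
  parts-mono (suc k) n = geo-mono (suc k) (parts (suc k)) (parts-mono k) n

  p-mono : ∀ n → p n ≤ p (suc n)
  p-mono n = subst₂ _≤_ (sym (p≡parts-≤ (suc n) n (n≤1+n n))) (sym (p≡parts (suc n))) (parts-mono n n)

  p-positive : ∀ n → 1 ≤ p n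
  p-positive zero = s≤s z≤n
  p-positive (suc n) = ≤-trans (p-positive n) (p-mono n)

  -- The partition into a single part is new: all others of n + 2 have parts at most n + 1, and
  -- these are at least as many as the partitions of n + 1.
  p-strict : ∀ n → 1 ≤ n → p n < p (suc n)
  p-strict (suc n) _ = subst₂ _<_ (sym (p≡parts (1 + n))) (trans new-part (sym (p≡parts (2 + n)))) (s≤s (parts-mono n (1 + n)))
    where
    new-part : 1 + parts (1 + n) (2 + n) ≡ parts (2 + n) (2 + n)
    new-part = begin
      1 + parts (1 + n) (2 + n)
        ≡⟨ +-comm 1 _ ⟩
      parts (1 + n) (2 + n) + 1
        ≡⟨ cong (parts (1 + n) (2 + n) +_) (sym (trans (shift-∸ (2 + n) (parts (2 + n)) (2 + n) ≤-refl) (trans (cong (parts (2 + n)) (n∸n≡0 n)) (parts-zero (2 + n))))) ⟩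
      parts (1 + n) (2 + n) + shift (2 + n) (parts (2 + n)) (2 + n)
        ≡⟨ sym (parts-step (1 + n) (2 + n)) ⟩
      parts (2 + n) (2 + n) ∎

  divisor-sum : ℕ → ℕ
  divisor-sum k = divisorSum k k

  divisorSum-stable : ∀ K k → k ≤ K → divisorSum K k ≡ divisor-sum k
  divisorSum-stable K k l with m≤n⇒m<n∨m≡n l
  ... | inj₂ refl = refl
  divisorSum-stable (suc K) k l | inj₁ (s≤s l′) =
    trans (cong₂ (λ u v → u + suc K * v) (divisorSum-stable K k l′) (shift-< (suc K) (geo K one) k (s≤s l′)))
      (trans (cong (divisor-sum k +_) (*-zeroʳ K)) (+-identityʳ _))

  divisor-sum-≥ : ∀ k → k ≤ divisor-sum k
  divisor-sum-≥ zero = z≤n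
  divisor-sum-≥ (suc k) = ≤-trans (≤-reflexive (sym (trans (cong (suc k *_) self) (*-identityʳ (suc k))))) (m≤n+m _ (divisorSum k (suc k)))
    where
    self : multiples k (suc k) ≡ 1
    self = trans (cong (multiples k) (sym (+-identityʳ (suc k)))) (trans (shift-≥ (suc k) (geo k one) 0) (geo-step k one 0))

  conv-sum : ∀ f g n → conv f g n ≡ sumTo (suc n) (λ k → f k * g (n ∸ k))
  conv-sum f g zero = sym (+-identityʳ _)
  conv-sum f g (suc n) = cong (f 0 * g (suc n) +_) (conv-sum (f ∘ suc) g n)

  p-recurrence : ∀ n → n * p n ≡ sumTo (suc n) (λ k → divisor-sum k * p (n ∸ k))
  p-recurrence n = begin
    n * p n                            ≡⟨ cong (n *_) (p≡parts n) ⟩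
    n * parts n n                      ≡⟨ recurrence n n ⟩
    conv (divisorSum n) (parts n) n    ≡⟨ conv-sum (divisorSum n) (parts n) n ⟩
    sumTo (suc n) (λ k → divisorSum n k * parts n (n ∸ k))
      ≡⟨ sumTo-cong (suc n) (λ k l → cong₂ _*_ (divisorSum-stable n k (≤-pred l)) (sym (p≡parts-≤ n (n ∸ k) (m∸n≤m n k)))) ⟩
    sumTo (suc n) (λ k → divisor-sum k * p (n ∸ k)) ∎

  cumulative : (ℕ → ℕ) → ℕ → ℕ
  cumulative f x = sumTo (suc x) f

  cumulative-shift : ∀ j f → cumulative (shift j f) ≗ shift j (cumulative f)
  cumulative-shift zero f x = refl
  cumulative-shift (suc j) f zero = refl
  cumulative-shift (suc j) f (suc x) = cumulative-shift j f x

  cumulative-one : ∀ x → cumulative one x ≡ 1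
  cumulative-one x = cong suc (sumTo-zero x (one ∘ suc) (λ _ _ → refl))

  -- Both sides vanish for x ≤ k and otherwise exceed their value at x - (k + 1) by one.
  count-multiples : ∀ k x → cumulative (multiples k) x ≡ x / suc k
  count-multiples k = <-rec (λ x → cumulative (multiples k) x ≡ x / suc k) step
    where
    unfold : cumulative (multiples k) ≗ shift (suc k) (λ m → 1 + cumulative (multiples k) m)
    unfold x = trans (cumulative-shift (suc k) (geo k one) x) (shift-cong (suc k) (λ m →
      trans (sumTo-cong (suc m) (λ i _ → geo-step k one i)) (trans (sumTo-⊕ (suc m) one (multiples k)) (cong (_+ cumulative (multiples k) m) (cumulative-one m)))) x)
    step : ∀ x → (∀ {m} → m < x → cumulative (multiples k) m ≡ m / suc k) → cumulative (multiples k) x ≡ x / suc k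
    step x rec with suc k ≤? x
    ... | no ¬l = trans (unfold x) (trans (shift-< (suc k) _ x (≰⇒> ¬l)) (sym (m<n⇒m/n≡0 (≰⇒> ¬l))))
    ... | yes l = trans (unfold x) (trans (shift-∸ (suc k) _ x l) (trans (cong suc (rec (∸-monoʳ-< {x} {suc k} {0} (s≤s z≤n) l))) (sym (m/n≡1+[m∸n]/n l))))

  cumulative-divisorSum : ∀ K x → cumulative (divisorSum K) x ≡ sumTo K (λ d → suc d * (x / suc d))
  cumulative-divisorSum zero x = sumTo-zero (suc x) _ (λ _ _ → refl)
  cumulative-divisorSum (suc K) x = begin
    cumulative (divisorSum (suc K)) x
      ≡⟨ sumTo-⊕ (suc x) (divisorSum K) (λ i → suc K * multiples K i) ⟩
    cumulative (divisorSum K) x + sumTo (suc x) (λ i → suc K * multiples K i)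
      ≡⟨ cong₂ _+_ (cumulative-divisorSum K x) (trans (sumTo-* (suc x) (suc K) (multiples K)) (cong (suc K *_) (count-multiples K x))) ⟩
    sumTo K (λ d → suc d * (x / suc d)) + suc K * (x / suc K)
      ≡⟨ sym (sumTo-last K (λ d → suc d * (x / suc d))) ⟩
    sumTo (suc K) (λ d → suc d * (x / suc d)) ∎

  -- Each d ≤ x is counted once for every multiple of it up to x.
  divisor-summatory : ∀ x → cumulative divisor-sum x ≡ sumTo x (λ d → suc d * (x / suc d))
  divisor-summatory x = trans (sumTo-cong (suc x) (λ k l → sym (divisorSum-stable x k (≤-pred l)))) (cumulative-divisorSum x x)

-- A fast table of partition numbers and its correctness

module Table where
  open import Defs using (p)
  open import Data.List using (List; []; _∷_; _++_; reverse; take; replicate; _∷ʳ_)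
  import Data.List.Properties as Listₚ
  open import Data.Nat
  open import Data.Nat.Properties
  open import Data.Sum using (inj₁; inj₂)
  open import Function.Strict using (force; force-≡)
  open import Function using (_∘_)
  open import Relation.Binary.PropositionalEquality
  open ≡-Reasoning
  open Series
  open Partitions

  -- large a n counts the partitions of n with all parts at least a, sorted by the number j of parts.
  largeTerm : ℕ → ℕ → ℕ → ℕ → ℕ
  largeTerm a s n i = shift (a * i) (parts (s + i)) n

  large : ℕ → ℕ → ℕ
  large a n = sumTo (suc n) (largeTerm a 0 n)

  sumTo-extend : ∀ M d f → (∀ i → M ≤ i → f i ≡ 0) → sumTo (M + d) f ≡ sumTo M f
  sumTo-extend zero d f h = sumTo-zero d f (λ i _ → h i z≤n)
  sumTo-extend (suc M) d f h = cong (f 0 +_) (sumTo-extend M d (f ∘ suc) (λ i l → h (suc i) (s≤s l)))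

  sumTo-truncate : ∀ M N f → (∀ i → M ≤ i → f i ≡ 0) → (∀ i → N ≤ i → f i ≡ 0) → sumTo M f ≡ sumTo N f
  sumTo-truncate M N f hM hN with ≤-total M N
  ... | inj₁ l = trans (sym (sumTo-extend M (N ∸ M) f hM)) (cong (λ v → sumTo v f) (m+[n∸m]≡n l))
  ... | inj₂ l = trans (cong (λ v → sumTo v f) (sym (m+[n∸m]≡n l))) (sumTo-extend N (M ∸ N) f hN)

  sumTo-shift : ∀ N k (F : ℕ → ℕ → ℕ) n → sumTo N (λ j → shift k (F j) n) ≡ shift k (λ m → sumTo N (λ j → F j m)) n
  sumTo-shift N zero F n = refl
  sumTo-shift N (suc k) F zero = sumTo-zero N _ (λ _ _ → refl)
  sumTo-shift N (suc k) F (suc n) = sumTo-shift N k F n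

  term-vanishes : ∀ b s n i → n < i → largeTerm (suc b) s n i ≡ 0
  term-vanishes b s n i l = shift-< (suc b * i) _ n (<-≤-trans l (m≤m+n i (b * i)))

  large-truncate : ∀ b n M → n < M → sumTo M (largeTerm (suc b) 0 n) ≡ large (suc b) n
  large-truncate b n M l = sumTo-truncate M (suc n) _ (λ i M≤i → term-vanishes b 0 n i (<-≤-trans l M≤i)) (λ i → term-vanishes b 0 n i)

  -- Euler's functional equation for F_a = Σ q^(aj) / ((1-q)⋯(1-q^j)). Multiplying the j-th term by
  -- 1 - q^j lowers the denominator, which gives F_a - F_(a+1) = q^a F_a.
  large-step : ∀ b → large (suc b) ≗ large (suc (suc b)) ⊕ shift (suc b) (large (suc b))
  large-step b n = begin
    largeTerm a 0 n 0 + sumTo n (λ j → largeTerm a 0 n (suc j))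
      ≡⟨ cong₂ _+_ (cong (λ v → shift v one n) (trans (*-zeroʳ a) (sym (*-zeroʳ (suc a))))) (sumTo-cong n (λ j _ → split j)) ⟩
    largeTerm (suc a) 0 n 0 + sumTo n ((λ j → largeTerm (suc a) 0 n (suc j)) ⊕ (λ j → shift a (λ m → largeTerm a 0 m j) n))
      ≡⟨ cong (largeTerm (suc a) 0 n 0 +_) (sumTo-⊕ n _ _) ⟩
    largeTerm (suc a) 0 n 0 + (sumTo n (λ j → largeTerm (suc a) 0 n (suc j)) + sumTo n (λ j → shift a (λ m → largeTerm a 0 m j) n))
      ≡⟨ sym (+-assoc (largeTerm (suc a) 0 n 0) _ _) ⟩
    large (suc a) n + sumTo n (λ j → shift a (λ m → largeTerm a 0 m j) n)
      ≡⟨ cong (large (suc a) n +_) (trans (sumTo-shift n a (λ j m → largeTerm a 0 m j) n) (shift-local a _ _ n (λ m l → large-truncate b m n (below l)))) ⟩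
    large (suc a) n + shift a (large a) n ∎
    where
    a = suc b
    split : ∀ j → largeTerm a 0 n (suc j) ≡ largeTerm (suc a) 0 n (suc j) + shift a (λ m → largeTerm a 0 m j) n
    split j = begin
      shift (a * suc j) (parts (suc j)) n
        ≡⟨ shift-cong (a * suc j) (parts-step j) n ⟩
      shift (a * suc j) (parts j ⊕ shift (suc j) (parts (suc j))) n
        ≡⟨ shift-⊕ (a * suc j) (parts j) _ n ⟩
      shift (a * suc j) (parts j) n + shift (a * suc j) (shift (suc j) (parts (suc j))) n
        ≡⟨ +-comm (shift (a * suc j) (parts j) n) _ ⟩
      shift (a * suc j) (shift (suc j) (parts (suc j))) n + shift (a * suc j) (parts j) n
        ≡⟨ cong₂ _+_ (trans (shift-shift (a * suc j) (suc j) _ n) (cong (λ v → shift v (parts (suc j)) n) (+-comm (a * suc j) (suc j))))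
             (trans (cong (λ v → shift v (parts j) n) (*-suc a j)) (sym (shift-shift a (a * j) (parts j) n))) ⟩
      shift (suc a * suc j) (parts (suc j)) n + shift a (shift (a * j) (parts j)) n ∎

  large-geo : ∀ b → large (suc b) ≗ geo b (large (suc (suc b)))
  large-geo b = geo-unique b _ _ (large-step b)

  -- For a = 1 the j-th term q^j / ((1-q)⋯(1-q^j)) counts the partitions with largest part j.
  large-one : large 1 ≗ p
  large-one zero = refl
  large-one (suc n) = trans (sumTo-cong (suc n) (λ i _ → cong (λ v → shift v (parts (suc i)) (suc n)) (*-identityˡ (suc i))))
    (trans (sym (parts-unroll (suc n) n)) (sym (p≡parts (suc n))))

  tab : (ℕ → ℕ) → ℕ → ℕ → List ℕ
  tab f i zero = []
  tab f i (suc L) = f i ∷ tab f (suc i) L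

  tab-cong : ∀ {f g} i L → f ≗ g → tab f i L ≡ tab g i L
  tab-cong i zero h = refl
  tab-cong i (suc L) h = cong₂ _∷_ (h i) (tab-cong (suc i) L h)

  tab-local : ∀ {f g} i L → (∀ n → n < i + L → f n ≡ g n) → tab f i L ≡ tab g i L
  tab-local i zero h = refl
  tab-local i (suc L) h = cong₂ _∷_ (h i (m<m+n i (s≤s z≤n))) (tab-local (suc i) L (λ n l → h n (≤-trans l (≤-reflexive (sym (+-suc i L))))))

  tab-snoc : ∀ f i L → tab f i L ∷ʳ f (i + L) ≡ tab f i (suc L)
  tab-snoc f i zero = cong (λ v → f v ∷ []) (+-identityʳ i)
  tab-snoc f i (suc L) = cong (f i ∷_) (trans (cong (λ v → tab f (suc i) L ∷ʳ f v) (+-suc i L)) (tab-snoc f (suc i) L))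

  take-tab : ∀ f i m r → take m (tab f i (m + r)) ≡ tab f i m
  take-tab f i zero r = refl
  take-tab f i (suc m) r = cong (f i ∷_) (take-tab f (suc i) m r)

  -- A queue (front, reversed back) holds the last k + 1 coefficients produced.
  geoQueue : List ℕ → List ℕ → List ℕ → List ℕ
  geoQueue′ : ℕ → List ℕ → List ℕ → List ℕ
  geoQueue [] F B = []
  geoQueue (x ∷ xs) (y ∷ F) B = force (x + y) (λ s → s ∷ geoQueue xs F (s ∷ B))
  geoQueue (x ∷ xs) [] B = geoQueue′ x xs (reverse B)
  geoQueue′ x xs [] = []
  geoQueue′ x xs (y ∷ F) = force (x + y) (λ s → s ∷ geoQueue xs F (s ∷ []))

  geoList : ℕ → List ℕ → List ℕ
  geoList k xs = geoQueue xs (replicate (suc k) 0) []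

  module _ (k : ℕ) (f : ℕ → ℕ) where
    private
      h : ℕ → ℕ
      h = geo k f

      advance : ∀ i F B → F ++ reverse B ≡ tab (shift (suc k) h) (suc i) k →
        F ++ reverse (h i ∷ B) ≡ tab (shift (suc k) h) (suc i) (suc k)
      advance i F B e = begin
        F ++ reverse (h i ∷ B)                                ≡⟨ cong (F ++_) (Listₚ.unfold-reverse (h i) B) ⟩
        F ++ (reverse B ++ h i ∷ [])                          ≡⟨ sym (Listₚ.++-assoc F (reverse B) _) ⟩
        (F ++ reverse B) ∷ʳ h i                               ≡⟨ cong₂ _∷ʳ_ e (sym (trans (cong (shift k h) (+-comm i k)) (shift-≥ k h i))) ⟩
        tab (shift (suc k) h) (suc i) k ∷ʳ shift (suc k) h (suc i + k) ≡⟨ tab-snoc (shift (suc k) h) (suc i) k ⟩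
        tab (shift (suc k) h) (suc i) (suc k)                 ∎

    -- Invariant: the front followed by the reversed back lists the next k + 1 coefficients of
    -- q^(k+1) h, that is, the last k + 1 coefficients of h, padded with zeros at the beginning.
    geoQueue-spec : ∀ L i F B → F ++ reverse B ≡ tab (shift (suc k) h) i (suc k) →
      geoQueue (tab f i L) F B ≡ tab h i L
    produce : ∀ L i y F B → y ≡ shift (suc k) h i → F ++ reverse B ≡ tab (shift (suc k) h) (suc i) k →
      force (f i + y) (λ s → s ∷ geoQueue (tab f (suc i) L) F (s ∷ B)) ≡ tab h i (suc L)
    geoQueue-spec zero i F B e = refl
    geoQueue-spec (suc L) i (y ∷ F) B e = produce L i y F B (Listₚ.∷-injectiveˡ e) (Listₚ.∷-injectiveʳ e)
    geoQueue-spec (suc L) i [] B e with reverse B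
    geoQueue-spec (suc L) i [] B () | []
    ... | y ∷ F = produce L i y F [] (Listₚ.∷-injectiveˡ e) (trans (Listₚ.++-identityʳ F) (Listₚ.∷-injectiveʳ e))
    produce L i y F B ey e = trans (force-≡ (f i + y) _) (trans
      (cong (λ s → s ∷ geoQueue (tab f (suc i) L) F (s ∷ B)) (trans (cong (f i +_) ey) (sym (geo-step k f i))))
      (cong (h i ∷_) (geoQueue-spec L (suc i) F (h i ∷ B) (advance i F B e))))

    geoList-spec : ∀ L → geoList k (tab f 0 L) ≡ tab h 0 L
    geoList-spec L = geoQueue-spec L 0 (replicate (suc k) 0) [] (trans (Listₚ.++-identityʳ _) (zeros (suc k) 0 ≤-refl))
      where
      zeros : ∀ m i → i + m ≤ suc k → replicate m 0 ≡ tab (shift (suc k) h) i m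
      zeros zero i l = refl
      zeros (suc m) i l = cong₂ _∷_ (sym (shift-< (suc k) h i (≤-trans (m<m+n i (s≤s z≤n)) l)))
        (zeros m (suc i) (≤-trans (≤-reflexive (sym (+-suc i m))) l))

  addShifted : ℕ → List ℕ → List ℕ → List ℕ
  addShifted b [] v = []
  addShifted (suc b) (x ∷ u) v = x ∷ addShifted b u v
  addShifted zero (x ∷ u) [] = x ∷ u
  -- `force` evaluates each sum before it is stored, so that no unevaluated sums pile up.
  addShifted zero (x ∷ u) (y ∷ v) = force (x + y) (λ s → s ∷ addShifted zero u v)

  addShifted-spec : ∀ a f h L → addShifted a (tab f 0 L) (tab h 0 (L ∸ a)) ≡ tab (f ⊕ shift a h) 0 L
  addShifted-spec a f h L = skip a 0 L refl
    where
    aligned : ∀ m L → addShifted 0 (tab f (a + m) L) (tab h m L) ≡ tab (f ⊕ shift a h) (a + m) L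
    aligned m zero = refl
    aligned m (suc L) = trans (force-≡ (f (a + m) + h m) _) (cong₂ _∷_ (cong (f (a + m) +_) (sym (shift-≥ a h m)))
      (trans (cong (λ v → addShifted 0 (tab f v L) (tab h (suc m) L)) (sym (+-suc a m))) (trans (aligned (suc m) L) (cong (λ v → tab (f ⊕ shift a h) v L) (+-suc a m)))))
    skip : ∀ b i L → i + b ≡ a → addShifted b (tab f i L) (tab h 0 (L ∸ b)) ≡ tab (f ⊕ shift a h) i L
    skip b i zero e = addShifted-[] b (tab h 0 (0 ∸ b))
      where
      addShifted-[] : ∀ b v → addShifted b [] v ≡ []
      addShifted-[] zero v = refl
      addShifted-[] (suc b) v = refl
    skip zero i (suc L) e = trans (cong (λ v → addShifted 0 (tab f v (suc L)) (tab h 0 (suc L))) i≡) (trans (aligned 0 (suc L)) (cong (λ v → tab (f ⊕ shift a h) v (suc L)) (sym i≡)))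
      where
      i≡ : i ≡ a + 0
      i≡ = trans (sym (+-identityʳ i)) (trans e (sym (+-identityʳ a)))
    skip (suc b) i (suc L) e = cong₂ _∷_ (trans (sym (+-identityʳ (f i))) (cong (f i +_) (sym (shift-< a h i (≤-trans (s≤s (m≤m+n i b)) (≤-reflexive (trans (sym (+-suc i b)) e)))))))
      (skip b (suc i) L (trans (sym (+-suc i b)) e))

  -- Horner's scheme in q^a for the sum over the number of parts; below each factor q^a the needed
  -- length drops by `a`.
  largeList : ℕ → ℕ → ℕ → List ℕ → ℕ → List ℕ
  largeList zero a j u L = u
  largeList (suc g) a j u L = addShifted a u (largeList g a (suc j) (geoList j (take (L ∸ a) u)) (L ∸ a))

  largeFuel : ℕ → ℕ → ℕ → ℕ → ℕ
  largeFuel zero a j = parts j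
  largeFuel (suc g) a j = parts j ⊕ shift a (largeFuel g a (suc j))

  take-∸ : ∀ f a L → take (L ∸ a) (tab f 0 L) ≡ tab f 0 (L ∸ a)
  take-∸ f a L with ≤-total a L
  ... | inj₁ l = trans (cong (λ v → take (L ∸ a) (tab f 0 v)) (sym (m∸n+n≡m l))) (take-tab f 0 (L ∸ a) a)
  ... | inj₂ l = trans (cong (λ v → take v (tab f 0 L)) (m≤n⇒m∸n≡0 l)) (sym (cong (tab f 0) (m≤n⇒m∸n≡0 l)))

  largeList-spec : ∀ g a j L → largeList g a j (tab (parts j) 0 L) L ≡ tab (largeFuel g a j) 0 L
  largeList-spec zero a j L = refl
  largeList-spec (suc g) a j L = trans (cong (addShifted a (tab (parts j) 0 L)) (trans
      (cong (λ v → largeList g a (suc j) v (L ∸ a)) (trans (cong (geoList j) (take-∸ (parts j) a L)) (geoList-spec j (parts j) (L ∸ a))))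
      (largeList-spec g a (suc j) (L ∸ a))))
    (addShifted-spec a (parts j) (largeFuel g a (suc j)) L)

  largeFuel-sum : ∀ g a j n → largeFuel g a j n ≡ sumTo (suc g) (largeTerm a j n)
  largeFuel-sum zero a j n = trans (cong₂ (λ u v → shift u (parts v) n) (sym (*-zeroʳ a)) (sym (+-identityʳ j))) (sym (+-identityʳ _))
  largeFuel-sum (suc g) a j n = cong₂ _+_ (cong₂ (λ u v → shift u (parts v) n) (sym (*-zeroʳ a)) (sym (+-identityʳ j)))
    (trans (shift-cong a (largeFuel-sum g a (suc j)) n) (trans (sym (sumTo-shift (suc g) a (λ i m → largeTerm a (suc j) m i) n))
      (sumTo-cong (suc g) (λ i _ → trans (shift-shift a (a * i) (parts (suc j + i)) n)
        (cong₂ (λ u v → shift u (parts v) n) (sym (*-suc a i)) (sym (+-suc j i)))))))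

  -- More than g parts, each at least b + 1, already sum to more than n.
  largeFuel-large : ∀ g b n → n < suc b * suc g → largeFuel g (suc b) 0 n ≡ large (suc b) n
  largeFuel-large g b n l = trans (largeFuel-sum g (suc b) 0 n) (sumTo-truncate (suc g) (suc n) _
    (λ i g<i → shift-< (suc b * i) (parts i) n (<-≤-trans l (*-monoʳ-≤ (suc b) g<i))) (λ i → term-vanishes b 0 n i))

  fill : ℕ → List ℕ → List ℕ
  fill zero xs = xs
  fill (suc k) xs = fill k (geoList k xs)

  fill-spec : ∀ k L → fill k (tab (large (suc k)) 0 L) ≡ tab p 0 L
  fill-spec zero L = tab-cong 0 L large-one
  fill-spec (suc k) L = trans (cong (fill k) (trans (geoList-spec k (large (suc (suc k))) L) (tab-cong 0 L (λ n → sym (large-geo k n))))) (fill-spec k L)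

  -- Parts at most k are treated one at a time, larger parts by their number.
  table : ℕ → ℕ → ℕ → List ℕ
  table k g L = fill k (largeList g (suc k) 0 (1 ∷ replicate (L ∸ 1) 0) L)

  table-spec : ∀ k g L → 0 < L → L ≤ suc k * suc g → table k g L ≡ tab p 0 L
  table-spec k g (suc L) _ l = trans (cong (fill k) (trans (cong (λ v → largeList g (suc k) 0 (1 ∷ v) (suc L)) (zeros L 0))
      (trans (largeList-spec g (suc k) 0 (suc L)) (tab-local 0 (suc L) (λ n n<L → largeFuel-large g k n (<-≤-trans n<L l))))))
    (fill-spec k (suc L))
    where
    zeros : ∀ m i → replicate m 0 ≡ tab one (suc i) m
    zeros zero i = refl
    zeros (suc m) i = cong (0 ∷_) (zeros m (suc i))

-- Numerical tests on consecutive values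

module Tests where
  open import Data.Bool using (Bool; true; _∧_)
  open import Data.List using (List; []; _∷_; drop)
  open import Data.Nat
  open import Data.Nat.Properties
  open import Relation.Binary.PropositionalEquality
  open Table using (table)

  windows : (ℕ → ℕ → ℕ → ℕ → Bool) → ℕ → ℕ → ℕ → List ℕ → Bool
  windows φ d c b [] = true
  windows φ d c b (a ∷ xs) = φ d c b a ∧ windows φ c b a xs

  windowsFrom : (ℕ → ℕ → ℕ → ℕ → Bool) → List ℕ → Bool
  windowsFrom φ (d ∷ c ∷ b ∷ xs) = windows φ d c b xs
  windowsFrom φ _ = true

  pairs : (ℕ → ℕ → Bool) → ℕ → List ℕ → ℕ → Bool
  pairs φ b (a ∷ xs) (suc k) = φ b a ∧ pairs φ a xs k
  pairs φ b _ _ = true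

  pairsFrom : (ℕ → ℕ → Bool) → List ℕ → ℕ → Bool
  pairsFrom φ [] k = true
  pairsFrom φ (b ∷ xs) k = pairs φ b xs k

  nth : List ℕ → ℕ → ℕ
  nth [] _ = 0
  nth (x ∷ xs) zero = x
  nth (x ∷ xs) (suc i) = nth xs i

  -- For consecutive values d, c, b, a, the last one at index m: δ m = δ₁/(ab), δ(m-1) = δ₀/(bc), ε
  -- m = (c δ₁ - a δ₀)/(abc) and 1 - ρ m = (a-b)/a. The tests are 50 δ ≤ 19 z³ and 5 |ε| ≤ 13 z⁵
  -- cleared of denominators; the two truncated differences cover both signs of ε.
  localTest′ : ℕ → ℕ → ℕ → ℕ → ℕ → ℕ → ℕ → Bool
  localTest′ c b a δ₀ δ₁ y₃ y₅ =
    (50 * δ₁ * (a * a) ≤ᵇ 19 * y₃ * b) ∧ (50 * δ₀ * (a * a * a) ≤ᵇ 19 * y₃ * (b * c)) ∧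
    (5 * (c * δ₁ ∸ a * δ₀) * (a * a * a * a) ≤ᵇ 13 * y₅ * (b * c)) ∧
    (5 * (a * δ₀ ∸ c * δ₁) * (a * a * a * a) ≤ᵇ 13 * y₅ * (b * c))

  cube fifth : ℕ → ℕ
  cube y = y * y * y
  fifth y = y * y * y * y * y

  localTest : ℕ → ℕ → ℕ → ℕ → Bool
  localTest d c b a = (a * c ≤ᵇ b * b) ∧ (b * d ≤ᵇ c * c) ∧ (b ≤ᵇ a) ∧
    localTest′ c b a (c * c ∸ b * d) (b * b ∸ a * c) (cube (a ∸ b)) (fifth (a ∸ b))

  square : ℕ → ℕ
  square x = x * x

  -- The claim multiplied by b² c², where consecutive u are ac/b² and bd/c², with product ad/(bc).
  -- The first three conditions make the truncated subtractions exact.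
  turanTest : ℕ → ℕ → ℕ → ℕ → Bool
  turanTest a b c d = (a * c ≤ᵇ b * b) ∧ (b * d ≤ᵇ c * c) ∧ (a * d ≤ᵇ b * c) ∧
    (suc (square (b * c ∸ a * d)) ≤ᵇ 4 * ((b * b ∸ a * c) * (c * c ∸ b * d)))

  capTest : ℕ → ℕ → Bool
  capTest b a = 1000 * b ≤ᵇ 991 * a

  -- Denominators cleared in 2⁹ p(300)/p(2000) ≤ z(2000)⁹ · 0.991^2000, where 2 is the value of z
  -- below 300.
  jumpTest : ℕ → ℕ → ℕ → Bool
  jumpTest x b a = 512 * x * (a ^ 8 * 1000 ^ 2000) ≤ᵇ (a ∸ b) ^ 9 * 991 ^ 2000

  smallTest : ℕ → ℕ → ℕ → Bool
  smallTest c b a = (b ≤ᵇ a) ∧ (1000 * (a ∸ b) ≤ᵇ c * a)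

  allTests : List ℕ → Bool
  -- A window of four that starts at m ends at m + 3: dropping 297 entries starts the local test at
  -- index 300, and dropping 94 starts the other one at `u 95`.
  allTests xs = windowsFrom localTest (drop 297 xs) ∧ windowsFrom turanTest (drop 94 xs) ∧
    pairsFrom capTest (drop 1 xs) 299 ∧ jumpTest (nth xs 300) (nth xs 1999) (nth xs 2000) ∧
    smallTest 70 (nth xs 299) (nth xs 300) ∧ smallTest 9 (nth xs 19999) (nth xs 20000)

  -- With the parts up to 100 treated singly, at most 200 larger parts can occur, because 101 · 201
  -- exceeds 20200.
  passes : allTests (table 100 200 20201) ≡ true
  passes = refl

-- What the tests say about p

module TestResults where
  open import Defs using (p)
  open import Data.Bool using (true; _∧_; T)
  open import Data.List using (drop)
  open import Data.Nat
  open import Data.Nat.Properties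
  open import Data.Product using (_×_; _,_; proj₁; proj₂)
  open import Data.Sum using (inj₁; inj₂)
  open import Data.Unit using (tt)
  open import Data.Empty using (⊥-elim)
  open import Relation.Binary.PropositionalEquality
  open Table using (tab; table; table-spec)
  open Tests

  both : ∀ {a b} → a ∧ b ≡ true → a ≡ true × b ≡ true
  both {true} {true} _ = refl , refl

  ≤ᵇ-sound : ∀ m n → (m ≤ᵇ n) ≡ true → m ≤ n
  ≤ᵇ-sound m n e = ≤ᵇ⇒≤ m n (subst T (sym e) tt)

  drop-tab : ∀ k f i L → drop k (tab f i L) ≡ tab f (k + i) (L ∸ k)
  drop-tab zero f i L = refl
  drop-tab (suc k) f i zero = refl
  drop-tab (suc k) f i (suc L) = trans (drop-tab k f (suc i) L) (cong (λ v → tab f v (L ∸ k)) (+-suc k i))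

  nth-tab : ∀ f i L k → k < L → nth (tab f i L) k ≡ f (k + i)
  nth-tab f i (suc L) zero _ = refl
  nth-tab f i (suc L) (suc k) (s≤s l) = trans (nth-tab f (suc i) L k l) (cong f (+-suc k i))

  windows-sound : ∀ φ f i L → windows φ (f i) (f (suc i)) (f (suc (suc i))) (tab f (suc (suc (suc i))) L) ≡ true →
    ∀ m → i ≤ m → m < i + L → φ (f m) (f (1 + m)) (f (2 + m)) (f (3 + m)) ≡ true
  windows-sound φ f i zero e m i≤m l = ⊥-elim (<⇒≱ l (≤-trans (≤-reflexive (+-identityʳ i)) i≤m))
  windows-sound φ f i (suc L) e m i≤m l with m≤n⇒m<n∨m≡n i≤m
  ... | inj₂ refl = proj₁ (both e)
  ... | inj₁ i<m = windows-sound φ f (suc i) L (proj₂ (both {φ (f i) (f (suc i)) (f (suc (suc i))) (f (suc (suc (suc i))))} e)) m i<m (≤-trans l (≤-reflexive (+-suc i L)))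

  windowsFrom-sound : ∀ φ f i L → windowsFrom φ (tab f i L) ≡ true →
    ∀ m → i ≤ m → 3 + m < i + L → φ (f m) (f (1 + m)) (f (2 + m)) (f (3 + m)) ≡ true
  windowsFrom-sound φ f i (suc (suc (suc L))) e m i≤m l = windows-sound φ f i L e m i≤m
    (+-cancelˡ-< 3 _ _ (≤-trans l (≤-reflexive (trans (+-suc i _) (cong suc (trans (+-suc i _) (cong suc (+-suc i L))))))))
  windowsFrom-sound φ f i 0 e m i≤m l = ⊥-elim (<⇒≱ l (≤-trans (≤-reflexive (+-identityʳ i)) (≤-trans i≤m (m≤n+m m 3))))
  windowsFrom-sound φ f i 1 e m i≤m l = ⊥-elim (<⇒≱ l (≤-trans (≤-reflexive (+-comm i 1)) (≤-trans (s≤s i≤m) (m≤n+m (suc m) 2))))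
  windowsFrom-sound φ f i 2 e m i≤m l = ⊥-elim (<⇒≱ l (≤-trans (≤-reflexive (+-comm i 2)) (≤-trans (s≤s (s≤s i≤m)) (m≤n+m (suc (suc m)) 1))))

  pairs-sound : ∀ φ f i L k → pairs φ (f i) (tab f (suc i) L) k ≡ true → ∀ m → m < k → m < L → φ (f (m + i)) (f (suc (m + i))) ≡ true
  pairs-sound φ f i (suc L) (suc k) e zero _ _ = proj₁ (both e)
  pairs-sound φ f i (suc L) (suc k) e (suc m) (s≤s lk) (s≤s lL) =
    subst (λ v → φ (f v) (f (suc v)) ≡ true) (+-suc m i) (pairs-sound φ f (suc i) L k (proj₂ (both {φ (f i) (f (suc i))} e)) m lk lL)

  module _ (f : ℕ → ℕ) (L : ℕ) (e : allTests (tab f 0 L) ≡ true) where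
    private
      e₁ = both {windowsFrom localTest (drop 297 (tab f 0 L))} e
      e₂ = both {windowsFrom turanTest (drop 94 (tab f 0 L))} (proj₂ e₁)
      e₃ = both {pairsFrom capTest (drop 1 (tab f 0 L)) 299} (proj₂ e₂)
      e₄ = both {jumpTest (nth (tab f 0 L) 300) (nth (tab f 0 L) 1999) (nth (tab f 0 L) 2000)} (proj₂ e₃)
      e₅ = both {smallTest 70 (nth (tab f 0 L) 299) (nth (tab f 0 L) 300)} (proj₂ e₄)

      at : ∀ k → k < L → nth (tab f 0 L) k ≡ f k
      at k l = trans (nth-tab f 0 L k l) (cong f (+-identityʳ k))

      from : ∀ φ k → windowsFrom φ (drop k (tab f 0 L)) ≡ true → k ≤ L →
        ∀ m → k ≤ m → 3 + m < L → φ (f m) (f (1 + m)) (f (2 + m)) (f (3 + m)) ≡ true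
      from φ k h k≤L m k≤m l = windowsFrom-sound φ f (k + 0) (L ∸ k) (trans (cong (windowsFrom φ) (sym (drop-tab k f 0 L))) h) m
        (≤-trans (≤-reflexive (+-identityʳ k)) k≤m) (≤-trans l (≤-reflexive (sym (trans (cong (_+ (L ∸ k)) (+-identityʳ k)) (m+[n∸m]≡n k≤L)))))

    local-sound : 297 ≤ L → ∀ m → 297 ≤ m → 3 + m < L → localTest (f m) (f (1 + m)) (f (2 + m)) (f (3 + m)) ≡ true
    local-sound = from localTest 297 (proj₁ e₁)

    turan-sound : 94 ≤ L → ∀ m → 94 ≤ m → 3 + m < L → turanTest (f m) (f (1 + m)) (f (2 + m)) (f (3 + m)) ≡ true
    turan-sound = from turanTest 94 (proj₁ e₂)

    cap-sound : ∀ m → m < 299 → 2 + m < L → capTest (f (1 + m)) (f (2 + m)) ≡ true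
    cap-sound m l = go L (proj₁ e₃)
      where
      go : ∀ L → pairsFrom capTest (drop 1 (tab f 0 L)) 299 ≡ true → 2 + m < L → capTest (f (1 + m)) (f (2 + m)) ≡ true
      go (suc zero) h (s≤s ())
      go (suc (suc L′)) h lL = subst (λ v → capTest (f v) (f (suc v)) ≡ true) (+-comm m 1) (pairs-sound capTest f 1 L′ 299 h m l (≤-pred (≤-pred lL)))

    jump-sound : ∀ m₀ M₀ → m₀ ≡ 300 → M₀ ≡ 2000 → 2000 < L → 512 * f m₀ * (f M₀ ^ 8 * 1000 ^ M₀) ≤ (f M₀ ∸ f (M₀ ∸ 1)) ^ 9 * 991 ^ M₀
    jump-sound _ _ refl refl l = ≤ᵇ-sound _ _ (subst₂ (λ u v → jumpTest u (proj₁ v) (proj₂ v) ≡ true) (at 300 (≤-trans (s≤s (m≤m+n 300 1700)) l))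
      (cong₂ _,_ (at 1999 (≤-trans (s≤s (m≤m+n 1999 1)) l)) (at 2000 l)) (proj₁ e₄))

    small-sound₁ : ∀ m₀ → m₀ ≡ 300 → 300 < L → 1000 * (f m₀ ∸ f (m₀ ∸ 1)) ≤ 70 * f m₀
    small-sound₁ _ refl l = ≤ᵇ-sound _ _ (proj₂ (both {f 299 ≤ᵇ f 300}
      (subst₂ (λ u v → smallTest 70 u v ≡ true) (at 299 (≤-trans (s≤s (m≤m+n 299 1)) l)) (at 300 l) (proj₁ e₅))))

    small-sound₂ : ∀ N₁ → N₁ ≡ 20000 → 20000 < L → 1000 * (f N₁ ∸ f (N₁ ∸ 1)) ≤ 9 * f N₁
    small-sound₂ _ refl l = ≤ᵇ-sound _ _ (proj₂ (both {f 19999 ≤ᵇ f 20000}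
      (subst₂ (λ u v → smallTest 9 u v ≡ true) (at 19999 (≤-trans (s≤s (m≤m+n 19999 1)) l)) (at 20000 l) (proj₂ e₅))))

  transport : ∀ xs ys → xs ≡ ys → allTests xs ≡ true → allTests ys ≡ true
  transport xs .xs refl e = e

  -- The thresholds are abstract so that the proofs below never unfold them.
  abstract
    m₀ M₀ N₁ N₀ : ℕ
    m₀ = 300
    M₀ = 2000
    N₁ = 20000
    N₀ = 20200

    3≤m₀ : 3 ≤ m₀
    3≤m₀ = ≤ᵇ⇒≤ 3 300 tt

    m₀≤M₀ : m₀ ≤ M₀
    m₀≤M₀ = ≤ᵇ⇒≤ 300 2000 tt

    M₀≤N₁ : M₀ ≤ N₁
    M₀≤N₁ = ≤ᵇ⇒≤ 2000 20000 tt

    N₁≤N₀ : N₁ ≤ N₀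
    N₁≤N₀ = ≤ᵇ⇒≤ 20000 20200 tt

    -- The inductive step looks back by at most one part in 200 of its index, and must still land at
    -- or above `N₁`.
    room : 200 * N₁ ≤ 199 * N₀
    room = ≤ᵇ⇒≤ (200 * 20000) (199 * 20200) tt

    tested : allTests (tab p 0 20201) ≡ true
    tested = transport (table 100 200 20201) (tab p 0 20201) (table-spec 100 200 20201 (s≤s z≤n) (≤ᵇ⇒≤ 20201 20301 tt)) passes

    local-holds : ∀ m → m₀ ≤ 3 + m → 3 + m ≤ N₀ → localTest (p m) (p (1 + m)) (p (2 + m)) (p (3 + m)) ≡ true
    local-holds m l u = local-sound p 20201 tested (≤ᵇ⇒≤ 297 20201 tt) m (+-cancelˡ-≤ 3 297 m l) (s≤s u)

    turan-holds : ∀ m → 94 ≤ m → 3 + m ≤ N₀ → turanTest (p m) (p (1 + m)) (p (2 + m)) (p (3 + m)) ≡ true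
    turan-holds m l u = turan-sound p 20201 tested (≤ᵇ⇒≤ 94 20201 tt) m l (s≤s u)

    cap-holds : ∀ m → 2 + m ≤ m₀ → capTest (p (1 + m)) (p (2 + m)) ≡ true
    cap-holds m l = cap-sound p 20201 tested m (≤-pred l) (s≤s (≤-trans l (≤ᵇ⇒≤ 300 20200 tt)))

    jump-holds : 512 * p m₀ * (p M₀ ^ 8 * 1000 ^ M₀) ≤ (p M₀ ∸ p (M₀ ∸ 1)) ^ 9 * 991 ^ M₀
    jump-holds = jump-sound p 20201 tested m₀ M₀ refl refl (≤ᵇ⇒≤ 2001 20201 tt)

    small-m₀ : 1000 * (p m₀ ∸ p (m₀ ∸ 1)) ≤ 70 * p m₀
    small-m₀ = small-sound₁ p 20201 tested m₀ refl (≤ᵇ⇒≤ 301 20201 tt)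

    small-N₁ : 1000 * (p N₁ ∸ p (N₁ ∸ 1)) ≤ 9 * p N₁
    small-N₁ = small-sound₂ p 20201 tested N₁ refl (≤ᵇ⇒≤ 20001 20201 tt)

    late : ∀ n → N₀ < 2 + n → N₁ ≤ n
    late n l = ≤-trans (≤ᵇ⇒≤ 20000 20199 tt) (≤-pred (≤-pred l))

  2≤m₀ : 2 ≤ m₀
  2≤m₀ = ≤-trans (n≤1+n 2) 3≤m₀

-- The properties of p that the analysis relies on

module TestedSequences where
  open import Data.Bool using (true)
  open import Data.Nat
  open import Relation.Binary.PropositionalEquality using (_≡_)
  open Partitions using (sumTo; divisor-sum)
  open Tests
  open TestResults using (m₀; M₀; N₁; N₀)

  -- In the analysis the sequence is a variable, so that neither `p` nor the table can unfold there.
  record TestedSequence : Set where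
    field
      f : ℕ → ℕ
      positive    : ∀ n → 1 ≤ f n
      monotone    : ∀ n → f n ≤ f (suc n)
      strict      : ∀ n → 1 ≤ n → f n < f (suc n)
      recurrence  : ∀ n → n * f n ≡ sumTo (suc n) (λ k → divisor-sum k * f (n ∸ k))
      locally     : ∀ m → m₀ ≤ 3 + m → 3 + m ≤ N₀ → localTest (f m) (f (1 + m)) (f (2 + m)) (f (3 + m)) ≡ true
      early       : ∀ m → 94 ≤ m → 3 + m ≤ N₀ → turanTest (f m) (f (1 + m)) (f (2 + m)) (f (3 + m)) ≡ true
      capped      : ∀ m → 2 + m ≤ m₀ → capTest (f (1 + m)) (f (2 + m)) ≡ true
      jump-test   : 512 * f m₀ * (f M₀ ^ 8 * 1000 ^ M₀) ≤ (f M₀ ∸ f (M₀ ∸ 1)) ^ 9 * 991 ^ M₀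
      small-start : 1000 * (f m₀ ∸ f (m₀ ∸ 1)) ≤ 70 * f m₀
      small-end   : 1000 * (f N₁ ∸ f (N₁ ∸ 1)) ≤ 9 * f N₁

-- Quadratic estimates for the summatory function of σ

module DivisorSums where
  open import Data.Nat
  open import Data.Nat.Properties
  open import Data.Nat.DivMod using (_/_; m≡m%n+[m/n]*n; m%n<n; m*n/n≡m; /-monoˡ-≤; m/n*n≤m; m/n≤m)
  open import Data.Sum using (inj₁; inj₂)
  open import Data.Empty using (⊥-elim)
  open import Function using (_∘_)
  open import Relation.Nullary using (yes; no)
  open import Relation.Binary.PropositionalEquality
  open Series
  open Partitions
  import Data.Nat.Solver
  open Data.Nat.Solver.+-*-Solver using (solve; _:=_; _:+_; _:*_; con)

  sumTo-mono : ∀ n {f g} → (∀ k → k < n → f k ≤ g k) → sumTo n f ≤ sumTo n g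
  sumTo-mono zero h = z≤n
  sumTo-mono (suc n) h = +-mono-≤ (h 0 (s≤s z≤n)) (sumTo-mono n (λ k l → h (suc k) (s≤s l)))

  sumTo-swap : ∀ m n (F : ℕ → ℕ → ℕ) → sumTo m (λ i → sumTo n (F i)) ≡ sumTo n (λ j → sumTo m (λ i → F i j))
  sumTo-swap zero n F = sym (sumTo-zero n _ (λ _ _ → refl))
  sumTo-swap (suc m) n F = trans (cong (sumTo n (F 0) +_) (sumTo-swap m n (F ∘ suc))) (sym (sumTo-⊕ n (F 0) (λ j → sumTo m (λ i → F (suc i) j))))

  -- The indicator of e < m.
  exceeds : ℕ → ℕ → ℕ
  exceeds e zero = 0
  exceeds zero (suc m) = 1
  exceeds (suc e) (suc m) = exceeds e m

  exceeds-< : ∀ e m → e < m → exceeds e m ≡ 1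
  exceeds-< zero (suc m) _ = refl
  exceeds-< (suc e) (suc m) (s≤s l) = exceeds-< e m l

  exceeds-≥ : ∀ e m → m ≤ e → exceeds e m ≡ 0
  exceeds-≥ e zero _ = refl
  exceeds-≥ (suc e) (suc m) (s≤s l) = exceeds-≥ e m l

  -- Layer-cake decomposition of m, cut off after E layers.
  layers : ∀ E m → sumTo E (λ e → exceeds e m) + (m ∸ E) ≡ m
  layers zero m = refl
  layers (suc E) zero = trans (+-identityʳ _) (sumTo-zero (suc E) _ (λ _ _ → refl))
  layers (suc E) (suc m) = cong suc (layers E m)

  triangle : ℕ → ℕ
  triangle m = sumTo m suc

  weighted-exceeds : ∀ x m (f : ℕ → ℕ) → m ≤ x → sumTo x (λ d → f d * exceeds d m) ≡ sumTo m f
  weighted-exceeds x zero f _ = sumTo-zero x _ (λ d _ → *-zeroʳ (f d))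
  weighted-exceeds (suc x) (suc m) f (s≤s l) = cong₂ _+_ (*-identityʳ (f 0)) (weighted-exceeds x m (f ∘ suc) l)

  <-/ : ∀ d e x → e < x / suc d → d < x / suc e
  <-/ d e x l = ≤-trans (≤-reflexive (sym (m*n/n≡m (suc d) (suc e)))) (/-monoˡ-≤ (suc e)
    (≤-trans (≤-reflexive (*-comm (suc d) (suc e))) (≤-trans (*-monoˡ-≤ (suc d) l) (m/n*n≤m x (suc d)))))

  -- Both conditions mean (d + 1)(e + 1) ≤ x.
  exceeds-sym : ∀ d e x → exceeds e (x / suc d) ≡ exceeds d (x / suc e)
  exceeds-sym d e x with suc e ≤? x / suc d
  ... | yes l = trans (exceeds-< e _ l) (sym (exceeds-< d _ (<-/ d e x l)))
  ... | no ¬l with suc d ≤? x / suc e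
  ...   | yes l = ⊥-elim (¬l (<-/ e d x l))
  ...   | no ¬l′ = trans (exceeds-≥ e _ (≤-pred (≰⇒> ¬l))) (sym (exceeds-≥ d _ (≤-pred (≰⇒> ¬l′))))

  -- Dirichlet's exchange: the pairs with (d+1)(e+1) ≤ x, weighted by d + 1, are summed over d
  -- first, which gives one triangular number for each of the E layers.
  layer-sum : ∀ E x → sumTo x (λ d → suc d * sumTo E (λ e → exceeds e (x / suc d))) ≡ sumTo E (λ e → triangle (x / suc e))
  layer-sum E x = trans (sumTo-cong x (λ d _ → trans (sym (sumTo-* E (suc d) _)) (sumTo-cong E (λ e _ → cong (suc d *_) (exceeds-sym d e x)))))
    (trans (sumTo-swap x E (λ d e → suc d * exceeds d (x / suc e)))
      (sumTo-cong E (λ e _ → weighted-exceeds x (x / suc e) suc (m/n≤m x (suc e)))))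

  S : ℕ → ℕ
  S x = cumulative divisor-sum x

  layered : ℕ → ℕ → ℕ
  layered E x = sumTo E (λ e → triangle (x / suc e))

  S-lower : ∀ E x → layered E x ≤ S x
  S-lower E x = ≤-trans (≤-reflexive (sym (layer-sum E x))) (≤-trans
    (sumTo-mono x (λ d _ → *-monoʳ-≤ (suc d) (≤-trans (m≤m+n _ (x / suc d ∸ E)) (≤-reflexive (layers E (x / suc d))))))
    (≤-reflexive (sym (divisor-summatory x))))

  S-upper : ∀ E x → S x ≤ layered E x + sumTo x (λ d → x ∸ suc d * E)
  S-upper E x = ≤-trans (≤-reflexive (divisor-summatory x)) (≤-trans
    (sumTo-mono x {g = (λ d → suc d * sumTo E (λ e → exceeds e (x / suc d))) ⊕ (λ d → x ∸ suc d * E)} (λ d _ → term d))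
    (≤-reflexive (trans (sumTo-⊕ x _ _) (cong (_+ sumTo x (λ d → x ∸ suc d * E)) (layer-sum E x)))))
    where
    term : ∀ d → suc d * (x / suc d) ≤ suc d * sumTo E (λ e → exceeds e (x / suc d)) + (x ∸ suc d * E)
    term d = ≤-trans (≤-reflexive (trans (cong (suc d *_) (sym (layers E (x / suc d)))) (*-distribˡ-+ (suc d) _ (x / suc d ∸ E))))
      (+-monoʳ-≤ _ (≤-trans (≤-reflexive (*-distribˡ-∸ (suc d) (x / suc d) E)) (∸-monoˡ-≤ (suc d * E) (≤-trans (≤-reflexive (*-comm (suc d) (x / suc d))) (m/n*n≤m x (suc d))))))

  -- 2 E (x ∸ (d+1) E) ≤ (x ∸ d E)² - (x ∸ (d+1) E)² telescopes.
  remainder-sum : ∀ E x n → 2 * E * sumTo n (λ d → x ∸ suc d * E) ≤ x * x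
  remainder-sum E x zero = ≤-trans (≤-reflexive (*-zeroʳ (2 * E))) z≤n
  remainder-sum E x (suc n) = ≤-trans (≤-reflexive (trans (cong (2 * E *_) (cong₂ _+_ (cong (x ∸_) (+-identityʳ E)) (sumTo-cong n (λ d _ → sym (∸-+-assoc x E (suc d * E))))))
      (*-distribˡ-+ (2 * E) (x ∸ E) _))) (≤-trans (+-monoʳ-≤ (2 * E * (x ∸ E)) (remainder-sum E (x ∸ E) n)) (square-step x))
    where
    square-step : ∀ x → 2 * E * (x ∸ E) + (x ∸ E) * (x ∸ E) ≤ x * x
    square-step x with ≤-total E x
    ... | inj₂ l = ≤-trans (≤-reflexive (cong (λ v → 2 * E * v + v * v) (m≤n⇒m∸n≡0 l))) (≤-trans (≤-reflexive (trans (+-identityʳ _) (*-zeroʳ (2 * E)))) z≤n)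
    ... | inj₁ l = ≤-trans (m≤m+n _ (E * E)) (≤-reflexive (trans
        (solve 2 (λ e u → con 2 :* e :* u :+ u :* u :+ e :* e := (e :+ u) :* (e :+ u)) refl E (x ∸ E)) (cong (λ v → v * v) (m+[n∸m]≡n l))))

  double-triangle : ∀ m → 2 * triangle m ≡ m * suc m
  double-triangle zero = refl
  double-triangle (suc m) = trans (cong (2 *_) (sumTo-last m suc)) (trans (*-distribˡ-+ 2 (triangle m) (suc m)) (trans (cong (_+ 2 * suc m) (double-triangle m))
    (solve 1 (λ m → m :* (con 1 :+ m) :+ con 2 :* (con 1 :+ m) := (con 1 :+ m) :* (con 1 :+ (con 1 :+ m))) refl m)))

  -- Here `q e` is Q/(e+1) without fractions, so `c₁` and `c₂` are Q² times Σ 1/e² and Σ 1/e up to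
  -- E; half of the first sum is the coefficient of x².
  module Layers (E Q : ℕ) (q : ℕ → ℕ) (qe : ∀ e → e < E → q e * suc e ≡ Q) where
    c₁ c₂ : ℕ
    c₁ = sumTo E (λ e → q e * q e)
    c₂ = sumTo E (λ e → q e * q e * suc e)

    private
      scaled : ∀ e x → e < E → 2 * (Q * Q) * triangle (x / suc e) ≡ q e * q e * (suc e * (x / suc e) * (suc e * (x / suc e) + suc e))
      scaled e x l = trans (cong (λ v → 2 * (v * v) * triangle m) (sym (qe e l))) (trans
        (solve 3 (λ a b t → con 2 :* (a :* b :* (a :* b)) :* t := a :* a :* (b :* b) :* (con 2 :* t)) refl (q e) (suc e) (triangle m))
        (trans (cong (q e * q e * (suc e * suc e) *_) (double-triangle m))
          (solve 3 (λ a b m → a :* a :* (b :* b) :* (m :* (con 1 :+ m)) := a :* a :* (b :* m :* (b :* m :+ b))) refl (q e) (suc e) m)))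
        where m = x / suc e

    layered-upper : ∀ x → 2 * (Q * Q) * layered E x ≤ c₁ * (x * x) + c₂ * x
    layered-upper x = ≤-trans (≤-reflexive (sym (sumTo-* E (2 * (Q * Q)) _))) (≤-trans (sumTo-mono E {g = (λ e → x * x * (q e * q e)) ⊕ (λ e → x * (q e * q e * suc e))} term)
      (≤-reflexive (trans (sumTo-⊕ E _ _) (cong₂ _+_ (trans (sumTo-* E (x * x) _) (*-comm (x * x) c₁)) (trans (sumTo-* E x _) (*-comm x c₂))))))
      where
      term : ∀ e → e < E → 2 * (Q * Q) * triangle (x / suc e) ≤ x * x * (q e * q e) + x * (q e * q e * suc e)
      term e l = ≤-trans (≤-reflexive (scaled e x l)) (≤-trans (*-monoʳ-≤ (q e * q e) (*-mono-≤ em≤x (+-monoˡ-≤ (suc e) em≤x)))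
        (≤-reflexive (solve 3 (λ a x e → a :* (x :* (x :+ e)) := x :* x :* a :+ x :* (a :* e)) refl (q e * q e) x (suc e))))
        where
        em≤x : suc e * (x / suc e) ≤ x
        em≤x = ≤-trans (≤-reflexive (*-comm (suc e) (x / suc e))) (m/n*n≤m x (suc e))

    layered-lower : ∀ x → c₁ * (suc x * suc x) ≤ 2 * (Q * Q) * layered E x + c₂ * suc x
    layered-lower x = ≤-trans (≤-reflexive (trans (*-comm c₁ _) (sym (sumTo-* E (suc x * suc x) _)))) (≤-trans
      (sumTo-mono E {g = (λ e → 2 * (Q * Q) * triangle (x / suc e)) ⊕ (λ e → suc x * (q e * q e * suc e))} term)
      (≤-reflexive (trans (sumTo-⊕ E _ _) (cong₂ _+_ (sumTo-* E (2 * (Q * Q)) _) (trans (sumTo-* E (suc x) _) (*-comm (suc x) c₂))))))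
      where
      term : ∀ e → e < E → suc x * suc x * (q e * q e) ≤ 2 * (Q * Q) * triangle (x / suc e) + suc x * (q e * q e * suc e)
      term e l = ≤-trans (≤-reflexive (*-comm (suc x * suc x) (q e * q e))) (≤-trans (*-monoʳ-≤ (q e * q e) (key (suc x) (suc e * (x / suc e)) (suc e) x<))
        (≤-reflexive (trans (solve 4 (λ a m e x → a :* (m :* (m :+ e) :+ x :* e) := a :* (m :* (m :+ e)) :+ x :* (a :* e)) refl (q e * q e) (suc e * (x / suc e)) (suc e) (suc x))
          (cong (_+ suc x * (q e * q e * suc e)) (sym (scaled e x l))))))
        where
        x< : suc x ≤ suc e * (x / suc e) + suc e
        x< = ≤-trans (≤-reflexive (cong suc (m≡m%n+[m/n]*n x (suc e)))) (≤-trans (+-monoˡ-≤ (x / suc e * suc e) (m%n<n x (suc e)))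
          (≤-reflexive (solve 2 (λ m e → e :+ m :* e := e :* m :+ e) refl (x / suc e) (suc e))))
        key : ∀ X M e → X ≤ M + e → X * X ≤ M * (M + e) + X * e
        -- X² ≤ X (M + e) = X M + X e, and the hypothesis is applied once more to X M.
        key X M e h = ≤-trans (*-monoʳ-≤ X h) (≤-trans (≤-reflexive (*-distribˡ-+ X M e)) (+-monoˡ-≤ (X * e) (≤-trans (*-monoˡ-≤ M h) (≤-reflexive (*-comm (M + e) M)))))

module Analysis (𝓡 : OrderedRing) where
  open Ordered 𝓡

  -- Finite sums in an ordered ring

  module Sums where
    open import Data.List using ([]; _∷_)
    open import Data.Nat as ℕ using (ℕ; zero; suc)
    import Data.Nat.Properties as ℕₚ
    open import Data.Product using (_,_)
    open import Data.Sum using (inj₁; inj₂)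
    open import Data.Unit using (tt)
    open import Relation.Nullary using (¬_)
    open import Relation.Binary.PropositionalEquality hiding ([_])
    open ≡-Reasoning

    ≡≤ : ∀ {x y z} → x ≡ y → y ≤ z → x ≤ z
    ≡≤ refl h = h

    ≤≡ : ∀ {x y z} → x ≤ y → y ≡ z → x ≤ z
    ≤≡ h refl = h

    #0≤ : ∀ n → # 0 ≤ # n
    #0≤ n = ≡≤ #-0 (#-nonneg n)

    nonneg# : ∀ {x} → # 0 ≤ x → 0# ≤ x
    nonneg# = ≡≤ (sym #-0)

    #nonneg : ∀ {x} → 0# ≤ x → # 0 ≤ x
    #nonneg = ≡≤ #-0

    *0≤ : ∀ {x y} → # 0 ≤ x → # 0 ≤ y → # 0 ≤ x * y
    *0≤ a b = #nonneg (*-nonneg (nonneg# a) (nonneg# b))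

    +0≤ : ∀ {x y} → # 0 ≤ x → # 0 ≤ y → # 0 ≤ x + y
    +0≤ a b = #nonneg (+-nonneg (nonneg# a) (nonneg# b))

    ^0≤ : ∀ {x} n → # 0 ≤ x → # 0 ≤ x ^ n
    ^0≤ zero h = ≤≡ (#0≤ 1) #-1
    ^0≤ (suc n) h = *0≤ h (^0≤ n h)

    *-monoʳ : ∀ {c x y} → # 0 ≤ c → x ≤ y → c * x ≤ c * y
    *-monoʳ {c} {x} {y} h1 h2 =
      arith (c ∷ x ∷ y ∷ [])
        ((con 0 :≤ var 0) ∷ (var 1 :≤ var 2) ∷ [])
        (var 0 :* var 1 :≤ var 0 :* var 2) 0
        ((1 , 0 ∷ 1 ∷ []) ∷ []) refl
        (h1 , h2 , tt)

    *-monoˡ : ∀ {c x y} → # 0 ≤ c → x ≤ y → x * c ≤ y * c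
    *-monoˡ {c} {x} {y} h1 h2 =
      arith (c ∷ x ∷ y ∷ [])
        ((con 0 :≤ var 0) ∷ (var 1 :≤ var 2) ∷ [])
        (var 1 :* var 0 :≤ var 2 :* var 0) 0
        ((1 , 0 ∷ 1 ∷ []) ∷ []) refl
        (h1 , h2 , tt)

    +-monoʳ : ∀ {c x y} → x ≤ y → c + x ≤ c + y
    +-monoʳ {c} {x} {y} h1 =
      arith (c ∷ x ∷ y ∷ [])
        ((var 1 :≤ var 2) ∷ [])
        (var 0 :+ var 1 :≤ var 0 :+ var 2) 0
        ((1 , 0 ∷ []) ∷ []) refl
        (h1 , tt)

    *-mono : ∀ {a b x y} → # 0 ≤ x → # 0 ≤ b → a ≤ b → x ≤ y → a * x ≤ b * y
    *-mono 0x 0b ab xy = ≤-trans (*-monoˡ 0x ab) (*-monoʳ 0b xy)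

    ^-mono : ∀ {x y} n → # 0 ≤ x → x ≤ y → x ^ n ≤ y ^ n
    ^-mono zero h k = ≤-refl
    ^-mono (suc n) h k = *-mono (^0≤ n h) (≤-trans h k) k (^-mono n h k)

    #mono : ∀ {m n} → m ℕ.≤ n → # m ≤ # n
    #mono {m} {n} h = ≤≡ (≡≤ (sym (+-identityʳ (# m))) (+-monoʳ (nonneg0 (n ℕ.∸ m))))
      (trans (sym (#-+ m (n ℕ.∸ m))) (cong # (ℕₚ.m+[n∸m]≡n h)))
      where
      nonneg0 : ∀ k → 0# ≤ # k
      nonneg0 k = nonneg# (#0≤ k)

    Pos : A → Set
    Pos x = ¬ (x ≤ # 0)

    pos⇒0≤ : ∀ {x} → Pos x → # 0 ≤ x
    pos⇒0≤ {x} h with ≤-total (# 0) x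
    ... | inj₁ a = a
    ... | inj₂ b with h b
    ...   | ()

    *-cancelˡ : ∀ {c x y} → Pos c → c * x ≤ c * y → x ≤ y
    *-cancelˡ {c} {x} {y} p h = 0≤⇒≤ (*-cancel (λ q → p (≤≡ q (sym #-0)))
      (≤≡ (≤⇒0≤ h) (ring (c ∷ x ∷ y ∷ []) (var 0 :* var 2 :- var 0 :* var 1) (var 0 :* (var 2 :- var 1)) refl)))

    *-cancel-≡ : ∀ {c x y} → Pos c → c * x ≡ c * y → x ≡ y
    *-cancel-≡ p e = ≤-antisym (*-cancelˡ p (reflexive e)) (*-cancelˡ p (reflexive (sym e)))

    Pos-≤ : ∀ {x y} → Pos x → x ≤ y → Pos y
    Pos-≤ p h q = p (≤-trans h q)

    Pos-* : ∀ {x y} → Pos x → Pos y → Pos (x * y)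
    Pos-* {x} {y} p q h = q (*-cancelˡ p (≤≡ h (ring (x ∷ []) (con 0) (var 0 :* con 0) refl)))

    Pos-^ : ∀ {x} n → Pos x → Pos (x ^ n)
    Pos-^ zero p h = 1≰0 (≤≡ h #-0)
    Pos-^ (suc n) p = Pos-* p (Pos-^ n p)

    #Pos : ∀ n → Pos (# (suc n))
    #Pos n h = #-pos n (≤≡ h #-0)

    #reflect : ∀ {m n} → # m ≤ # n → m ℕ.≤ n
    #reflect {m} {n} h with ℕₚ.≤-total m n
    ... | inj₁ le = le
    ... | inj₂ ge with ℕₚ.m≤n⇒m<n∨m≡n ge
    ...   | inj₂ e = ℕₚ.≤-reflexive (sym e)
    ...   | inj₁ lt with absurd (≤-trans (#mono lt) h)
      where
      absurd : ¬ (# (suc n) ≤ # n)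
      absurd k = #Pos 0 (cancel1 (≡≤ (sym (#-suc n)) k))
        where
        cancel1 : 1# + # n ≤ # n → # 1 ≤ # 0
        cancel1 k = ≡≤ #-1 (arith (1# ∷ # n ∷ []) ((var 0 :+ var 1 :≤ var 1) ∷ []) (var 0 :≤ con 0) 0 ((1 , 0 ∷ []) ∷ []) refl (k , tt))
    ...     | ()

    #suc : ∀ n → # (suc n) ≡ # n + # 1
    #suc n = trans (#-suc n) (trans (+-comm 1# (# n)) (cong (# n +_) (sym #-1)))

    sum : ℕ → (ℕ → A) → A
    sum zero f = # 0
    sum (suc n) f = sum n f + f n

    sum-cong : ∀ n {f g} → (∀ k → k ℕ.< n → f k ≡ g k) → sum n f ≡ sum n g
    sum-cong zero h = refl
    sum-cong (suc n) h = cong₂ _+_ (sum-cong n (λ k l → h k (ℕₚ.m≤n⇒m≤1+n l))) (h n ℕₚ.≤-refl)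

    sum-mono : ∀ n {f g} → (∀ k → k ℕ.< n → f k ≤ g k) → sum n f ≤ sum n g
    sum-mono zero h = ≤-refl
    sum-mono (suc n) h = +-mono-≤ (sum-mono n (λ k l → h k (ℕₚ.m≤n⇒m≤1+n l))) (h n ℕₚ.≤-refl)

    sum-nonneg : ∀ n {f} → (∀ k → # 0 ≤ f k) → # 0 ≤ sum n f
    sum-nonneg zero h = ≤-refl
    sum-nonneg (suc n) h = +0≤ (sum-nonneg n h) (h n)

    sum-+ : ∀ n f g → sum n (λ k → f k + g k) ≡ sum n f + sum n g
    sum-+ zero f g = ring [] (con 0) (con 0 :+ con 0) refl
    sum-+ (suc n) f g = trans (cong (_+ (f n + g n)) (sum-+ n f g)) (+-interchange _ _ _ _)

    sum-*ˡ : ∀ n c f → sum n (λ k → c * f k) ≡ c * sum n f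
    sum-*ˡ zero c f = ring (c ∷ []) (con 0) (var 0 :* con 0) refl
    sum-*ˡ (suc n) c f = trans (cong (_+ c * f n) (sum-*ˡ n c f)) (sym (distribˡ c _ _))

    sum-split : ∀ m n f → sum (m ℕ.+ n) f ≡ sum m f + sum n (λ k → f (m ℕ.+ k))
    sum-split m zero f = trans (cong (λ v → sum v f) (ℕₚ.+-identityʳ m)) (ring (sum m f ∷ []) (var 0) (var 0 :+ con 0) refl)
    sum-split m (suc n) f = trans (cong (λ v → sum v f) (ℕₚ.+-suc m n))
      (trans (cong (_+ f (m ℕ.+ n)) (sum-split m n f)) (+-assoc _ _ _))

    sum-head : ∀ n f → sum (suc n) f ≡ f 0 + sum n (λ k → f (suc k))
    sum-head n f = trans (sum-split 1 n f) (cong (_+ sum n (λ k → f (suc k))) (ring (f 0 ∷ []) (con 0 :+ var 0) (var 0) refl))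

    -- Summation by parts.
    abel-mono : ∀ (a b R : ℕ → A) → (∀ k → R (suc k) ≤ R k) → (∀ k → # 0 ≤ R k) →
      (∀ k → sum k a ≤ sum k b) → ∀ n → sum n (λ k → a k * R k) ≤ sum n (λ k → b k * R k)
    abel-mono a b R dec pos dom n = drop (≤-trans (reflexive (by-parts a n)) (≤-trans (middle n) (reflexive (sym (by-parts b n))))) (*-monoˡ (pos n) (dom n))
      where
      by-parts : ∀ c n → sum n (λ k → c k * R k) - sum n c * R n ≡ sum n (λ k → sum (suc k) c * (R k - R (suc k)))
      by-parts c zero = ring (R 0 ∷ []) (con 0 :- con 0 :* var 0) (con 0) refl
      by-parts c (suc n) = trans
        (ring (sum n (λ k → c k * R k) ∷ c n ∷ R n ∷ R (suc n) ∷ sum n c ∷ [])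
          (var 0 :+ var 1 :* var 2 :- (var 4 :+ var 1) :* var 3)
          (var 0 :- var 4 :* var 2 :+ (var 4 :+ var 1) :* (var 2 :- var 3)) refl)
        (cong (_+ sum (suc n) c * (R n - R (suc n))) (by-parts c n))
      middle : ∀ n → sum n (λ k → sum (suc k) a * (R k - R (suc k))) ≤ sum n (λ k → sum (suc k) b * (R k - R (suc k)))
      middle n = sum-mono n (λ k _ → *-monoˡ (#nonneg (≤⇒0≤ (dec k))) (dom (suc k)))
      drop : ∀ {x y u v} → x - u ≤ y - v → u ≤ v → x ≤ y
      drop {x} {y} {u} {v} p q = arith (x ∷ y ∷ u ∷ v ∷ []) ((var 0 :- var 2 :≤ var 1 :- var 3) ∷ (var 2 :≤ var 3) ∷ [])
        (var 0 :≤ var 1) 0 ((1 , 0 ∷ []) ∷ (1 , 1 ∷ []) ∷ []) refl (p , q , tt)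

    -- Multiplying Σ f(k) r^k by t = 1 - r replaces f by its differences, up to a boundary term f(n)
    -- r^(n+1). This term is nonnegative, but `strong` has to keep it for the induction on n.
    geometric : ∀ (f g : ℕ → A) (r t : A) → # 0 ≤ r → r + t ≡ # 1 → (∀ k → # 0 ≤ f k) →
      f 0 ≤ g 0 → (∀ k → f (suc k) ≤ f k + g (suc k)) → ∀ n →
      t * sum n (λ k → f k * r ^ k) ≤ sum n (λ k → g k * r ^ k)
    geometric f g r t 0r e 0f base step zero = reflexive (ring (t ∷ []) (var 0 :* con 0) (con 0) refl)
    geometric f g r t 0r e 0f base step (suc n) = ≤-trans (weaken (*0≤ (0f n) (^0≤ (suc n) 0r))) (strong n)
      where
      weaken : ∀ {x u} → # 0 ≤ u → x ≤ x + u
      weaken {x} {u} h = arith (x ∷ u ∷ []) ((con 0 :≤ var 1) ∷ []) (var 0 :≤ var 0 :+ var 1) 0 ((1 , 0 ∷ []) ∷ []) refl (h , tt)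
      S G : ℕ → A
      S n = sum n (λ k → f k * r ^ k)
      G n = sum n (λ k → g k * r ^ k)
      t≡ : t ≡ # 1 - r
      t≡ = trans (ring (t ∷ r ∷ []) (var 0) ((var 1 :+ var 0) :- var 1) refl) (cong (_- r) e)
      strong : ∀ n → t * S (suc n) + f n * r ^ suc n ≤ G (suc n)
      strong zero = ≡≤ (trans (cong (λ v → v * (# 0 + f 0 * 1#) + f 0 * (r * 1#)) t≡)
          (trans (cong (λ v → (# 1 - r) * (# 0 + f 0 * v) + f 0 * (r * v)) (sym #-1))
          (ring (f 0 ∷ r ∷ []) ((con 1 :- var 1) :* (con 0 :+ var 0 :* con 1) :+ var 0 :* (var 1 :* con 1)) (con 0 :+ var 0 :* con 1) refl)))
        (≤≡ (+-monoʳ (*-monoˡ (#0≤ 1) base)) (cong (λ v → # 0 + g 0 * v) #-1))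
      strong (suc n) = ≤-trans (≡≤ (cong (λ v → v * S (suc (suc n)) + f (suc n) * r ^ suc (suc n)) t≡)
        (≡≤ (ring (r ∷ S (suc n) ∷ f (suc n) ∷ r ^ suc n ∷ f n ∷ [])
           ((con 1 :- var 0) :* (var 1 :+ var 2 :* var 3) :+ var 2 :* (var 0 :* var 3))
           (((con 1 :- var 0) :* var 1 :+ var 4 :* var 3) :+ (var 2 :- var 4) :* var 3) refl)
        (≡≤ (cong (λ v → (v * S (suc n) + f n * r ^ suc n) + (f (suc n) - f n) * r ^ suc n) (sym t≡))
          (+-mono-≤ (strong n) (*-monoˡ (^0≤ (suc n) 0r) (shift (step n))))))) ≤-refl
        where
        shift : ∀ {x y z} → x ≤ y + z → x - y ≤ z
        shift {x} {y} {z} h = arith (x ∷ y ∷ z ∷ []) ((var 0 :≤ var 1 :+ var 2) ∷ []) (var 0 :- var 1 :≤ var 2) 0 ((1 , 0 ∷ []) ∷ []) refl (h , tt)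

    tail : (ℕ → A) → ℕ → ℕ → A
    tail c n i = sum (n ℕ.∸ suc i) (λ j → c (suc i ℕ.+ j))

    tail-suc : ∀ c n i → i ℕ.< n → tail c (suc n) i ≡ tail c n i + c n
    tail-suc c n i l = trans (cong (λ v → sum v (λ j → c (suc i ℕ.+ j))) (ℕₚ.+-∸-assoc 1 l))
      (cong (λ v → tail c n i + c v) (ℕₚ.m+[n∸m]≡n l))

    tail-end : ∀ c n → tail c (suc n) n ≡ # 0
    tail-end c n = cong (λ v → sum v (λ j → c (suc n ℕ.+ j))) (ℕₚ.n∸n≡0 n)

    -- Exchange of the summations over i < k; `tail c n i` collects the c k with i < k < n.
    sum-swap : ∀ c g n → sum n (λ k → c k * sum k g) ≡ sum n (λ i → g i * tail c n i)
    sum-swap c g zero = refl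
    sum-swap c g (suc n) = begin
      sum n (λ k → c k * sum k g) + c n * sum n g
        ≡⟨ cong₂ _+_ (sum-swap c g n) (sym (sum-*ˡ n (c n) g)) ⟩
      sum n (λ i → g i * tail c n i) + sum n (λ i → c n * g i)
        ≡⟨ sym (sum-+ n _ _) ⟩
      sum n (λ i → g i * tail c n i + c n * g i)
        ≡⟨ sum-cong n (λ i l → trans (ring (g i ∷ tail c n i ∷ c n ∷ [])
             (var 0 :* var 1 :+ var 2 :* var 0) (var 0 :* (var 1 :+ var 2)) refl)
             (cong (g i *_) (sym (tail-suc c n i l)))) ⟩
      sum n (λ i → g i * tail c (suc n) i)
        ≡⟨ ring (sum n (λ i → g i * tail c (suc n) i) ∷ g n ∷ []) (var 0) (var 0 :+ var 1 :* con 0) refl ⟩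
      sum n (λ i → g i * tail c (suc n) i) + g n * # 0
        ≡⟨ cong (λ v → sum n (λ i → g i * tail c (suc n) i) + g n * v) (sym (tail-end c n)) ⟩
      sum n (λ i → g i * tail c (suc n) i) + g n * tail c (suc n) n ∎

  -- Moments of σ compared with polynomials

  module Moments where
    open import Data.Nat as ℕ using (ℕ; zero; suc)
    open import Relation.Binary.PropositionalEquality hiding ([_])
    open import Data.List using ([]; _∷_)
    open import Data.Product using (_,_)
    open ≡-Reasoning
    open Sums

    pow1 pow2 pow3 : ℕ → A
    pow1 k = # k
    pow2 k = # k * # k
    pow3 k = # k * # k * # k

    -- Rising factorials replace powers because Σ k(k+1)⋯(k+a-1) r^k has the closed form a! r /
    -- (1-r)^(a+1).
    rise2 rise3 rise4 fall2 odds : ℕ → A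
    rise2 k = # k * (# k + # 1)
    rise3 k = # k * (# k + # 1) * (# k + # 2)
    rise4 k = # k * (# k + # 1) * (# k + # 2) * (# k + # 3)
    fall2 k = # k * (# k - # 1)
    odds zero = # 0
    odds (suc k) = # 2 * # k + # 1

    -- The outcome is a domination of partial sums; by `abel-mono` it then holds against every
    -- decreasing weight, in particular `R n k` and `r ^ k`.
    module Bounds (σ : ℕ → ℕ) (σ-zero : σ 0 ≡ 0) (hi : ∀ j → # 6 * sum (suc j) (λ k → # (σ k)) ≤ # 5 * (# j * # j + # j)) (lo : ∀ j → # 81 * (# j * # j) ≤ # 100 * sum (suc j) (λ k → # (σ k))) where

      S : ℕ → A
      S j = sum (suc j) (λ k → # (σ k))

      closed : ∀ (c : A) (f F : ℕ → A) → F 0 ≡ # 0 → (∀ j → F (suc j) ≡ F j + c * f j) → ∀ j → c * sum j f ≡ F j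
      closed c f F z s zero = trans (ring (c ∷ []) (var 0 :* con 0) (con 0) refl) (sym z)
      closed c f F z s (suc j) = trans (distribˡ c _ _) (trans (cong (_+ c * f j) (closed c f F z s j)) (sym (s j)))

      -- Σ_{i ≤ j} i^a σ(i) = j^a S(j) - Σ_{i < j} ((i+1)^a - i^a) S(i).
      moment : ∀ (f : ℕ → A) → f 0 ≡ # 0 → ∀ j →
        sum (suc j) (λ k → f k * # (σ k)) ≡ f j * S j - sum j (λ i → (f (suc i) - f i) * S i)
      moment f z zero = trans (cong (λ v → # 0 + v * # (σ 0)) z)
        (trans (ring (# (σ 0) ∷ []) (con 0 :+ con 0 :* var 0) (con 0 :* (con 0 :+ var 0) :- con 0) refl)
          (cong (λ v → v * S 0 - # 0) (sym z)))
      moment f z (suc j) = trans (cong (_+ f (suc j) * # (σ (suc j))) (moment f z j))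
        (ring (f j ∷ S j ∷ sum j (λ i → (f (suc i) - f i) * S i) ∷ f (suc j) ∷ # (σ (suc j)) ∷ [])
          (var 0 :* var 1 :- var 2 :+ var 3 :* var 4) (var 3 :* (var 1 :+ var 4) :- (var 2 :+ (var 3 :- var 0) :* var 1)) refl)

      w1 w2 w3 : ℕ → A
      w1 k = # 1
      w2 k = # 2 * # k + # 1
      w3 k = # 3 * # k * # k + # 3 * # k + # 1

      lower-sum : ∀ (w : ℕ → A) → (∀ i → # 0 ≤ w i) → ∀ j →
        sum j (λ i → w i * (# 81 * (# i * # i))) ≤ # 100 * sum j (λ i → w i * S i)
      lower-sum w 0w j = ≤≡ (sum-mono j (λ i _ → ≤≡ (*-monoʳ (0w i) (lo i))
          (ring (w i ∷ S i ∷ []) (var 0 :* (con 100 :* var 1)) (con 100 :* (var 0 :* var 1)) refl)))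
        (sum-*ˡ j (# 100) (λ i → w i * S i))

      upper-sum : ∀ j → # 6 * sum j (λ i → w1 i * S i) ≤ sum j (λ i → # 5 * (# i * # i + # i))
      upper-sum j = ≡≤ (sym (sum-*ˡ j (# 6) _)) (sum-mono j (λ i _ → ≡≤ (cong (# 6 *_) (*-one (S i))) (hi i)))
        where
        *-one : ∀ x → # 1 * x ≡ x
        *-one x = ring (x ∷ []) (con 1 :* var 0) (var 0) refl

      sum-w1 : ∀ j → # 2 * sum j (λ k → # 1 * (# 81 * (# k * # k))) ≡ # 54 * (# j * # j * # j) + # 27 * # j - # 81 * (# j * # j)
      sum-w1 = closed (# 2) (λ k → # 1 * (# 81 * (# k * # k))) (λ j → # 54 * (# j * # j * # j) + # 27 * # j - # 81 * (# j * # j)) zero-case step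
        where
        zero-case : # 54 * (# 0 * # 0 * # 0) + # 27 * # 0 - # 81 * (# 0 * # 0) ≡ # 0
        zero-case = ring [] (con 54 :* (con 0 :* con 0 :* con 0) :+ con 27 :* con 0 :- con 81 :* (con 0 :* con 0)) (con 0) refl
        step : ∀ j → # 54 * (# (suc j) * # (suc j) * # (suc j)) + # 27 * # (suc j) - # 81 * (# (suc j) * # (suc j)) ≡ # 54 * (# j * # j * # j) + # 27 * # j - # 81 * (# j * # j) + # 2 * (# 1 * (# 81 * (# j * # j)))
        step j rewrite #suc j = ring (# j ∷ []) (con 54 :* ((var 0 :+ con 1) :* (var 0 :+ con 1) :* (var 0 :+ con 1)) :+ con 27 :* (var 0 :+ con 1) :- con 81 :* ((var 0 :+ con 1) :* (var 0 :+ con 1))) (con 54 :* (var 0 :* var 0 :* var 0) :+ con 27 :* var 0 :- con 81 :* (var 0 :* var 0) :+ con 2 :* (con 1 :* (con 81 :* (var 0 :* var 0)))) refl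

      sum-w2 : ∀ j → # 2 * sum j (λ k → (# 2 * # k + # 1) * (# 81 * (# k * # k))) ≡ # 81 * (# j * # j * # j * # j) + # 27 * # j - # 108 * (# j * # j * # j)
      sum-w2 = closed (# 2) (λ k → (# 2 * # k + # 1) * (# 81 * (# k * # k))) (λ j → # 81 * (# j * # j * # j * # j) + # 27 * # j - # 108 * (# j * # j * # j)) zero-case step
        where
        zero-case : # 81 * (# 0 * # 0 * # 0 * # 0) + # 27 * # 0 - # 108 * (# 0 * # 0 * # 0) ≡ # 0
        zero-case = ring [] (con 81 :* (con 0 :* con 0 :* con 0 :* con 0) :+ con 27 :* con 0 :- con 108 :* (con 0 :* con 0 :* con 0)) (con 0) refl
        step : ∀ j → # 81 * (# (suc j) * # (suc j) * # (suc j) * # (suc j)) + # 27 * # (suc j) - # 108 * (# (suc j) * # (suc j) * # (suc j)) ≡ # 81 * (# j * # j * # j * # j) + # 27 * # j - # 108 * (# j * # j * # j) + # 2 * ((# 2 * # j + # 1) * (# 81 * (# j * # j)))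
        step j rewrite #suc j = ring (# j ∷ []) (con 81 :* ((var 0 :+ con 1) :* (var 0 :+ con 1) :* (var 0 :+ con 1) :* (var 0 :+ con 1)) :+ con 27 :* (var 0 :+ con 1) :- con 108 :* ((var 0 :+ con 1) :* (var 0 :+ con 1) :* (var 0 :+ con 1))) (con 81 :* (var 0 :* var 0 :* var 0 :* var 0) :+ con 27 :* var 0 :- con 108 :* (var 0 :* var 0 :* var 0) :+ con 2 :* ((con 2 :* var 0 :+ con 1) :* (con 81 :* (var 0 :* var 0)))) refl

      sum-w3 : ∀ j → # 20 * sum j (λ k → (# 3 * # k * # k + # 3 * # k + # 1) * (# 81 * (# k * # k))) ≡ # 972 * (# j * # j * # j * # j * # j) + # 405 * (# j * # j) + # 108 * # j - # 1215 * (# j * # j * # j * # j) - # 270 * (# j * # j * # j)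
      sum-w3 = closed (# 20) (λ k → (# 3 * # k * # k + # 3 * # k + # 1) * (# 81 * (# k * # k))) (λ j → # 972 * (# j * # j * # j * # j * # j) + # 405 * (# j * # j) + # 108 * # j - # 1215 * (# j * # j * # j * # j) - # 270 * (# j * # j * # j)) zero-case step
        where
        zero-case : # 972 * (# 0 * # 0 * # 0 * # 0 * # 0) + # 405 * (# 0 * # 0) + # 108 * # 0 - # 1215 * (# 0 * # 0 * # 0 * # 0) - # 270 * (# 0 * # 0 * # 0) ≡ # 0
        zero-case = ring [] (con 972 :* (con 0 :* con 0 :* con 0 :* con 0 :* con 0) :+ con 405 :* (con 0 :* con 0) :+ con 108 :* con 0 :- con 1215 :* (con 0 :* con 0 :* con 0 :* con 0) :- con 270 :* (con 0 :* con 0 :* con 0)) (con 0) refl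
        step : ∀ j → # 972 * (# (suc j) * # (suc j) * # (suc j) * # (suc j) * # (suc j)) + # 405 * (# (suc j) * # (suc j)) + # 108 * # (suc j) - # 1215 * (# (suc j) * # (suc j) * # (suc j) * # (suc j)) - # 270 * (# (suc j) * # (suc j) * # (suc j)) ≡ # 972 * (# j * # j * # j * # j * # j) + # 405 * (# j * # j) + # 108 * # j - # 1215 * (# j * # j * # j * # j) - # 270 * (# j * # j * # j) + # 20 * ((# 3 * # j * # j + # 3 * # j + # 1) * (# 81 * (# j * # j)))
        step j rewrite #suc j = ring (# j ∷ []) (con 972 :* ((var 0 :+ con 1) :* (var 0 :+ con 1) :* (var 0 :+ con 1) :* (var 0 :+ con 1) :* (var 0 :+ con 1)) :+ con 405 :* ((var 0 :+ con 1) :* (var 0 :+ con 1)) :+ con 108 :* (var 0 :+ con 1) :- con 1215 :* ((var 0 :+ con 1) :* (var 0 :+ con 1) :* (var 0 :+ con 1) :* (var 0 :+ con 1)) :- con 270 :* ((var 0 :+ con 1) :* (var 0 :+ con 1) :* (var 0 :+ con 1))) (con 972 :* (var 0 :* var 0 :* var 0 :* var 0 :* var 0) :+ con 405 :* (var 0 :* var 0) :+ con 108 :* var 0 :- con 1215 :* (var 0 :* var 0 :* var 0 :* var 0) :- con 270 :* (var 0 :* var 0 :* var 0) :+ con 20 :* ((con 3 :* var 0 :* var 0 :+ con 3 :* var 0 :+ con 1) :* (con 81 :* (var 0 :* var 0)))) refl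

      sum-up : ∀ j → # 3 * sum j (λ k → # 5 * (# k * # k + # k)) ≡ # 5 * (# j * # j * # j) - # 5 * # j
      sum-up = closed (# 3) (λ k → # 5 * (# k * # k + # k)) (λ j → # 5 * (# j * # j * # j) - # 5 * # j) zero-case step
        where
        zero-case : # 5 * (# 0 * # 0 * # 0) - # 5 * # 0 ≡ # 0
        zero-case = ring [] (con 5 :* (con 0 :* con 0 :* con 0) :- con 5 :* con 0) (con 0) refl
        step : ∀ j → # 5 * (# (suc j) * # (suc j) * # (suc j)) - # 5 * # (suc j) ≡ # 5 * (# j * # j * # j) - # 5 * # j + # 3 * (# 5 * (# j * # j + # j))
        step j rewrite #suc j = ring (# j ∷ []) (con 5 :* ((var 0 :+ con 1) :* (var 0 :+ con 1) :* (var 0 :+ con 1)) :- con 5 :* (var 0 :+ con 1)) (con 5 :* (var 0 :* var 0 :* var 0) :- con 5 :* var 0 :+ con 3 :* (con 5 :* (var 0 :* var 0 :+ var 0))) refl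

      sum-linear : ∀ j → # 1 * sum j (λ k → # 10 * # k) ≡ # 5 * (# j * # j) - # 5 * # j
      sum-linear = closed (# 1) (λ k → # 10 * # k) (λ j → # 5 * (# j * # j) - # 5 * # j) zero-case step
        where
        zero-case : # 5 * (# 0 * # 0) - # 5 * # 0 ≡ # 0
        zero-case = ring [] (con 5 :* (con 0 :* con 0) :- con 5 :* con 0) (con 0) refl
        step : ∀ j → # 5 * (# (suc j) * # (suc j)) - # 5 * # (suc j) ≡ # 5 * (# j * # j) - # 5 * # j + # 1 * (# 10 * # j)
        step j rewrite #suc j = ring (# j ∷ []) (con 5 :* ((var 0 :+ con 1) :* (var 0 :+ con 1)) :- con 5 :* (var 0 :+ con 1)) (con 5 :* (var 0 :* var 0) :- con 5 :* var 0 :+ con 1 :* (con 10 :* var 0)) refl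

      sum-rise2 : ∀ j → # 3 * sum j (λ k → # k * (# k + # 1)) ≡ # j * # j * # j - # j
      sum-rise2 = closed (# 3) (λ k → # k * (# k + # 1)) (λ j → # j * # j * # j - # j) zero-case step
        where
        zero-case : # 0 * # 0 * # 0 - # 0 ≡ # 0
        zero-case = ring [] (con 0 :* con 0 :* con 0 :- con 0) (con 0) refl
        step : ∀ j → # (suc j) * # (suc j) * # (suc j) - # (suc j) ≡ # j * # j * # j - # j + # 3 * (# j * (# j + # 1))
        step j rewrite #suc j = ring (# j ∷ []) ((var 0 :+ con 1) :* (var 0 :+ con 1) :* (var 0 :+ con 1) :- (var 0 :+ con 1)) (var 0 :* var 0 :* var 0 :- var 0 :+ con 3 :* (var 0 :* (var 0 :+ con 1))) refl

      sum-rise3 : ∀ j → # 4 * sum j (λ k → # k * (# k + # 1) * (# k + # 2)) ≡ (# j * # j - # 1 * # j) * ((# j + # 1) * (# j + # 2))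
      sum-rise3 = closed (# 4) (λ k → # k * (# k + # 1) * (# k + # 2)) (λ j → (# j * # j - # 1 * # j) * ((# j + # 1) * (# j + # 2))) zero-case step
        where
        zero-case : (# 0 * # 0 - # 1 * # 0) * ((# 0 + # 1) * (# 0 + # 2)) ≡ # 0
        zero-case = ring [] ((con 0 :* con 0 :- con 1 :* con 0) :* ((con 0 :+ con 1) :* (con 0 :+ con 2))) (con 0) refl
        step : ∀ j → (# (suc j) * # (suc j) - # 1 * # (suc j)) * ((# (suc j) + # 1) * (# (suc j) + # 2)) ≡ (# j * # j - # 1 * # j) * ((# j + # 1) * (# j + # 2)) + # 4 * (# j * (# j + # 1) * (# j + # 2))
        step j rewrite #suc j = ring (# j ∷ []) (((var 0 :+ con 1) :* (var 0 :+ con 1) :- con 1 :* (var 0 :+ con 1)) :* (((var 0 :+ con 1) :+ con 1) :* ((var 0 :+ con 1) :+ con 2))) ((var 0 :* var 0 :- con 1 :* var 0) :* ((var 0 :+ con 1) :* (var 0 :+ con 2)) :+ con 4 :* (var 0 :* (var 0 :+ con 1) :* (var 0 :+ con 2))) refl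

      sum-rise4 : ∀ j → # 5 * sum j (λ k → # k * (# k + # 1) * (# k + # 2) * (# k + # 3)) ≡ (# j * # j - # 1 * # j) * ((# j + # 1) * (# j + # 2) * (# j + # 3))
      sum-rise4 = closed (# 5) (λ k → # k * (# k + # 1) * (# k + # 2) * (# k + # 3)) (λ j → (# j * # j - # 1 * # j) * ((# j + # 1) * (# j + # 2) * (# j + # 3))) zero-case step
        where
        zero-case : (# 0 * # 0 - # 1 * # 0) * ((# 0 + # 1) * (# 0 + # 2) * (# 0 + # 3)) ≡ # 0
        zero-case = ring [] ((con 0 :* con 0 :- con 1 :* con 0) :* ((con 0 :+ con 1) :* (con 0 :+ con 2) :* (con 0 :+ con 3))) (con 0) refl
        step : ∀ j → (# (suc j) * # (suc j) - # 1 * # (suc j)) * ((# (suc j) + # 1) * (# (suc j) + # 2) * (# (suc j) + # 3)) ≡ (# j * # j - # 1 * # j) * ((# j + # 1) * (# j + # 2) * (# j + # 3)) + # 5 * (# j * (# j + # 1) * (# j + # 2) * (# j + # 3))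
        step j rewrite #suc j = ring (# j ∷ []) (((var 0 :+ con 1) :* (var 0 :+ con 1) :- con 1 :* (var 0 :+ con 1)) :* (((var 0 :+ con 1) :+ con 1) :* ((var 0 :+ con 1) :+ con 2) :* ((var 0 :+ con 1) :+ con 3))) ((var 0 :* var 0 :- con 1 :* var 0) :* ((var 0 :+ con 1) :* (var 0 :+ con 2) :* (var 0 :+ con 3)) :+ con 5 :* (var 0 :* (var 0 :+ con 1) :* (var 0 :+ con 2) :* (var 0 :+ con 3))) refl

      sum-fall2 : ∀ j → # 3 * sum j (λ k → # k * (# k - # 1)) ≡ # j * # j * # j - # 3 * (# j * # j) + # 2 * # j
      sum-fall2 = closed (# 3) (λ k → # k * (# k - # 1)) (λ j → # j * # j * # j - # 3 * (# j * # j) + # 2 * # j) zero-case step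
        where
        zero-case : # 0 * # 0 * # 0 - # 3 * (# 0 * # 0) + # 2 * # 0 ≡ # 0
        zero-case = ring [] (con 0 :* con 0 :* con 0 :- con 3 :* (con 0 :* con 0) :+ con 2 :* con 0) (con 0) refl
        step : ∀ j → # (suc j) * # (suc j) * # (suc j) - # 3 * (# (suc j) * # (suc j)) + # 2 * # (suc j) ≡ # j * # j * # j - # 3 * (# j * # j) + # 2 * # j + # 3 * (# j * (# j - # 1))
        step j rewrite #suc j = ring (# j ∷ []) ((var 0 :+ con 1) :* (var 0 :+ con 1) :* (var 0 :+ con 1) :- con 3 :* ((var 0 :+ con 1) :* (var 0 :+ con 1)) :+ con 2 :* (var 0 :+ con 1)) (var 0 :* var 0 :* var 0 :- con 3 :* (var 0 :* var 0) :+ con 2 :* var 0 :+ con 3 :* (var 0 :* (var 0 :- con 1))) refl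

      moment1 : ∀ j → sum (suc j) (λ k → pow1 k * # (σ k)) ≡ pow1 j * S j - sum j (λ i → w1 i * S i)
      moment1 j = trans (moment pow1 zero-case j) (cong (λ v → pow1 j * S j - v) (sum-cong j (λ i _ → cong (_* S i) (step i))))
        where
        zero-case : pow1 0 ≡ # 0
        zero-case = ring [] (con 0) (con 0) refl
        step : ∀ i → pow1 (suc i) - pow1 i ≡ w1 i
        step i rewrite #suc i = ring (# i ∷ []) ((var 0 :+ con 1) :- var 0) (con 1) refl

      moment2 : ∀ j → sum (suc j) (λ k → pow2 k * # (σ k)) ≡ pow2 j * S j - sum j (λ i → w2 i * S i)
      moment2 j = trans (moment pow2 zero-case j) (cong (λ v → pow2 j * S j - v) (sum-cong j (λ i _ → cong (_* S i) (step i))))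
        where
        zero-case : pow2 0 ≡ # 0
        zero-case = ring [] (con 0 :* con 0) (con 0) refl
        step : ∀ i → pow2 (suc i) - pow2 i ≡ w2 i
        step i rewrite #suc i = ring (# i ∷ []) ((var 0 :+ con 1) :* (var 0 :+ con 1) :- var 0 :* var 0) (con 2 :* var 0 :+ con 1) refl

      moment3 : ∀ j → sum (suc j) (λ k → pow3 k * # (σ k)) ≡ pow3 j * S j - sum j (λ i → w3 i * S i)
      moment3 j = trans (moment pow3 zero-case j) (cong (λ v → pow3 j * S j - v) (sum-cong j (λ i _ → cong (_* S i) (step i))))
        where
        zero-case : pow3 0 ≡ # 0
        zero-case = ring [] (con 0 :* con 0 :* con 0) (con 0) refl
        step : ∀ i → pow3 (suc i) - pow3 i ≡ w3 i
        step i rewrite #suc i = ring (# i ∷ []) ((var 0 :+ con 1) :* (var 0 :+ con 1) :* (var 0 :+ con 1) :- var 0 :* var 0 :* var 0) (con 3 :* var 0 :* var 0 :+ con 3 :* var 0 :+ con 1) refl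

      arith-hi1 : Certificate 6 λ x s m u v b →
        con 0 :≤ x ⇒ con 6 :* s :≤ con 5 :* (x :* x :+ x) ⇒ m :≤ x :* s :- u ⇒ con 2 :* v :≤ con 2 :* v ⇒ v :≤ con 100 :* u ⇒
        con 54 :* (x :* x :* x) :+ con 27 :* x :- con 81 :* (x :* x) :≤ con 2 :* v ⇒
        (x :+ con 1) :* (x :+ con 1) :* (x :+ con 1) :- (x :+ con 1) :≤ con 3 :* b ⇒ ⊢ con 100 :* m :≤ con 169 :* b
      arith-hi1 = cert 5 ((757 , 0 ∷ []) ∷ (271 , 0 ∷ 0 ∷ []) ∷ (600 , 2 ∷ []) ∷ (6 , 4 ∷ []) ∷ (3 , 5 ∷ []) ∷ (338 , 6 ∷ []) ∷ (100 , 0 ∷ 1 ∷ []) ∷ []) refl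

      arith-lo1 : Certificate 6 λ x s m u v b →
        con 0 :≤ x ⇒ con 81 :* (x :* x) :≤ con 100 :* s ⇒ x :* s :- u :≤ m ⇒ con 6 :* u :≤ v ⇒
        con 3 :* v :≤ con 5 :* (x :* x :* x) :- con 5 :* x ⇒
        con 3 :* b :≤ (x :+ con 1) :* (x :+ con 1) :* (x :+ con 1) :- con 3 :* ((x :+ con 1) :* (x :+ con 1)) :+ con 2 :* (x :+ con 1) ⇒
        ⊢ con 479 :* b :≤ con 300 :* m
      arith-lo1 = cert 2 ((729 , 0 ∷ []) ∷ (900 , 2 ∷ []) ∷ (150 , 3 ∷ []) ∷ (50 , 4 ∷ []) ∷ (479 , 5 ∷ []) ∷ (9 , 0 ∷ 1 ∷ []) ∷ []) refl

      arith-hi2 : Certificate 6 λ x s m u v b →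
        con 0 :≤ x ⇒ con 6 :* s :≤ con 5 :* (x :* x :+ x) ⇒ m :≤ x :* x :* s :- u ⇒ v :≤ con 100 :* u ⇒
        con 81 :* (x :* x :* x :* x) :+ con 27 :* x :- con 108 :* (x :* x :* x) :≤ con 2 :* v ⇒
        ((x :+ con 1) :* (x :+ con 1) :- con 1 :* (x :+ con 1)) :* ((x :+ con 1 :+ con 1) :* (x :+ con 1 :+ con 2)) :≤ con 4 :* b ⇒
        ⊢ con 300 :* m :≤ con 514 :* b
      arith-hi2 = cert 1 ((1623 , 0 ∷ []) ∷ (2827 , 0 ∷ 0 ∷ []) ∷ (718 , 0 ∷ 0 ∷ 0 ∷ []) ∷ (600 , 2 ∷ []) ∷ (6 , 3 ∷ []) ∷ (3 , 4 ∷ []) ∷ (257 , 5 ∷ []) ∷ (100 , 0 ∷ 0 ∷ 1 ∷ []) ∷ []) refl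

      arith-hi3 : Certificate 6 λ x s m u v b →
        con 0 :≤ x ⇒ con 6 :* s :≤ con 5 :* (x :* x :+ x) ⇒ m :≤ x :* x :* x :* s :- u ⇒ v :≤ con 100 :* u ⇒
        con 972 :* (x :* x :* x :* x :* x) :+ con 405 :* (x :* x) :+ con 108 :* x :- con 1215 :* (x :* x :* x :* x) :- con 270 :* (x :* x :* x) :≤ con 20 :* v ⇒
        ((x :+ con 1) :* (x :+ con 1) :- con 1 :* (x :+ con 1)) :* ((x :+ con 1 :+ con 1) :* (x :+ con 1 :+ con 2) :* (x :+ con 1 :+ con 3)) :≤ con 5 :* b ⇒
        ⊢ con 600 :* m :≤ con 1042 :* b
      arith-hi3 = cert 9 ((50340 , 0 ∷ []) ∷ (105415 , 0 ∷ 0 ∷ []) ∷ (72130 , 0 ∷ 0 ∷ 0 ∷ []) ∷ (12195 , 0 ∷ 0 ∷ 0 ∷ 0 ∷ []) ∷ (6000 , 2 ∷ []) ∷ (60 , 3 ∷ []) ∷ (3 , 4 ∷ []) ∷ (2084 , 5 ∷ []) ∷ (1000 , 0 ∷ 0 ∷ 0 ∷ 1 ∷ []) ∷ []) refl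

      by-cases : ∀ (f g : ℕ → A) → (∀ j → sum (suc j) f ≤ sum (suc j) g) → ∀ k → sum k f ≤ sum k g
      by-cases f g h zero = ≤-refl
      by-cases f g h (suc j) = h j

      scaled : ∀ c d (f g : ℕ → A) → (∀ j → c * sum (suc j) f ≤ d * sum (suc j) g) →
        ∀ k → sum k (λ i → c * f i) ≤ sum k (λ i → d * g i)
      scaled c d f g h = by-cases _ _ (λ j → ≡≤ (sum-*ˡ (suc j) c f) (≤≡ (h j) (sym (sum-*ˡ (suc j) d g))))

      one-nonneg : ∀ i → # 0 ≤ w1 i
      one-nonneg _ = #0≤ 1

      w2-nonneg : ∀ i → # 0 ≤ w2 i
      w2-nonneg i = +0≤ (*0≤ (#0≤ 2) (#0≤ i)) (#0≤ 1)

      w3-nonneg : ∀ i → # 0 ≤ w3 i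
      w3-nonneg i = +0≤ (+0≤ (*0≤ (*0≤ (#0≤ 3) (#0≤ i)) (#0≤ i)) (*0≤ (#0≤ 3) (#0≤ i))) (#0≤ 1)

      -- In `moment1` the first term is at most 5/6 x³ and the subtracted sum at least 81/300 x³ to
      -- leading order; the difference 169/300 is compared with the leading term x³/3 of the sum of
      -- `rise2`. The constants of `hi2`, `hi3` and `lo1` arise in the same way, with the two bounds
      -- exchanged in `lo1`.
      hi1 : ∀ k → sum k (λ i → # 100 * (pow1 i * # (σ i))) ≤ sum k (λ i → # 169 * rise2 i)
      hi1 = scaled (# 100) (# 169) (λ i → pow1 i * # (σ i)) rise2 (λ j →
        use arith-hi1 (#0≤ j) (hi j) (reflexive (moment1 j)) ≤-refl (lower-sum w1 one-nonneg j) (reflexive (sym (sum-w1 j)))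
          (reflexive (sym (trans (sum-rise2 (suc j)) (cong (λ v → v * v * v - v) (#suc j))))))

      lo1 : ∀ k → sum k (λ i → # 479 * fall2 i) ≤ sum k (λ i → # 300 * (pow1 i * # (σ i)))
      lo1 = scaled (# 479) (# 300) fall2 (λ i → pow1 i * # (σ i)) (λ j →
        use arith-lo1 (#0≤ j) (lo j) (reflexive (sym (moment1 j))) (upper-sum j) (reflexive (sum-up j))
          (reflexive (trans (sum-fall2 (suc j)) (cong (λ v → v * v * v - # 3 * (v * v) + # 2 * v) (#suc j)))))

      hi2 : ∀ k → sum k (λ i → # 300 * (pow2 i * # (σ i))) ≤ sum k (λ i → # 514 * rise3 i)
      hi2 = scaled (# 300) (# 514) (λ i → pow2 i * # (σ i)) rise3 (λ j →
        use arith-hi2 (#0≤ j) (hi j) (reflexive (moment2 j)) (lower-sum w2 w2-nonneg j) (reflexive (sym (sum-w2 j)))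
          (reflexive (sym (trans (sum-rise3 (suc j)) (cong (λ v → (v * v - # 1 * v) * ((v + # 1) * (v + # 2))) (#suc j))))))

      hi3 : ∀ k → sum k (λ i → # 600 * (pow3 i * # (σ i))) ≤ sum k (λ i → # 1042 * rise4 i)
      hi3 = scaled (# 600) (# 1042) (λ i → pow3 i * # (σ i)) rise4 (λ j →
        use arith-hi3 (#0≤ j) (hi j) (reflexive (moment3 j)) (lower-sum w3 w3-nonneg j) (reflexive (sym (sum-w3 j)))
          (reflexive (sym (trans (sum-rise4 (suc j)) (cong (λ v → (v * v - # 1 * v) * ((v + # 1) * (v + # 2) * (v + # 3))) (#suc j))))))

      hi0 : ∀ k → sum k (λ i → # 6 * # (σ i)) ≤ sum k (λ i → # 10 * # i)
      hi0 = by-cases _ _ (λ j → ≡≤ (sum-*ˡ (suc j) (# 6) _) (≤≡ (hi j)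
        (sym (trans (ring (sum (suc j) (λ k → # 10 * # k) ∷ []) (var 0) (con 1 :* var 0) refl)
          (trans (sum-linear (suc j)) (trans (cong (λ v → # 5 * (v * v) - # 5 * v) (#suc j))
            (ring (# j ∷ []) (con 5 :* ((var 0 :+ con 1) :* (var 0 :+ con 1)) :- con 5 :* (var 0 :+ con 1))
              (con 5 :* (var 0 :* var 0 :+ var 0)) refl)))))))

      -- The odd numbers have the squares as partial sums, which is the shape of `lo`.
      lo0 : ∀ k → sum k (λ i → # 81 * odds i) ≤ sum k (λ i → # 100 * # (σ i))
      lo0 = by-cases _ _ (λ j → ≡≤ (trans (sum-*ˡ (suc j) (# 81) odds) (cong (# 81 *_) (squares j)))
          (≤≡ (lo j) (sym (sum-*ˡ (suc j) (# 100) _))))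
        where
        squares : ∀ j → sum (suc j) odds ≡ # j * # j
        squares zero = ring [] (con 0 :+ con 0) (con 0 :* con 0) refl
        squares (suc j) rewrite #suc j = trans (cong (_+ (# 2 * # j + # 1)) (squares j))
          (ring (# j ∷ []) (var 0 :* var 0 :+ (con 2 :* var 0 :+ con 1)) ((var 0 :+ con 1) :* (var 0 :+ con 1)) refl)

  -- Bounds on absolute values, products of ratios, and their weighted means

  module Weights where
    open import Data.Nat as ℕ using (ℕ; zero; suc; _∸_)
    open import Relation.Binary.PropositionalEquality hiding ([_])
    open import Data.List using ([]; _∷_)
    import Data.Nat.Properties as ℕₚ
    open import Data.Product using (_×_; _,_; proj₂)
    open import Data.Sum using (inj₁; inj₂)
    open import Data.Unit using (tt)
    open ≡-Reasoning
    open Sums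

    Within : A → A → Set
    Within b x = (- b ≤ x) × (x ≤ b)

    -- `Expr` has no unary minus, so certificates see a lower bound as `# 0 - b`.
    neg-arith : ∀ {b} → - b ≡ # 0 - b
    neg-arith {b} = trans (sym (+-identityˡ (- b))) (cong (_- b) (sym #-0))

    within : ∀ {b x} → # 0 - b ≤ x → x ≤ b → Within b x
    within l u = ≡≤ neg-arith l , u

    low : ∀ {b x} → Within b x → # 0 - b ≤ x
    low (l , _) = ≡≤ (sym neg-arith) l

    upp : ∀ {b x} → Within b x → x ≤ b
    upp = proj₂

    +-low : Certificate 4 λ b c x y →
      con 0 :- b :≤ x ⇒ con 0 :- c :≤ y ⇒ ⊢ con 0 :- (b :+ c) :≤ x :+ y
    +-low = cert 0 ((1 , 0 ∷ []) ∷ (1 , 1 ∷ []) ∷ []) refl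

    -- 2 (xy + bc) = (b + x)(c + y) + (b - x)(c - y), with nonnegative factors; the upper bound
    -- pairs the factors crosswise.
    *-low : Certificate 4 λ b c x y →
      con 0 :- b :≤ x ⇒ x :≤ b ⇒ con 0 :- c :≤ y ⇒ y :≤ c ⇒ ⊢ con 0 :- b :* c :≤ x :* y
    *-low = cert 1 ((1 , 0 ∷ 2 ∷ []) ∷ (1 , 1 ∷ 3 ∷ []) ∷ []) refl

    *-upp : Certificate 4 λ b c x y →
      con 0 :- b :≤ x ⇒ x :≤ b ⇒ con 0 :- c :≤ y ⇒ y :≤ c ⇒ ⊢ x :* y :≤ b :* c
    *-upp = cert 1 ((1 , 0 ∷ 3 ∷ []) ∷ (1 , 1 ∷ 2 ∷ []) ∷ []) refl

    neg-low : Certificate 2 λ b x →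
      x :≤ b ⇒ ⊢ con 0 :- b :≤ con 0 :- x
    neg-low = cert 0 ((1 , 0 ∷ []) ∷ []) refl

    neg-upp : Certificate 2 λ b x →
      con 0 :- b :≤ x ⇒ ⊢ con 0 :- x :≤ b
    neg-upp = cert 0 ((1 , 0 ∷ []) ∷ []) refl

    mono-low : Certificate 3 λ b c x →
      con 0 :- b :≤ x ⇒ b :≤ c ⇒ ⊢ con 0 :- c :≤ x
    mono-low = cert 0 ((1 , 0 ∷ []) ∷ (1 , 1 ∷ []) ∷ []) refl

    within-+ : ∀ {b c x y} → Within b x → Within c y → Within (b + c) (x + y)
    within-+ p q = within (use +-low (low p) (low q)) (+-mono-≤ (upp p) (upp q))

    within-* : ∀ {b c x y} → Within b x → Within c y → Within (b * c) (x * y)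
    within-* p q = within (use *-low (low p) (upp p) (low q) (upp q)) (use *-upp (low p) (upp p) (low q) (upp q))

    within-neg : ∀ {b x} → Within b x → Within b (# 0 - x)
    within-neg p = within (use neg-low (upp p)) (use neg-upp (low p))

    within-mono : ∀ {b c x} → Within b x → b ≤ c → Within c x
    within-mono p h = within (use mono-low (low p) h) (≤-trans (upp p) h)

    within-≡ : ∀ {b x y} → Within b x → x ≡ y → Within b y
    within-≡ p refl = p

    within-≡ᵇ : ∀ {b c x} → Within b x → b ≡ c → Within c x
    within-≡ᵇ p refl = p

    within-refl : ∀ {x} → # 0 ≤ x → Within x x
    within-refl {x} h = within (arith (x ∷ []) ((con 0 :≤ var 0) ∷ []) (con 0 :- var 0 :≤ var 0) 0 ((2 , 0 ∷ []) ∷ []) refl (h , tt)) ≤-refl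

    within-scale : ∀ {b c x} → # 0 ≤ c → Within b x → Within (c * b) (c * x)
    within-scale h p = within-* (within-refl h) p

    within-sum : ∀ n {f b} → (∀ k → k ℕ.< n → Within (b k) (f k)) → Within (sum n b) (sum n f)
    within-sum zero h = within-refl ≤-refl
    within-sum (suc n) h = within-+ (within-sum n (λ k l → h k (ℕₚ.m≤n⇒m≤1+n l))) (h n ℕₚ.≤-refl)

    zero-* : ∀ x → # 0 * x ≡ # 0
    zero-* x = ring (x ∷ []) (con 0 :* var 0) (con 0) refl

    *-zero : ∀ x → x * # 0 ≡ # 0
    *-zero x = ring (x ∷ []) (var 0 :* con 0) (con 0) refl

    one-* : ∀ x → # 1 * x ≡ x
    one-* x = ring (x ∷ []) (con 1 :* var 0) (var 0) refl

    *-one : ∀ x → x * # 1 ≡ x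
    *-one x = ring (x ∷ []) (var 0 :* con 1) (var 0) refl

    module Products (ρ : ℕ → A) (ρ-zero : ρ 0 ≡ # 0) (ρ-nonneg : ∀ m → # 0 ≤ ρ m) (ρ≤1 : ∀ m → ρ m ≤ # 1) where

      R : ℕ → ℕ → A
      R n zero = # 1
      R n (suc k) = R n k * ρ (n ∸ k)

      R-nonneg : ∀ n k → # 0 ≤ R n k
      R-nonneg n zero = #0≤ 1
      R-nonneg n (suc k) = *0≤ (R-nonneg n k) (ρ-nonneg (n ∸ k))

      shrink : Certificate 2 λ x y →
        con 0 :≤ x ⇒ y :≤ con 1 ⇒ ⊢ x :* y :≤ x
      shrink = cert 0 ((1 , 0 ∷ 1 ∷ []) ∷ []) refl

      R-dec : ∀ n k → R n (suc k) ≤ R n k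
      R-dec n k = use shrink (R-nonneg n k) (ρ≤1 (n ∸ k))

      R≤1 : ∀ n k → R n k ≤ # 1
      R≤1 n zero = ≤-refl
      R≤1 n (suc k) = ≤-trans (R-dec n k) (R≤1 n k)

      -- The convention ρ 0 = 0 ends the product, so boundary terms of the sums vanish.
      R-end : ∀ n k → n ℕ.< k → R n k ≡ # 0
      R-end n (suc k) (ℕ.s≤s h) with ℕₚ.m≤n⇒m<n∨m≡n h
      ... | inj₁ l = trans (cong (_* ρ (n ∸ k)) (R-end n k l)) (zero-* _)
      ... | inj₂ refl = trans (cong (λ v → R n n * ρ v) (ℕₚ.n∸n≡0 n)) (trans (cong (R n n *_) ρ-zero) (*-zero _))

      R-shift : ∀ n k → R (suc n) (suc k) ≡ ρ (suc n) * R n k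
      R-shift n zero = ring (ρ (suc n) ∷ []) (con 1 :* var 0) (var 0 :* con 1) refl
      R-shift n (suc k) = trans (cong (_* ρ (n ∸ k)) (R-shift n k)) (*-assoc _ _ _)

      R-split : ∀ n i l → R n (i ℕ.+ l) ≡ R n i * R (n ∸ i) l
      R-split n i zero = trans (cong (R n) (ℕₚ.+-identityʳ i)) (sym (*-one _))
      R-split n i (suc l) = trans (cong (R n) (ℕₚ.+-suc i l))
        (trans (cong₂ _*_ (R-split n i l) (cong ρ (sym (ℕₚ.∸-+-assoc n i l)))) (*-assoc _ _ _))

      module Renewal (σ : ℕ → ℕ) (renewal : ∀ n → sum (suc n) (λ k → # (σ k) * R n k) ≡ # n) where

        -- Not normalised: by `renewal` the weights have total mass n.
        mean : ℕ → (ℕ → A) → A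
        mean n F = sum (suc n) (λ k → # (σ k) * R n k * F k)

        mean-cong : ∀ n {F G} → (∀ k → k ℕ.≤ n → F k ≡ G k) → mean n F ≡ mean n G
        mean-cong n h = sum-cong (suc n) (λ k l → cong (# (σ k) * R n k *_) (h k (ℕₚ.≤-pred l)))

        mean-+ : ∀ n F G → mean n (λ k → F k + G k) ≡ mean n F + mean n G
        mean-+ n F G = trans (sum-cong (suc n) (λ k _ → distribˡ _ _ _)) (sum-+ (suc n) _ _)

        mean-*ˡ : ∀ n c F → mean n (λ k → c * F k) ≡ c * mean n F
        mean-*ˡ n c F = trans (sum-cong (suc n) (λ k _ →
            ring (# (σ k) * R n k ∷ c ∷ F k ∷ []) (var 0 :* (var 1 :* var 2)) (var 1 :* (var 0 :* var 2)) refl))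
          (sum-*ˡ (suc n) c _)

        mean-mono : ∀ n {F G} → (∀ k → k ℕ.≤ n → F k ≤ G k) → mean n F ≤ mean n G
        mean-mono n h = sum-mono (suc n) (λ k l → *-monoʳ (*0≤ (#0≤ (σ k)) (R-nonneg n k)) (h k (ℕₚ.≤-pred l)))

        mean-const : ∀ n c → mean n (λ _ → c) ≡ c * # n
        mean-const n c = trans (sum-cong (suc n) (λ k _ → *-comm _ c)) (trans (sum-*ˡ (suc n) c _) (cong (c *_) (renewal n)))

        mean-within : ∀ n {F b} → (∀ k → k ℕ.≤ n → Within (b k) (F k)) → Within (mean n b) (mean n F)
        mean-within n h = within-sum (suc n) (λ k l → within-scale (*0≤ (#0≤ (σ k)) (R-nonneg n k)) (h k (ℕₚ.≤-pred l)))

        -- A factor ρ(n+1-k) lengthens the product R (n+1) k by one step, and R (n+1) (k+1) = ρ(n+1)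
        -- R n k. Thus means at n + 1 become means at n, which is how the renewal identity is
        -- differenced.
        mean-shift : ∀ n G → mean (suc n) (λ k → ρ (suc n ∸ k) * G k) ≡ ρ (suc n) * mean n G
        mean-shift n G = begin
          sum (suc (suc n)) (λ k → # (σ k) * R (suc n) k * (ρ (suc n ∸ k) * G k))
            ≡⟨ sum-cong (suc (suc n)) (λ k _ → step k) ⟩
          sum (suc n) h + h (suc n)
            ≡⟨ cong (sum (suc n) h +_) last ⟩
          sum (suc n) h + # 0
            ≡⟨ ring (sum (suc n) h ∷ []) (var 0 :+ con 0) (var 0) refl ⟩
          sum (suc n) h
            ≡⟨ sum-*ˡ (suc n) (ρ (suc n)) _ ⟩
          ρ (suc n) * mean n G ∎
          where
          h : ℕ → A
          h k = ρ (suc n) * (# (σ k) * R n k * G k)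
          step : ∀ k → # (σ k) * R (suc n) k * (ρ (suc n ∸ k) * G k) ≡ h k
          step k = trans (ring (# (σ k) ∷ R (suc n) k ∷ ρ (suc n ∸ k) ∷ G k ∷ [])
              (var 0 :* var 1 :* (var 2 :* var 3)) ((var 1 :* var 2) :* (var 0 :* var 3)) refl)
            (trans (cong (_* (# (σ k) * G k)) (R-shift n k))
              (ring (ρ (suc n) ∷ R n k ∷ # (σ k) ∷ G k ∷ [])
                ((var 0 :* var 1) :* (var 2 :* var 3)) (var 0 :* (var 2 :* var 1 :* var 3)) refl))
          last : h (suc n) ≡ # 0
          last = trans (cong (λ v → ρ (suc n) * (# (σ (suc n)) * v * G (suc n))) (R-end n (suc n) ℕₚ.≤-refl))
            (ring (ρ (suc n) ∷ # (σ (suc n)) ∷ G (suc n) ∷ []) (var 0 :* (var 1 :* con 0 :* var 2)) (con 0) refl)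

        mean-ρ : ∀ n → mean (suc n) (λ k → ρ (suc n ∸ k)) ≡ ρ (suc n) * # n
        mean-ρ n = trans (mean-cong (suc n) (λ k _ → sym (*-one _)))
          (trans (mean-shift n (λ _ → # 1)) (cong (ρ (suc n) *_) (trans (mean-const n (# 1)) (one-* _))))

        mean-ρρ : ∀ n → mean (suc (suc n)) (λ k → ρ (suc (suc n) ∸ k) * ρ (suc n ∸ k)) ≡ ρ (suc (suc n)) * (ρ (suc n) * # n)
        mean-ρρ n = trans (mean-shift (suc n) (λ k → ρ (suc n ∸ k))) (cong (ρ (suc (suc n)) *_) (mean-ρ n))

        mean-ρρρ : ∀ n → mean (suc (suc (suc n))) (λ k → ρ (suc (suc (suc n)) ∸ k) * (ρ (suc (suc n) ∸ k) * ρ (suc n ∸ k)))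
                       ≡ ρ (suc (suc (suc n))) * (ρ (suc (suc n)) * (ρ (suc n) * # n))
        mean-ρρρ n = trans (mean-shift (suc (suc n)) (λ k → ρ (suc (suc n) ∸ k) * ρ (suc n ∸ k))) (cong (ρ (suc (suc (suc n))) *_) (mean-ρρ n))

        δ ε : ℕ → A
        δ m = ρ m - ρ (m ∸ 1)
        ε m = δ m - δ (m ∸ 1)

        -- For n = M + 3 and k fixed: X, Y, Z are the increments of ρ over the last k steps ending at n, n - 1, n - 2.
        X Y Z : ℕ → ℕ → A
        X n k = ρ n - ρ (n ∸ k)
        Y n k = X (n ∸ 1) k
        Z n k = X (n ∸ 1 ∸ 1) k

        mean-affine : ∀ n c₀ c₁ F → mean n (λ k → c₀ + c₁ * F k) ≡ c₀ * # n + c₁ * mean n F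
        mean-affine n c₀ c₁ F = trans (mean-+ n _ _) (cong₂ _+_ (mean-const n c₀) (mean-*ˡ n c₁ F))

        -- The difference of the renewal identities at n + 1 and n.
        mean-X : ∀ n → mean (suc n) (X (suc n)) ≡ ρ (suc n)
        mean-X n = begin
          mean (suc n) (X (suc n))
            ≡⟨ mean-cong (suc n) (λ k _ → ring (a ∷ ρ (suc n ∸ k) ∷ []) (var 0 :- var 1) (var 0 :+ (con 0 :- con 1) :* var 1) refl) ⟩
          mean (suc n) (λ k → a + (# 0 - # 1) * ρ (suc n ∸ k))
            ≡⟨ mean-affine (suc n) a (# 0 - # 1) _ ⟩
          a * # (suc n) + (# 0 - # 1) * mean (suc n) (λ k → ρ (suc n ∸ k))
            ≡⟨ cong₂ (λ u v → a * u + (# 0 - # 1) * v) (#suc n) (mean-ρ n) ⟩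
          a * (# n + # 1) + (# 0 - # 1) * (a * # n)
            ≡⟨ ring (a ∷ # n ∷ []) (var 0 :* (var 1 :+ con 1) :+ (con 0 :- con 1) :* (var 0 :* var 1)) (var 0) refl ⟩
          a ∎
          where a = ρ (suc n)

        -- The combination is chosen so that only means of 1, ρ(n-k) and ρ(n-k) ρ(n-1-k) occur, all
        -- of them known. The product X Y is the price of differencing a multiplicative weight.
        mean-XY : ∀ n → let n′ = suc (suc n) in
          mean n′ (λ k → ρ n′ * (X n′ k - Y n′ k) + X n′ k * Y n′ k) ≡ ρ n′ * δ n′
        mean-XY n = begin
          mean n′ (λ k → a * (X n′ k - Y n′ k) + X n′ k * Y n′ k)
            ≡⟨ mean-cong n′ (λ k _ → ring (a ∷ b ∷ ρ (n′ ∸ k) ∷ ρ (suc n ∸ k) ∷ [])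
                 (var 0 :* ((var 0 :- var 2) :- (var 1 :- var 3)) :+ (var 0 :- var 2) :* (var 1 :- var 3))
                 ((var 0 :* var 0 :+ (con 0 :- (var 0 :+ var 1)) :* var 2) :+ con 1 :* (var 2 :* var 3)) refl) ⟩
          mean n′ (λ k → (a * a + (# 0 - (a + b)) * ρ (n′ ∸ k)) + # 1 * (ρ (n′ ∸ k) * ρ (suc n ∸ k)))
            ≡⟨ mean-+ n′ _ _ ⟩
          mean n′ (λ k → a * a + (# 0 - (a + b)) * ρ (n′ ∸ k)) + mean n′ (λ k → # 1 * (ρ (n′ ∸ k) * ρ (suc n ∸ k)))
            ≡⟨ cong₂ _+_ (trans (mean-affine n′ _ _ _) (cong₂ (λ u v → a * a * u + (# 0 - (a + b)) * v) e₂ (trans (mean-ρ (suc n)) (cong (a *_) (#suc n)))))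
                 (trans (mean-*ˡ n′ (# 1) _) (cong (# 1 *_) (mean-ρρ n))) ⟩
          (a * a * (# n + # 1 + # 1) + (# 0 - (a + b)) * (a * (# n + # 1))) + # 1 * (a * (b * # n))
            ≡⟨ ring (a ∷ b ∷ # n ∷ [])
                 ((var 0 :* var 0 :* (var 2 :+ con 1 :+ con 1) :+ (con 0 :- (var 0 :+ var 1)) :* (var 0 :* (var 2 :+ con 1))) :+ con 1 :* (var 0 :* (var 1 :* var 2)))
                 (var 0 :* (var 0 :- var 1)) refl ⟩
          a * (a - b) ∎
          where
          n′ = suc (suc n)
          a = ρ n′
          b = ρ (suc n)
          e₂ : # n′ ≡ # n + # 1 + # 1
          e₂ = trans (#suc (suc n)) (cong (_+ # 1) (#suc n))

        -- One more difference: X - 2Y + Z is linear in ε, and all other terms are products of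
        -- increments.
        mean-XYZ : ∀ n → let n′ = suc (suc (suc n)); a = ρ n′; b = ρ (suc (suc n)) in
          mean n′ (λ k → a * b * (X n′ k - # 2 * Y n′ k + Z n′ k)
                       + b * (X n′ k * (Y n′ k - Z n′ k)) + b * (Y n′ k * (X n′ k - Z n′ k))
                       - (a - b) * (Y n′ k * Z n′ k) + X n′ k * (Y n′ k * Z n′ k))
          ≡ a * b * ε n′
        mean-XYZ n = begin
          mean n′ (λ k → a * b * (X n′ k - # 2 * Y n′ k + Z n′ k)
                       + b * (X n′ k * (Y n′ k - Z n′ k)) + b * (Y n′ k * (X n′ k - Z n′ k))
                       - (a - b) * (Y n′ k * Z n′ k) + X n′ k * (Y n′ k * Z n′ k))
            ≡⟨ mean-cong n′ (λ k _ → ring (a ∷ b ∷ c ∷ ρ (n′ ∸ k) ∷ ρ (suc (suc n) ∸ k) ∷ ρ (suc n ∸ k) ∷ [])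
                 (ea :* eb :* ((ea :- ex) :- con 2 :* (eb :- ey) :+ (ec :- ez))
                   :+ eb :* ((ea :- ex) :* ((eb :- ey) :- (ec :- ez))) :+ eb :* ((eb :- ey) :* ((ea :- ex) :- (ec :- ez)))
                   :- (ea :- eb) :* ((eb :- ey) :* (ec :- ez)) :+ (ea :- ex) :* ((eb :- ey) :* (ec :- ez)))
                 ((ea :* ea :* eb :+ (con 0 :- C1E) :* ex) :+ (con 2 :* eb :+ ec) :* (ex :* ey) :+ (con 0 :- con 1) :* (ex :* (ey :* ez))) refl) ⟩
          mean n′ (λ k → a * a * b + (# 0 - c₁) * x k + (# 2 * b + c) * (x k * y k) + (# 0 - # 1) * (x k * (y k * z k)))
            ≡⟨ trans (mean-+ n′ _ _) (cong₂ _+_ (trans (mean-+ n′ _ _) (cong₂ _+_ (mean-affine n′ _ _ _) (mean-*ˡ n′ _ _))) (mean-*ˡ n′ _ _)) ⟩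
          a * a * b * # n′ + (# 0 - c₁) * mean n′ x + (# 2 * b + c) * mean n′ (λ k → x k * y k) + (# 0 - # 1) * mean n′ (λ k → x k * (y k * z k))
            ≡⟨ cong₂ _+_ (cong₂ _+_ (cong₂ (λ u v → a * a * b * u + (# 0 - c₁) * v) e₃ (trans (mean-ρ (suc (suc n))) (cong (a *_) e₂)))
                 (cong ((# 2 * b + c) *_) (trans (mean-ρρ (suc n)) (cong (λ v → a * (b * v)) (#suc n)))))
                 (cong ((# 0 - # 1) *_) (mean-ρρρ n)) ⟩
          a * a * b * (# n + # 1 + # 1 + # 1) + (# 0 - c₁) * (a * (# n + # 1 + # 1)) + (# 2 * b + c) * (a * (b * (# n + # 1))) + (# 0 - # 1) * (a * (b * (c * # n)))
            ≡⟨ ring (a ∷ b ∷ c ∷ # n ∷ [])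
                 (ea :* ea :* eb :* (ex :+ con 1 :+ con 1 :+ con 1) :+ (con 0 :- C1E) :* (ea :* (ex :+ con 1 :+ con 1))
                   :+ (con 2 :* eb :+ ec) :* (ea :* (eb :* (ex :+ con 1))) :+ (con 0 :- con 1) :* (ea :* (eb :* (ec :* ex))))
                 (ea :* eb :* ((ea :- eb) :- (eb :- ec))) refl ⟩
          a * b * ((a - b) - (b - c)) ∎
          where
          n′ = suc (suc (suc n))
          a = ρ n′
          b = ρ (suc (suc n))
          c = ρ (suc n)
          x y z : ℕ → A
          x k = ρ (n′ ∸ k)
          y k = ρ (suc (suc n) ∸ k)
          z k = ρ (suc n ∸ k)
          ea eb ec ex ey ez C1E : Expr
          ea = var 0
          eb = var 1
          ec = var 2
          ex = var 3
          ey = var 4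
          ez = var 5
          C1E = ea :* eb :+ con 2 :* (eb :* eb)
          c₁ = a * b + # 2 * (b * b)
          e₂ : # (suc (suc n)) ≡ # n + # 1 + # 1
          e₂ = trans (#suc (suc n)) (cong (_+ # 1) (#suc n))
          e₃ : # n′ ≡ # n + # 1 + # 1 + # 1
          e₃ = trans (#suc (suc (suc n))) (cong (_+ # 1) e₂)

  -- Moments under geometric weights

  module Geometric where
    open import Data.Nat as ℕ using (ℕ; zero; suc)
    open import Relation.Binary.PropositionalEquality hiding ([_])
    open import Data.List using ([]; _∷_)
    open import Data.Product using (_,_)
    open ≡-Reasoning
    open Sums
    open Moments
    open Weights using (zero-*; one-*)

    rise2-nonneg : ∀ k → # 0 ≤ rise2 k
    rise2-nonneg k = *0≤ (#0≤ k) (+0≤ (#0≤ k) (#0≤ 1))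

    rise3-nonneg : ∀ k → # 0 ≤ rise3 k
    rise3-nonneg k = *0≤ (rise2-nonneg k) (+0≤ (#0≤ k) (#0≤ 2))

    rise4-nonneg : ∀ k → # 0 ≤ rise4 k
    rise4-nonneg k = *0≤ (rise3-nonneg k) (+0≤ (#0≤ k) (#0≤ 3))

    module Rates (r t : A) (0≤r : # 0 ≤ r) (0≤t : # 0 ≤ t) (r+t≡1 : r + t ≡ # 1) where

      r≤1-lemma : Certificate 2 λ r t →
        con 0 :≤ t ⇒ r :+ t :≤ con 1 ⇒ ⊢ r :≤ con 1
      r≤1-lemma = cert 0 ((1 , 0 ∷ []) ∷ (1 , 1 ∷ []) ∷ []) refl

      r≤1 : r ≤ # 1
      r≤1 = use r≤1-lemma 0≤t (reflexive r+t≡1)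

      r^-nonneg : ∀ k → # 0 ≤ r ^ k
      r^-nonneg k = ^0≤ k 0≤r

      r^-dec : ∀ k → r ^ suc k ≤ r ^ k
      r^-dec k = ≤≡ (*-monoˡ (r^-nonneg k) r≤1) (one-* _)

      r^-anti : ∀ {i j} → i ℕ.≤ j → r ^ j ≤ r ^ i
      r^-anti {zero} {zero} ℕ.z≤n = ≤-refl
      r^-anti {zero} {suc j} ℕ.z≤n = ≤-trans (r^-dec j) (r^-anti {0} {j} ℕ.z≤n)
      r^-anti (ℕ.s≤s h) = *-monoʳ 0≤r (r^-anti h)

      weighted : (ℕ → A) → ℕ → A
      weighted f n = sum n (λ k → f k * r ^ k)

      const-sum : ∀ n → t * weighted (λ _ → # 1) n ≤ # 1
      const-sum n = ≤-trans (geometric (λ _ → # 1) g r t 0≤r r+t≡1 (λ _ → #0≤ 1) ≤-refl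
          (λ k → reflexive (ring [] (con 1) (con 1 :+ con 0) refl)) n) (bound n)
        where
        g : ℕ → A
        g zero = # 1
        g (suc k) = # 0
        value : ∀ n → weighted g (suc n) ≡ # 1
        value zero = trans (cong (λ v → # 0 + # 1 * v) (sym #-1)) (ring [] (con 0 :+ con 1 :* con 1) (con 1) refl)
        value (suc n) = trans (cong₂ _+_ (value n) (zero-* (r ^ suc n))) (ring [] (con 1 :+ con 0) (con 1) refl)
        bound : ∀ n → weighted g n ≤ # 1
        bound zero = #0≤ 1
        bound (suc n) = reflexive (value n)

      lin-sum : ∀ n → t * weighted pow1 n ≤ weighted (λ _ → # 1) n
      lin-sum = geometric pow1 (λ _ → # 1) r t 0≤r r+t≡1 #0≤ (#0≤ 1) (λ k → reflexive (#suc k))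

      -- The differences of a rising factorial of length a are a times a shorter one, so each of
      -- these steps gains a factor a/t.
      rise2-sum : ∀ n → t * weighted rise2 n ≤ weighted (λ k → # 2 * pow1 k) n
      rise2-sum = geometric rise2 (λ k → # 2 * pow1 k) r t 0≤r r+t≡1 rise2-nonneg
        (reflexive (ring [] (con 0 :* (con 0 :+ con 1)) (con 2 :* con 0) refl)) step
        where
        step : ∀ k → rise2 (suc k) ≤ rise2 k + # 2 * pow1 (suc k)
        step k rewrite #suc k = reflexive (ring (# k ∷ [])
          ((var 0 :+ con 1) :* (var 0 :+ con 1 :+ con 1)) (var 0 :* (var 0 :+ con 1) :+ con 2 :* (var 0 :+ con 1)) refl)

      rise3-sum : ∀ n → t * weighted rise3 n ≤ weighted (λ k → # 3 * rise2 k) n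
      rise3-sum = geometric rise3 (λ k → # 3 * rise2 k) r t 0≤r r+t≡1 rise3-nonneg
        (reflexive (ring [] (con 0 :* (con 0 :+ con 1) :* (con 0 :+ con 2)) (con 3 :* (con 0 :* (con 0 :+ con 1))) refl)) step
        where
        step : ∀ k → rise3 (suc k) ≤ rise3 k + # 3 * rise2 (suc k)
        step k rewrite #suc k = reflexive (ring (# k ∷ [])
          ((var 0 :+ con 1) :* (var 0 :+ con 1 :+ con 1) :* (var 0 :+ con 1 :+ con 2))
          (var 0 :* (var 0 :+ con 1) :* (var 0 :+ con 2) :+ con 3 :* ((var 0 :+ con 1) :* (var 0 :+ con 1 :+ con 1))) refl)

      rise4-sum : ∀ n → t * weighted rise4 n ≤ weighted (λ k → # 4 * rise3 k) n
      rise4-sum = geometric rise4 (λ k → # 4 * rise3 k) r t 0≤r r+t≡1 rise4-nonneg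
        (reflexive (ring [] (con 0 :* (con 0 :+ con 1) :* (con 0 :+ con 2) :* (con 0 :+ con 3))
          (con 4 :* (con 0 :* (con 0 :+ con 1) :* (con 0 :+ con 2))) refl)) step
        where
        step : ∀ k → rise4 (suc k) ≤ rise4 k + # 4 * rise3 (suc k)
        step k rewrite #suc k = reflexive (ring (# k ∷ [])
          ((var 0 :+ con 1) :* (var 0 :+ con 1 :+ con 1) :* (var 0 :+ con 1 :+ con 2) :* (var 0 :+ con 1 :+ con 3))
          (var 0 :* (var 0 :+ con 1) :* (var 0 :+ con 2) :* (var 0 :+ con 3)
            :+ con 4 :* ((var 0 :+ con 1) :* (var 0 :+ con 1 :+ con 1) :* (var 0 :+ con 1 :+ con 2))) refl)

      weighted-*ˡ : ∀ c f n → weighted (λ k → c * f k) n ≡ c * weighted f n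
      weighted-*ˡ c f n = trans (sum-cong n (λ k _ → *-assoc c (f k) (r ^ k))) (sum-*ˡ n c _)

      weighted-mono : ∀ {f g} n → (∀ k → f k ≤ g k) → weighted f n ≤ weighted g n
      weighted-mono n h = sum-mono n (λ k _ → *-monoˡ (r^-nonneg k) (h k))

      lin-bound : ∀ n → t * t * weighted pow1 n ≤ # 1
      lin-bound n = ≤-trans (≡≤ (*-assoc t t _) (*-monoʳ 0≤t (lin-sum n))) (const-sum n)

      rise2-bound : ∀ n → t * t * t * weighted rise2 n ≤ # 2
      rise2-bound n = ≤-trans (≡≤ (*-assoc (t * t) t _) (*-monoʳ (*0≤ 0≤t 0≤t) (≤≡ (rise2-sum n) (weighted-*ˡ (# 2) pow1 n))))
        (≡≤ (ring (t ∷ weighted pow1 n ∷ []) (var 0 :* var 0 :* (con 2 :* var 1)) (con 2 :* (var 0 :* var 0 :* var 1)) refl)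
          (≤≡ (*-monoʳ (#0≤ 2) (lin-bound n)) (ring [] (con 2 :* con 1) (con 2) refl)))

      rise3-bound : ∀ n → t * t * t * t * weighted rise3 n ≤ # 6
      rise3-bound n = ≤-trans (≡≤ (*-assoc (t * t * t) t _) (*-monoʳ (*0≤ (*0≤ 0≤t 0≤t) 0≤t) (≤≡ (rise3-sum n) (weighted-*ˡ (# 3) rise2 n))))
        (≡≤ (ring (t ∷ weighted rise2 n ∷ []) (var 0 :* var 0 :* var 0 :* (con 3 :* var 1)) (con 3 :* (var 0 :* var 0 :* var 0 :* var 1)) refl)
          (≤≡ (*-monoʳ (#0≤ 3) (rise2-bound n)) (ring [] (con 3 :* con 2) (con 6) refl)))

      rise4-bound : ∀ n → t * t * t * t * t * weighted rise4 n ≤ # 24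
      rise4-bound n = ≤-trans (≡≤ (*-assoc (t * t * t * t) t _) (*-monoʳ (*0≤ (*0≤ (*0≤ 0≤t 0≤t) 0≤t) 0≤t) (≤≡ (rise4-sum n) (weighted-*ˡ (# 4) rise3 n))))
        (≡≤ (ring (t ∷ weighted rise3 n ∷ []) (var 0 :* var 0 :* var 0 :* var 0 :* (con 4 :* var 1)) (con 4 :* (var 0 :* var 0 :* var 0 :* var 0 :* var 1)) refl)
          (≤≡ (*-monoʳ (#0≤ 4) (rise3-bound n)) (ring [] (con 4 :* con 6) (con 24) refl)))

      module Masses (σ : ℕ → ℕ) (σ-zero : σ 0 ≡ 0) (hi : ∀ j → # 6 * sum (suc j) (λ k → # (σ k)) ≤ # 5 * (# j * # j + # j)) (lo : ∀ j → # 81 * (# j * # j) ≤ # 100 * sum (suc j) (λ k → # (σ k))) where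

        open Bounds σ σ-zero hi lo

        mass : (ℕ → A) → ℕ → A
        mass f n = weighted (λ k → f k * # (σ k)) n

        compare : ∀ c d (f g : ℕ → A) → (∀ k → sum k (λ i → c * f i) ≤ sum k (λ i → d * g i)) →
          ∀ n → c * weighted f n ≤ d * weighted g n
        compare c d f g h n = ≡≤ (sym (weighted-*ˡ c f n)) (≤≡ (abel-mono _ _ (r ^_) r^-dec r^-nonneg h n) (weighted-*ˡ d g n))

        mass0-arith : Certificate 3 λ t m e →
          con 6 :* m :≤ con 10 :* e ⇒ con 0 :≤ t ⇒ t :* t :* e :≤ con 1 ⇒ ⊢ con 3 :* (t :* t :* m) :≤ con 5
        mass0-arith = cert 1 ((1 , 0 ∷ 1 ∷ 1 ∷ []) ∷ (10 , 2 ∷ []) ∷ []) refl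

        -- Each of the four mass bounds multiplies a ratio from the moment comparison by the
        -- factorial from the geometric sum: 5/3 · 1, 1.69 · 2, 514/300 · 6 and 1042/600 · 24.
        mass0 : ∀ n → # 3 * (t * t * weighted (λ k → # (σ k)) n) ≤ # 5
        mass0 n = use mass0-arith (compare (# 6) (# 10) (λ k → # (σ k)) pow1 hi0 n) 0≤t (lin-bound n)

        mass1-arith : Certificate 3 λ t m e →
          con 100 :* m :≤ con 169 :* e ⇒ con 0 :≤ t ⇒ t :* t :* t :* e :≤ con 2 ⇒ ⊢ con 100 :* (t :* t :* t :* m) :≤ con 338
        mass1-arith = cert 0 ((1 , 0 ∷ 1 ∷ 1 ∷ 1 ∷ []) ∷ (169 , 2 ∷ []) ∷ []) refl

        mass1 : ∀ n → # 100 * (t * t * t * mass pow1 n) ≤ # 338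
        mass1 n = use mass1-arith (compare (# 100) (# 169) (λ k → pow1 k * # (σ k)) rise2 hi1 n) 0≤t (rise2-bound n)

        mass2-arith : Certificate 3 λ t m e →
          con 300 :* m :≤ con 514 :* e ⇒ con 0 :≤ t ⇒ t :* t :* t :* t :* e :≤ con 6 ⇒ ⊢ con 100 :* (t :* t :* t :* t :* m) :≤ con 1028
        mass2-arith = cert 2 ((1 , 0 ∷ 1 ∷ 1 ∷ 1 ∷ 1 ∷ []) ∷ (514 , 2 ∷ []) ∷ []) refl

        mass2 : ∀ n → # 100 * (t * t * t * t * mass pow2 n) ≤ # 1028
        mass2 n = use mass2-arith (compare (# 300) (# 514) (λ k → pow2 k * # (σ k)) rise3 hi2 n) 0≤t (rise3-bound n)

        mass3-arith : Certificate 3 λ t m e →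
          con 600 :* m :≤ con 1042 :* e ⇒ con 0 :≤ t ⇒ t :* t :* t :* t :* t :* e :≤ con 24 ⇒
          ⊢ con 100 :* (t :* t :* t :* t :* t :* m) :≤ con 4168
        mass3-arith = cert 5 ((1 , 0 ∷ 1 ∷ 1 ∷ 1 ∷ 1 ∷ 1 ∷ []) ∷ (1042 , 2 ∷ []) ∷ []) refl

        mass3 : ∀ n → # 100 * (t * t * t * t * t * mass pow3 n) ≤ # 4168
        mass3 n = use mass3-arith (compare (# 600) (# 1042) (λ k → pow3 k * # (σ k)) rise4 hi3 n) 0≤t (rise4-bound n)

  -- The bounds 0.81 x² and 5/6 (x² + x) for the summatory function of σ

  module DivisorSumBounds where
    open import Data.Bool using (Bool; true; _∧_; T)
    open import Data.List using ([]; _∷_)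
    open import Data.Nat as ℕ using (ℕ; zero; suc; _!; _≤ᵇ_)
    import Data.Nat.Properties as ℕₚ
    open import Data.Nat.DivMod using (_/_; m/n*n≡m)
    open import Data.Nat.Divisibility using (∣-trans; m≤n⇒m!∣n!; m∣m*n)
    open import Data.Product using (_×_; _,_; proj₁; proj₂)
    open import Data.Sum using (inj₁; inj₂)
    open import Data.Unit using (tt)
    open import Relation.Binary.PropositionalEquality hiding ([_])
    open import Relation.Nullary using (yes; no)
    open Partitions using (sumTo; sumTo-last; divisor-sum; divisor-summatory)
    open DivisorSums
    open Sums

    cofactor : ℕ → ℕ → ℕ
    cofactor E e = E ! / suc e

    cofactor-exact : ∀ E e → e ℕ.< E → cofactor E e ℕ.* suc e ≡ E !
    cofactor-exact E e l = m/n*n≡m {E !} {suc e} (∣-trans (m∣m*n {suc e} (e !)) (m≤n⇒m!∣n! l))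

    -- With 60 layers half of Σ 1/e² is about 0.814, and cutting there costs at most x²/120; the
    -- limit is π²/12 ≈ 0.8225. Both targets 0.81 and 5/6 then leave enough room for the linear
    -- terms once x ≥ 200.
    open Layers 60 (60 !) (cofactor 60) (cofactor-exact 60)

    Q² : ℕ
    Q² = 60 ! ℕ.* 60 !

    c₁-low : 1628 ℕ.* Q² ℕ.≤ 1000 ℕ.* c₁
    c₁-low = ℕₚ.≤ᵇ⇒≤ _ _ tt

    c₁-high : 1000 ℕ.* c₁ ℕ.≤ 1629 ℕ.* Q²
    c₁-high = ℕₚ.≤ᵇ⇒≤ _ _ tt

    c₂-high : 100 ℕ.* c₂ ℕ.≤ 469 ℕ.* Q²
    c₂-high = ℕₚ.≤ᵇ⇒≤ _ _ tt

    far-lower : Certificate 6 λ a b Q L s x →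
      con 1628 :* Q :≤ con 1000 :* a ⇒ con 100 :* b :≤ con 469 :* Q ⇒
      a :* ((x :+ con 1) :* (x :+ con 1)) :≤ con 2 :* Q :* L :+ b :* (x :+ con 1) ⇒ L :≤ s ⇒ con 200 :≤ x ⇒ con 0 :≤ Q ⇒
      ⊢ Q :* (con 81 :* (x :* x)) :≤ Q :* (con 100 :* s)
    far-lower = cert 19 ((40401 , 0 ∷ []) ∷ (402 , 0 ∷ 4 ∷ []) ∷ (1 , 0 ∷ 4 ∷ 4 ∷ []) ∷ (2010 , 1 ∷ []) ∷ (10 , 1 ∷ 4 ∷ []) ∷ (1000 , 2 ∷ []) ∷ (2000 , 3 ∷ 5 ∷ []) ∷ (30138 , 5 ∷ []) ∷ (1766 , 4 ∷ 5 ∷ []) ∷ (8 , 4 ∷ 4 ∷ 5 ∷ []) ∷ []) refl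

    far-upper : Certificate 7 λ a b Q L s x r →
      con 1000 :* a :≤ con 1629 :* Q ⇒ con 100 :* b :≤ con 469 :* Q ⇒ con 2 :* Q :* L :≤ a :* (x :* x) :+ b :* x ⇒ s :≤ L :+ r ⇒
      con 120 :* r :≤ x :* x ⇒ con 200 :≤ x ⇒ con 0 :≤ Q ⇒ ⊢ Q :* (con 6 :* s) :≤ Q :* (con 5 :* (x :* x :+ x))
    far-upper = cert 999 ((120000 , 0 ∷ []) ∷ (1200 , 0 ∷ 5 ∷ []) ∷ (3 , 0 ∷ 5 ∷ 5 ∷ []) ∷ (6000 , 1 ∷ []) ∷ (30 , 1 ∷ 5 ∷ []) ∷ (3000 , 2 ∷ []) ∷ (6000 , 3 ∷ 6 ∷ []) ∷ (50 , 4 ∷ 6 ∷ []) ∷ (706000 , 6 ∷ []) ∷ (16130 , 5 ∷ 6 ∷ []) ∷ (63 , 5 ∷ 5 ∷ 6 ∷ []) ∷ []) refl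

    -- For x < 200 the linear error terms are too large, and the bounds are evaluated one by one.
    nearTest : ℕ → ℕ → Bool
    nearTest x s = (81 ℕ.* (x ℕ.* x) ≤ᵇ 100 ℕ.* s) ∧ (6 ℕ.* s ≤ᵇ 5 ℕ.* (x ℕ.* x ℕ.+ x))

    near : ℕ → Bool
    near zero = true
    near (suc x) = nearTest x (sumTo x (λ d → suc d ℕ.* (x / suc d))) ∧ near x

    ∧-true : ∀ {a b} → a ∧ b ≡ true → a ≡ true × b ≡ true
    ∧-true {true} {true} _ = refl , refl

    near-sound : ∀ n → near n ≡ true → ∀ x → x ℕ.< n → nearTest x (S x) ≡ true
    near-sound (suc n) e x (ℕ.s≤s l) with ℕₚ.m≤n⇒m<n∨m≡n l
    ... | inj₁ x<n = near-sound n (proj₂ (∧-true e)) x x<n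
    ... | inj₂ refl = trans (cong (nearTest x) (divisor-summatory x)) (proj₁ (∧-true e))

    near-holds : near 200 ≡ true
    near-holds = refl

    ≤ᵇ-true : ∀ m n → (m ≤ᵇ n) ≡ true → m ℕ.≤ n
    ≤ᵇ-true m n e = ℕₚ.≤ᵇ⇒≤ m n (subst T (sym e) tt)

    #-sum : ∀ n f → # (sumTo n f) ≡ sum n (λ k → # (f k))
    #-sum zero f = refl
    #-sum (suc n) f = trans (cong # (sumTo-last n f)) (trans (#-+ _ _) (cong (_+ # (f n)) (#-sum n f)))

    Q²-pos : 1 ℕ.≤ Q²
    Q²-pos = ℕₚ.≤ᵇ⇒≤ _ _ tt

    Pos-# : ∀ n → 1 ℕ.≤ n → Pos (# n)
    Pos-# (suc n) _ = #Pos n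

    casts : ∀ m x → # (m ℕ.* (x ℕ.* x)) ≡ # m * (# x * # x)
    casts m x = trans (#-* m (x ℕ.* x)) (cong (# m *_) (#-* x x))

    -- The huge numbers enter as variables: only the inequalities between them matter, and `60 !`
    -- must not unfold.
    module _ (Q a b : ℕ) (a-low : 1628 ℕ.* Q ℕ.≤ 1000 ℕ.* a) (a-high : 1000 ℕ.* a ℕ.≤ 1629 ℕ.* Q) (b-high : 100 ℕ.* b ℕ.≤ 469 ℕ.* Q) (Q-pos : 1 ℕ.≤ Q)
      (upper : ∀ x → 2 ℕ.* Q ℕ.* layered 60 x ℕ.≤ a ℕ.* (x ℕ.* x) ℕ.+ b ℕ.* x)
      (lower : ∀ x → a ℕ.* (suc x ℕ.* suc x) ℕ.≤ 2 ℕ.* Q ℕ.* layered 60 x ℕ.+ b ℕ.* suc x) where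
      private
        two : ∀ m n k l → m ℕ.* n ℕ.≤ k ℕ.* l → # m * # n ≤ # k * # l
        two m n k l h = ≡≤ (sym (#-* m n)) (≤≡ (#mono h) (#-* k l))

        tripleˡ : ∀ Q L → # (2 ℕ.* Q ℕ.* L) ≡ # 2 * # Q * # L
        tripleˡ Q L = trans (#-* (2 ℕ.* Q) L) (cong (_* # L) (#-* 2 Q))

        far : ∀ x → 200 ℕ.≤ x → (# 81 * (# x * # x) ≤ # 100 * # (S x)) × (# 6 * # (S x) ≤ # 5 * (# x * # x + # x))
        far x h = *-cancelˡ (Pos-# Q Q-pos) (use far-lower {# a} {# b} {# Q} {# (layered 60 x)} (two 1628 Q 1000 a a-low) (two 100 b 469 Q b-high) low
                    (#mono (S-lower 60 x)) (#mono h) (#0≤ Q))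
                , *-cancelˡ (Pos-# Q Q-pos) (use far-upper {# a} {# b} {# Q} {# (layered 60 x)} {_} {_} {# r} (two 1000 a 1629 Q a-high) (two 100 b 469 Q b-high) upp
                    (≤≡ (#mono (S-upper 60 x)) (#-+ (layered 60 x) r)) (≡≤ (sym (#-* 120 r)) (≤≡ (#mono (remainder-sum 60 x x)) (#-* x x))) (#mono h) (#0≤ Q))
          where
          r : ℕ
          r = sumTo x (λ d → x ℕ.∸ suc d ℕ.* 60)
          low : # a * ((# x + # 1) * (# x + # 1)) ≤ # 2 * # Q * # (layered 60 x) + # b * (# x + # 1)
          low = ≡≤ (trans (cong (λ v → # a * (v * v)) (sym (#suc x))) (sym (casts a (suc x)))) (≤≡ (#mono (lower x))
            (trans (#-+ (2 ℕ.* Q ℕ.* layered 60 x) (b ℕ.* suc x)) (cong₂ _+_ (tripleˡ Q (layered 60 x)) (trans (#-* b (suc x)) (cong (# b *_) (#suc x))))))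
          upp : # 2 * # Q * # (layered 60 x) ≤ # a * (# x * # x) + # b * # x
          upp = ≡≤ (sym (tripleˡ Q (layered 60 x))) (≤≡ (#mono (upper x)) (trans (#-+ (a ℕ.* (x ℕ.* x)) (b ℕ.* x)) (cong₂ _+_ (casts a x) (#-* b x))))

        close : ∀ x → x ℕ.< 200 → (# 81 * (# x * # x) ≤ # 100 * # (S x)) × (# 6 * # (S x) ≤ # 5 * (# x * # x + # x))
        close x l = ≡≤ (sym (casts 81 x)) (≤≡ (#mono (≤ᵇ-true _ _ (proj₁ t))) (#-* 100 (S x)))
                  , ≡≤ (sym (#-* 6 (S x))) (≤≡ (#mono (≤ᵇ-true _ _ (proj₂ t))) (trans (#-* 5 (x ℕ.* x ℕ.+ x)) (cong (# 5 *_) (trans (#-+ (x ℕ.* x) x) (cong (_+ # x) (#-* x x))))))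
          where t = ∧-true (near-sound 200 near-holds x l)

      both : ∀ x → (# 81 * (# x * # x) ≤ # 100 * # (S x)) × (# 6 * # (S x) ≤ # 5 * (# x * # x + # x))
      both x with 200 ℕ.≤? x
      ... | yes h = far x h
      ... | no h = close x (ℕₚ.≰⇒> h)

    divisor-sum-bounds : ∀ x → (# 81 * (# x * # x) ≤ # 100 * sum (suc x) (λ k → # (divisor-sum k))) × (# 6 * sum (suc x) (λ k → # (divisor-sum k)) ≤ # 5 * (# x * # x + # x))
    divisor-sum-bounds x = subst (λ v → (# 81 * (# x * # x) ≤ # 100 * v) × (# 6 * v ≤ # 5 * (# x * # x + # x))) (#-sum (suc x) divisor-sum)
      (both Q² c₁ c₂ c₁-low c₁-high c₂-high Q²-pos layered-upper layered-lower x)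

  -- Certificates for the estimates of δ and ε

  module Differences where
    open import Data.Nat as ℕ using (ℕ; zero; suc; _∸_)
    open import Relation.Binary.PropositionalEquality hiding ([_])
    open import Data.List using ([]; _∷_)
    import Data.Nat.Properties as ℕₚ
    open import Data.Product using (_×_; _,_; ∃)
    open import Data.Sum using (_⊎_; inj₁; inj₂)
    open import Data.Unit using (tt)
    open import Data.Empty using (⊥; ⊥-elim)
    open import Relation.Binary.Definitions using (tri<; tri≈; tri>)
    open ≡-Reasoning
    open Sums
    open Moments
    open Weights
    open Geometric

    -- For u = z m and v = z(m-1) the bound v ≤ u (1 + 0.38 u²) is raised to the ninth power by
    -- cubing twice and rounding: 1 + 1.16 u², then 1 + 3.5 u².
    ratio-arith : Certificate 3 λ u v d →
      con 50 :* d :≤ con 19 :* u :^ 3 ⇒ v :- u :≤ d ⇒ ⊢ con 50 :* v :≤ u :* (con 50 :+ con 19 :* u :^ 2)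
    ratio-arith = cert 0 ((1 , 0 ∷ []) ∷ (50 , 1 ∷ []) ∷ []) refl

    ratio-cube : Certificate 1 λ u →
      con 0 :≤ u ⇒ con 100 :* u :≤ con 7 ⇒
      ⊢ u :^ 3 :* (con 50 :+ con 19 :* u :^ 2) :^ 3 :≤ con 1250 :* (u :^ 3 :* (con 100 :+ con 116 :* u :^ 2))
    ratio-cube = cert 699999999 ((1564150220787 , 0 ∷ 0 ∷ 0 ∷ 0 ∷ 0 ∷ []) ∷ (541836091 , 0 ∷ 0 ∷ 0 ∷ 0 ∷ 0 ∷ 1 ∷ 1 ∷ 1 ∷ []) ∷ (758805791100 , 0 ∷ 0 ∷ 0 ∷ 0 ∷ 0 ∷ 0 ∷ 1 ∷ []) ∷ (48013000000 , 0 ∷ 0 ∷ 0 ∷ 0 ∷ 0 ∷ 0 ∷ 0 ∷ 0 ∷ 1 ∷ []) ∷ (54150000000 , 0 ∷ 0 ∷ 0 ∷ 0 ∷ 0 ∷ 0 ∷ 1 ∷ 1 ∷ []) ∷ []) refl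

    ratio-ninth : Certificate 1 λ u →
      con 0 :≤ u ⇒ con 100 :* u :≤ con 7 ⇒ ⊢ (con 100 :+ con 116 :* u :^ 2) :^ 3 :≤ con 500000 :* (con 2 :+ con 7 :* u :^ 2)
    ratio-ninth = cert 10937499 ((1992844077 , 0 ∷ 0 ∷ []) ∷ (12650851830000 , 0 ∷ 0 ∷ 0 ∷ 0 ∷ 1 ∷ []) ∷ (170723000000 , 0 ∷ 0 ∷ 0 ∷ 0 ∷ 0 ∷ 1 ∷ []) ∷ (4423615427 , 0 ∷ 0 ∷ 1 ∷ 1 ∷ []) ∷ (126389012200 , 0 ∷ 0 ∷ 0 ∷ 1 ∷ 1 ∷ []) ∷ []) refl

    ratio-final : Certificate 3 λ u y r →
      con 0 :≤ y ⇒ y :≤ u ⇒ con 100 :* u :≤ con 7 ⇒ con 1000 :* y :≤ con 9 ⇒ con 25 :* r :+ con 24 :* y :≤ con 25 ⇒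
      con 25 :≤ con 25 :* r :+ con 24 :* y ⇒ ⊢ (con 2 :+ con 7 :* u :^ 2) :* (con 1 :- u) :≤ con 2 :* r
    ratio-final = cert 6099 ((6341 , 1 ∷ []) ∷ (488 , 5 ∷ []) ∷ (837 , 1 ∷ 2 ∷ []) ∷ (41 , 0 ∷ 3 ∷ []) ∷ (17 , 0 ∷ 2 ∷ []) ∷ (41000 , 1 ∷ 1 ∷ []) ∷ (128100 , 0 ∷ 0 ∷ 1 ∷ []) ∷ (128100 , 0 ∷ 1 ∷ 1 ∷ []) ∷ (42700 , 1 ∷ 1 ∷ 1 ∷ []) ∷ (42700 , 0 ∷ 0 ∷ 0 ∷ []) ∷ []) refl

    ratio-cancel : Certificate 3 λ v u g →
      (con 50 :* v) :^ 3 :≤ (u :* g) :^ 3 ⇒ u :^ 3 :* g :^ 3 :≤ con 1250 :* (u :^ 3 :* (con 100 :+ con 116 :* u :^ 2)) ⇒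
      ⊢ con 100 :* v :^ 3 :≤ u :^ 3 :* (con 100 :+ con 116 :* u :^ 2)
    ratio-cancel = cert 1249 ((1 , 0 ∷ []) ∷ (1 , 1 ∷ []) ∷ []) refl

    ratio-cancel2 : Certificate 3 λ v u g →
      (con 100 :* v :^ 3) :^ 3 :≤ (u :^ 3 :* (con 100 :+ con 116 :* u :^ 2)) :^ 3 ⇒
      u :^ 9 :* (con 100 :+ con 116 :* u :^ 2) :^ 3 :≤ u :^ 9 :* (con 500000 :* (con 2 :+ con 7 :* u :^ 2)) ⇒
      ⊢ con 2 :* v :^ 9 :≤ u :^ 9 :* (con 2 :+ con 7 :* u :^ 2)
    ratio-cancel2 = cert 499999 ((1 , 0 ∷ []) ∷ (1 , 1 ∷ []) ∷ []) refl

    ratio-combine : Certificate 4 λ v u r q →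
      con 2 :* v :^ 9 :≤ u :^ 9 :* (con 2 :+ con 7 :* u :^ 2) ⇒ q :≤ con 1 :- u ⇒ con 0 :≤ q ⇒
      (con 2 :+ con 7 :* u :^ 2) :* (con 1 :- u) :≤ con 2 :* r ⇒ con 0 :≤ u :^ 9 ⇒ con 0 :≤ con 2 :+ con 7 :* u :^ 2 ⇒
      ⊢ q :* v :^ 9 :≤ r :* u :^ 9
    ratio-combine = cert 1 ((1 , 0 ∷ 2 ∷ []) ∷ (1 , 1 ∷ 4 ∷ 5 ∷ []) ∷ (1 , 3 ∷ 4 ∷ []) ∷ []) refl

    h≤r-arith : Certificate 3 λ h r y →
      con 1000 :* h :≤ con 991 ⇒ con 25 :≤ con 25 :* r :+ con 24 :* y ⇒ con 1000 :* y :≤ con 9 ⇒ con 0 :≤ y ⇒ ⊢ h :≤ r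
    h≤r-arith = cert 24999 ((9 , []) ∷ (25 , 0 ∷ []) ∷ (1000 , 1 ∷ []) ∷ (24 , 2 ∷ []) ∷ []) refl

    0≤h-arith : Certificate 1 λ h →
      con 991 :≤ con 1000 :* h ⇒ ⊢ con 0 :≤ h
    0≤h-arith = cert 999 ((991 , []) ∷ (1 , 0 ∷ []) ∷ []) refl

    q-large : Certificate 2 λ q y →
      con 1 :≤ y :+ q ⇒ con 1000 :* y :≤ con 9 ⇒ ⊢ con 991 :≤ con 1000 :* q
    q-large = cert 0 ((1000 , 0 ∷ []) ∷ (1 , 1 ∷ []) ∷ []) refl

    cancel-1000 : Certificate 2 λ x y →
      con 1000 :* x :≤ con 991 ⇒ con 991 :≤ con 1000 :* y ⇒ ⊢ x :≤ y
    cancel-1000 = cert 999 ((1 , 0 ∷ []) ∷ (1 , 1 ∷ []) ∷ []) refl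

    compare-high : Certificate 4 λ u v a b →
      v :≤ u ⇒ a :≤ con 1 :- u ⇒ con 1 :- v :≤ b ⇒ ⊢ a :≤ b
    compare-high = cert 0 ((1 , 0 ∷ []) ∷ (1 , 1 ∷ []) ∷ (1 , 2 ∷ []) ∷ []) refl

    as-difference : Certificate 2 λ u p →
      u :+ p :≤ con 1 ⇒ ⊢ p :≤ con 1 :- u
    as-difference = cert 0 ((1 , 0 ∷ []) ∷ []) refl

    as-difference′ : Certificate 2 λ u p →
      con 1 :≤ u :+ p ⇒ ⊢ con 1 :- u :≤ p
    as-difference′ = cert 0 ((1 , 0 ∷ []) ∷ []) refl

    exchange : Certificate 4 λ u v a b →
      v :+ b :≤ con 1 ⇒ con 1 :≤ u :+ a ⇒ ⊢ v :- u :≤ a :- b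
    exchange = cert 0 ((1 , 0 ∷ []) ∷ (1 , 1 ∷ []) ∷ []) refl

    trade : Certificate 6 λ R p v r V c →
      R :* V :≤ c ⇒ con 0 :≤ R ⇒ con 0 :≤ r ⇒ p :* v :≤ r :* V ⇒ ⊢ R :* p :* v :≤ r :* c
    trade = cert 0 ((1 , 1 ∷ 3 ∷ []) ∷ (1 , 0 ∷ 2 ∷ []) ∷ []) refl

    low-combine : Certificate 7 λ R S H c v p P →
      R :* v :≤ c :* P ⇒ S :* con 512 :≤ v :* H ⇒ H :≤ p ⇒ con 0 :≤ R ⇒ con 0 :≤ v ⇒ con 0 :≤ P ⇒ con 0 :≤ c ⇒ con 0 :≤ H ⇒ con 0 :≤ p ⇒
      ⊢ R :* S :* con 512 :≤ c :* (P :* p)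
    low-combine = cert 0 ((1 , 1 ∷ 3 ∷ []) ∷ (1 , 0 ∷ 7 ∷ []) ∷ (1 , 2 ∷ 6 ∷ 5 ∷ []) ∷ []) refl

    -- The rate is 24 w while y = 25 w, so each constant grows by a power of 25/24: 1.0851 here,
    -- then 2.2606, 7.0643, and so on.
    lin-y : Certificate 2 λ w m →
      con 0 :≤ w ⇒ con 24 :* w :* (con 24 :* w) :* m :≤ con 1 ⇒ ⊢ con 10000 :* ((con 25 :* w) :^ 2 :* m) :≤ con 10851
    lin-y = cert 35 ((11 , []) ∷ (390625 , 1 ∷ []) ∷ []) refl

    rise2-y : Certificate 2 λ w m →
      con 0 :≤ w ⇒ con 24 :* w :* (con 24 :* w) :* (con 24 :* w) :* m :≤ con 2 ⇒ ⊢ con 10000 :* ((con 25 :* w) :^ 3 :* m) :≤ con 22606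
    rise2-y = cert 863 ((334 , []) ∷ (9765625 , 1 ∷ []) ∷ []) refl

    rise3-y : Certificate 2 λ w m →
      con 24 :* w :* (con 24 :* w) :* (con 24 :* w) :* (con 24 :* w) :* m :≤ con 6 ⇒
      ⊢ con 10000 :* ((con 25 :* w) :^ 4 :* m) :≤ con 70643
    rise3-y = cert 20735 ((9498 , []) ∷ (244140625 , 0 ∷ []) ∷ []) refl

    mass1-y : Certificate 2 λ w m →
      con 100 :* (con 24 :* w :* (con 24 :* w) :* (con 24 :* w) :* m) :≤ con 338 ⇒ ⊢ con 10000 :* ((con 25 :* w) :^ 3 :* m) :≤ con 38204
    mass1-y = cert 3455 ((1774 , []) ∷ (390625 , 0 ∷ []) ∷ []) refl

    mass2-y : Certificate 2 λ w m →
      con 100 :* (con 24 :* w :* (con 24 :* w) :* (con 24 :* w) :* (con 24 :* w) :* m) :≤ con 1028 ⇒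
      ⊢ con 10000 :* ((con 25 :* w) :^ 4 :* m) :≤ con 121035
    mass2-y = cert 82943 ((64540 , []) ∷ (9765625 , 0 ∷ []) ∷ []) refl

    mass3-y : Certificate 2 λ w m →
      con 100 :* (con 24 :* w :* (con 24 :* w) :* (con 24 :* w) :* (con 24 :* w) :* (con 24 :* w) :* m) :≤ con 4168 ⇒
      ⊢ con 10000 :* ((con 25 :* w) :^ 5 :* m) :≤ con 511178
    mass3-y = cert 1990655 ((1427768 , []) ∷ (244140625 , 0 ∷ []) ∷ []) refl

    -- 4124 rounds up 0.38 · 10851, the drift of ρ away from its value at n.
    u0-low : Certificate 4 λ y u x e →
      y :* u :+ x :≤ con 1 ⇒ con 1 :≤ y :* u :+ x ⇒ con 50 :* x :≤ con 19 :* (y :^ 3 :* e) ⇒ con 10000 :* (y :^ 2 :* e) :≤ con 10851 ⇒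
      con 0 :≤ y ⇒ ⊢ con 10000 :- con 4124 :* y :≤ con 10000 :* (y :* u)
    u0-low = cert 49 ((500000 , 1 ∷ []) ∷ (10000 , 2 ∷ []) ∷ (19 , 3 ∷ 4 ∷ []) ∷ (31 , 4 ∷ []) ∷ []) refl

    u0-high : Certificate 4 λ y u x e →
      y :* u :+ x :≤ con 1 ⇒ con 1 :≤ y :* u :+ x ⇒ con 0 :- con 19 :* (y :^ 3 :* e) :≤ con 50 :* x ⇒
      con 10000 :* (y :^ 2 :* e) :≤ con 10851 ⇒ con 0 :≤ y ⇒ ⊢ con 10000 :* (y :* u) :≤ con 10000 :+ con 4124 :* y
    u0-high = cert 49 ((500000 , 0 ∷ []) ∷ (10000 , 2 ∷ []) ∷ (19 , 3 ∷ 4 ∷ []) ∷ (31 , 4 ∷ []) ∷ []) refl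

    u1-low : Certificate 5 λ y u v x e →
      y :* v :+ x :≤ u :- con 1 ⇒ u :- con 1 :≤ y :* v :+ x ⇒ con 50 :* x :≤ con 19 :* (y :^ 3 :* e) ⇒
      con 10000 :* (y :^ 3 :* e) :≤ con 22606 ⇒ con 0 :≤ y ⇒ con 10000 :- con 4124 :* y :≤ con 10000 :* (y :* u) ⇒
      ⊢ con 10000 :- con 22716 :* y :≤ con 10000 :* (y :^ 2 :* v)
    u1-low = cert 49 ((500000 , 1 ∷ 4 ∷ []) ∷ (10000 , 2 ∷ 4 ∷ []) ∷ (19 , 3 ∷ 4 ∷ []) ∷ (86 , 4 ∷ []) ∷ (50 , 5 ∷ []) ∷ []) refl

    u2-low : Certificate 6 λ y u v s x e →
      y :* s :+ x :≤ con 2 :* v :- con 2 :* (u :- con 1) ⇒ con 2 :* v :- con 2 :* (u :- con 1) :≤ y :* s :+ x ⇒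
      con 50 :* x :≤ con 19 :* (y :^ 3 :* e) ⇒ con 10000 :* (y :^ 4 :* e) :≤ con 70643 ⇒ con 0 :≤ y ⇒
      con 10000 :* (y :* u) :≤ con 10000 :+ con 4124 :* y ⇒ con 10000 :- con 22716 :* y :≤ con 10000 :* (y :^ 2 :* v) ⇒
      con 1000 :* y :≤ con 9 ⇒ ⊢ con 20000 :- con 92353 :* y :≤ con 10000 :* (y :^ 3 :* s)
    u2-low = cert 449 ((4500000 , 1 ∷ 4 ∷ 4 ∷ []) ∷ (90000 , 2 ∷ 4 ∷ 4 ∷ []) ∷ (171 , 3 ∷ 4 ∷ []) ∷ (9121400 , 4 ∷ 4 ∷ []) ∷ (900 , 5 ∷ 4 ∷ []) ∷ (900 , 6 ∷ []) ∷ (3833 , 7 ∷ 4 ∷ []) ∷ []) refl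

    n-low : Certificate 4 λ y u v c →
      con 81 :* (con 2 :* v :- (u :- con 1)) :≤ con 100 :* c ⇒ con 0 :≤ y ⇒ con 10000 :* (y :* u) :≤ con 10000 :+ con 4124 :* y ⇒
      con 10000 :- con 22716 :* y :≤ con 10000 :* (y :^ 2 :* v) ⇒ con 1000 :* y :≤ con 9 ⇒ ⊢ con 157 :≤ con 100 :* (y :^ 2 :* c)
    n-low = cert 1249999 ((1198759 , []) ∷ (1250000 , 0 ∷ 1 ∷ 1 ∷ []) ∷ (10125 , 2 ∷ 1 ∷ []) ∷ (20250 , 3 ∷ []) ∷ (561249 , 4 ∷ []) ∷ (59494500 , 1 ∷ 1 ∷ []) ∷ []) refl

    k-low : Certificate 3 λ y s c →
      con 479 :* s :≤ con 300 :* c ⇒ con 20000 :- con 92353 :* y :≤ con 10000 :* (y :^ 3 :* s) ⇒ con 1000 :* y :≤ con 9 ⇒ con 0 :≤ y ⇒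
      ⊢ con 305 :≤ con 100 :* (y :^ 3 :* c)
    k-low = cert 29999999 ((31866217 , []) ∷ (10000000 , 0 ∷ 3 ∷ 3 ∷ 3 ∷ []) ∷ (479000 , 1 ∷ []) ∷ (44237087 , 2 ∷ []) ∷ []) refl

    -- At y = 0.009: 1 - y + 1.3 · 12.1035 y ≈ 1.1326.
    δ-product-high : Certificate 5 λ y q k d m →
      con 0 :- con 13 :* (y :^ 5 :* m) :≤ con 10 :* (q :- k :* d) ⇒ y :+ q :≤ con 1 ⇒ con 10000 :* (y :^ 4 :* m) :≤ con 121035 ⇒
      con 0 :≤ y ⇒ con 1000 :* y :≤ con 9 ⇒ ⊢ con 10000 :* (k :* d) :≤ con 11327
    δ-product-high = cert 1999 ((1781 , []) ∷ (2000000 , 0 ∷ []) ∷ (20000000 , 1 ∷ []) ∷ (2600 , 2 ∷ 3 ∷ []) ∷ (294691 , 4 ∷ []) ∷ []) refl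

    δ-product-low : Certificate 5 λ y q k d m →
      con 10 :* (q :- k :* d) :≤ con 13 :* (y :^ 5 :* m) ⇒ con 1 :≤ y :+ q ⇒ con 10000 :* (y :^ 4 :* m) :≤ con 121035 ⇒ con 0 :≤ y ⇒
      con 1000 :* y :≤ con 9 ⇒ ⊢ con 8493 :≤ con 10000 :* (k :* d)
    δ-product-low = cert 1999 ((1781 , []) ∷ (2000000 , 0 ∷ []) ∷ (20000000 , 1 ∷ []) ∷ (2600 , 2 ∷ 3 ∷ []) ∷ (334691 , 4 ∷ []) ∷ []) refl

    δ-high : Certificate 3 λ y k d →
      con 10000 :* (k :* d) :≤ con 11327 ⇒ con 305 :≤ con 100 :* (y :^ 3 :* k) ⇒ con 0 :≤ d ⇒ con 0 :≤ y ⇒ con 0 :≤ y :^ 3 ⇒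
      ⊢ con 1000 :* d :≤ con 374 :* y :^ 3
    δ-high = cert 60 ((2 , 0 ∷ 4 ∷ []) ∷ (200 , 1 ∷ 2 ∷ []) ∷ (160 , 4 ∷ []) ∷ []) refl

    δ-low : Certificate 4 λ y q k d →
      con 8493 :≤ con 10000 :* (k :* d) ⇒ con 100 :* (y :* y :* y :* (q :* k)) :≤ con 338 ⇒ con 0 :≤ d ⇒ con 1 :≤ y :+ q ⇒ con 0 :≤ y ⇒
      con 1000 :* y :≤ con 9 ⇒ con 0 :≤ y :^ 3 ⇒ con 0 :≤ k ⇒ ⊢ con 2487 :* y :^ 3 :≤ con 10000 :* d
    δ-low = cert 3379 ((991 , 0 ∷ 6 ∷ []) ∷ (100000 , 1 ∷ 2 ∷ []) ∷ (10503 , 6 ∷ []) ∷ (10000000 , 3 ∷ 7 ∷ 2 ∷ 6 ∷ []) ∷ (10000 , 5 ∷ 7 ∷ 2 ∷ 6 ∷ []) ∷ []) refl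

    negative : Certificate 2 λ d k →
      d :≤ con 0 ⇒ con 0 :≤ k ⇒ ⊢ con 10000 :* (k :* d) :≤ con 0
    negative = cert 0 ((10000 , 0 ∷ 1 ∷ []) ∷ []) refl

    one≤ : Certificate 1 λ q →
      con 991 :≤ con 1000 :* q ⇒ ⊢ con 1 :≤ con 2 :* q
    one≤ = cert 499 ((491 , []) ∷ (1 , 0 ∷ []) ∷ []) refl

    scale-zero : Certificate 1 λ q →
      q :≤ con 0 ⇒ ⊢ con 2 :* q :≤ con 0
    scale-zero = cert 0 ((2 , 0 ∷ []) ∷ []) refl

    meanV-high-arith : Certificate 6 λ q v x d y m →
      q :* v :+ x :≤ q :* d ⇒ con 0 :- con 361 :* (y :^ 6 :* m) :≤ con 2500 :* x ⇒ con 10000 :* (y :^ 4 :* m) :≤ con 121035 ⇒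
      con 1000 :* d :≤ con 374 :* y :^ 3 ⇒ con 1000 :* y :≤ con 9 ⇒ con 991 :≤ con 1000 :* q ⇒ con 0 :≤ y :^ 2 ⇒ con 0 :≤ q ⇒
      ⊢ q :* (con 100 :* v) :≤ q :* (con 177 :* y :^ 2)
    meanV-high-arith = cert 247749999 ((24775000000 , 0 ∷ []) ∷ (9910000 , 1 ∷ []) ∷ (357751 , 2 ∷ 6 ∷ []) ∷ (24775000 , 3 ∷ 7 ∷ []) ∷ (9265850 , 4 ∷ 6 ∷ 7 ∷ []) ∷ (43693635 , 5 ∷ 6 ∷ []) ∷ (74722350 , 6 ∷ 7 ∷ []) ∷ []) refl

    meanV-low-arith : Certificate 6 λ q v x d y m →
      q :* d :≤ q :* v :+ x ⇒ con 2500 :* x :≤ con 361 :* (y :^ 6 :* m) ⇒ con 10000 :* (y :^ 4 :* m) :≤ con 121035 ⇒ con 0 :≤ d ⇒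
      con 991 :≤ con 1000 :* q ⇒ con 0 :≤ y :^ 2 ⇒ con 0 :≤ q ⇒ ⊢ q :* (con 0 :- con 177 :* y :^ 2) :≤ q :* (con 100 :* v)
    meanV-low-arith = cert 247749999 ((24775000000 , 0 ∷ []) ∷ (9910000 , 1 ∷ []) ∷ (357751 , 2 ∷ 5 ∷ []) ∷ (24775000000 , 3 ∷ 6 ∷ []) ∷ (43693635 , 4 ∷ 5 ∷ []) ∷ (158115000 , 5 ∷ 6 ∷ []) ∷ []) refl

    rise-step : Certificate 2 λ s x →
      s :≤ x :* x :* x ⇒ con 0 :≤ x ⇒ ⊢ s :+ con 3 :* (x :* x) :≤ (x :+ con 1) :* (x :+ con 1) :* (x :+ con 1)
    rise-step = cert 0 ((1 , []) ∷ (1 , 0 ∷ []) ∷ (3 , 1 ∷ []) ∷ []) refl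

    potential-step : Certificate 5 λ y x s g p →
      con 6 :* s :≤ con 5 :* (x :* x :+ x) ⇒ con 0 :≤ y ⇒ con 0 :≤ p ⇒
      ⊢ con 6 :* (y :* y :* (g :* ((con 1 :- y) :* p))) :+ (con 1 :- y) :* p :* (con 5 :* (y :* y :* ((x :+ con 1) :* (x :+ con 1) :+ (x :+ con 1))) :+ con 10 :* ((x :+ con 1) :* (con 1 :- y) :* y) :+ con 10 :* (con 1 :- y) :- con 6 :* (y :* y :* (s :+ g))) :≤ p :* (con 5 :* (y :* y :* (x :* x :+ x)) :+ con 10 :* (x :* (con 1 :- y) :* y) :+ con 10 :* (con 1 :- y) :- con 6 :* (y :* y :* s))
    potential-step = cert 0 ((1 , 0 ∷ 1 ∷ 1 ∷ 1 ∷ 2 ∷ []) ∷ []) refl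

    Ψ-positive : Certificate 4 λ y x s q →
      con 6 :* s :≤ con 5 :* (x :* x :+ x) ⇒ con 0 :≤ y ⇒ con 0 :≤ x ⇒ con 0 :≤ q ⇒
      ⊢ con 0 :≤ con 5 :* (y :* y :* (x :* x :+ x)) :+ con 10 :* (x :* q :* y) :+ con 10 :* q :- con 6 :* (y :* y :* s)
    Ψ-positive = cert 0 ((1 , 0 ∷ 1 ∷ 1 ∷ []) ∷ (10 , 3 ∷ []) ∷ (10 , 1 ∷ 2 ∷ 3 ∷ []) ∷ []) refl

    W-arith : Certificate 8 λ w T R y x q s L →
      w :≤ R :* T ⇒
      con 6 :* (y :* y :* T) :+ L :≤ con 5 :* (y :* y :* (x :* x :+ x)) :+ con 10 :* (x :* q :* y) :+ con 10 :* q :- con 6 :* (y :* y :* s) ⇒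
      con 0 :≤ L ⇒ con 81 :* (x :* x) :≤ con 100 :* s ⇒ q :≤ con 1 :- y ⇒ con 0 :≤ y ⇒ con 0 :≤ x ⇒ con 0 :≤ R ⇒
      ⊢ con 300 :* (y :* y :* w) :≤ R :* (con 500 :+ con 500 :* (x :* y) :+ con 7 :* (x :* y) :^ 2)
    W-arith = cert 0 ((300 , 0 ∷ 5 ∷ 5 ∷ []) ∷ (50 , 1 ∷ 7 ∷ []) ∷ (50 , 2 ∷ 7 ∷ []) ∷ (3 , 3 ∷ 5 ∷ 5 ∷ 7 ∷ []) ∷ (500 , 4 ∷ 7 ∷ []) ∷ (500 , 4 ∷ 5 ∷ 6 ∷ 7 ∷ []) ∷ (250 , 5 ∷ 5 ∷ 6 ∷ 7 ∷ []) ∷ (500 , 5 ∷ 7 ∷ []) ∷ []) refl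

    crude-high-arith : Certificate 6 λ r y m p d n →
      con 0 :- con 19 :* (y :^ 3 :* m) :≤ r :* (con 50 :* (p :- d :* n)) ⇒ con 10000 :* (y :^ 3 :* m) :≤ con 38204 ⇒ p :≤ con 1 ⇒
      con 991 :≤ con 1000 :* r ⇒ con 0 :≤ r ⇒ ⊢ r :* (con 1000 :* (d :* n)) :≤ r :* con 2466
    crude-high-arith = cert 499 ((527 , []) ∷ (10000 , 0 ∷ []) ∷ (19 , 1 ∷ []) ∷ (500000 , 2 ∷ 4 ∷ []) ∷ (733 , 3 ∷ []) ∷ []) refl

    crude-low-arith : Certificate 6 λ r y m p d n →
      r :* (con 50 :* (p :- d :* n)) :≤ con 19 :* (y :^ 3 :* m) ⇒ con 10000 :* (y :^ 3 :* m) :≤ con 38204 ⇒ con 0 :≤ p ⇒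
      con 991 :≤ con 1000 :* r ⇒ con 0 :≤ r ⇒ ⊢ r :* (con 0 :- con 2466 :* con 1) :≤ r :* (con 1000 :* (d :* n))
    crude-low-arith = cert 499 ((496027 , []) ∷ (10000 , 0 ∷ []) ∷ (19 , 1 ∷ []) ∷ (500000 , 2 ∷ 4 ∷ []) ∷ (1233 , 3 ∷ []) ∷ []) refl

    crude-high : Certificate 4 λ y c d n →
      con 1000 :* (d :* n) :≤ con 2466 ⇒ con 157 :≤ con 100 :* (y :^ 2 :* c) ⇒ c :≤ n ⇒ con 0 :≤ d ⇒ con 0 :≤ y :^ 2 ⇒
      ⊢ con 1000 :* d :≤ con 1600 :* y :^ 2
    crude-high = cert 1232 ((800 , 0 ∷ 4 ∷ []) ∷ (8000 , 1 ∷ 3 ∷ []) ∷ (800000 , 2 ∷ 3 ∷ 4 ∷ []) ∷ (23000 , 3 ∷ []) ∷ []) refl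

    flip : Certificate 2 λ d n →
      con 0 :- con 2466 :* con 1 :≤ con 1000 :* (d :* n) ⇒ ⊢ con 1000 :* ((con 0 :- d) :* n) :≤ con 2466
    flip = cert 0 ((1 , 0 ∷ []) ∷ []) refl

    unflip : Certificate 2 λ d b →
      con 1000 :* (con 0 :- d) :≤ b ⇒ ⊢ con 0 :- b :≤ con 1000 :* d
    unflip = cert 0 ((1 , 0 ∷ []) ∷ []) refl

    trivial-high : Certificate 2 λ d b →
      d :≤ con 0 ⇒ con 0 :≤ b ⇒ ⊢ con 1000 :* d :≤ con 1600 :* b
    trivial-high = cert 0 ((1000 , 0 ∷ []) ∷ (1600 , 1 ∷ []) ∷ []) refl

    negate : Certificate 1 λ d →
      con 0 :≤ d ⇒ ⊢ con 0 :- d :≤ con 0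
    negate = cert 0 ((1 , 0 ∷ []) ∷ []) refl

    negate′ : Certificate 1 λ d →
      d :≤ con 0 ⇒ ⊢ con 0 :≤ con 0 :- d
    negate′ = cert 0 ((1 , 0 ∷ []) ∷ []) refl

    ρn≤r-arith : Certificate 4 λ a b y r →
      con 1000 :* (a :- b) :≤ con 1600 :* y :^ 2 ⇒ y :+ b :≤ con 1 ⇒ con 25 :≤ con 25 :* r :+ con 24 :* y ⇒ con 0 :≤ y ⇒
      con 1000 :* y :≤ con 9 ⇒ ⊢ a :≤ r
    ρn≤r-arith = cert 4999 ((5 , 0 ∷ []) ∷ (5000 , 1 ∷ []) ∷ (200 , 2 ∷ []) ∷ (128 , 3 ∷ []) ∷ (8 , 3 ∷ 4 ∷ []) ∷ []) refl

    search-start : Certificate 2 λ y c →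
      con 157 :≤ con 100 :* (y :^ 2 :* c) ⇒ con 1000 :* y :≤ con 9 ⇒ con 0 :≤ y ⇒ con 0 :≤ c ⇒ ⊢ con 1 :≤ con 2 :* (c :* y)
    search-start = cert 1569 ((10 , 0 ∷ []) ∷ (1 , 1 ∷ 2 ∷ 3 ∷ []) ∷ (3131 , 2 ∷ 3 ∷ []) ∷ []) refl

    merge : Certificate 3 λ e u v →
      u :≤ v ⇒ ⊢ e :+ u :+ v :≤ e :+ con 2 :* v
    merge = cert 0 ((1 , 0 ∷ []) ∷ []) refl

    T-arith : Certificate 11 λ e y m1 m2 m3 p5 p3 p6 p8 p9 t →
      t :≤ e :* (con 325000 :* p5 :+ con 47500 :* p3 :+ con 36100 :* p6) :+ con 370500 :* p8 :+ con 13718 :* p9 ⇒ p5 :≤ y :^ 5 :* m1 ⇒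
      p3 :≤ y :^ 3 :* m1 ⇒ p6 :≤ y :^ 6 :* m2 ⇒ p8 :≤ y :^ 8 :* m2 ⇒ p9 :≤ y :^ 9 :* m3 ⇒ con 10000 :* (y :^ 3 :* m1) :≤ con 38204 ⇒
      con 10000 :* (y :^ 4 :* m2) :≤ con 121035 ⇒ con 10000 :* (y :^ 5 :* m3) :≤ con 511178 ⇒ con 0 :≤ e ⇒ con 0 :≤ y :^ 2 ⇒
      con 0 :≤ y :^ 4 ⇒ con 1000 :* y :≤ con 9 ⇒ con 0 :≤ y ⇒ ⊢ t :≤ con 181700 :* e :+ con 5185600 :* y :^ 4
    T-arith = cert 19999999 ((20000000 , 0 ∷ []) ∷ (6500000000000 , 1 ∷ 9 ∷ []) ∷ (950000000000 , 2 ∷ 9 ∷ []) ∷ (722000000000 , 3 ∷ 9 ∷ []) ∷ (7410000000000 , 4 ∷ []) ∷ (274360000000 , 5 ∷ []) ∷ (95000000 , 6 ∷ 9 ∷ []) ∷ (650000000 , 6 ∷ 9 ∷ 10 ∷ []) ∷ (72200000 , 7 ∷ 9 ∷ 10 ∷ []) ∷ (741000000 , 7 ∷ 11 ∷ []) ∷ (27436000 , 8 ∷ 11 ∷ []) ∷ (1900722513 , 9 ∷ []) ∷ (67142654000 , 12 ∷ 13 ∷ 9 ∷ []) ∷ (33571327 , 12 ∷ 12 ∷ 9 ∷ []) ∷ (385392000 , 11 ∷ []) ∷ []) refl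

    shift-small : Certificate 3 λ y s c →
      con 2 :* (s :* y) :≤ con 1 ⇒ con 157 :≤ con 100 :* (y :^ 2 :* c) ⇒ con 1000 :* y :≤ con 9 ⇒ con 0 :≤ y ⇒
      ⊢ y :^ 2 :* (con 200 :* (s :+ con 1)) :≤ y :^ 2 :* c
    shift-small = cert 4999 ((3269 , []) ∷ (500000 , 0 ∷ 3 ∷ []) ∷ (50 , 1 ∷ []) ∷ (509 , 2 ∷ []) ∷ (1000 , 2 ∷ 3 ∷ []) ∷ []) refl

    near : Certificate 3 λ u y j →
      con 1000 :* u :≤ con 1000 :* y :+ con 400 :* (j :* y :^ 3) ⇒ con 2 :* (j :* y) :≤ con 1 ⇒ con 0 :≤ y ⇒ con 1000 :* y :≤ con 9 ⇒
      ⊢ con 500 :* u :≤ con 501 :* y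
    near = cert 9 ((5 , 0 ∷ []) ∷ (1000 , 1 ∷ 2 ∷ 2 ∷ []) ∷ (1 , 3 ∷ 2 ∷ []) ∷ (1 , 2 ∷ []) ∷ []) refl

    near-cube : Certificate 2 λ u y →
      (con 500 :* u) :^ 3 :≤ (con 501 :* y) :^ 3 ⇒ con 0 :≤ y :^ 3 ⇒ ⊢ con 380 :* u :^ 3 :≤ con 400 :* y :^ 3
    near-cube = cert 6249999 ((19 , 0 ∷ []) ∷ (110721481 , 1 ∷ []) ∷ []) refl

    near-step : Certificate 7 λ u v y j d p q →
      con 1000 :* u :≤ con 1000 :* y :+ con 400 :* (j :* y :^ 3) ⇒ con 380 :* u :^ 3 :≤ con 400 :* y :^ 3 ⇒
      con 50 :* d :≤ con 19 :* u :^ 3 ⇒ v :+ p :≤ con 1 ⇒ con 1 :≤ u :+ q ⇒ q :- p :≤ d ⇒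
      ⊢ con 1000 :* v :≤ con 1000 :* y :+ con 400 :* ((j :+ con 1) :* y :^ 3)
    near-step = cert 0 ((1 , 0 ∷ []) ∷ (1 , 1 ∷ []) ∷ (20 , 2 ∷ []) ∷ (1000 , 3 ∷ []) ∷ (1000 , 4 ∷ []) ∷ (1000 , 5 ∷ []) ∷ []) refl

    short-mono : Certificate 3 λ j s y →
      j :≤ s ⇒ con 0 :≤ y ⇒ con 2 :* (s :* y) :≤ con 1 ⇒ ⊢ con 2 :* (j :* y) :≤ con 1
    short-mono = cert 0 ((1 , 2 ∷ []) ∷ (2 , 0 ∷ 1 ∷ []) ∷ []) refl

    R-step : Certificate 6 λ R p q x u y →
      q :- x :* y :≤ R ⇒ R :≤ con 1 ⇒ u :+ p :≤ con 1 ⇒ con 1 :≤ u :+ p ⇒ u :≤ y ⇒ con 0 :≤ u ⇒ p :≤ con 1 ⇒ con 0 :≤ p ⇒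
      ⊢ q :- (x :+ con 1) :* y :≤ R :* p
    R-step = cert 0 ((1 , 0 ∷ []) ∷ (1 , 1 ∷ 5 ∷ []) ∷ (1 , 3 ∷ []) ∷ (1 , 4 ∷ []) ∷ (1 , 2 ∷ 1 ∷ []) ∷ []) refl

    Rs-arith : Certificate 6 λ q b y v s R →
      q :- s :* v :≤ R ⇒ con 0 :- con 1600 :* y :^ 2 :≤ con 1000 :* (q :- b) ⇒ con 1 :≤ y :+ b ⇒ con 500 :* v :≤ con 501 :* y ⇒
      con 2 :* (s :* y) :≤ con 1 ⇒ con 1000 :* y :≤ con 9 ⇒ con 0 :≤ y ⇒ con 0 :≤ s ⇒ ⊢ con 48 :≤ con 100 :* R
    Rs-arith = cert 6249 ((6169 , []) ∷ (625000 , 0 ∷ []) ∷ (625 , 1 ∷ []) ∷ (625000 , 2 ∷ []) ∷ (1250 , 3 ∷ 7 ∷ []) ∷ (313125 , 4 ∷ []) ∷ (634 , 5 ∷ []) ∷ (1000 , 5 ∷ 6 ∷ []) ∷ []) refl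

    dominated-small : Certificate 8 λ y q W R u s x g →
      con 300 :* (y :* y :* (q :* W)) :≤ R :* (con 500 :+ con 500 :* u :+ con 7 :* u :^ 2) ⇒ con 1 :≤ con 2 :* (s :* y) ⇒
      con 991 :≤ con 1000 :* q ⇒ u :≤ con 70 ⇒ con 0 :≤ u ⇒ con 0 :≤ R ⇒ con 0 :≤ y ⇒ u :≤ x :* y ⇒ s :+ x :≤ g ⇒
      ⊢ y :* q :* (con 29 :* (y :* W)) :≤ y :* q :* (con 100 :* (g :* R))
    dominated-small = cert 299 ((29 , 0 ∷ []) ∷ (15 , 1 ∷ 5 ∷ 2 ∷ []) ∷ (14865 , 1 ∷ 5 ∷ []) ∷ (15 , 2 ∷ 5 ∷ []) ∷ (30 , 2 ∷ 5 ∷ 4 ∷ []) ∷ (203 , 3 ∷ 4 ∷ 5 ∷ []) ∷ (1020 , 4 ∷ 5 ∷ []) ∷ (365 , 5 ∷ []) ∷ (30 , 7 ∷ 5 ∷ 2 ∷ []) ∷ (29730 , 7 ∷ 5 ∷ []) ∷ (30 , 8 ∷ 5 ∷ 6 ∷ 2 ∷ []) ∷ (29730 , 8 ∷ 5 ∷ 6 ∷ []) ∷ []) refl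

    small-case : Certificate 6 λ R S W g y p →
      con 29 :* (y :* W) :≤ con 100 :* (g :* R) ⇒ con 0 :≤ S ⇒ con 0 :≤ y :* (S :* W) :* p ⇒
      ⊢ con 0 :≤ con 4900 :* (con 100 :* (g :* (S :* R)) :- con 29 :* (y :* (S :* W))) :+ con 29 :* (y :* (S :* W) :* p)
    small-case = cert 0 ((4900 , 0 ∷ 1 ∷ []) ∷ (29 , 2 ∷ []) ∷ []) refl

    large-case : Certificate 6 λ R S W g y u →
      con 70 :≤ u ⇒ con 0 :≤ y :* (S :* W) ⇒ con 0 :≤ g :* (S :* R) ⇒
      ⊢ con 0 :≤ con 4900 :* (con 100 :* (g :* (S :* R)) :- con 29 :* (y :* (S :* W))) :+ con 29 :* (y :* (S :* W) :* u :^ 2)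
    large-case = cert 0 ((4060 , 0 ∷ 1 ∷ []) ∷ (29 , 0 ∷ 0 ∷ 1 ∷ []) ∷ (490000 , 2 ∷ []) ∷ []) refl

    abs-upper : Certificate 4 λ k e E x →
      con 0 :≤ k :+ e ⇒ con 0 :≤ e ⇒ x :≤ E ⇒ con 0 :- E :≤ x ⇒ ⊢ k :* x :≤ (k :+ con 2 :* e) :* E
    abs-upper = cert 0 ((1 , 0 ∷ 2 ∷ []) ∷ (1 , 1 ∷ 3 ∷ []) ∷ []) refl

    abs-lower : Certificate 4 λ k e E x →
      con 0 :≤ k :+ e ⇒ con 0 :≤ e ⇒ x :≤ E ⇒ con 0 :- E :≤ x ⇒ ⊢ con 0 :- (k :+ con 2 :* e) :* E :≤ k :* x
    abs-lower = cert 0 ((1 , 0 ∷ 3 ∷ []) ∷ (1 , 1 ∷ 2 ∷ []) ∷ []) refl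

    fifth-growth : Certificate 2 λ u y →
      con 0 :≤ y ⇒ y :≤ u ⇒ ⊢ u :^ 5 :≤ y :^ 5 :+ con 5 :* (u :^ 4 :* (u :- y))
    fifth-growth = cert 0 ((4 , 1 ∷ 1 ∷ 1 ∷ 1 ∷ 1 ∷ []) ∷ (15 , 0 ∷ 1 ∷ 1 ∷ 1 ∷ 1 ∷ []) ∷ (20 , 0 ∷ 0 ∷ 1 ∷ 1 ∷ 1 ∷ []) ∷ (10 , 0 ∷ 0 ∷ 0 ∷ 1 ∷ 1 ∷ []) ∷ []) refl

    fifth-cube : Certificate 3 λ u y x →
      u :^ 5 :≤ y :^ 5 :+ con 5 :* (u :^ 4 :* (u :- y)) ⇒ con 50 :* (u :- y) :≤ con 19 :* (x :* u :^ 3) ⇒ con 0 :≤ u :^ 4 ⇒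
      ⊢ con 10 :* u :^ 5 :≤ con 10 :* y :^ 5 :+ con 19 :* (x :* u :^ 7)
    fifth-cube = cert 0 ((10 , 0 ∷ []) ∷ (1 , 1 ∷ 2 ∷ []) ∷ []) refl

    deviation-high : Certificate 7 λ u y a b c j x →
      u :+ a :≤ con 1 ⇒ con 1 :≤ y :+ b ⇒ con 50 :* (b :- a) :≤ j :* c ⇒ j :≤ x ⇒ con 0 :≤ c ⇒ ⊢ con 50 :* (u :- y) :≤ x :* c
    deviation-high = cert 0 ((50 , 0 ∷ []) ∷ (50 , 1 ∷ []) ∷ (1 , 2 ∷ []) ∷ (1 , 3 ∷ 4 ∷ []) ∷ []) refl

    deviation-low : Certificate 3 λ u y x →
      u :≤ con 2 ⇒ con 2 :≤ u ⇒ con 1 :≤ x ⇒ con 0 :≤ y ⇒ ⊢ con 50 :* (u :- y) :≤ x :* (con 19 :* con 2 :^ 3)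
    deviation-low = cert 0 ((52 , []) ∷ (50 , 0 ∷ []) ∷ (152 , 2 ∷ []) ∷ (50 , 3 ∷ []) ∷ []) refl

    P-low : Certificate 4 λ y v K P →
      y :^ 5 :* K :≤ P ⇒ con 305 :≤ con 100 :* (v :^ 3 :* K) ⇒ con 500 :* v :≤ con 501 :* y ⇒ con 0 :≤ v ⇒ con 0 :≤ y ⇒
      con 0 :≤ v :^ 3 ⇒ con 0 :≤ y :^ 3 ⇒ ⊢ v :^ 2 :* (con 303 :* y :^ 3) :≤ v :^ 2 :* (con 100 :* (v :* P))
    P-low = cert 249999 ((25000000 , 0 ∷ 5 ∷ []) ∷ (250000 , 1 ∷ 4 ∷ 4 ∷ 4 ∷ 4 ∷ 4 ∷ []) ∷ (303 , 2 ∷ 2 ∷ 6 ∷ []) ∷ (303000 , 2 ∷ 6 ∷ 3 ∷ []) ∷ (196697 , 4 ∷ 4 ∷ 4 ∷ 4 ∷ 4 ∷ []) ∷ []) refl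

    v-cube : Certificate 2 λ v y →
      (con 500 :* v) :^ 3 :≤ (con 501 :* y) :^ 3 ⇒ con 0 :≤ y :^ 3 ⇒ ⊢ con 1000 :* v :^ 3 :≤ con 1007 :* y :^ 3
    v-cube = cert 124999 ((1 , 0 ∷ []) ∷ (123499 , 1 ∷ []) ∷ []) refl

    M-high : Certificate 4 λ v M m y →
      con 3 :* M :≤ v :^ 5 :* m ⇒ con 10000 :* (v :^ 5 :* m) :≤ con 511178 ⇒ con 1000 :* v :^ 3 :≤ con 1007 :* y :^ 3 ⇒
      con 0 :≤ v :^ 3 ⇒ con 0 :≤ y :^ 3 ⇒ ⊢ con 100 :* (v :^ 3 :* M) :≤ con 1716 :* y :^ 3
    M-high = cert 149999 ((5000000 , 0 ∷ 3 ∷ []) ∷ (500 , 1 ∷ 3 ∷ []) ∷ (255589 , 2 ∷ []) ∷ (21877 , 4 ∷ []) ∷ []) refl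

    V-high : Certificate 3 λ v V y →
      con 100 :* V :≤ con 177 :* v :^ 2 ⇒ con 1000 :* v :^ 3 :≤ con 1007 :* y :^ 3 ⇒ con 0 :≤ v ⇒ con 0 :≤ y :^ 3 ⇒
      ⊢ con 100 :* (v :* V) :≤ con 179 :* y :^ 3
    V-high = cert 999 ((1000 , 0 ∷ 2 ∷ []) ∷ (177 , 1 ∷ []) ∷ (761 , 3 ∷ []) ∷ []) refl

    S-high : Certificate 4 λ S y m t →
      con 10 :* S :≤ con 10 :* (y :^ 5 :* t) :+ con 19 :* (y :^ 7 :* m) ⇒ con 10000 :* (y :^ 3 :* m) :≤ con 38204 ⇒
      con 1000 :* y :≤ con 9 ⇒ con 0 :≤ y ⇒ con 0 :≤ y :^ 3 ⇒ con 0 :≤ y :^ 4 ⇒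
      ⊢ con 6370000 :* S :≤ con 6370000 :* (y :^ 5 :* t) :+ con 416500 :* y :^ 3
    S-high = cert 2499 ((1592500000 , 0 ∷ []) ∷ (3025750 , 1 ∷ 5 ∷ []) ∷ (115595753 , 2 ∷ 4 ∷ []) ∷ (888223 , 4 ∷ []) ∷ []) refl

    -- In units of 10⁴ y³: 184.73 · 3.03 - 0.0754 · 17.16 - 71.05 · 1.79 ≈ 431, and 0.48 of this
    -- just exceeds 207.
    bracket : Certificate 5 λ R P M V y →
      con 303 :* y :^ 3 :≤ con 100 :* P ⇒ con 100 :* M :≤ con 1716 :* y :^ 3 ⇒ con 100 :* V :≤ con 179 :* y :^ 3 ⇒
      con 48 :≤ con 100 :* R ⇒ con 0 :≤ R ⇒ con 0 :≤ y :^ 3 ⇒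
      ⊢ R :* (con 754 :* M :- con 1847300 :* P :+ con 710500 :* V) :≤ con 0 :- con 2070000 :* y :^ 3
    bracket = cert 1249 ((23091250 , 0 ∷ 4 ∷ []) ∷ (9425 , 1 ∷ 4 ∷ []) ∷ (8881250 , 2 ∷ 4 ∷ []) ∷ (53907317 , 3 ∷ 5 ∷ []) ∷ (51216 , 5 ∷ []) ∷ []) refl

    Σε-arith : Certificate 9 λ E R v V S B P y t →
      con 24500 :* (con 100 :* E :- con 29 :* (v :* (R :* V))) :≤ con 6370000 :* S :+ R :* (con 754 :* B :- con 1847300 :* P) ⇒
      con 6370000 :* S :≤ con 6370000 :* (y :^ 5 :* t) :+ con 416500 :* y :^ 3 ⇒
      R :* (con 754 :* B :- con 1847300 :* P :+ con 710500 :* (v :* V)) :≤ con 0 :- con 2070000 :* y :^ 3 ⇒ con 0 :≤ y :^ 3 ⇒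
      ⊢ con 245 :* E :≤ con 637 :* (y :^ 5 :* t) :- con 165 :* y :^ 3
    Σε-arith = cert 9999 ((1 , 0 ∷ []) ∷ (1 , 1 ∷ []) ∷ (1 , 2 ∷ []) ∷ (3500 , 3 ∷ []) ∷ []) refl

    flip-low : Certificate 5 λ E R v V c →
      con 0 :- c :≤ con 24500 :* (con 100 :* E :- con 29 :* (v :* (R :* V))) ⇒
      ⊢ con 24500 :* (con 100 :* (con 0 :- E) :- con 29 :* (v :* (R :* (con 0 :- V)))) :≤ c
    flip-low = cert 0 ((1 , 0 ∷ []) ∷ []) refl

    flip-V : Certificate 2 λ V c →
      con 0 :- c :≤ con 100 :* V ⇒ ⊢ con 100 :* (con 0 :- V) :≤ c
    flip-V = cert 0 ((1 , 0 ∷ []) ∷ []) refl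

    unflip-E : Certificate 2 λ E c →
      con 245 :* (con 0 :- E) :≤ c ⇒ ⊢ con 0 :- c :≤ con 245 :* E
    unflip-E = cert 0 ((1 , 0 ∷ []) ∷ []) refl

    contract : Certificate 6 λ p e n S T y →
      p :* (e :* n :- S) :+ T :≤ p :* e ⇒ con 245 :* S :≤ con 637 :* (y :^ 5 :* n) :- con 165 :* y :^ 3 ⇒
      con 0 :- (con 181700 :* e :+ con 5185600 :* y :^ 4) :≤ con 125000 :* T ⇒ con 98 :≤ con 100 :* p ⇒ con 0 :≤ p ⇒ con 0 :≤ e ⇒
      con 0 :≤ y :^ 3 ⇒ con 1000 :* y :≤ con 9 ⇒
      ⊢ p :* (con 1000 :* (e :* n)) :≤ p :* (con 2500 :* e :+ con 2600 :* (y :^ 5 :* n) :- con 290 :* y :^ 3)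
    contract = cert 61249 ((61250000 , 0 ∷ []) ∷ (250000 , 1 ∷ 4 ∷ []) ∷ (490 , 2 ∷ []) ∷ (918750 , 3 ∷ 5 ∷ []) ∷ (234875 , 3 ∷ 6 ∷ []) ∷ (2540944 , 7 ∷ 6 ∷ []) ∷ (1004500 , 5 ∷ []) ∷ (149254 , 6 ∷ []) ∷ []) refl

    contract-last : Certificate 5 λ e n c b y →
      con 1000 :* (e :* n) :≤ con 2500 :* e :+ con 2600 :* (y :^ 5 :* n) :- con 290 :* y :^ 3 ⇒ con 3 :* (y :* y :* (b :* c)) :≤ con 5 ⇒
      con 991 :≤ con 1000 :* b ⇒ n :≤ c :+ con 1 ⇒ con 1000 :* y :≤ con 9 ⇒ con 0 :≤ y ⇒ con 0 :≤ y :^ 3 ⇒ con 0 :≤ c ⇒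
      con 0 :≤ y :^ 5 ⇒ ⊢ (con 2 :* n :- con 5) :* (con 2 :* e) :≤ (con 2 :* n :- con 5) :* (con 5 :* y :^ 5)
    contract-last = cert 14864999999 ((59460000 , 0 ∷ []) ∷ (2000000000 , 1 ∷ 6 ∷ []) ∷ (6000000 , 2 ∷ 7 ∷ 8 ∷ []) ∷ (5946000000 , 3 ∷ 8 ∷ []) ∷ (755142000 , 4 ∷ 5 ∷ 6 ∷ []) ∷ (377571 , 4 ∷ 4 ∷ 6 ∷ []) ∷ (7212816749 , 6 ∷ []) ∷ []) refl

    p-large : Certificate 3 λ a b y →
      con 0 :- con 1600 :* y :^ 2 :≤ con 1000 :* (a :- b) ⇒ con 991 :≤ con 1000 :* b ⇒ con 1000 :* y :≤ con 9 ⇒ con 0 :≤ y ⇒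
      ⊢ con 98 :≤ con 100 :* (a :* b)
    p-large = cert 6249999 ((1220354 , []) ∷ (625 , 0 ∷ 1 ∷ []) ∷ (619375 , 0 ∷ []) ∷ (1238669 , 1 ∷ []) ∷ (625 , 1 ∷ 1 ∷ []) ∷ (1982000 , 2 ∷ 3 ∷ []) ∷ (991 , 2 ∷ 2 ∷ []) ∷ (2000 , 1 ∷ 2 ∷ 3 ∷ []) ∷ (1 , 1 ∷ 2 ∷ 2 ∷ []) ∷ []) refl

    n-large : Certificate 3 λ y c n →
      con 157 :≤ con 100 :* (y :^ 2 :* c) ⇒ con 1000 :* y :≤ con 9 ⇒ con 0 :≤ y ⇒ c :≤ n ⇒ con 0 :≤ c ⇒ ⊢ con 1 :≤ con 2 :* n :- con 5
    n-large = cert 784999 ((30000 , 0 ∷ []) ∷ (6000 , 1 ∷ 2 ∷ 4 ∷ []) ∷ (3 , 1 ∷ 1 ∷ 4 ∷ []) ∷ (1570000 , 3 ∷ []) ∷ (1569757 , 4 ∷ []) ∷ []) refl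

    negated : Certificate 5 λ p m n S T →
      p :* ((con 0 :- m) :* n :- S) :+ T :≤ p :* (con 0 :- m) ⇒ p :* (con 0 :- m) :≤ p :* ((con 0 :- m) :* n :- S) :+ T ⇒
      ⊢ p :* (m :* n :- (con 0 :- S)) :+ (con 0 :- T) :≤ p :* m
    negated = cert 0 ((1 , 1 ∷ []) ∷ []) refl

    negated-high : Certificate 2 λ S c →
      con 0 :- c :≤ con 245 :* S ⇒ ⊢ con 245 :* (con 0 :- S) :≤ c
    negated-high = cert 0 ((1 , 0 ∷ []) ∷ []) refl

    negated-low : Certificate 2 λ T c →
      con 125000 :* T :≤ c ⇒ ⊢ con 0 :- c :≤ con 125000 :* (con 0 :- T)
    negated-low = cert 0 ((1 , 0 ∷ []) ∷ []) refl

    neg-nonneg : Certificate 1 λ x →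
      x :≤ con 0 ⇒ ⊢ con 0 :≤ con 0 :- x
    neg-nonneg = cert 0 ((1 , 0 ∷ []) ∷ []) refl

    e-low : Certificate 3 λ x e b →
      con 0 :- e :≤ x ⇒ con 2 :* e :≤ con 5 :* b ⇒ ⊢ con 0 :- con 5 :* b :≤ con 2 :* x
    e-low = cert 0 ((2 , 0 ∷ []) ∷ (1 , 1 ∷ []) ∷ []) refl

    e-upp : Certificate 3 λ x e b →
      x :≤ e ⇒ con 2 :* e :≤ con 5 :* b ⇒ ⊢ con 2 :* x :≤ con 5 :* b
    e-upp = cert 0 ((2 , 0 ∷ []) ∷ (1 , 1 ∷ []) ∷ []) refl

    δ-grow-low : Certificate 3 λ d p y →
      con 2487 :* y :^ 3 :≤ con 10000 :* p ⇒ con 0 :- con 5 :* y :^ 5 :≤ con 2 :* (d :- p) ⇒ con 1000 :* y :≤ con 9 ⇒ con 0 :≤ y ⇒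
      con 0 :≤ y :^ 3 ⇒ ⊢ con 0 :≤ d
    δ-grow-low = cert 399999 ((40 , 0 ∷ []) ∷ (200000 , 1 ∷ []) ∷ (1000 , 2 ∷ 3 ∷ 4 ∷ []) ∷ (9 , 2 ∷ 4 ∷ []) ∷ (99399 , 4 ∷ []) ∷ []) refl

    δ-grow-high : Certificate 3 λ d p y →
      con 1000 :* p :≤ con 374 :* y :^ 3 ⇒ con 2 :* (d :- p) :≤ con 5 :* y :^ 5 ⇒ con 1000 :* y :≤ con 9 ⇒ con 0 :≤ y ⇒
      con 0 :≤ y :^ 3 ⇒ ⊢ con 1000 :* d :≤ con 375 :* y :^ 3
    δ-grow-high = cert 399 ((400 , 0 ∷ []) ∷ (200000 , 1 ∷ []) ∷ (2000 , 2 ∷ 3 ∷ 4 ∷ []) ∷ (1 , 2 ∷ 2 ∷ 4 ∷ []) ∷ (319 , 4 ∷ []) ∷ []) refl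

    z-fall : Certificate 4 λ u y a b →
      u :+ a :≤ con 1 ⇒ con 1 :≤ y :+ b ⇒ con 0 :≤ a :- b ⇒ ⊢ u :≤ y
    z-fall = cert 0 ((1 , 0 ∷ []) ∷ (1 , 1 ∷ []) ∷ (1 , 2 ∷ []) ∷ []) refl

    z-near : Certificate 4 λ u y a b →
      con 1 :≤ u :+ a ⇒ y :+ b :≤ con 1 ⇒ con 1000 :* (a :- b) :≤ con 375 :* y :^ 3 ⇒ con 1000 :* y :≤ con 9 ⇒ con 0 :≤ y ⇒
      ⊢ con 9999 :* y :≤ con 10000 :* u
    z-near = cert 799 ((8000000 , 0 ∷ []) ∷ (8000000 , 1 ∷ []) ∷ (8000 , 2 ∷ []) ∷ (3000 , 3 ∷ 4 ∷ 4 ∷ []) ∷ (27 , 3 ∷ 4 ∷ []) ∷ (557 , 4 ∷ []) ∷ []) refl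

    -- Going from y = z N to z(N+1) costs so little that 0.375 and 2.5, proved in terms of y, imply
    -- the 0.38 and 2.6 of the hypothesis.
    cube-near : Certificate 2 λ u y →
      (con 9999 :* y) :^ 3 :≤ (con 10000 :* u) :^ 3 ⇒ con 0 :≤ y :^ 3 ⇒ ⊢ con 9996 :* y :^ 3 :≤ con 10000 :* u :^ 3
    cube-near = cert 99999999 ((1 , 0 ∷ []) ∷ (100029999 , 1 ∷ []) ∷ []) refl

    fifth-near : Certificate 2 λ u y →
      (con 9999 :* y) :^ 5 :≤ (con 10000 :* u) :^ 5 ⇒ con 0 :≤ y :^ 5 ⇒ ⊢ con 9994 :* y :^ 5 :≤ con 10000 :* u :^ 5
    fifth-near = cert 9999999999999999 ((1 , 0 ∷ []) ∷ (10009999000049999 , 1 ∷ []) ∷ []) refl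

    δ-here-high : Certificate 3 λ d u y →
      con 1000 :* d :≤ con 375 :* y :^ 3 ⇒ con 9996 :* y :^ 3 :≤ con 10000 :* u :^ 3 ⇒ con 0 :≤ y :^ 3 ⇒
      ⊢ con 50 :* d :≤ con 19 :* u :^ 3
    δ-here-high = cert 9999 ((500 , 0 ∷ []) ∷ (19 , 1 ∷ []) ∷ (2424 , 2 ∷ []) ∷ []) refl

    δ-here-low : Certificate 2 λ d c →
      con 0 :≤ d ⇒ con 0 :≤ c ⇒ ⊢ con 0 :- con 19 :* c :≤ con 50 :* d
    δ-here-low = cert 0 ((50 , 0 ∷ []) ∷ (19 , 1 ∷ []) ∷ []) refl

    ε-here-high : Certificate 3 λ x u y →
      con 2 :* x :≤ con 5 :* y :^ 5 ⇒ con 9994 :* y :^ 5 :≤ con 10000 :* u :^ 5 ⇒ con 0 :≤ y :^ 5 ⇒ ⊢ con 5 :* x :≤ con 13 :* u :^ 5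
    ε-here-high = cert 9999 ((25000 , 0 ∷ []) ∷ (13 , 1 ∷ []) ∷ (4922 , 2 ∷ []) ∷ []) refl

    ε-here-low : Certificate 3 λ x u y →
      con 0 :- con 5 :* y :^ 5 :≤ con 2 :* x ⇒ con 9994 :* y :^ 5 :≤ con 10000 :* u :^ 5 ⇒ con 0 :≤ y :^ 5 ⇒
      ⊢ con 0 :- con 13 :* u :^ 5 :≤ con 5 :* x
    ε-here-low = cert 9999 ((25000 , 0 ∷ []) ∷ (13 , 1 ∷ []) ∷ (4922 , 2 ∷ []) ∷ []) refl

    relax : Certificate 2 λ p c →
      con 1000 :* p :≤ con 374 :* c ⇒ con 0 :≤ c ⇒ ⊢ con 1000 :* p :≤ con 375 :* c
    relax = cert 0 ((1 , 0 ∷ []) ∷ (1 , 1 ∷ []) ∷ []) refl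

    turan-lower : Certificate 4 λ y u d g →
      con 2487 :* y :^ 3 :≤ con 10000 :* d ⇒ con 2487 :* u :^ 3 :≤ con 10000 :* g ⇒ u :^ 3 :≤ y :^ 3 ⇒ con 0 :≤ d ⇒ con 0 :≤ u :^ 3 ⇒
      con 0 :≤ g ⇒ ⊢ con 2487 :* con 2487 :* con 2487 :* u :^ 9 :≤ con 10000 :* con 10000 :* con 10000 :* (d :* g :^ 2)
    turan-lower = cert 0 ((6185169 , 0 ∷ 4 ∷ 4 ∷ []) ∷ (15382515303 , 2 ∷ 4 ∷ 4 ∷ []) ∷ (24870000 , 1 ∷ 3 ∷ 4 ∷ []) ∷ (100000000 , 1 ∷ 3 ∷ 5 ∷ []) ∷ []) refl

    square-upper : Certificate 2 λ x b →
      x :≤ b ⇒ con 0 :- b :≤ x ⇒ ⊢ x :^ 2 :≤ b :^ 2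
    square-upper = cert 0 ((1 , 0 ∷ 1 ∷ []) ∷ []) refl

    turan-upper : Certificate 3 λ e u p →
      (con 5 :* e) :^ 2 :≤ (con 13 :* u :^ 5) :^ 2 ⇒ con 0 :≤ p ⇒ p :≤ con 1 ⇒ con 0 :≤ u :^ 9 ⇒ con 1000 :* u :≤ con 9 ⇒
      ⊢ con 25000 :* (e :^ 2 :* p) :≤ con 1521 :* u :^ 9
    turan-upper = cert 0 ((1000 , 0 ∷ 1 ∷ []) ∷ (1521 , 2 ∷ 3 ∷ []) ∷ (169 , 1 ∷ 3 ∷ 4 ∷ []) ∷ []) refl

    turan-gap : Certificate 5 λ u d g e p →
      con 2487 :* con 2487 :* con 2487 :* u :^ 9 :≤ con 10000 :* con 10000 :* con 10000 :* (d :* g :^ 2) ⇒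
      con 25000 :* (e :^ 2 :* p) :≤ con 1521 :* u :^ 9 ⇒ con 0 :≤ u :^ 9 ⇒
      ⊢ con 6 :* u :^ 9 :≤ con 10000 :* (con 4 :* (d :* g :^ 2) :- e :^ 2 :* p)
    turan-gap = cert 24999999 ((1 , 0 ∷ []) ∷ (10000000 , 1 ∷ []) ∷ (22515303 , 2 ∷ []) ∷ []) refl

    -- The analytic data and the induction hypothesis

    record RenewalData : Set where
      field
        σ : ℕ → ℕ
        ρ w : ℕ → A
        ρ-zero : ρ 0 ≡ # 0
        ρ-nonneg : ∀ m → # 0 ≤ ρ m
        ρ≤1 : ∀ m → ρ m ≤ # 1

      open Products ρ ρ-zero ρ-nonneg ρ≤1 public

      -- z m is 1 - ρ m from m₀ on and the trivial value 2 below m₀. It is built from w = z / 25 because the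
      -- comparison of R n k with z(n - k)⁹ uses powers of the rate 1 - 24 w n, slightly larger than ρ n.
      z : ℕ → A
      z m = # 25 * w m

      field
        σ-zero : σ 0 ≡ 0
        σ-≥ : ∀ k → k ℕ.≤ σ k
        hi : ∀ j → # 6 * sum (suc j) (λ k → # (σ k)) ≤ # 5 * (# j * # j + # j)
        lo : ∀ j → # 81 * (# j * # j) ≤ # 100 * sum (suc j) (λ k → # (σ k))
        renewal : ∀ n → sum (suc n) (λ k → # (σ k) * R n k) ≡ # n
        w-pos : ∀ m → Pos (w m)
        m₀ M₀ N₁ : ℕ
        2≤m₀ : 2 ℕ.≤ m₀
        m₀≤M₀ : m₀ ℕ.≤ M₀
        M₀≤N₁ : M₀ ℕ.≤ N₁
        z-high : ∀ m → m₀ ℕ.≤ m → z m + ρ m ≡ # 1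
        z-low : ∀ m → m ℕ.< m₀ → z m ≡ # 2
        z-m₀ : # 100 * z m₀ ≤ # 7
        z-N₁ : # 1000 * z N₁ ≤ # 9
        low-cap : ∀ m → 2 ℕ.≤ m → m ℕ.≤ m₀ → # 1000 * ρ m ≤ # 991
        h : A
        h-value : # 1000 * h ≡ # 991
        -- 512 is 2⁹, the ninth power of the value of `z` below `m₀`.
        jump : ∀ j → M₀ ∸ j ℕ.< m₀ → R M₀ j * # 512 ≤ z M₀ ^ 9 * h ^ M₀

    module Inputs (I : RenewalData) where

      open RenewalData I
      open Renewal σ renewal public
      open Bounds σ σ-zero hi lo public

      -- Here |δ| ≤ 0.38 z³ and |ε| ≤ 2.6 z⁵. In `δ-prev` the previous δ is bounded by `z m` rather
      -- than by the larger z(m-1), so that increments of ρ ending at n and at n - 1 share one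
      -- bound.
      record Local (m : ℕ) : Set where
        field
          z-dec  : z m ≤ z (m ∸ 1)
          δ-here : Within (# 19 * z m ^ 3) (# 50 * δ m)
          δ-prev : Within (# 19 * z m ^ 3) (# 50 * δ (m ∸ 1))
          ε-here : Within (# 13 * z m ^ 5) (# 5 * ε m)

      Good : ℕ → Set
      Good n = ∀ m → m ℕ.≤ n → Local m

      z-pos : ∀ m → Pos (z m)
      z-pos m = Pos-* (#Pos 24) (w-pos m)

      z-nonneg : ∀ m → # 0 ≤ z m
      z-nonneg m = pos⇒0≤ (z-pos m)

      z-anti : ∀ {n} → Good n → ∀ {i j} → i ℕ.≤ j → j ℕ.≤ n → z j ≤ z i
      z-anti good {i} {zero} ℕ.z≤n _ = ≤-refl
      z-anti good {i} {suc j} h l with ℕₚ.m≤n⇒m<n∨m≡n h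
      ... | inj₂ refl = ≤-refl
      ... | inj₁ (ℕ.s≤s i≤j) = ≤-trans (Local.z-dec (good (suc j) l)) (z-anti good i≤j (ℕₚ.≤-trans (ℕₚ.n≤1+n j) l))

      -- v⁹ ≤ u⁹ (1 + 3.5 u²) and q ≤ 1 - u. The loss 3.5 u² is absorbed because r = 1 - 0.96 y
      -- stays above 1 - y by four percent of y, for y ≤ u ≤ 0.07 and y ≤ 0.009. Nine is the highest
      -- power of z in `envelope`.
      growth : ∀ {u v d q r y} → # 0 ≤ u → # 0 ≤ v → # 0 ≤ q → # 100 * u ≤ # 7 → # 50 * d ≤ # 19 * u ^ 3 → v - u ≤ d → q ≤ # 1 - u →
        # 0 ≤ y → y ≤ u → # 1000 * y ≤ # 9 → # 25 * r + # 24 * y ≡ # 25 → q * v ^ 9 ≤ r * u ^ 9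
      growth {u} {v} {d} {q} {r} {y} 0u 0v 0q us ds vu qu 0y yu ys rr =
        use ratio-combine second qu 0q (use ratio-final 0y yu us ys (reflexive rr) (reflexive (sym rr))) (^0≤ 9 0u) (+0≤ (#0≤ 2) (*0≤ (#0≤ 7) (^0≤ 2 0u)))
        where
        first : # 100 * v ^ 3 ≤ u ^ 3 * (# 100 + # 116 * u ^ 2)
        first = use ratio-cancel {v} {u} {# 50 + # 19 * u ^ 2} (^-mono 3 (*0≤ (#0≤ 50) 0v) (use ratio-arith ds vu)) (use ratio-cube 0u us)
        second : # 2 * v ^ 9 ≤ u ^ 9 * (# 2 + # 7 * u ^ 2)
        second = use ratio-cancel2 {v} {u} {u} (^-mono 3 (*0≤ (#0≤ 100) (^0≤ 3 0v)) first) (*-monoʳ (^0≤ 9 0u) (use ratio-ninth 0u us))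

      -- Moments, δ, and the linear relation for ε at an index where the hypothesis holds

      module At (n : ℕ) (N₁≤n : N₁ ℕ.≤ n) (good : Good n) where

        y q r t : A
        y = z n
        q = ρ n
        t = # 24 * w n
        r = # 1 - t

        m₀≤n : m₀ ℕ.≤ n
        m₀≤n = ℕₚ.≤-trans m₀≤M₀ (ℕₚ.≤-trans M₀≤N₁ N₁≤n)

        y-small : # 1000 * y ≤ # 9
        y-small = ≤-trans (*-monoʳ (#0≤ 1000) (z-anti good N₁≤n ℕₚ.≤-refl)) z-N₁

        y-nonneg : # 0 ≤ y
        y-nonneg = z-nonneg n

        q+y : y + q ≡ # 1
        q+y = z-high n m₀≤n

        r+t : r + t ≡ # 1
        r+t = ring (t ∷ []) (con 1 :- var 0 :+ var 0) (con 1) refl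

        25r : # 25 * r + # 24 * y ≡ # 25
        25r = ring (w n ∷ []) (con 25 :* (con 1 :- con 24 :* var 0) :+ con 24 :* (con 25 :* var 0)) (con 25) refl

        0≤t : # 0 ≤ t
        0≤t = *0≤ (#0≤ 24) (pos⇒0≤ (w-pos n))

        h≤r : h ≤ r
        h≤r = use h≤r-arith (reflexive h-value) (reflexive (sym 25r)) y-small y-nonneg

        0≤h : # 0 ≤ h
        0≤h = use 0≤h-arith (reflexive (sym h-value))

        0≤r : # 0 ≤ r
        0≤r = ≤-trans 0≤h h≤r

        -- Up to `m₀` the tested cap 0.991 lies below q ≥ 0.991; from there on z decreases, so ρ
        -- increases.
        ρ≤q : ∀ j → 2 ℕ.≤ j → j ℕ.≤ n → ρ j ≤ q
        ρ≤q j 2≤j j≤n with ℕₚ.≤-total j m₀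
        ... | inj₁ j≤m₀ = use cancel-1000 (low-cap j 2≤j j≤m₀) (use q-large (reflexive (sym q+y)) y-small)
        ... | inj₂ m₀≤j = use compare-high (z-anti good j≤n ℕₚ.≤-refl)
                (use as-difference (reflexive (z-high j m₀≤j))) (use as-difference′ (reflexive (sym q+y)))

        0≤q : # 0 ≤ q
        0≤q = ρ-nonneg n

        R≤q^ : ∀ m l → m ℕ.≤ n → l ℕ.< m → R m l ≤ q ^ l
        R≤q^ m zero _ _ = reflexive #-1
        R≤q^ m (suc l) m≤n l<m = ≤≡ (*-mono (ρ-nonneg (m ∸ l)) (^0≤ l 0≤q) (R≤q^ m l m≤n (ℕₚ.<-trans (ℕₚ.n<1+n l) l<m))
            (ρ≤q (m ∸ l) (ℕₚ.≤-trans (ℕₚ.≤-reflexive (sym (ℕₚ.m+n∸n≡m 2 l))) (ℕₚ.∸-monoˡ-≤ l l<m)) (ℕₚ.≤-trans (ℕₚ.m∸n≤m m l) m≤n)))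
          (*-comm _ _)

        -- The factor q absorbs ρ 1 = 1, the only value of ρ exceeding q.
        qR≤q^ : ∀ m l → m ℕ.≤ n → q * R m l ≤ q ^ l
        qR≤q^ m l m≤n with ℕₚ.<-cmp l m
        ... | tri< l<m _ _ = ≤-trans (*-monoʳ 0≤q (R≤q^ m l m≤n l<m)) (≤≡ (*-monoˡ (^0≤ l 0≤q) (ρ≤1 n)) (one-* _))
        ... | tri> _ _ m<l = ≡≤ (trans (cong (q *_) (R-end m l m<l)) (*-zero q)) (^0≤ l 0≤q)
        qR≤q^ zero zero m≤n | tri≈ _ refl _ = ≤≡ (≡≤ (*-one q) (ρ≤1 n)) #-1
        qR≤q^ (suc m) (suc .m) m≤n | tri≈ _ refl _ = *-monoʳ 0≤q (≤-trans (R-dec (suc m) m) (R≤q^ (suc m) m m≤n ℕₚ.≤-refl))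

        open Rates r t 0≤r 0≤t r+t public
        open Masses σ σ-zero hi lo public

        z-step : ∀ m → m₀ ℕ.< m → m ℕ.≤ n → ρ m * z (m ∸ 1) ^ 9 ≤ r * z m ^ 9
        z-step (suc m) (ℕ.s≤s m₀≤m) m≤n = growth (z-nonneg (suc m)) (z-nonneg m) (ρ-nonneg (suc m))
          (≤-trans (*-monoʳ (#0≤ 100) (z-anti good (ℕₚ.m≤n⇒m≤1+n m₀≤m) m≤n)) z-m₀)
          (upp (Local.δ-here (good (suc m) m≤n)))
          (use exchange (reflexive (z-high m m₀≤m)) (reflexive (sym (z-high (suc m) (ℕₚ.m≤n⇒m≤1+n m₀≤m)))))
          (use as-difference (reflexive (z-high (suc m) (ℕₚ.m≤n⇒m≤1+n m₀≤m))))
          y-nonneg (z-anti good m≤n ℕₚ.≤-refl) y-small 25r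

        -- Looking back from n, z⁹ grows while R decays. Each step satisfies `z-step`, so the growth
        -- is paid for by using the rate r instead of q.
        Ω-high : ∀ k → m₀ ℕ.≤ n ∸ k → R n k * z (n ∸ k) ^ 9 ≤ y ^ 9 * r ^ k
        Ω-high zero _ = reflexive (trans (one-* _) (sym (trans (cong (y ^ 9 *_) (sym #-1)) (*-one _))))
        Ω-high (suc k) le = ≤≡ (use trade {_} {_} {_} {_} {z (n ∸ k) ^ 9} (Ω-high k (ℕₚ.≤-trans le (ℕₚ.∸-monoʳ-≤ n (ℕₚ.n≤1+n k)))) (R-nonneg n k) 0≤r
            (≡≤ (cong (λ v → ρ (n ∸ k) * z v ^ 9) (pred-∸ n k)) (z-step (n ∸ k) (above n k le) (ℕₚ.m∸n≤m n k))))
          (ring (r ∷ y ^ 9 ∷ r ^ k ∷ []) (var 0 :* (var 1 :* var 2)) (var 1 :* (var 0 :* var 2)) refl)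
          where
          pred-∸ : ∀ n k → n ∸ suc k ≡ (n ∸ k) ∸ 1
          pred-∸ n k = trans (cong (n ∸_) (ℕₚ.+-comm 1 k)) (sym (ℕₚ.∸-+-assoc n k 1))
          above : ∀ n k → m₀ ℕ.≤ n ∸ suc k → m₀ ℕ.< n ∸ k
          above n k le with n ∸ k | pred-∸ n k
          ... | zero  | e = ⊥-elim (ℕₚ.<⇒≱ (ℕₚ.≤-trans (ℕ.s≤s ℕ.z≤n) 2≤m₀) (ℕₚ.≤-trans le (ℕₚ.≤-reflexive e)))
          ... | suc j | e = ℕ.s≤s (ℕₚ.≤-trans le (ℕₚ.≤-reflexive e))

        Ω-low : ∀ k → k ℕ.≤ n → n ∸ k ℕ.< m₀ → R n k * z (n ∸ k) ^ 9 ≤ y ^ 9 * r ^ k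
        Ω-low k k≤n lt = ≡≤ (trans (cong₂ (λ u v → R n u * v ^ 9) k≡ (z-low (n ∸ k) lt))
            (trans (cong (_* # 2 ^ 9) (R-split n i j)) (trans (cong (λ v → R n i * R v j * # 2 ^ 9) n∸i)
              (ring (R n i ∷ R M₀ j ∷ []) (var 0 :* var 1 :* con 2 :^ 9) (var 0 :* var 1 :* con 512) refl))))
          (≤≡ (use low-combine {_} {_} {h ^ M₀} (≡≤ (cong (λ v → R n i * z v ^ 9) (sym n∸i)) (Ω-high i (ℕₚ.≤-trans m₀≤M₀ (ℕₚ.≤-reflexive (sym n∸i)))))
               (jump j M₀∸j) (≤-trans (^-mono M₀ 0≤h h≤r) (r^-anti j≤M₀)) (R-nonneg n i) (^0≤ 9 (z-nonneg M₀)) (r^-nonneg i) (^0≤ 9 y-nonneg)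
               (^0≤ M₀ 0≤h) (r^-nonneg j))
            (cong (y ^ 9 *_) (trans (sym (^-+ r i j)) (cong (r ^_) (sym k≡)))))
          where
          M₀≤n = ℕₚ.≤-trans M₀≤N₁ N₁≤n
          i = n ∸ M₀
          j = k ∸ i
          i≤k : i ℕ.≤ k
          i≤k = ℕₚ.≤-trans (ℕₚ.∸-monoʳ-≤ n (ℕₚ.≤-trans (ℕₚ.<⇒≤ lt) m₀≤M₀)) (ℕₚ.≤-reflexive (ℕₚ.m∸[m∸n]≡n k≤n))
          k≡ : k ≡ i ℕ.+ j
          k≡ = sym (ℕₚ.m+[n∸m]≡n i≤k)
          n∸i : n ∸ i ≡ M₀
          n∸i = ℕₚ.m∸[m∸n]≡n M₀≤n
          n∸k : n ∸ k ≡ M₀ ∸ j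
          n∸k = trans (cong (n ∸_) k≡) (trans (sym (ℕₚ.∸-+-assoc n i j)) (cong (_∸ j) n∸i))
          M₀∸j : M₀ ∸ j ℕ.< m₀
          M₀∸j = ℕₚ.≤-trans (ℕₚ.≤-reflexive (cong suc (sym n∸k))) lt
          j≤M₀ : j ℕ.≤ M₀
          j≤M₀ = ℕₚ.≤-trans (ℕₚ.∸-monoˡ-≤ i k≤n) (ℕₚ.≤-reflexive n∸i)

        Ω : ∀ k → R n k * z (n ∸ k) ^ 9 ≤ y ^ 9 * r ^ k
        Ω k with ℕₚ.≤-total m₀ (n ∸ k)
        ... | inj₁ le = Ω-high k le
        ... | inj₂ le with ℕₚ.m≤n⇒m<n∨m≡n le
        ...   | inj₂ e = Ω-high k (ℕₚ.≤-reflexive (sym e))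
        ...   | inj₁ lt with ℕₚ.≤-total k n
        ...     | inj₁ k≤n = Ω-low k k≤n lt
        ...     | inj₂ n≤k with ℕₚ.m≤n⇒m<n∨m≡n n≤k
        ...       | inj₂ refl = Ω-low k ℕₚ.≤-refl lt
        ...       | inj₁ n<k = ≡≤ (trans (cong (_* z (n ∸ k) ^ 9) (R-end n k n<k)) (zero-* _)) (*0≤ (^0≤ 9 y-nonneg) (r^-nonneg k))

        -- As y ≤ u, u^b y^(9-b) ≤ u⁹, and y^(9-b) cancels: the ninth power controls all lower ones.
        lower-power : ∀ {c R u p} b → b ℕ.≤ 9 → # 0 ≤ c → # 0 ≤ R → y ≤ u → c * (R * u ^ 9) ≤ y ^ 9 * p → c * (R * u ^ b) ≤ y ^ b * p
        lower-power {c} {R} {u} {p} b b≤9 0c 0R yu H = *-cancelˡ (Pos-^ (9 ∸ b) (z-pos n)) (≤-trans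
            (≡≤ (ring (y ^ (9 ∸ b) ∷ c ∷ R ∷ u ^ b ∷ []) (var 0 :* (var 1 :* (var 2 :* var 3))) ((var 1 :* (var 2 :* var 3)) :* var 0) refl)
              (*-monoʳ (*0≤ 0c (*0≤ 0R (^0≤ b (≤-trans y-nonneg yu)))) (^-mono (9 ∸ b) y-nonneg yu)))
            (≡≤ (trans (ring (u ^ (9 ∸ b) ∷ c ∷ R ∷ u ^ b ∷ []) ((var 1 :* (var 2 :* var 3)) :* var 0) (var 1 :* (var 2 :* (var 3 :* var 0))) refl)
                  (cong (λ v → c * (R * v)) (join u)))
              (≤≡ H (trans (cong (_* p) (sym (join y))) (ring (y ^ b ∷ y ^ (9 ∸ b) ∷ p ∷ []) (var 0 :* var 1 :* var 2) (var 1 :* (var 0 :* var 2)) refl)))))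
          where
          join : ∀ x → x ^ b * x ^ (9 ∸ b) ≡ x ^ 9
          join x = trans (sym (^-+ x b (9 ∸ b))) (cong (x ^_) (ℕₚ.m+[n∸m]≡n b≤9))

        mean-dominated : ∀ N c → # 0 ≤ c →
          (∀ j → j ℕ.< N → c * (R N (suc j) * z (N ∸ suc j) ^ 9) ≤ y ^ 9 * r ^ suc j) →
          (∀ j → j ℕ.< N → y ≤ z (N ∸ suc j)) →
          ∀ b → b ℕ.≤ 9 → ∀ f → (∀ k → # 0 ≤ f k) → c * mean N (λ k → f k * z (N ∸ k) ^ b) ≤ y ^ b * mass f (suc N)
        mean-dominated N c 0c H yz b b≤9 f 0f = ≡≤ (sym (sum-*ˡ (suc N) c _)) (≤≡ (sum-mono (suc N) term) (sum-*ˡ (suc N) (y ^ b) _))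
          where
          term : ∀ k → k ℕ.< suc N → c * (# (σ k) * R N k * (f k * z (N ∸ k) ^ b)) ≤ y ^ b * (f k * # (σ k) * r ^ k)
          term zero _ = reflexive (trans (cong (λ v → c * (# v * # 1 * (f 0 * z N ^ b))) σ-zero)
            (trans (ring (c ∷ f 0 ∷ z N ^ b ∷ y ^ b ∷ r ^ 0 ∷ []) (var 0 :* (con 0 :* con 1 :* (var 1 :* var 2))) (var 3 :* (var 1 :* con 0 :* var 4)) refl)
              (cong (λ v → y ^ b * (f 0 * # v * r ^ 0)) (sym σ-zero))))
          term (suc j) (ℕ.s≤s j<N) = ≡≤ (ring (c ∷ # (σ (suc j)) ∷ R N (suc j) ∷ f (suc j) ∷ z (N ∸ suc j) ^ b ∷ [])
              (var 0 :* (var 1 :* var 2 :* (var 3 :* var 4))) ((var 3 :* var 1) :* (var 0 :* (var 2 :* var 4))) refl)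
            (≤≡ (*-monoʳ (*0≤ (0f (suc j)) (#0≤ (σ (suc j)))) (lower-power {p = r ^ suc j} b b≤9 0c (R-nonneg N (suc j)) (yz j j<N) (H j j<N)))
              (ring (f (suc j) ∷ # (σ (suc j)) ∷ y ^ b ∷ r ^ suc j ∷ []) ((var 0 :* var 1) :* (var 2 :* var 3)) (var 2 :* (var 0 :* var 1 :* var 3)) refl))

        mean-at : ∀ b → b ℕ.≤ 9 → ∀ f → (∀ k → # 0 ≤ f k) → mean n (λ k → f k * z (n ∸ k) ^ b) ≤ y ^ b * mass f (suc n)
        mean-at b b≤9 f 0f = ≡≤ (sym (one-* _)) (mean-dominated n (# 1) (#0≤ 1) (λ j _ → ≡≤ (one-* _) (Ω (suc j)))
          (λ j _ → z-anti good (ℕₚ.m∸n≤m n (suc j)) ℕₚ.≤-refl) b b≤9 f 0f)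

        -- f k is a sum of k values of g at n, ..., n-k+1, and z is largest at the far end.
        path : ∀ c p (f g : ℕ → A) → # 0 ≤ c → f 0 ≡ # 0 → (∀ k → f (suc k) ≡ f k + g (n ∸ k)) →
          (∀ m → m ℕ.≤ n → Within (c * z m ^ p) (g m)) →
          ∀ k → Within (# k * (c * z (n ∸ k) ^ p)) (f k)
        path c p f g 0c f0 fs H zero = within-≡ (within-≡ᵇ (within-refl ≤-refl) (sym (zero-* _))) (sym f0)
        path c p f g 0c f0 fs H (suc k) = within-≡ (within-≡ᵇ (within-+
            (within-mono (path c p f g 0c f0 fs H k) (*-monoʳ (#0≤ k) up))
            (within-mono (H (n ∸ k) (ℕₚ.m∸n≤m n k)) up))
            (trans (ring (# k ∷ c * z (n ∸ suc k) ^ p ∷ []) (var 0 :* var 1 :+ var 1) ((var 0 :+ con 1) :* var 1) refl)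
              (cong (_* (c * z (n ∸ suc k) ^ p)) (sym (#suc k))))) (sym (fs k))
          where
          up : c * z (n ∸ k) ^ p ≤ c * z (n ∸ suc k) ^ p
          up = *-monoʳ 0c (^-mono p (z-nonneg (n ∸ k)) (z-anti good (ℕₚ.∸-monoʳ-≤ n (ℕₚ.n≤1+n k)) (ℕₚ.m∸n≤m n k)))

        -- The far end of j + 1 steps is n - j. This index is the one needed when the step is
        -- counted from n + 1.
        path⁺ : ∀ c p (f g : ℕ → A) → # 0 ≤ c → f 0 ≡ # 0 → (∀ k → f (suc k) ≡ f k + g (n ∸ k)) →
          (∀ m → m ℕ.≤ n → Within (c * z m ^ p) (g m)) →
          ∀ j → Within (# (suc j) * (c * z (n ∸ j) ^ p)) (f (suc j))
        path⁺ c p f g 0c f0 fs H j = within-≡ (within-≡ᵇ (within-+ (path c p f g 0c f0 fs H j) (H (n ∸ j) (ℕₚ.m∸n≤m n j)))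
            (trans (ring (# j ∷ c * z (n ∸ j) ^ p ∷ []) (var 0 :* var 1 :+ var 1) ((var 0 :+ con 1) :* var 1) refl)
              (cong (_* (c * z (n ∸ j) ^ p)) (sym (#suc j))))) (sym (fs j))

        pred-∸ : ∀ n k → n ∸ suc k ≡ (n ∸ k) ∸ 1
        pred-∸ n k = trans (cong (n ∸_) (ℕₚ.+-comm 1 k)) (sym (ℕₚ.∸-+-assoc n k 1))

        swap-∸ : ∀ n k → (n ∸ 1) ∸ k ≡ (n ∸ k) ∸ 1
        swap-∸ n k = trans (ℕₚ.∸-+-assoc n 1 k) (pred-∸ n k)

        V : ℕ → ℕ → A
        V m k = δ m - δ (m ∸ k)

        Scaled : ℕ → ℕ → (ℕ → A) → Set
        Scaled c p f = ∀ k → Within (# k * (# c * z (n ∸ k) ^ p)) (f k)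

        Scaled⁺ : ℕ → ℕ → (ℕ → A) → Set
        Scaled⁺ c p f = ∀ j → Within (# (suc j) * (# c * z (n ∸ j) ^ p)) (f (suc j))

        module _ where
          private
            zero-diff : ∀ x c → # c * (x - x) ≡ # 0
            zero-diff x c = ring (x ∷ # c ∷ []) (var 1 :* (var 0 :- var 0)) (con 0) refl
            telescope : ∀ c x u v → # c * (x - v) ≡ # c * (x - u) + # c * (u - v)
            telescope c x u v = ring (# c ∷ x ∷ u ∷ v ∷ []) (var 0 :* (var 1 :- var 3)) (var 0 :* (var 1 :- var 2) :+ var 0 :* (var 2 :- var 3)) refl

            X-step : ∀ k → # 50 * X n (suc k) ≡ # 50 * X n k + # 50 * δ (n ∸ k)
            X-step k = trans (cong (λ v → # 50 * (ρ n - ρ v)) (pred-∸ n k)) (telescope 50 _ _ _)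
            Y-step : ∀ k → # 50 * Y n (suc k) ≡ # 50 * Y n k + # 50 * δ ((n ∸ k) ∸ 1)
            Y-step k = trans (cong (λ v → # 50 * (ρ (n ∸ 1) - ρ v)) (pred-∸ (n ∸ 1) k))
              (trans (telescope 50 _ (ρ (n ∸ 1 ∸ k)) _) (cong (λ v → # 50 * Y n k + # 50 * δ v) (swap-∸ n k)))
            V-step : ∀ k → # 5 * V n (suc k) ≡ # 5 * V n k + # 5 * ε (n ∸ k)
            V-step k = trans (cong (λ v → # 5 * (δ n - δ v)) (pred-∸ n k)) (telescope 5 _ _ _)

          X-path : Scaled 19 3 (λ k → # 50 * X n k)
          X-path = path (# 19) 3 _ (λ m → # 50 * δ m) (#0≤ 19) (zero-diff (ρ n) 50) X-step (λ m l → Local.δ-here (good m l))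

          X-path⁺ : Scaled⁺ 19 3 (λ k → # 50 * X n k)
          X-path⁺ = path⁺ (# 19) 3 _ (λ m → # 50 * δ m) (#0≤ 19) (zero-diff (ρ n) 50) X-step (λ m l → Local.δ-here (good m l))

          Y-path : Scaled 19 3 (λ k → # 50 * Y n k)
          Y-path = path (# 19) 3 _ (λ m → # 50 * δ (m ∸ 1)) (#0≤ 19) (zero-diff (ρ (n ∸ 1)) 50) Y-step (λ m l → Local.δ-prev (good m l))

          Y-path⁺ : Scaled⁺ 19 3 (λ k → # 50 * Y n k)
          Y-path⁺ = path⁺ (# 19) 3 _ (λ m → # 50 * δ (m ∸ 1)) (#0≤ 19) (zero-diff (ρ (n ∸ 1)) 50) Y-step (λ m l → Local.δ-prev (good m l))

          V-path : Scaled 13 5 (λ k → # 5 * V n k)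
          V-path = path (# 13) 5 _ (λ m → # 5 * ε m) (#0≤ 13) (zero-diff (δ n) 5) V-step (λ m l → Local.ε-here (good m l))

          V-path⁺ : Scaled⁺ 13 5 (λ k → # 5 * V n k)
          V-path⁺ = path⁺ (# 13) 5 _ (λ m → # 5 * ε m) (#0≤ 13) (zero-diff (δ n) 5) V-step (λ m l → Local.ε-here (good m l))

        lin≤ : ∀ N → # 10000 * (y ^ 2 * weighted pow1 N) ≤ # 10851
        lin≤ N = use lin-y (pos⇒0≤ (w-pos n)) (lin-bound N)

        rise2≤ : ∀ N → # 10000 * (y ^ 3 * weighted rise2 N) ≤ # 22606
        rise2≤ N = use rise2-y (pos⇒0≤ (w-pos n)) (rise2-bound N)

        rise3≤ : ∀ N → # 10000 * (y ^ 4 * weighted rise3 N) ≤ # 70643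
        rise3≤ N = use rise3-y (rise3-bound N)

        mass1≤ : ∀ N → # 10000 * (y ^ 3 * mass pow1 N) ≤ # 38204
        mass1≤ N = use mass1-y (mass1 N)

        mass2≤ : ∀ N → # 10000 * (y ^ 4 * mass pow2 N) ≤ # 121035
        mass2≤ N = use mass2-y (mass2 N)

        mass3≤ : ∀ N → # 10000 * (y ^ 5 * mass pow3 N) ≤ # 511178
        mass3≤ N = use mass3-y (mass3 N)

        pow2-nonneg : ∀ k → # 0 ≤ pow2 k
        pow2-nonneg k = *0≤ (#0≤ k) (#0≤ k)

        pow3-nonneg : ∀ k → # 0 ≤ pow3 k
        pow3-nonneg k = *0≤ (pow2-nonneg k) (#0≤ k)

        -- Where no power of z enters the mean, the true rate q serves and the factor 25/24 is
        -- saved.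
        module Q = Rates q y 0≤q y-nonneg (trans (+-comm q y) q+y)
        module QM = Q.Masses σ σ-zero hi lo

        q-mean : ∀ f → (∀ k → # 0 ≤ f k) → q * mean n f ≤ QM.mass f (suc n)
        q-mean f 0f = ≡≤ (sym (sum-*ˡ (suc n) q _)) (sum-mono (suc n) (λ k _ →
          ≡≤ (ring (q ∷ # (σ k) ∷ R n k ∷ f k ∷ []) (var 0 :* (var 1 :* var 2 :* var 3)) ((var 3 :* var 1) :* (var 0 :* var 2)) refl)
            (*-monoʳ (*0≤ (0f k) (#0≤ (σ k))) (qR≤q^ n k ℕₚ.≤-refl))))

        meanK : A
        meanK = mean n pow1

        n-upper : # 3 * (y * y * (q * # n)) ≤ # 5
        n-upper = ≤-trans (*-monoʳ (#0≤ 3) (*-monoʳ (*0≤ y-nonneg y-nonneg)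
            (≡≤ (cong (q *_) (sym (trans (mean-const n (# 1)) (one-* _))))
              (≤≡ (q-mean (λ _ → # 1) (λ _ → #0≤ 1)) (sum-cong (suc n) (λ k _ → cong (_* q ^ k) (one-* _)))))))
          (QM.mass0 (suc n))

        meanK-upper : # 100 * (y * y * y * (q * meanK)) ≤ # 338
        meanK-upper = ≤-trans (*-monoʳ (#0≤ 100) (*-monoʳ (*0≤ (*0≤ y-nonneg y-nonneg) y-nonneg) (q-mean pow1 #0≤))) (QM.mass1 (suc n))

        -- Lower bounds: R n k - R n (suc k) = R n k (y + X n k) telescopes.
        total : (ℕ → A) → A
        total f = sum (suc n) (λ k → f k * R n k)

        diffs : (ℕ → A) → ℕ → A
        diffs f zero = f 0
        diffs f (suc k) = f (suc k) - f k

        telescoped : ∀ f → y * total f + sum (suc n) (λ k → f k * (R n k * X n k)) ≡ total (diffs f)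
        telescoped f = begin
          y * total f + sum (suc n) (λ k → f k * (R n k * X n k))
            ≡⟨ cong (_+ sum (suc n) (λ k → f k * (R n k * X n k))) (sym (sum-*ˡ (suc n) y _)) ⟩
          sum (suc n) (λ k → y * (f k * R n k)) + sum (suc n) (λ k → f k * (R n k * X n k))
            ≡⟨ sym (sum-+ (suc n) _ _) ⟩
          sum (suc n) (λ k → y * (f k * R n k) + f k * (R n k * X n k))
            ≡⟨ sum-cong (suc n) (λ k _ → drop k) ⟩
          sum (suc n) (λ k → f k * (R n k - R n (suc k)))
            ≡⟨ parts n ⟩
          total (diffs f) - f n * R n (suc n)
            ≡⟨ cong (λ v → total (diffs f) - f n * v) (R-end n (suc n) ℕₚ.≤-refl) ⟩
          total (diffs f) - f n * # 0
            ≡⟨ ring (total (diffs f) ∷ f n ∷ []) (var 0 :- var 1 :* con 0) (var 0) refl ⟩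
          total (diffs f) ∎
          where
          y≡ : y ≡ # 1 - q
          y≡ = trans (ring (y ∷ q ∷ []) (var 0) (var 0 :+ var 1 :- var 1) refl) (cong (_- q) q+y)
          drop : ∀ k → y * (f k * R n k) + f k * (R n k * X n k) ≡ f k * (R n k - R n (suc k))
          drop k = trans (cong (λ v → v * (f k * R n k) + f k * (R n k * X n k)) y≡)
            (ring (q ∷ f k ∷ R n k ∷ ρ (n ∸ k) ∷ [])
              ((con 1 :- var 0) :* (var 1 :* var 2) :+ var 1 :* (var 2 :* (var 0 :- var 3))) (var 1 :* (var 2 :- var 2 :* var 3)) refl)
          parts : ∀ N → sum (suc N) (λ k → f k * (R n k - R n (suc k))) ≡ sum (suc N) (λ k → diffs f k * R n k) - f N * R n (suc N)
          parts zero = ring (f 0 ∷ R n 0 ∷ R n 1 ∷ []) (con 0 :+ var 0 :* (var 1 :- var 2)) (con 0 :+ var 0 :* var 1 :- var 0 :* var 2) refl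
          parts (suc N) = trans (cong (_+ f (suc N) * (R n (suc N) - R n (suc (suc N)))) (parts N))
            (ring (sum (suc N) (λ k → diffs f k * R n k) ∷ f N ∷ f (suc N) ∷ R n (suc N) ∷ R n (suc (suc N)) ∷ [])
              (var 0 :- var 1 :* var 3 :+ var 2 :* (var 3 :- var 4))
              (var 0 :+ (var 2 :- var 1) :* var 3 :- var 2 :* var 4) refl)

        -- The error in `telescoped` from replacing every ρ(n-k) by ρ n.
        drift : ∀ (f : ℕ → A) → (∀ k → # 0 ≤ f k) →
          Within (# 19 * (y ^ 3 * weighted (λ k → f k * # k) (suc n))) (# 50 * sum (suc n) (λ k → f k * (R n k * X n k)))
        drift f 0f = within-≡ (within-mono (within-sum (suc n) {f = λ k → f k * R n k * (# 50 * X n k)} {b = λ k → f k * R n k * (# k * (# 19 * z (n ∸ k) ^ 3))} (λ k _ → within-scale (*0≤ (0f k) (R-nonneg n k)) (X-path k))) bound) collect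
          where
          collect : sum (suc n) (λ k → f k * R n k * (# 50 * X n k)) ≡ # 50 * sum (suc n) (λ k → f k * (R n k * X n k))
          collect = trans (sum-cong (suc n) (λ k _ → ring (f k ∷ R n k ∷ X n k ∷ [])
              (var 0 :* var 1 :* (con 50 :* var 2)) (con 50 :* (var 0 :* (var 1 :* var 2))) refl))
            (sum-*ˡ (suc n) (# 50) _)
          bound : sum (suc n) (λ k → f k * R n k * (# k * (# 19 * z (n ∸ k) ^ 3))) ≤ # 19 * (y ^ 3 * weighted (λ k → f k * # k) (suc n))
          bound = ≤≡ (sum-mono (suc n) (λ k _ →
              ≡≤ (ring (f k ∷ R n k ∷ # k ∷ z (n ∸ k) ^ 3 ∷ []) (var 0 :* var 1 :* (var 2 :* (con 19 :* var 3))) (con 19 :* (var 0 :* var 2) :* (con 1 :* (var 1 :* var 3))) refl)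
              (≤≡ (*-monoʳ (*0≤ (#0≤ 19) (*0≤ (0f k) (#0≤ k)))
                    (lower-power {p = r ^ k} 3 (ℕ.s≤s (ℕ.s≤s (ℕ.s≤s ℕ.z≤n))) (#0≤ 1) (R-nonneg n k) (z-anti good (ℕₚ.m∸n≤m n k) ℕₚ.≤-refl) (≡≤ (one-* _) (Ω k))))
                (ring (f k ∷ # k ∷ y ^ 3 ∷ r ^ k ∷ []) (con 19 :* (var 0 :* var 1) :* (var 2 :* var 3)) (con 19 :* var 2 :* (var 0 :* var 1 :* var 3)) refl))))
            (trans (sum-*ˡ (suc n) (# 19 * y ^ 3) _) (*-assoc _ _ _))

        -- R n k behaves like (1-y)^k, so y U₀ ≈ 1, y² U₁ ≈ 1 and y³ U₂ ≈ 2. Each bound follows from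
        -- the previous ones through `telescoped`.
        U₀ U₁ U₂ : A
        U₀ = total (λ _ → # 1)
        U₁ = total pow1
        U₂ = total fall2

        fall2-nonneg : ∀ k → # 0 ≤ fall2 k
        fall2-nonneg zero = reflexive (ring [] (con 0) (con 0 :* (con 0 :- con 1)) refl)
        fall2-nonneg (suc k) = ≤≡ (*0≤ (#0≤ (suc k)) (#0≤ k)) (cong (# (suc k) *_)
          (trans (ring (# k ∷ []) (var 0) (var 0 :+ con 1 :- con 1) refl) (cong (_- # 1) (sym (#suc k)))))

        total-head : ∀ f → total f ≡ f 0 + sum n (λ k → f (suc k) * R n (suc k))
        total-head f = trans (sum-head n _) (cong (_+ sum n (λ k → f (suc k) * R n (suc k))) (*-one (f 0)))

        diffs-one : total (diffs (λ _ → # 1)) ≡ # 1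
        diffs-one = trans (total-head _) (trans (cong (# 1 +_) (zeros n)) (ring [] (con 1 :+ con 0) (con 1) refl))
          where
          zeros : ∀ N → sum N (λ k → (# 1 - # 1) * R n (suc k)) ≡ # 0
          zeros zero = refl
          zeros (suc N) = trans (cong (_+ (# 1 - # 1) * R n (suc N)) (zeros N)) (ring (R n (suc N) ∷ []) (con 0 :+ (con 1 :- con 1) :* var 0) (con 0) refl)

        diffs-lin : total (diffs pow1) ≡ U₀ - # 1
        diffs-lin = trans (total-head _) (trans (cong (# 0 +_) (sum-cong n (λ k _ → cong (_* R n (suc k))
            (trans (cong (_- # k) (#suc k)) (ring (# k ∷ []) (var 0 :+ con 1 :- var 0) (con 1) refl)))))
          (trans (ring (sum n (λ k → # 1 * R n (suc k)) ∷ []) (con 0 :+ var 0) (con 1 :+ var 0 :- con 1) refl)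
            (cong (_- # 1) (sym (total-head (λ _ → # 1))))))

        diffs-fall2 : total (diffs fall2) ≡ # 2 * U₁ - # 2 * (U₀ - # 1)
        diffs-fall2 = begin
          total (diffs fall2)
            ≡⟨ total-head _ ⟩
          # 0 * (# 0 - # 1) + sum n (λ k → (fall2 (suc k) - fall2 k) * R n (suc k))
            ≡⟨ cong₂ _+_ (zero-* _) (trans (sum-cong n (λ k _ → split k)) (trans (sum-+ n _ _) (cong₂ _+_ (sum-*ˡ n (# 2) _) (sum-*ˡ n (# 0 - # 2) _)))) ⟩
          # 0 + (# 2 * sum n (λ k → # (suc k) * R n (suc k)) + (# 0 - # 2) * sum n (λ k → # 1 * R n (suc k)))
            ≡⟨ ring (sum n (λ k → # (suc k) * R n (suc k)) ∷ sum n (λ k → # 1 * R n (suc k)) ∷ [])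
                 (con 0 :+ (con 2 :* var 0 :+ (con 0 :- con 2) :* var 1)) (con 2 :* (con 0 :+ var 0) :- con 2 :* (con 1 :+ var 1 :- con 1)) refl ⟩
          # 2 * (# 0 + sum n (λ k → # (suc k) * R n (suc k))) - # 2 * (# 1 + sum n (λ k → # 1 * R n (suc k)) - # 1)
            ≡⟨ cong₂ (λ u v → # 2 * u - # 2 * (v - # 1)) (sym (total-head pow1)) (sym (total-head (λ _ → # 1))) ⟩
          # 2 * U₁ - # 2 * (U₀ - # 1) ∎
          where
          split : ∀ k → (fall2 (suc k) - fall2 k) * R n (suc k) ≡ # 2 * (# (suc k) * R n (suc k)) + (# 0 - # 2) * (# 1 * R n (suc k))
          split k rewrite #suc k = ring (# k ∷ R n (suc k) ∷ [])
            (((var 0 :+ con 1) :* (var 0 :+ con 1 :- con 1) :- var 0 :* (var 0 :- con 1)) :* var 1)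
            (con 2 :* ((var 0 :+ con 1) :* var 1) :+ (con 0 :- con 2) :* (con 1 :* var 1)) refl

        module _ where
          private
            e₀ e₁ e₂ : A
            e₀ = weighted (λ k → # 1 * # k) (suc n)
            e₁ = weighted (λ k → pow1 k * # k) (suc n)
            e₂ = weighted (λ k → fall2 k * # k) (suc n)
            x₀ x₁ x₂ : A
            x₀ = sum (suc n) (λ k → # 1 * (R n k * X n k))
            x₁ = sum (suc n) (λ k → pow1 k * (R n k * X n k))
            x₂ = sum (suc n) (λ k → fall2 k * (R n k * X n k))
            b₀ : # 10000 * (y ^ 2 * e₀) ≤ # 10851
            b₀ = ≤-trans (*-monoʳ (#0≤ 10000) (*-monoʳ (^0≤ 2 y-nonneg) (weighted-mono (suc n) (λ k → reflexive (one-* (# k)))))) (lin≤ (suc n))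
            b₁ : # 10000 * (y ^ 3 * e₁) ≤ # 22606
            b₁ = ≤-trans (*-monoʳ (#0≤ 10000) (*-monoʳ (^0≤ 3 y-nonneg) (weighted-mono (suc n) (λ k → step k (#0≤ k))))) (rise2≤ (suc n))
              where
              step : ∀ k → # 0 ≤ # k → # k * # k ≤ rise2 k
              step k h = arith (# k ∷ []) ((con 0 :≤ var 0) ∷ []) (var 0 :* var 0 :≤ var 0 :* (var 0 :+ con 1)) 0 ((1 , 0 ∷ []) ∷ []) refl (h , tt)
            b₂ : # 10000 * (y ^ 4 * e₂) ≤ # 70643
            b₂ = ≤-trans (*-monoʳ (#0≤ 10000) (*-monoʳ (^0≤ 4 y-nonneg) (weighted-mono (suc n) (λ k → step k (#0≤ k))))) (rise3≤ (suc n))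
              where
              step : ∀ k → # 0 ≤ # k → # k * (# k - # 1) * # k ≤ rise3 k
              step k h = arith (# k ∷ []) ((con 0 :≤ var 0) ∷ []) (var 0 :* (var 0 :- con 1) :* var 0 :≤ var 0 :* (var 0 :+ con 1) :* (var 0 :+ con 2)) 0 ((4 , 0 ∷ 0 ∷ []) ∷ (2 , 0 ∷ []) ∷ []) refl (h , tt)
            E₀ : y * U₀ + x₀ ≡ # 1
            E₀ = trans (telescoped (λ _ → # 1)) diffs-one
            E₁ : y * U₁ + x₁ ≡ U₀ - # 1
            E₁ = trans (telescoped pow1) diffs-lin
            E₂ : y * U₂ + x₂ ≡ # 2 * U₁ - # 2 * (U₀ - # 1)
            E₂ = trans (telescoped fall2) diffs-fall2
            D₀ = drift (λ _ → # 1) (λ _ → #0≤ 1)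
            D₁ = drift pow1 #0≤
            D₂ = drift fall2 fall2-nonneg
            U₀-low = use u0-low (reflexive E₀) (reflexive (sym E₀)) (upp D₀) b₀ y-nonneg
            U₀-high = use u0-high (reflexive E₀) (reflexive (sym E₀)) (low D₀) b₀ y-nonneg
            U₁-low = use u1-low (reflexive E₁) (reflexive (sym E₁)) (upp D₁) b₁ y-nonneg U₀-low
            U₂-low = use u2-low (reflexive E₂) (reflexive (sym E₂)) (upp D₂) b₂ y-nonneg U₀-high U₁-low y-small

            odds-total : total odds ≡ # 2 * U₁ - (U₀ - # 1)
            odds-total = begin
              total odds
                ≡⟨ total-head odds ⟩
              # 0 + sum n (λ k → (# 2 * # k + # 1) * R n (suc k))
                ≡⟨ cong (# 0 +_) (trans (sum-cong n (λ k _ → split k)) (trans (sum-+ n _ _) (cong₂ _+_ (sum-*ˡ n (# 2) _) (sum-*ˡ n (# 0 - # 1) _)))) ⟩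
              # 0 + (# 2 * sum n (λ k → # (suc k) * R n (suc k)) + (# 0 - # 1) * sum n (λ k → # 1 * R n (suc k)))
                ≡⟨ ring (sum n (λ k → # (suc k) * R n (suc k)) ∷ sum n (λ k → # 1 * R n (suc k)) ∷ [])
                     (con 0 :+ (con 2 :* var 0 :+ (con 0 :- con 1) :* var 1)) (con 2 :* (con 0 :+ var 0) :- (con 1 :+ var 1 :- con 1)) refl ⟩
              # 2 * (# 0 + sum n (λ k → # (suc k) * R n (suc k))) - (# 1 + sum n (λ k → # 1 * R n (suc k)) - # 1)
                ≡⟨ cong₂ (λ u v → # 2 * u - (v - # 1)) (sym (total-head pow1)) (sym (total-head (λ _ → # 1))) ⟩
              # 2 * U₁ - (U₀ - # 1) ∎
              where
              split : ∀ k → (# 2 * # k + # 1) * R n (suc k) ≡ # 2 * (# (suc k) * R n (suc k)) + (# 0 - # 1) * (# 1 * R n (suc k))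
              split k rewrite #suc k = ring (# k ∷ R n (suc k) ∷ []) ((con 2 :* var 0 :+ con 1) :* var 1)
                (con 2 :* ((var 0 :+ con 1) :* var 1) :+ (con 0 :- con 1) :* (con 1 :* var 1)) refl

            odds≤n : # 81 * (# 2 * U₁ - (U₀ - # 1)) ≤ # 100 * # n
            odds≤n = ≡≤ (cong (# 81 *_) (sym odds-total)) (≡≤ (trans (sym (sum-*ˡ (suc n) (# 81) _)) (sum-cong (suc n) (λ k _ → sym (*-assoc _ _ _))))
              (≤≡ (abel-mono _ _ (R n) (R-dec n) (R-nonneg n) lo0 (suc n))
                (trans (sum-cong (suc n) (λ k _ → *-assoc _ _ _)) (trans (sum-*ˡ (suc n) (# 100) _) (cong (# 100 *_) (renewal n))))))

            fall≤K : # 479 * U₂ ≤ # 300 * meanK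
            fall≤K = ≡≤ (trans (sym (sum-*ˡ (suc n) (# 479) _)) (sum-cong (suc n) (λ k _ → sym (*-assoc _ _ _))))
              (≤≡ (abel-mono _ _ (R n) (R-dec n) (R-nonneg n) lo1 (suc n))
                (trans (sum-cong (suc n) (λ k _ → ring (# k ∷ # (σ k) ∷ R n k ∷ []) (con 300 :* (var 0 :* var 1) :* var 2) (con 300 :* (var 1 :* var 2 :* var 0)) refl))
                  (sum-*ˡ (suc n) (# 300) _)))

          -- The asymptotic value of y² n is π²/6 ≈ 1.645.
          n-lower : # 157 ≤ # 100 * (y ^ 2 * # n)
          n-lower = use n-low odds≤n y-nonneg U₀-high U₁-low y-small

          meanK-lower : # 305 ≤ # 100 * (y ^ 3 * meanK)
          meanK-lower = use k-low fall≤K U₂-low y-small y-nonneg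

        2≤n : 2 ℕ.≤ n
        2≤n = ℕₚ.≤-trans 2≤m₀ m₀≤n

        mean-X′ : ∀ m → 2 ℕ.≤ m → mean m (X m) ≡ ρ m
        mean-X′ (suc (suc m)) (ℕ.s≤s (ℕ.s≤s _)) = mean-X (suc m)

        mean-XY′ : ∀ m → 2 ℕ.≤ m → mean m (λ k → ρ m * (X m k - Y m k) + X m k * Y m k) ≡ ρ m * δ m
        mean-XY′ (suc (suc m)) (ℕ.s≤s (ℕ.s≤s _)) = mean-XY m

        -- X n k is the sum of δ(n-i) over i < k, and each term differs from δ n by V n i; the
        -- errors 2.6 i z⁵ add up to k(k-1)/2.
        deviation : ∀ k → Within (fall2 k * (# 13 * z (n ∸ k) ^ 5)) (# 10 * (X n k - # k * δ n))
        deviation zero = within-≡ (within-≡ᵇ (within-refl ≤-refl) (ring (z n ^ 5 ∷ []) (con 0) (con 0 :* (con 0 :- con 1) :* (con 13 :* var 0)) refl))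
          (ring (ρ n ∷ δ n ∷ []) (con 0) (con 10 :* (var 0 :- var 0 :- con 0 :* var 1)) refl)
        deviation (suc k) = within-≡ (within-≡ᵇ (within-+
            (within-mono (deviation k) (*-monoʳ (fall2-nonneg k) up))
            (within-scale (#0≤ 2) (within-neg (within-mono (V-path k) (*-monoʳ (#0≤ k) up))))) bound) value
          where
          B = # 13 * z (n ∸ suc k) ^ 5
          up : # 13 * z (n ∸ k) ^ 5 ≤ B
          up = *-monoʳ (#0≤ 13) (^-mono 5 (z-nonneg (n ∸ k)) (z-anti good (ℕₚ.∸-monoʳ-≤ n (ℕₚ.n≤1+n k)) (ℕₚ.m∸n≤m n k)))
          bound : fall2 k * B + # 2 * (# k * B) ≡ fall2 (suc k) * B
          bound rewrite #suc k = ring (# k ∷ B ∷ []) (var 0 :* (var 0 :- con 1) :* var 1 :+ con 2 :* (var 0 :* var 1))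
            ((var 0 :+ con 1) :* (var 0 :+ con 1 :- con 1) :* var 1) refl
          value : # 10 * (X n k - # k * δ n) + # 2 * (# 0 - # 5 * V n k) ≡ # 10 * (X n (suc k) - # (suc k) * δ n)
          value = trans (ring (ρ n ∷ ρ (n ∸ k) ∷ # k ∷ δ n ∷ ρ ((n ∸ k) ∸ 1) ∷ [])
              (con 10 :* (var 0 :- var 1 :- var 2 :* var 3) :+ con 2 :* (con 0 :- con 5 :* (var 3 :- (var 1 :- var 4))))
              (con 10 :* (var 0 :- var 4 :- (var 2 :+ con 1) :* var 3)) refl)
            (cong₂ (λ u v → # 10 * (ρ n - ρ u - v * δ n)) (sym (pred-∸ n k)) (sym (#suc k)))

        -- Since the mean of X is ρ n, this says that ρ n is close to `meanK` · δ n, so the bounds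
        -- on `meanK` determine δ n.
        mean-deviation : Within (# 13 * (y ^ 5 * mass pow2 (suc n))) (# 10 * (q - meanK * δ n))
        mean-deviation = within-≡ (within-mono (mean-within n {F = λ k → # 10 * (X n k - # k * δ n)} {b = λ k → fall2 k * (# 13 * z (n ∸ k) ^ 5)} (λ k _ → deviation k)) bound) value
          where
          bound : mean n (λ k → fall2 k * (# 13 * z (n ∸ k) ^ 5)) ≤ # 13 * (y ^ 5 * mass pow2 (suc n))
          bound = ≤-trans (mean-mono n (λ k _ → step k (#0≤ k) (^0≤ 5 (z-nonneg (n ∸ k)))))
            (≡≤ (mean-*ˡ n (# 13) _) (*-monoʳ (#0≤ 13) (mean-at 5 (ℕₚ.m≤m+n 5 4) pow2 pow2-nonneg)))
            where
            step : ∀ k {v} → # 0 ≤ # k → # 0 ≤ v → fall2 k * (# 13 * v) ≤ # 13 * (pow2 k * v)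
            step k {v} h g = arith (# k ∷ v ∷ []) ((con 0 :≤ var 0) ∷ (con 0 :≤ var 1) ∷ [])
              (var 0 :* (var 0 :- con 1) :* (con 13 :* var 1) :≤ con 13 :* (var 0 :* var 0 :* var 1)) 0 ((13 , 0 ∷ 1 ∷ []) ∷ []) refl (h , g , tt)
          value : mean n (λ k → # 10 * (X n k - # k * δ n)) ≡ # 10 * (q - meanK * δ n)
          value = trans (mean-*ˡ n (# 10) _) (cong (# 10 *_) (trans
            (mean-cong n (λ k _ → ring (X n k ∷ # k ∷ δ n ∷ []) (var 0 :- var 1 :* var 2) (var 0 :+ (con 0 :- var 2) :* var 1) refl))
            (trans (mean-+ n _ _) (trans (cong₂ _+_ (mean-X′ n 2≤n) (mean-*ˡ n _ _)) (ring (q ∷ δ n ∷ meanK ∷ []) (var 0 :+ (con 0 :- var 1) :* var 2) (var 0 :- var 2 :* var 1) refl)))))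

        meanK-nonneg : # 0 ≤ meanK
        meanK-nonneg = sum-nonneg (suc n) (λ k → *0≤ (*0≤ (#0≤ (σ k)) (R-nonneg n k)) (#0≤ k))

        positive-8493 : ∀ {x} → # 8493 ≤ x → x ≤ # 0 → ⊥
        positive-8493 h g = #Pos 8492 (≤-trans h g)

        -- `meanK` is nonnegative and its product with δ n is at least 0.8493.
        δ-nonneg : # 0 ≤ δ n
        δ-nonneg with ≤-total (# 0) (δ n)
        ... | inj₁ h = h
        ... | inj₂ h = ⊥-elim (positive-8493 (use δ-product-low (upp mean-deviation) (reflexive (sym q+y)) (mass2≤ (suc n)) y-nonneg y-small)
                                             (use negative h meanK-nonneg))

        δ-upper : # 1000 * δ n ≤ # 374 * y ^ 3
        δ-upper = use δ-high (use δ-product-high (low mean-deviation) (reflexive q+y) (mass2≤ (suc n)) y-nonneg y-small) meanK-lower δ-nonneg y-nonneg (^0≤ 3 y-nonneg)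

        δ-lower : # 2487 * y ^ 3 ≤ # 10000 * δ n
        δ-lower = use δ-low (use δ-product-low (upp mean-deviation) (reflexive (sym q+y)) (mass2≤ (suc n)) y-nonneg y-small) meanK-upper δ-nonneg (reflexive (sym q+y)) y-nonneg y-small (^0≤ 3 y-nonneg) meanK-nonneg

        X-Y : ∀ k → X n k - Y n k ≡ V n k
        X-Y k = trans (cong (λ v → X n k - (ρ (n ∸ 1) - ρ v)) (swap-∸ n k))
          (ring (ρ n ∷ ρ (n ∸ k) ∷ ρ (n ∸ 1) ∷ ρ ((n ∸ k) ∸ 1) ∷ [])
            ((var 0 :- var 1) :- (var 2 :- var 3)) ((var 0 :- var 2) :- (var 1 :- var 3)) refl)

        meanV : A
        meanV = mean n (V n)

        meanV-identity : q * meanV + mean n (λ k → X n k * Y n k) ≡ q * δ n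
        meanV-identity = trans (cong (_+ mean n (λ k → X n k * Y n k)) (sym (mean-*ˡ n q (V n))))
          (trans (sym (mean-+ n _ _)) (trans (mean-cong n (λ k _ → cong (λ v → q * v + X n k * Y n k) (sym (X-Y k)))) (mean-XY′ n 2≤n)))

        meanXY-within : Within (# 361 * (y ^ 6 * mass pow2 (suc n))) (# 2500 * mean n (λ k → X n k * Y n k))
        meanXY-within = within-≡ (within-mono (mean-within n {F = λ k → # 50 * X n k * (# 50 * Y n k)}
            {b = λ k → # k * (# 19 * z (n ∸ k) ^ 3) * (# k * (# 19 * z (n ∸ k) ^ 3))} (λ k _ → within-* (X-path k) (Y-path k))) bound)
          (trans (mean-cong n (λ k _ → ring (X n k ∷ Y n k ∷ []) (con 50 :* var 0 :* (con 50 :* var 1)) (con 2500 :* (var 0 :* var 1)) refl)) (mean-*ˡ n (# 2500) _))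
          where
          bound : mean n (λ k → # k * (# 19 * z (n ∸ k) ^ 3) * (# k * (# 19 * z (n ∸ k) ^ 3))) ≤ # 361 * (y ^ 6 * mass pow2 (suc n))
          bound = ≡≤ (trans (mean-cong n (λ k _ → ring (# k ∷ z (n ∸ k) ∷ [])
              (var 0 :* (con 19 :* var 1 :^ 3) :* (var 0 :* (con 19 :* var 1 :^ 3))) (con 361 :* (var 0 :* var 0 :* var 1 :^ 6)) refl)) (mean-*ˡ n (# 361) _))
            (*-monoʳ (#0≤ 361) (mean-at 6 (ℕₚ.m≤m+n 6 3) pow2 pow2-nonneg))

        Pos-q : Pos q
        Pos-q = Pos-≤ (#Pos 0) (use one≤ (use q-large (reflexive (sym q+y)) y-small)) ∘′ use scale-zero
          where
          infixr 9 _∘′_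
          _∘′_ : ∀ {x y} → Pos y → (x ≤ # 0 → y ≤ # 0) → Pos x
          (p ∘′ f) h = p (f h)

        -- The mean of X Y contributes 0.38² · 12.1035 ≈ 1.748 times y², and δ n only 0.374 y³. The
        -- hypothesis on ε alone would allow about 2.6 · 3.05 y².
        meanV-bound : Within (# 177 * y ^ 2) (# 100 * meanV)
        meanV-bound = within
          (*-cancelˡ Pos-q (use meanV-low-arith (reflexive (sym meanV-identity)) (upp meanXY-within) (mass2≤ (suc n)) δ-nonneg q-big (^0≤ 2 y-nonneg) 0≤q))
          (*-cancelˡ Pos-q (use meanV-high-arith (reflexive meanV-identity) (low meanXY-within) (mass2≤ (suc n)) δ-upper y-small q-big (^0≤ 2 y-nonneg) 0≤q))
          where q-big = use q-large (reflexive (sym q+y)) y-small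

        -- The mass of the weights beyond i; it appears when the mean of V, a sum of ε(n-i) over i <
        -- k, is summed over k first.
        W : ℕ → A
        W = tail (λ k → # (σ k) * R n k) (suc n)

        V-sum : ∀ k → sum k (λ i → ε (n ∸ i)) ≡ V n k
        V-sum zero = ring (δ n ∷ []) (con 0) (var 0 :- var 0) refl
        V-sum (suc k) = trans (cong (_+ ε (n ∸ k)) (V-sum k)) (trans
          (ring (δ n ∷ δ (n ∸ k) ∷ δ ((n ∸ k) ∸ 1) ∷ []) (var 0 :- var 1 :+ (var 1 :- var 2)) (var 0 :- var 2) refl)
          (cong (λ v → δ n - δ v) (sym (pred-∸ n k))))

        -- A linear relation between earlier values of ε, with a right-hand side that `meanV-bound`
        -- makes small. This is the source of the contraction.
        constraint : sum (suc n) (λ i → ε (n ∸ i) * W i) ≡ meanV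
        constraint = trans (sym (sum-swap (λ k → # (σ k) * R n k) (λ i → ε (n ∸ i)) (suc n))) (mean-cong n (λ k _ → V-sum k))

        W-total : sum (suc n) W ≡ meanK
        W-total = trans (sum-cong (suc n) (λ i _ → sym (one-* (W i))))
          (trans (sym (sum-swap (λ k → # (σ k) * R n k) (λ _ → # 1) (suc n))) (mean-cong n (λ k _ → ones k)))
          where
          ones : ∀ k → sum k (λ _ → # 1) ≡ # k
          ones zero = refl
          ones (suc k) = trans (cong (_+ # 1) (ones k)) (sym (#suc k))

        W-nonneg : ∀ i → # 0 ≤ W i
        W-nonneg i = sum-nonneg (n ∸ i) (λ j → *0≤ (#0≤ (σ (suc i ℕ.+ j))) (R-nonneg n (suc i ℕ.+ j)))

        -- After exchanging sums, 3 Σ i² over i < k is at most k³, and z(n-i) ≤ z(n-k) moves the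
        -- power of z inside.
        W-moment : sum (suc n) (λ i → # 3 * (# i * # i) * (W i * z (n ∸ i) ^ 5)) ≤ y ^ 5 * mass pow3 (suc n)
        W-moment = ≤-trans (sum-mono (suc n) (λ i _ → *-monoʳ (*0≤ (#0≤ 3) (pow2-nonneg i)) (shift i)))
          (≡≤ (sym (sum-swap c (λ i → # 3 * (# i * # i)) (suc n)))
            (≤-trans (sum-mono (suc n) (λ k _ → ≤≡ (*-monoʳ (c-nonneg k) (cubes k))
                (ring (# (σ k) ∷ R n k ∷ z (n ∸ k) ^ 5 ∷ pow3 k ∷ []) (var 0 :* var 1 :* var 2 :* var 3) (var 0 :* var 1 :* (var 3 :* var 2)) refl)))
              (mean-at 5 (ℕₚ.m≤m+n 5 4) pow3 pow3-nonneg)))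
          where
          c : ℕ → A
          c k = # (σ k) * R n k * z (n ∸ k) ^ 5
          c-nonneg : ∀ k → # 0 ≤ c k
          c-nonneg k = *0≤ (*0≤ (#0≤ (σ k)) (R-nonneg n k)) (^0≤ 5 (z-nonneg (n ∸ k)))
          shift : ∀ i → W i * z (n ∸ i) ^ 5 ≤ tail c (suc n) i
          shift i = ≡≤ (*-comm _ _) (≡≤ (sym (sum-*ˡ (n ∸ i) (z (n ∸ i) ^ 5) _)) (sum-mono (n ∸ i) (λ j _ →
            ≡≤ (*-comm _ _) (*-monoʳ (*0≤ (#0≤ (σ (suc i ℕ.+ j))) (R-nonneg n (suc i ℕ.+ j)))
              (^-mono 5 (z-nonneg (n ∸ i)) (z-anti good (ℕₚ.∸-monoʳ-≤ n (ℕₚ.≤-trans (ℕₚ.n≤1+n i) (ℕₚ.m≤m+n (suc i) j))) (ℕₚ.m∸n≤m n i)))))))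
          cubes : ∀ k → sum k (λ i → # 3 * (# i * # i)) ≤ pow3 k
          cubes zero = reflexive (ring [] (con 0) (con 0 :* con 0 :* con 0) refl)
          cubes (suc k) rewrite #suc k = use rise-step (cubes k) (#0≤ k)

        -- The potential Ψ i = 10 (y² i(i+1)/2 + i q y + q) - 6 y² S(i) bounds Σ_{j ≥ 0} σ(i+1+j) q^(j+1) from above.
        Ψ : ℕ → A
        Ψ i = # 5 * (y * y * (# i * # i + # i)) + # 10 * (# i * q * y) + # 10 * q - # 6 * (y * y * S i)

        q≡ : q ≡ # 1 - y
        q≡ = trans (ring (y ∷ q ∷ []) (var 1) (var 0 :+ var 1 :- var 0) refl) (cong (_- y) q+y)

        -- Exactly what is lost is 5/6 (m² + m) - S m ≥ 0, times positive factors.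
        Ψ-step : ∀ m p → # 0 ≤ p → # 6 * (y * y * (# (σ (suc m)) * (q * p))) + (q * p) * Ψ (suc m) ≤ p * Ψ m
        Ψ-step m p 0p rewrite #suc m | q≡ = use potential-step {_} {_} {S m} (hi m) y-nonneg 0p

        Ψ-nonneg : ∀ m → # 0 ≤ Ψ m
        Ψ-nonneg m = use Ψ-positive {_} {_} {S m} (hi m) y-nonneg (#0≤ m) 0≤q

        potential : ∀ i L → # 6 * (y * y * sum L (λ j → # (σ (suc i ℕ.+ j)) * q ^ suc j)) + q ^ L * Ψ (i ℕ.+ L) ≤ Ψ i
        potential i zero = reflexive (trans (cong₂ (λ u v → # 6 * (y * y * # 0) + u * Ψ v) (sym #-1) (ℕₚ.+-identityʳ i))
          (ring (y ∷ Ψ i ∷ []) (con 6 :* (var 0 :* var 0 :* con 0) :+ con 1 :* var 1) (var 1) refl))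
        potential i (suc L) = ≤-trans (≡≤ (trans (cong (λ v → # 6 * (y * y * T (suc L)) + q ^ suc L * Ψ v) (ℕₚ.+-suc i L))
            (ring (y ∷ T L ∷ # (σ (suc (i ℕ.+ L))) ∷ q ∷ q ^ L ∷ Ψ (suc (i ℕ.+ L)) ∷ [])
              (con 6 :* (var 0 :* var 0 :* (var 1 :+ var 2 :* (var 3 :* var 4))) :+ (var 3 :* var 4) :* var 5)
              (con 6 :* (var 0 :* var 0 :* var 1) :+ (con 6 :* (var 0 :* var 0 :* (var 2 :* (var 3 :* var 4))) :+ (var 3 :* var 4) :* var 5)) refl))
            (+-monoʳ (Ψ-step (i ℕ.+ L) (q ^ L) (^0≤ L 0≤q)))) (potential i L)
          where
          T : ℕ → A
          T L = sum L (λ j → # (σ (suc i ℕ.+ j)) * q ^ suc j)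

        -- After division by 300 the potential is 5/3 (1 + iy) plus 7/300 (iy)²; the coefficient
        -- 7/300 = 5/6 - 81/100 is the gap between the two bounds on S.
        W-bound : ∀ i → # 300 * (y * y * (q * W i)) ≤ R n i * (# 500 + # 500 * (# i * y) + # 7 * (# i * y) ^ 2)
        W-bound i = use W-arith first (potential i (n ∸ i)) (*0≤ (^0≤ (n ∸ i) 0≤q) (Ψ-nonneg (i ℕ.+ (n ∸ i)))) (lo i) (reflexive q≡) y-nonneg (#0≤ i) (R-nonneg n i)
          where
          first : q * W i ≤ R n i * sum (n ∸ i) (λ j → # (σ (suc i ℕ.+ j)) * q ^ suc j)
          first = ≡≤ (sym (sum-*ˡ (n ∸ i) q _)) (≤≡ (sum-mono (n ∸ i) (λ j _ →
              ≡≤ (trans (cong (λ v → q * (# (σ (suc i ℕ.+ j)) * v)) (trans (cong (R n) (sym (ℕₚ.+-suc i j))) (R-split n i (suc j))))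
                    (ring (q ∷ # (σ (suc i ℕ.+ j)) ∷ R n i ∷ R (n ∸ i) (suc j) ∷ []) (var 0 :* (var 1 :* (var 2 :* var 3))) (var 2 :* var 1 :* (var 0 :* var 3)) refl))
                (≤≡ (*-monoʳ (*0≤ (R-nonneg n i) (#0≤ (σ (suc i ℕ.+ j)))) (qR≤q^ (n ∸ i) (suc j) (ℕₚ.m∸n≤m n i))) (*-assoc _ _ _))))
            (sum-*ˡ (n ∸ i) (R n i) _))

      -- The inductive step from N to N + 1

      module Step (N : ℕ) (N₁≤N : N₁ ℕ.≤ N) (room : 200 ℕ.* N₁ ℕ.≤ 199 ℕ.* N) (good : Good N) where

        module B = At N N₁≤N good
        open B using (y; y-nonneg; y-small; r; 0≤r; Ω; V)

        n : ℕ
        n = suc N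

        -- σ 0 = 0 removes k = 0, the only term at the new index n, about which nothing is known
        -- yet.
        mean-within⁺ : ∀ {F b : ℕ → A} → (∀ j → j ℕ.≤ N → Within (b (suc j)) (F (suc j))) → Within (mean n b) (mean n F)
        mean-within⁺ {F} {b} h = within-sum (suc n) term
          where
          vanish : ∀ u → # (σ 0) * # 1 * u ≡ # 0
          vanish u = trans (cong (λ v → # v * # 1 * u) σ-zero) (ring (u ∷ []) (con 0 :* con 1 :* var 0) (con 0) refl)
          term : ∀ k → k ℕ.< suc n → Within (# (σ k) * R n k * b k) (# (σ k) * R n k * F k)
          term zero _ = within-≡ (within-≡ᵇ (within-refl ≤-refl) (sym (vanish (b 0)))) (sym (vanish (F 0)))
          term (suc j) (ℕ.s≤s (ℕ.s≤s l)) = within-scale (*0≤ (#0≤ (σ (suc j))) (R-nonneg n (suc j))) (h j l)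

        mean-mono⁺ : ∀ {F G : ℕ → A} → (∀ j → j ℕ.≤ N → F (suc j) ≤ G (suc j)) → mean n F ≤ mean n G
        mean-mono⁺ {F} {G} h = sum-mono (suc n) term
          where
          vanish : ∀ u → # (σ 0) * # 1 * u ≡ # 0
          vanish u = trans (cong (λ v → # v * # 1 * u) σ-zero) (ring (u ∷ []) (con 0 :* con 1 :* var 0) (con 0) refl)
          term : ∀ k → k ℕ.< suc n → # (σ k) * R n k * F k ≤ # (σ k) * R n k * G k
          term zero _ = reflexive (trans (vanish (F 0)) (sym (vanish (G 0))))
          term (suc j) (ℕ.s≤s (ℕ.s≤s l)) = *-monoʳ (*0≤ (#0≤ (σ (suc j))) (R-nonneg n (suc j))) (h j l)

        y≤z : ∀ j → y ≤ z (N ∸ j)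
        y≤z j = z-anti good (ℕₚ.m∸n≤m N j) ℕₚ.≤-refl

        -- A first crude bound on δ n shows ρ n ≤ r.
        X-split : ∀ j → X n (suc j) ≡ δ n + X N j
        X-split j = ring (ρ n ∷ ρ N ∷ ρ (N ∸ j) ∷ []) (var 0 :- var 2) ((var 0 :- var 1) :+ (var 1 :- var 2)) refl

        crude-remainder : Within (# 19 * (y ^ 3 * B.mass pow1 (suc n))) (r * (# 50 * (ρ n - δ n * # n)))
        crude-remainder = within-≡ (within-mono (within-scale 0≤r (mean-within⁺ {F = λ k → # 50 * (X n k - δ n)} {b = λ k → # 19 * (# k * z (n ∸ k) ^ 3)} (λ j _ → term j))) bound)
            (cong (r *_) value)
          where
          term : ∀ j → Within (# 19 * (# (suc j) * z (N ∸ j) ^ 3)) (# 50 * (X n (suc j) - δ n))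
          term j = within-≡ (within-mono (B.X-path j) (≤≡ (*-monoˡ (*0≤ (#0≤ 19) (^0≤ 3 (z-nonneg (N ∸ j)))) (#mono (ℕₚ.n≤1+n j)))
              (ring (# (suc j) ∷ z (N ∸ j) ^ 3 ∷ []) (var 0 :* (con 19 :* var 1)) (con 19 :* (var 0 :* var 1)) refl)))
            (trans (ring (δ n ∷ X N j ∷ []) (con 50 :* var 1) (con 50 :* ((var 0 :+ var 1) :- var 0)) refl)
              (cong (λ v → # 50 * (v - δ n)) (sym (X-split j))))
          bound : r * mean n (λ k → # 19 * (# k * z (n ∸ k) ^ 3)) ≤ # 19 * (y ^ 3 * B.mass pow1 (suc n))
          bound = ≡≤ (trans (cong (r *_) (mean-*ˡ n (# 19) _)) (ring (r ∷ mean n (λ k → # k * z (n ∸ k) ^ 3) ∷ []) (var 0 :* (con 19 :* var 1)) (con 19 :* (var 0 :* var 1)) refl))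
            (*-monoʳ (#0≤ 19) (B.mean-dominated n r 0≤r dom (λ j _ → y≤z j) 3 (ℕₚ.m≤m+n 3 6) pow1 #0≤))
            where
            dom : ∀ j → j ℕ.< n → r * (R n (suc j) * z (N ∸ j) ^ 9) ≤ y ^ 9 * r ^ suc j
            -- So far only ρ n ≤ 1 is known; the missing factor r is supplied by multiplying the
            -- whole estimate by r.
            dom j _ = ≤≡ (*-monoʳ 0≤r (≤-trans (*-monoˡ (^0≤ 9 (z-nonneg (N ∸ j))) (≡≤ (R-shift N j) (≤≡ (*-monoˡ (R-nonneg N j) (ρ≤1 n)) (one-* _)))) (Ω j)))
              (ring (r ∷ y ^ 9 ∷ r ^ j ∷ []) (var 0 :* (var 1 :* var 2)) (var 1 :* (var 0 :* var 2)) refl)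
          value : mean n (λ k → # 50 * (X n k - δ n)) ≡ # 50 * (ρ n - δ n * # n)
          value = trans (mean-*ˡ n (# 50) _) (cong (# 50 *_) (trans (mean-cong n (λ k _ → ring (X n k ∷ δ n ∷ []) (var 0 :- var 1) (var 0 :+ (con 0 :- var 1)) refl))
            (trans (mean-+ n _ _) (trans (cong₂ _+_ (mean-X N) (mean-const n _)) (ring (ρ n ∷ δ n ∷ # n ∷ []) (var 0 :+ (con 0 :- var 1) :* var 2) (var 0 :- var 1 :* var 2) refl)))))

        r-large : # 991 ≤ # 1000 * r
        r-large = ≤-trans (reflexive (sym h-value)) (*-monoʳ (#0≤ 1000) B.h≤r)

        Pos-r : Pos r
        Pos-r p = #Pos 990 (≤-trans r-large (≤≡ (*-monoʳ (#0≤ 1000) p) (*-zero (# 1000))))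

        N≤n : # N ≤ # n
        N≤n = #mono (ℕₚ.n≤1+n N)

        δn-crude : Within (# 1600 * y ^ 2) (# 1000 * δ n)
        δn-crude = within lower upper
          where
          hi-prod : # 1000 * (δ n * # n) ≤ # 2466
          hi-prod = *-cancelˡ Pos-r (use crude-high-arith (low crude-remainder) (B.mass1≤ (suc n)) (ρ≤1 n) r-large 0≤r)
          lo-prod : # 0 - # 2466 * # 1 ≤ # 1000 * (δ n * # n)
          lo-prod = *-cancelˡ Pos-r (use crude-low-arith (upp crude-remainder) (B.mass1≤ (suc n)) (ρ-nonneg n) r-large 0≤r)

          upper : # 1000 * δ n ≤ # 1600 * y ^ 2
          upper with ≤-total (# 0) (δ n)
          ... | inj₁ p = use crude-high hi-prod B.n-lower N≤n p (^0≤ 2 y-nonneg)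
          ... | inj₂ p = use trivial-high p (^0≤ 2 y-nonneg)
          lower : # 0 - # 1600 * y ^ 2 ≤ # 1000 * δ n
          lower with ≤-total (# 0) (δ n)
          ... | inj₁ p = use unflip (use trivial-high (use negate p) (^0≤ 2 y-nonneg))
          ... | inj₂ p = use unflip (use crude-high (use flip lo-prod) B.n-lower N≤n (use negate′ p) (^0≤ 2 y-nonneg))

        ρn≤r : ρ n ≤ r
        ρn≤r = use ρn≤r-arith (upp δn-crude) (reflexive B.q+y) (reflexive (sym B.25r)) y-nonneg y-small

        -- R n (j+1) = ρ n R N j, and ρ n ≤ r provides one more power of r; so the estimates at N
        -- carry over to n.
        moment-bound : ∀ b → b ℕ.≤ 9 → ∀ f → (∀ k → # 0 ≤ f k) → mean n (λ k → f k * z (n ∸ k) ^ b) ≤ y ^ b * B.mass f (suc n)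
        moment-bound b b≤9 f 0f = ≡≤ (sym (one-* _)) (B.mean-dominated n (# 1) (#0≤ 1) dom (λ j _ → y≤z j) b b≤9 f 0f)
          where
          dom : ∀ j → j ℕ.< n → # 1 * (R n (suc j) * z (N ∸ j) ^ 9) ≤ y ^ 9 * r ^ suc j
          dom j _ = ≡≤ (trans (one-* _) (trans (cong (_* z (N ∸ j) ^ 9) (R-shift N j)) (*-assoc _ _ _)))
            (≤≡ (*-mono (*0≤ (R-nonneg N j) (^0≤ 9 (z-nonneg (N ∸ j)))) 0≤r ρn≤r (Ω j))
              (ring (r ∷ y ^ 9 ∷ r ^ j ∷ []) (var 0 :* (var 1 :* var 2)) (var 1 :* (var 0 :* var 2)) refl))

        2≤N : 2 ℕ.≤ N
        2≤N = B.2≤n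

        -- The recursion for ε n, up to the terms of second order collected in T.
        a b : A
        a = ρ n
        b = ρ N

        T : ℕ → A
        T k = b * (X n k * (Y n k - Z n k)) + b * (Y n k * (X n k - Z n k)) - (a - b) * (Y n k * Z n k) + X n k * (Y n k * Z n k)

        Σε : A
        Σε = mean n (λ k → ε (n ∸ k))

        second-difference : ∀ k → X n k - # 2 * Y n k + Z n k ≡ ε n - ε (n ∸ k)
        second-difference k = trans (cong₂ (λ u v → X n k - # 2 * (ρ N - ρ u) + (ρ (N ∸ 1) - ρ v)) (B′ n k) (trans (cong (_∸ k) refl) (B″ k)))
          (ring (ρ n ∷ ρ (n ∸ k) ∷ ρ N ∷ ρ ((n ∸ k) ∸ 1) ∷ ρ (N ∸ 1) ∷ ρ ((n ∸ k) ∸ 1 ∸ 1) ∷ [])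
            ((var 0 :- var 1) :- con 2 :* (var 2 :- var 3) :+ (var 4 :- var 5))
            (((var 0 :- var 2) :- (var 2 :- var 4)) :- ((var 1 :- var 3) :- (var 3 :- var 5))) refl)
          where
          B′ : ∀ m k → (m ∸ 1) ∸ k ≡ (m ∸ k) ∸ 1
          B′ m k = trans (ℕₚ.∸-+-assoc m 1 k) (trans (cong (m ∸_) (ℕₚ.+-comm 1 k)) (sym (ℕₚ.∸-+-assoc m k 1)))
          B″ : ∀ k → (N ∸ 1) ∸ k ≡ ((n ∸ k) ∸ 1) ∸ 1
          B″ k = trans (B′ N k) (cong (_∸ 1) (B′ n k))

        -- `mean-XYZ` with X - 2Y + Z rewritten as ε n - ε(n-k).
        recursion : a * b * (ε n * # n - Σε) + mean n T ≡ a * b * ε n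
        recursion = trans (cong (_+ mean n T) (sym (trans (mean-*ˡ n (a * b) _) (cong (a * b *_) (trans
            (mean-cong n (λ k _ → ring (ε n ∷ ε (n ∸ k) ∷ []) (var 0 :- var 1) (var 0 :+ (con 0 :- con 1) :* var 1) refl))
            (trans (mean-+ n _ _) (trans (cong₂ _+_ (mean-const n (ε n)) (mean-*ˡ n (# 0 - # 1) _))
              (ring (ε n * # n ∷ Σε ∷ []) (var 0 :+ (con 0 :- con 1) :* var 1) (var 0 :- var 1) refl))))))))
          (trans (sym (mean-+ n _ _)) (trans (mean-cong n (λ k _ → trans (cong (λ v → a * b * v + T k) (sym (second-difference k)))
              (ring (a * b * (X n k - # 2 * Y n k + Z n k) ∷ b * (X n k * (Y n k - Z n k)) ∷ b * (Y n k * (X n k - Z n k)) ∷ (a - b) * (Y n k * Z n k) ∷ X n k * (Y n k * Z n k) ∷ [])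
                (var 0 :+ (var 1 :+ var 2 :- var 3 :+ var 4)) (var 0 :+ var 1 :+ var 2 :- var 3 :+ var 4) refl)))
            (identity N 2≤N)))
          where
          identity : ∀ N → 2 ℕ.≤ N → let n = suc N; a = ρ n; b = ρ N in
            mean n (λ k → a * b * (X n k - # 2 * Y n k + Z n k)
                         + b * (X n k * (Y n k - Z n k)) + b * (Y n k * (X n k - Z n k))
                         - (a - b) * (Y n k * Z n k) + X n k * (Y n k * Z n k))
            ≡ a * b * ε n
          identity (suc (suc m)) (ℕ.s≤s (ℕ.s≤s _)) = mean-XYZ m

        -- Finds an s with s ≤ 1/(2y) ≤ s + 1 by descending from m.
        search : ∀ m → # 1 ≤ # 2 * (# m * y) → ∃ λ s → (# 1 ≤ # 2 * (# (suc s) * y)) × (# 2 * (# s * y) ≤ # 1)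
        search zero h = ⊥-elim (#Pos 0 (≤≡ h (ring (y ∷ []) (con 2 :* (con 0 :* var 0)) (con 0) refl)))
        search (suc m) h with ≤-total (# 2 * (# m * y)) (# 1)
        ... | inj₁ p = m , h , p
        ... | inj₂ p = search m p

        -- `T` itself involves ε n through X and through δ n = ε n + δ N. Its size is therefore kept
        -- as an unknown e, for which the final inequality is solved.
        module Bounded (e : A) (0≤e : # 0 ≤ e) (e-within : Within e (ε n)) where

          δn-within : Within (# 50 * e + # 19 * y ^ 3) (# 50 * δ n)
          δn-within = within-≡ (within-+ (within-scale (#0≤ 50) e-within) (Local.δ-here (good N ℕₚ.≤-refl)))
            (ring (δ n ∷ δ N ∷ []) (con 50 :* (var 0 :- var 1) :+ con 50 :* var 1) (con 50 :* var 0) refl)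

          cube≤ : ∀ j → # 19 * y ^ 3 ≤ # 19 * z (N ∸ j) ^ 3
          cube≤ j = *-monoʳ (#0≤ 19) (^-mono 3 y-nonneg (y≤z j))

          X-within : ∀ j → Within (# 50 * e + # (suc j) * (# 19 * z (N ∸ j) ^ 3)) (# 50 * X n (suc j))
          X-within j = within-≡ (within-≡ᵇ (within-+ (within-mono δn-within (+-monoʳ (cube≤ j))) (B.X-path j))
              (trans (ring (e ∷ z (N ∸ j) ^ 3 ∷ # j ∷ []) ((con 50 :* var 0 :+ con 19 :* var 1) :+ var 2 :* (con 19 :* var 1)) (con 50 :* var 0 :+ (var 2 :+ con 1) :* (con 19 :* var 1)) refl)
                (cong (λ v → # 50 * e + v * (# 19 * z (N ∸ j) ^ 3)) (sym (#suc j)))))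
            (trans (ring (δ n ∷ X N j ∷ []) (con 50 :* var 0 :+ con 50 :* var 1) (con 50 :* (var 0 :+ var 1)) refl) (cong (# 50 *_) (sym (X-split j))))

          drop-within : ∀ j → Within (# 50 * e + # (suc j) * (# 19 * z (N ∸ j) ^ 3)) (# 50 * (a - b))
          drop-within j = within-mono δn-within (+-monoʳ (≤-trans (cube≤ j)
            (≡≤ (sym (one-* _)) (*-monoˡ (*0≤ (#0≤ 19) (^0≤ 3 (z-nonneg (N ∸ j)))) (#mono (ℕ.s≤s (ℕ.z≤n {j})))))))

          YZ-within : ∀ j → Within (# (suc j) * (# 13 * z (N ∸ j) ^ 5)) (# 5 * (Y n (suc j) - Z n (suc j)))
          YZ-within j = within-≡ (B.V-path⁺ j) (cong (# 5 *_) (sym (B.X-Y (suc j))))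

          XZ-within : ∀ j → Within (# 5 * e + # 2 * (# (suc j) * (# 13 * z (N ∸ j) ^ 5))) (# 5 * (X n (suc j) - Z n (suc j)))
          XZ-within j = within-≡ (within-mono (within-+ (within-+ (within-scale (#0≤ 5) e-within) (B.V-path j)) (YZ-within j))
              (use merge (*-monoˡ (*0≤ (#0≤ 13) (^0≤ 5 (z-nonneg (N ∸ j)))) (#mono (ℕₚ.n≤1+n j))))) value
            where
            value : # 5 * ε n + # 5 * V N j + # 5 * (Y n (suc j) - Z n (suc j)) ≡ # 5 * (X n (suc j) - Z n (suc j))
            value = trans (cong (λ v → # 5 * ε n + # 5 * V N j + # 5 * (ρ N - ρ v - Z n (suc j))) (B.pred-∸ N j))
              (ring (ρ n ∷ ρ N ∷ ρ (N ∸ 1) ∷ ρ (N ∸ j) ∷ ρ ((N ∸ j) ∸ 1) ∷ Z n (suc j) ∷ [])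
                (con 5 :* ((var 0 :- var 1) :- (var 1 :- var 2)) :+ con 5 :* ((var 1 :- var 2) :- (var 3 :- var 4)) :+ con 5 :* ((var 1 :- var 4) :- var 5))
                (con 5 :* ((var 0 :- var 3) :- var 5)) refl)

          b-within : Within (# 1) b
          b-within = within-mono (within-refl (ρ-nonneg N)) (ρ≤1 N)

          -- The factor 125000 = 50³ = 500 · 50 · 5 clears the denominators of the bounds multiplied
          -- in `T`; the coefficients result from expanding those products.
          envelope : ℕ → A
          envelope k = e * (# 325000 * (pow1 k * z (n ∸ k) ^ 5) + # 47500 * (pow1 k * z (n ∸ k) ^ 3) + # 36100 * (pow2 k * z (n ∸ k) ^ 6))
            + # 370500 * (pow2 k * z (n ∸ k) ^ 8) + # 13718 * (pow3 k * z (n ∸ k) ^ 9)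

          T-within : ∀ j → Within (envelope (suc j)) (# 125000 * T (suc j))
          T-within j = within-≡ (within-≡ᵇ (within-+ (within-+ (within-+ first second) third) fourth)
              (ring (e ∷ # (suc j) ∷ z (N ∸ j) ∷ [])
                (con 500 :* (con 1 :* (cX :* cV)) :+ con 500 :* (con 1 :* (cY :* (con 5 :* var 0 :+ con 2 :* cV))) :+ cX :* (cY :* cY) :+ cX :* (cY :* cY))
                (var 0 :* (con 325000 :* (var 1 :* var 2 :^ 5) :+ con 47500 :* (var 1 :* var 2 :^ 3) :+ con 36100 :* (var 1 :* var 1 :* var 2 :^ 6))
                  :+ con 370500 :* (var 1 :* var 1 :* var 2 :^ 8) :+ con 13718 :* (var 1 :* var 1 :* var 1 :* var 2 :^ 9)) refl))
            (ring (a ∷ b ∷ X n k ∷ Y n k ∷ Z n k ∷ [])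
              (con 500 :* (var 1 :* (con 50 :* var 2 :* (con 5 :* (var 3 :- var 4)))) :+ con 500 :* (var 1 :* (con 50 :* var 3 :* (con 5 :* (var 2 :- var 4))))
                :+ (con 0 :- con 50 :* (var 0 :- var 1) :* (con 50 :* var 3 :* (con 50 :* var 4))) :+ con 50 :* var 2 :* (con 50 :* var 3 :* (con 50 :* var 4)))
              (con 125000 :* (var 1 :* (var 2 :* (var 3 :- var 4)) :+ var 1 :* (var 3 :* (var 2 :- var 4)) :- (var 0 :- var 1) :* (var 3 :* var 4) :+ var 2 :* (var 3 :* var 4))) refl)
            where
            k = suc j
            cX cY cV : Expr
            cX = con 50 :* var 0 :+ var 1 :* (con 19 :* var 2 :^ 3)
            cY = var 1 :* (con 19 :* var 2 :^ 3)
            cV = var 1 :* (con 13 :* var 2 :^ 5)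
            first = within-scale (#0≤ 500) (within-* b-within (within-* (X-within j) (YZ-within j)))
            second = within-scale (#0≤ 500) (within-* b-within (within-* (B.X-path⁺ j) (XZ-within j)))
            third = within-neg (within-* (drop-within j) (within-* (B.X-path⁺ j) (B.Y-path⁺ j)))
            fourth = within-* (X-within j) (within-* (B.X-path⁺ j) (B.Y-path⁺ j))

          meanT-bound : Within (# 181700 * e + # 5185600 * y ^ 4) (# 125000 * mean n T)
          meanT-bound = within-≡ (within-mono (mean-within⁺ {F = λ k → # 125000 * T k} {b = envelope} (λ j _ → T-within j))
            (use T-arith {_} {y} {B.mass pow1 (suc n)} {B.mass pow2 (suc n)} {B.mass pow3 (suc n)} (reflexive linear)
              (moment-bound 5 (ℕₚ.m≤m+n 5 4) pow1 #0≤) (moment-bound 3 (ℕₚ.m≤m+n 3 6) pow1 #0≤) (moment-bound 6 (ℕₚ.m≤m+n 6 3) pow2 B.pow2-nonneg)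
              (moment-bound 8 (ℕₚ.m≤m+n 8 1) pow2 B.pow2-nonneg) (moment-bound 9 ℕₚ.≤-refl pow3 B.pow3-nonneg)
              (B.mass1≤ (suc n)) (B.mass2≤ (suc n)) (B.mass3≤ (suc n)) 0≤e (^0≤ 2 y-nonneg) (^0≤ 4 y-nonneg) y-small y-nonneg))
            (mean-*ˡ n (# 125000) T)
            where
            linear : mean n envelope ≡ e * (# 325000 * mean n (λ k → pow1 k * z (n ∸ k) ^ 5) + # 47500 * mean n (λ k → pow1 k * z (n ∸ k) ^ 3) + # 36100 * mean n (λ k → pow2 k * z (n ∸ k) ^ 6))
              + # 370500 * mean n (λ k → pow2 k * z (n ∸ k) ^ 8) + # 13718 * mean n (λ k → pow3 k * z (n ∸ k) ^ 9)
            linear = trans (mean-+ n _ _) (cong₂ _+_ (trans (mean-+ n _ _) (cong₂ _+_ (trans (mean-*ˡ n e _) (cong (e *_)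
                (trans (mean-+ n _ _) (cong₂ _+_ (trans (mean-+ n _ _) (cong₂ _+_ (mean-*ˡ n _ _) (mean-*ˡ n _ _))) (mean-*ˡ n _ _))))) (mean-*ˡ n _ _))) (mean-*ˡ n _ _))

          module Shifted (s : ℕ) (long : # 1 ≤ # 2 * (# (suc s) * y)) (short : # 2 * (# s * y) ≤ # 1) where

            -- 200 (s+1) y² ≤ 100 y + 200 y² < 0.92, whereas y² N ≥ 1.57.
            200s≤N : 200 ℕ.* suc s ℕ.≤ N
            200s≤N = #reflect (≡≤ (trans (#-* 200 (suc s)) (cong (# 200 *_) (#suc s)))
              (*-cancelˡ (Pos-^ 2 (z-pos N)) (use shift-small short B.n-lower y-small y-nonneg)))

            s≤N : s ℕ.≤ N
            s≤N = ℕₚ.≤-trans (ℕₚ.n≤1+n s) (ℕₚ.≤-trans (ℕₚ.m≤n*m (suc s) 200) 200s≤N)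

            n′ : ℕ
            n′ = N ∸ s

            N₁≤n′ : N₁ ℕ.≤ n′
            N₁≤n′ = ℕₚ.m+n≤o⇒m≤o∸n N₁ (ℕₚ.*-cancelˡ-≤ 200 (ℕₚ.≤-trans
              (ℕₚ.≤-reflexive (ℕₚ.*-distribˡ-+ 200 N₁ s))
              (ℕₚ.≤-trans (ℕₚ.+-mono-≤ room (ℕₚ.≤-trans (ℕₚ.*-monoʳ-≤ 200 (ℕₚ.n≤1+n s)) 200s≤N)) (ℕₚ.≤-reflexive (ℕₚ.+-comm (199 ℕ.* N) N)))))

            good′ : Good n′
            good′ m l = good m (ℕₚ.≤-trans l (ℕₚ.m∸n≤m N s))

            module C = At n′ N₁≤n′ good′

            y′ Rs : A
            y′ = z n′
            Rs = R n (suc s)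

            y≤y′ : y ≤ y′
            y≤y′ = y≤z s

            m₀≤ : ∀ j → j ℕ.≤ s → m₀ ℕ.≤ N ∸ j
            m₀≤ j j≤s = ℕₚ.≤-trans m₀≤M₀ (ℕₚ.≤-trans M₀≤N₁ (ℕₚ.≤-trans N₁≤n′ (ℕₚ.∸-monoʳ-≤ N j≤s)))

            -- Over at most 1/(2y) steps z grows so little that 0.38 z³ stays below 0.4 y³, so the
            -- increments add up linearly.
            close : ∀ j → j ℕ.≤ s → # 1000 * z (N ∸ j) ≤ # 1000 * y + # 400 * (# j * y ^ 3)
            close zero _ = reflexive (ring (y ∷ []) (con 1000 :* var 0) (con 1000 :* var 0 :+ con 400 :* (con 0 :* var 0 :^ 3)) refl)
            close (suc j) j<s = ≤≡ (use near-step {z (N ∸ j)} IH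
                (use near-cube (^-mono 3 (*0≤ (#0≤ 500) (z-nonneg (N ∸ j))) (use near IH (use short-mono (#mono j≤s) y-nonneg short) y-nonneg y-small)) (^0≤ 3 y-nonneg))
                (upp (Local.δ-here (good (N ∸ j) (ℕₚ.m∸n≤m N j))))
                (reflexive (z-high (N ∸ suc j) (m₀≤ (suc j) j<s))) (reflexive (sym (z-high (N ∸ j) (m₀≤ j j≤s))))
                (reflexive (cong (λ v → ρ (N ∸ j) - ρ v) (B.pred-∸ N j))))
              (cong (λ v → # 1000 * y + # 400 * (v * y ^ 3)) (sym (#suc j)))
              where
              j≤s = ℕₚ.≤-trans (ℕₚ.n≤1+n j) j<s
              IH = close j j≤s

            y′-near : # 500 * y′ ≤ # 501 * y
            y′-near = use near (close s ℕₚ.≤-refl) short y-nonneg y-small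

            -- Bernoulli's inequality for the factors 1 - z(N-i), each with z(N-i) ≤ y′. As s y is
            -- at most 1/2, this keeps `Rs` above 0.48.
            R-low : ∀ j → j ℕ.≤ s → ρ n - # j * y′ ≤ R n (suc j)
            R-low zero _ = reflexive (ring (ρ n ∷ y′ ∷ []) (var 0 :- con 0 :* var 1) (con 1 :* var 0) refl)
            R-low (suc j) j<s = ≡≤ (cong (λ v → ρ n - v * y′) (#suc j))
              (use R-step {_} {_} {_} {_} {z (N ∸ j)} (R-low j j≤s) (R≤1 n (suc j)) (reflexive (z-high (N ∸ j) (m₀≤ j j≤s))) (reflexive (sym (z-high (N ∸ j) (m₀≤ j j≤s))))
                (z-anti good (ℕₚ.∸-monoʳ-≤ N j≤s) (ℕₚ.m∸n≤m N j)) (z-nonneg (N ∸ j)) (ρ≤1 (N ∸ j)) (ρ-nonneg (N ∸ j)))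
              where j≤s = ℕₚ.≤-trans (ℕₚ.n≤1+n j) j<s

            Rs-low : # 48 ≤ # 100 * Rs
            Rs-low = use Rs-arith {_} {_} {_} {_} {# s} (R-low s ℕₚ.≤-refl) (low δn-crude) (reflexive (sym B.q+y)) y′-near short y-small y-nonneg (#0≤ s)

            Rs-nonneg : # 0 ≤ Rs
            Rs-nonneg = R-nonneg n (suc s)

            index : suc n ≡ suc s ℕ.+ suc n′
            index = trans (cong (λ v → suc (suc v)) (sym (ℕₚ.m+[n∸m]≡n s≤N))) (cong suc (sym (ℕₚ.+-suc s n′)))

            mean-split : ∀ F → mean n F ≡ sum (suc s) (λ k → # (σ k) * R n k * F k)
              + sum (suc n′) (λ i → # (σ (suc s ℕ.+ i)) * (Rs * R n′ i) * F (suc s ℕ.+ i))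
            mean-split F = trans (cong (λ v → sum v (λ k → # (σ k) * R n k * F k)) index)
              (trans (sum-split (suc s) (suc n′) _) (cong (sum (suc s) (λ k → # (σ k) * R n k * F k) +_)
                (sum-cong (suc n′) (λ i _ → cong (λ v → # (σ (suc s ℕ.+ i)) * v * F (suc s ℕ.+ i)) (R-split n (suc s) i)))))

            -- The coefficient of ε (n′ ∸ i) after subtracting a multiple of the constraint at n′.
            coeff excess : ℕ → A
            coeff i = # 4900 * (# 100 * (# (σ (suc s ℕ.+ i)) * (Rs * R n′ i)) - # 29 * (y′ * (Rs * C.W i)))
            excess i = # 29 * (y′ * (Rs * C.W i) * (# i * y′) ^ 2)

            long′ : # 1 ≤ # 2 * (# (suc s) * y′)
            long′ = ≤-trans long (*-monoʳ (#0≤ 2) (*-monoʳ (#0≤ (suc s)) y≤y′))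

            RsW-nonneg : ∀ i → # 0 ≤ y′ * (Rs * C.W i)
            RsW-nonneg i = *0≤ C.y-nonneg (*0≤ Rs-nonneg (C.W-nonneg i))

            excess-nonneg : ∀ i → # 0 ≤ excess i
            excess-nonneg i = *0≤ (#0≤ 29) (*0≤ (RsW-nonneg i) (^0≤ 2 (*0≤ (#0≤ i) C.y-nonneg)))

            -- σ(s+1+i) is at least s + 1 + i ≥ (1/2 + i y′)/y′, while 0.29 y′ times W i is about
            -- 0.29 · 5/3 (1 + i y′)/y′ times R n′ i; and 0.29 · 5/3 < 1/2. The quadratic term of
            -- `W-bound` spoils this only for i y′ > 70, where (i y′)² / 4900 exceeds 1 and `excess`
            -- makes up for it.
            coeff+excess : ∀ i → # 0 ≤ coeff i + excess i
            coeff+excess i with ≤-total (# i * y′) (# 70)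
            ... | inj₂ big = use large-case {R n′ i} big (RsW-nonneg i) (*0≤ (#0≤ (σ (suc s ℕ.+ i))) (*0≤ Rs-nonneg (R-nonneg n′ i)))
            ... | inj₁ small = use small-case {R n′ i} {_} {C.W i}
                (*-cancelˡ (Pos-* (z-pos n′) C.Pos-q) (use dominated-small (C.W-bound i) long′ (use q-large (reflexive (sym C.q+y)) C.y-small) small
                  (*0≤ (#0≤ i) C.y-nonneg) (R-nonneg n′ i) C.y-nonneg ≤-refl (≡≤ (sym (#-+ (suc s) i)) (#mono (σ-≥ (suc s ℕ.+ i))))))
                Rs-nonneg (*0≤ (RsW-nonneg i) (^0≤ 2 (*0≤ (#0≤ i) C.y-nonneg)))

            -- From k + e ≥ 0 and e ≥ 0 one gets |k| ≤ k + 2e, so the sign of the coefficient need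
            -- not be decided.
            within-signed : ∀ {k e E x} → # 0 ≤ k + e → # 0 ≤ e → Within E x → Within ((k + # 2 * e) * E) (k * x)
            within-signed p q w = within (use abs-lower p q (upp w) (low w)) (use abs-upper p q (upp w) (low w))

            head-bound tail-bound : A
            head-bound = sum (suc s) (λ k → # 490000 * (# (σ k) * R n k) * (# 13 * z (n ∸ k) ^ 5))
            tail-bound = sum (suc n′) (λ i → (coeff i + # 2 * excess i) * (# 13 * z (n′ ∸ i) ^ 5))

            -- The sum for `Σε` is split after s. The head keeps its weights; in the tail the
            -- relation at `n′` is subtracted before absolute values are taken, so the tail weights
            -- become smaller.
            combined : Within (head-bound + tail-bound) (# 24500 * (# 100 * Σε - # 29 * (y′ * (Rs * C.meanV))))
            combined = within-≡ (within-+ (within-sum (suc s) head-term) (within-sum (suc n′) tail-term)) value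
              where
              head-term : ∀ k → k ℕ.< suc s → Within (# 490000 * (# (σ k) * R n k) * (# 13 * z (n ∸ k) ^ 5)) (# 490000 * (# (σ k) * R n k) * (# 5 * ε (n ∸ k)))
              head-term zero _ = within-≡ (within-≡ᵇ (within-refl ≤-refl) (vanish (# 13 * z n ^ 5))) (vanish (# 5 * ε n))
                where
                vanish : ∀ u → # 0 ≡ # 490000 * (# (σ 0) * # 1) * u
                vanish u = trans (ring (u ∷ []) (con 0) (con 490000 :* (con 0 :* con 1) :* var 0) refl) (cong (λ v → # 490000 * (# v * # 1) * u) (sym σ-zero))
              head-term (suc k) _ = within-scale (*0≤ (#0≤ 490000) (*0≤ (#0≤ (σ (suc k))) (R-nonneg n (suc k)))) (Local.ε-here (good (N ∸ k) (ℕₚ.m∸n≤m N k)))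
              tail-term : ∀ i → i ℕ.< suc n′ → Within ((coeff i + # 2 * excess i) * (# 13 * z (n′ ∸ i) ^ 5)) (coeff i * (# 5 * ε (n′ ∸ i)))
              tail-term i _ = within-signed (coeff+excess i) (excess-nonneg i) (Local.ε-here (good′ (n′ ∸ i) (ℕₚ.m∸n≤m n′ i)))
              value : sum (suc s) (λ k → # 490000 * (# (σ k) * R n k) * (# 5 * ε (n ∸ k))) + sum (suc n′) (λ i → coeff i * (# 5 * ε (n′ ∸ i)))
                ≡ # 24500 * (# 100 * Σε - # 29 * (y′ * (Rs * C.meanV)))
              value = begin
                sum (suc s) (λ k → # 490000 * (# (σ k) * R n k) * (# 5 * ε (n ∸ k))) + sum (suc n′) (λ i → coeff i * (# 5 * ε (n′ ∸ i)))
                  ≡⟨ cong₂ _+_ (trans (sum-cong (suc s) (λ k _ → ring (# (σ k) * R n k ∷ ε (n ∸ k) ∷ []) (con 490000 :* var 0 :* (con 5 :* var 1)) (con 2450000 :* (var 0 :* var 1)) refl))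
                       (sum-*ˡ (suc s) (# 2450000) _))
                     (trans (sum-cong (suc n′) (λ i _ → trans (split i) (cong (λ v → # 2450000 * (# (σ (suc s ℕ.+ i)) * (Rs * R n′ i) * ε v) + (# 0 - # 710500) * (y′ * Rs) * (ε (n′ ∸ i) * C.W i)) (ℕₚ.∸-+-assoc N s i))))
                       (trans (sum-+ (suc n′) _ _) (cong₂ _+_ (sum-*ˡ (suc n′) (# 2450000) _) (trans (sum-*ˡ (suc n′) ((# 0 - # 710500) * (y′ * Rs)) _) (cong ((# 0 - # 710500) * (y′ * Rs) *_) C.constraint))))) ⟩
                # 2450000 * sum (suc s) (λ k → # (σ k) * R n k * ε (n ∸ k))
                  + (# 2450000 * sum (suc n′) (λ i → # (σ (suc s ℕ.+ i)) * (Rs * R n′ i) * ε (n ∸ (suc s ℕ.+ i))) + (# 0 - # 710500) * (y′ * Rs) * C.meanV)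
                  ≡⟨ ring (sum (suc s) (λ k → # (σ k) * R n k * ε (n ∸ k)) ∷ sum (suc n′) (λ i → # (σ (suc s ℕ.+ i)) * (Rs * R n′ i) * ε (n ∸ (suc s ℕ.+ i))) ∷ y′ ∷ Rs ∷ C.meanV ∷ [])
                       (con 2450000 :* var 0 :+ (con 2450000 :* var 1 :+ (con 0 :- con 710500) :* (var 2 :* var 3) :* var 4))
                       (con 24500 :* (con 100 :* (var 0 :+ var 1) :- con 29 :* (var 2 :* (var 3 :* var 4)))) refl ⟩
                # 24500 * (# 100 * (sum (suc s) (λ k → # (σ k) * R n k * ε (n ∸ k)) + sum (suc n′) (λ i → # (σ (suc s ℕ.+ i)) * (Rs * R n′ i) * ε (n ∸ (suc s ℕ.+ i)))) - # 29 * (y′ * (Rs * C.meanV)))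
                  ≡⟨ cong (λ v → # 24500 * (# 100 * v - # 29 * (y′ * (Rs * C.meanV)))) (sym (mean-split (λ k → ε (n ∸ k)))) ⟩
                # 24500 * (# 100 * Σε - # 29 * (y′ * (Rs * C.meanV))) ∎
                where
                split : ∀ i → coeff i * (# 5 * ε (n′ ∸ i)) ≡ # 2450000 * (# (σ (suc s ℕ.+ i)) * (Rs * R n′ i) * ε (n′ ∸ i)) + (# 0 - # 710500) * (y′ * Rs) * (ε (n′ ∸ i) * C.W i)
                split i = ring (# (σ (suc s ℕ.+ i)) ∷ Rs ∷ R n′ i ∷ y′ ∷ C.W i ∷ ε (n′ ∸ i) ∷ [])
                  (con 4900 :* (con 100 :* (var 0 :* (var 1 :* var 2)) :- con 29 :* (var 3 :* (var 1 :* var 4))) :* (con 5 :* var 5))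
                  (con 2450000 :* (var 0 :* (var 1 :* var 2) :* var 5) :+ (con 0 :- con 710500) :* (var 3 :* var 1) :* (var 5 :* var 4)) refl

            -- Where z is 1 - ρ this is the bound on X; below `m₀` the right-hand side is already at
            -- least 19 · 8.
            z-deviation : ∀ j → j ℕ.≤ N → # 50 * (z (N ∸ j) - y) ≤ # (suc j) * (# 19 * z (N ∸ j) ^ 3)
            z-deviation j j≤N with ℕₚ.≤-total m₀ (N ∸ j)
            ... | inj₁ le = use deviation-high (reflexive (z-high (N ∸ j) le)) (reflexive (sym B.q+y)) (upp (B.X-path j)) (#mono (ℕₚ.n≤1+n j)) (*0≤ (#0≤ 19) (^0≤ 3 (z-nonneg (N ∸ j))))
            ... | inj₂ ge with ℕₚ.m≤n⇒m<n∨m≡n ge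
            ...   | inj₂ e = use deviation-high (reflexive (z-high (N ∸ j) (ℕₚ.≤-reflexive (sym e)))) (reflexive (sym B.q+y)) (upp (B.X-path j)) (#mono (ℕₚ.n≤1+n j)) (*0≤ (#0≤ 19) (^0≤ 3 (z-nonneg (N ∸ j))))
            ...   | inj₁ lt = ≤≡ (use deviation-low (reflexive (z-low (N ∸ j) lt)) (reflexive (sym (z-low (N ∸ j) lt))) (#mono (ℕ.s≤s (ℕ.z≤n {j}))) y-nonneg)
                (cong (λ v → # (suc j) * (# 19 * v ^ 3)) (sym (z-low (N ∸ j) lt)))

            S₅ : A
            S₅ = mean n (λ k → z (n ∸ k) ^ 5)

            -- Convexity, u⁵ ≤ y⁵ + 5 u⁴ (u - y), together with u - y ≤ 0.38 k u³.
            S₅-bound : # 10 * S₅ ≤ # 10 * (y ^ 5 * # n) + # 19 * (y ^ 7 * B.mass pow1 (suc n))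
            S₅-bound = ≡≤ (sym (mean-*ˡ n (# 10) _)) (≤-trans (mean-mono⁺ {G = λ k → # 10 * y ^ 5 + # 19 * (pow1 k * z (n ∸ k) ^ 7)} term)
              (≡≤ (trans (mean-+ n _ _) (cong₂ _+_ (trans (mean-const n _) (*-assoc _ _ _)) (mean-*ˡ n (# 19) _)))
                (+-monoʳ (*-monoʳ (#0≤ 19) (moment-bound 7 (ℕₚ.m≤m+n 7 2) pow1 #0≤)))))
              where
              term : ∀ j → j ℕ.≤ N → # 10 * z (N ∸ j) ^ 5 ≤ # 10 * y ^ 5 + # 19 * (# (suc j) * z (N ∸ j) ^ 7)
              term j j≤N = use fifth-cube {_} {_} {# (suc j)} (use fifth-growth y-nonneg (y≤z j)) (≤≡ (z-deviation j j≤N)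
                (ring (# (suc j) ∷ z (N ∸ j) ^ 3 ∷ []) (var 0 :* (con 19 :* var 1)) (con 19 :* (var 0 :* var 1)) refl)) (^0≤ 4 (z-nonneg (N ∸ j)))

            P₅ M₅ : A
            P₅ = sum (suc n′) (λ i → C.W i * z (n′ ∸ i) ^ 5)
            M₅ = sum (suc n′) (λ i → # i * # i * (C.W i * z (n′ ∸ i) ^ 5))

            P₅-bound : y ^ 5 * C.meanK ≤ P₅
            P₅-bound = ≡≤ (trans (cong (y ^ 5 *_) (sym C.W-total)) (sym (sum-*ˡ (suc n′) (y ^ 5) C.W)))
              (sum-mono (suc n′) (λ i _ → ≡≤ (*-comm _ _) (*-monoʳ (C.W-nonneg i) (^-mono 5 y-nonneg
                (≤-trans y≤y′ (z-anti good′ (ℕₚ.m∸n≤m n′ i) ℕₚ.≤-refl))))))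

            M₅-bound : # 3 * M₅ ≤ y′ ^ 5 * C.mass pow3 (suc n′)
            M₅-bound = ≡≤ (trans (sym (sum-*ˡ (suc n′) (# 3) _)) (sum-cong (suc n′) (λ i _ → sym (*-assoc _ _ _)))) C.W-moment

            bound-value : head-bound + tail-bound ≡ # 6370000 * S₅ + Rs * (# 754 * (y′ ^ 3 * M₅) - # 1847300 * (y′ * P₅))
            bound-value = begin
              head-bound + tail-bound
                ≡⟨ cong₂ _+_ (trans (sum-cong (suc s) (λ k _ → ring (# (σ k) * R n k ∷ z (n ∸ k) ^ 5 ∷ []) (con 490000 :* var 0 :* (con 13 :* var 1)) (con 6370000 :* (var 0 :* var 1)) refl)) (sum-*ˡ (suc s) (# 6370000) _))
                    (trans (sum-cong (suc n′) (λ i _ → trans (split i) (cong (λ v → # 6370000 * (# (σ (suc s ℕ.+ i)) * (Rs * R n′ i) * z v ^ 5)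
                        + ((# 0 - # 1847300) * (y′ * Rs) * (C.W i * z (n′ ∸ i) ^ 5) + # 754 * (y′ ^ 3 * Rs) * (# i * # i * (C.W i * z (n′ ∸ i) ^ 5)))) (ℕₚ.∸-+-assoc N s i))))
                      (trans (sum-+ (suc n′) _ _) (cong₂ _+_ (sum-*ˡ (suc n′) (# 6370000) _)
                        (trans (sum-+ (suc n′) _ _) (cong₂ _+_ (sum-*ˡ (suc n′) ((# 0 - # 1847300) * (y′ * Rs)) _) (sum-*ˡ (suc n′) (# 754 * (y′ ^ 3 * Rs)) _)))))) ⟩
              # 6370000 * h₁ + (# 6370000 * h₂ + ((# 0 - # 1847300) * (y′ * Rs) * P₅ + # 754 * (y′ ^ 3 * Rs) * M₅))
                ≡⟨ ring (h₁ ∷ h₂ ∷ y′ ∷ Rs ∷ P₅ ∷ M₅ ∷ [])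
                     (con 6370000 :* var 0 :+ (con 6370000 :* var 1 :+ ((con 0 :- con 1847300) :* (var 2 :* var 3) :* var 4 :+ con 754 :* (var 2 :^ 3 :* var 3) :* var 5)))
                     (con 6370000 :* (var 0 :+ var 1) :+ var 3 :* (con 754 :* (var 2 :^ 3 :* var 5) :- con 1847300 :* (var 2 :* var 4))) refl ⟩
              # 6370000 * (h₁ + h₂) + Rs * (# 754 * (y′ ^ 3 * M₅) - # 1847300 * (y′ * P₅))
                ≡⟨ cong (λ v → # 6370000 * v + Rs * (# 754 * (y′ ^ 3 * M₅) - # 1847300 * (y′ * P₅))) (sym (mean-split (λ k → z (n ∸ k) ^ 5))) ⟩
              # 6370000 * S₅ + Rs * (# 754 * (y′ ^ 3 * M₅) - # 1847300 * (y′ * P₅)) ∎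
              where
              h₁ h₂ : A
              h₁ = sum (suc s) (λ k → # (σ k) * R n k * z (n ∸ k) ^ 5)
              h₂ = sum (suc n′) (λ i → # (σ (suc s ℕ.+ i)) * (Rs * R n′ i) * z (n ∸ (suc s ℕ.+ i)) ^ 5)
              split : ∀ i → (coeff i + # 2 * excess i) * (# 13 * z (n′ ∸ i) ^ 5) ≡ # 6370000 * (# (σ (suc s ℕ.+ i)) * (Rs * R n′ i) * z (n′ ∸ i) ^ 5)
                + ((# 0 - # 1847300) * (y′ * Rs) * (C.W i * z (n′ ∸ i) ^ 5) + # 754 * (y′ ^ 3 * Rs) * (# i * # i * (C.W i * z (n′ ∸ i) ^ 5)))
              split i = ring (# (σ (suc s ℕ.+ i)) ∷ Rs ∷ R n′ i ∷ y′ ∷ C.W i ∷ # i ∷ z (n′ ∸ i) ^ 5 ∷ [])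
                ((con 4900 :* (con 100 :* (var 0 :* (var 1 :* var 2)) :- con 29 :* (var 3 :* (var 1 :* var 4))) :+ con 2 :* (con 29 :* (var 3 :* (var 1 :* var 4) :* (var 5 :* var 3) :^ 2))) :* (con 13 :* var 6))
                (con 6370000 :* (var 0 :* (var 1 :* var 2) :* var 6) :+ ((con 0 :- con 1847300) :* (var 3 :* var 1) :* (var 4 :* var 6) :+ con 754 :* (var 3 :^ 3 :* var 1) :* (var 5 :* var 5 :* (var 4 :* var 6)))) refl

            -- 637/245 = 13/5 is the constant of the hypothesis. The term -165 y³ is the gain: the
            -- subtracted weight outweighs both the bound on `meanV` and the growth of z⁵ in the
            -- mean.
            Σε-within : Within (# 637 * (y ^ 5 * # n) - # 165 * y ^ 3) (# 245 * Σε)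
            Σε-within = within
              (use unflip-E (core (≤≡ (use flip-low (low combined)) bound-value) (use flip-V (low C.meanV-bound))))
              (core (≤≡ (upp combined) bound-value) (upp C.meanV-bound))
              where
              vc : # 1000 * y′ ^ 3 ≤ # 1007 * y ^ 3
              vc = use v-cube {y′} (^-mono 3 (*0≤ (#0≤ 500) C.y-nonneg) y′-near) (^0≤ 3 y-nonneg)
              core : ∀ {E V} → # 24500 * (# 100 * E - # 29 * (y′ * (Rs * V))) ≤ # 6370000 * S₅ + Rs * (# 754 * (y′ ^ 3 * M₅) - # 1847300 * (y′ * P₅)) →
                # 100 * V ≤ # 177 * y′ ^ 2 → # 245 * E ≤ # 637 * (y ^ 5 * # n) - # 165 * y ^ 3
              core {E} {V} first hV = use Σε-arith {_} {_} {_} {_} {_} {y′ ^ 3 * M₅} {y′ * P₅} first (use S-high {_} {_} {B.mass pow1 (suc n)} S₅-bound (B.mass1≤ (suc n)) y-small y-nonneg (^0≤ 3 y-nonneg) (^0≤ 4 y-nonneg))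
                (use bracket {_} {_} {_} {_} {y}
                  (*-cancelˡ (Pos-^ 2 (z-pos n′)) (use P-low P₅-bound C.meanK-lower y′-near C.y-nonneg y-nonneg (^0≤ 3 C.y-nonneg) (^0≤ 3 y-nonneg)))
                  (use M-high {_} {_} {C.mass pow3 (suc n′)} M₅-bound (C.mass3≤ (suc n′)) vc (^0≤ 3 C.y-nonneg) (^0≤ 3 y-nonneg))
                  (use V-high {_} {_} {y} hV vc C.y-nonneg (^0≤ 3 y-nonneg)) Rs-low Rs-nonneg (^0≤ 3 y-nonneg))
                (^0≤ 3 y-nonneg)

            b-large : # 991 ≤ # 1000 * b
            b-large = use q-large (reflexive (sym B.q+y)) y-small

            p-big : # 98 ≤ # 100 * (a * b)
            p-big = use p-large (low δn-crude) b-large y-small y-nonneg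

            Pos-p : Pos (a * b)
            Pos-p h = #Pos 97 (≤-trans p-big (≤≡ (*-monoʳ (#0≤ 100) h) (*-zero (# 100))))

            Pos-n : Pos (# 2 * # n - # 5)
            Pos-n h = #Pos 0 (≤-trans (use n-large B.n-lower y-small y-nonneg N≤n (#0≤ N)) h)

            -- The gain in `Σε-within` also covers the mean of T, about 41.5 y⁴ ≤ 0.374 y³ apart
            -- from multiples of e. For negative ε n the signs in `recursion` are reversed.
            e-bound : ε n ≡ e ⊎ ε n ≡ # 0 - e → # 2 * e ≤ # 5 * y ^ 5
            e-bound c = *-cancelˡ Pos-n (use contract-last (*-cancelˡ Pos-p (core c)) B.n-upper b-large (reflexive (#suc N)) y-small y-nonneg (^0≤ 3 y-nonneg) (#0≤ N) (^0≤ 5 y-nonneg))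
              where
              core : ε n ≡ e ⊎ ε n ≡ # 0 - e → a * b * (# 1000 * (e * # n)) ≤ a * b * (# 2500 * e + # 2600 * (y ^ 5 * # n) - # 290 * y ^ 3)
              core (inj₁ eq) = use contract {_} {_} {_} {Σε} {mean n T}
                (reflexive (trans (cong (λ v → a * b * (v * # n - Σε) + mean n T) (sym eq)) (trans recursion (cong (a * b *_) eq))))
                (upp Σε-within) (low meanT-bound) p-big (pos⇒0≤ Pos-p) 0≤e (^0≤ 3 y-nonneg) y-small
              core (inj₂ eq) = use contract {_} {_} {_} {# 0 - Σε} {# 0 - mean n T}
                (use negated (reflexive rec) (reflexive (sym rec))) (use negated-high (low Σε-within)) (use negated-low (upp meanT-bound)) p-big (pos⇒0≤ Pos-p) 0≤e (^0≤ 3 y-nonneg) y-small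
                where
                rec : a * b * ((# 0 - e) * # n - Σε) + mean n T ≡ a * b * (# 0 - e)
                rec = trans (cong (λ v → a * b * (v * # n - Σε) + mean n T) (sym eq)) (trans recursion (cong (a * b *_) eq))

        magnitude : ∀ x → ∃ λ e → (# 0 ≤ e) × Within e x × (x ≡ e ⊎ x ≡ # 0 - e)
        magnitude x with ≤-total (# 0) x
        ... | inj₁ h = x , h , within-refl h , inj₁ refl
        ... | inj₂ h = (# 0 - x) , use neg-nonneg h , within-≡ (within-neg (within-refl (use neg-nonneg h))) double , inj₂ (sym double)
          where
          double : # 0 - (# 0 - x) ≡ x
          double = ring (x ∷ []) (con 0 :- (con 0 :- var 0)) (var 0) refl

        -- The constant 5/2 is strictly better than the 13/5 assumed, which pays for replacing y = z
        -- N by the smaller z n.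
        εn-small : Within (# 5 * y ^ 5) (# 2 * ε n)
        εn-small = settle (magnitude (ε n)) (search N (use search-start {y} {# N} B.n-lower y-small y-nonneg (#0≤ N)))
          where
          settle : ∃ (λ e → (# 0 ≤ e) × Within e (ε n) × (ε n ≡ e ⊎ ε n ≡ # 0 - e)) →
            ∃ (λ s → (# 1 ≤ # 2 * (# (suc s) * y)) × (# 2 * (# s * y) ≤ # 1)) → Within (# 5 * y ^ 5) (# 2 * ε n)
          settle (e , 0≤e , w , c) (s , long , short) = within (use e-low {ε n} {e} {y ^ 5} (low w) bound) (use e-upp {ε n} {e} {y ^ 5} (upp w) bound)
            where
            bound : # 2 * e ≤ # 5 * y ^ 5
            bound = Bounded.Shifted.e-bound e 0≤e w s long short c

        δn-nonneg : # 0 ≤ δ n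
        δn-nonneg = use δ-grow-low B.δ-lower (low εn-small) y-small y-nonneg (^0≤ 3 y-nonneg)

        δn-upper : # 1000 * δ n ≤ # 375 * y ^ 3
        δn-upper = use δ-grow-high B.δ-upper (upp εn-small) y-small y-nonneg (^0≤ 3 y-nonneg)

        m₀≤N : m₀ ℕ.≤ N
        m₀≤N = B.m₀≤n

        zn-near : # 9999 * y ≤ # 10000 * z n
        zn-near = use z-near (reflexive (sym (z-high n (ℕₚ.m≤n⇒m≤1+n m₀≤N)))) (reflexive B.q+y) δn-upper y-small y-nonneg

        zn-fall : z n ≤ z N
        zn-fall = use z-fall (reflexive (z-high n (ℕₚ.m≤n⇒m≤1+n m₀≤N))) (reflexive (sym B.q+y)) δn-nonneg

        next : Local n
        next = record
          { z-dec  = zn-fall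
          ; δ-here = within (use δ-here-low δn-nonneg (^0≤ 3 (z-nonneg n))) (use δ-here-high δn-upper cube (^0≤ 3 y-nonneg))
          ; δ-prev = within (use δ-here-low B.δ-nonneg (^0≤ 3 (z-nonneg n))) (use δ-here-high {_} {_} {y} (use relax B.δ-upper (^0≤ 3 y-nonneg)) cube (^0≤ 3 y-nonneg))
          ; ε-here = within (use ε-here-low {_} {_} {y} (low εn-small) fifths (^0≤ 5 y-nonneg)) (use ε-here-high {_} {_} {y} (upp εn-small) fifths (^0≤ 5 y-nonneg))
          }
          where
          cube : # 9996 * y ^ 3 ≤ # 10000 * z n ^ 3
          cube = use cube-near (^-mono 3 (*0≤ (#0≤ 9999) y-nonneg) zn-near) (^0≤ 3 y-nonneg)
          fifths : # 9994 * y ^ 5 ≤ # 10000 * z n ^ 5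
          fifths = use fifth-near (^-mono 5 (*0≤ (#0≤ 9999) y-nonneg) zn-near) (^0≤ 5 y-nonneg)

      -- The induction and the inequality for large n

      module Induction (N₀ : ℕ) (N₁≤N₀ : N₁ ℕ.≤ N₀) (room : 200 ℕ.* N₁ ℕ.≤ 199 ℕ.* N₀) (base : Good N₀) where

        good : ∀ k → Good (N₀ ℕ.+ k)
        good zero m l = base m (ℕₚ.≤-trans l (ℕₚ.≤-reflexive (ℕₚ.+-identityʳ N₀)))
        good (suc k) m l with ℕₚ.m≤n⇒m<n∨m≡n (ℕₚ.≤-trans l (ℕₚ.≤-reflexive (ℕₚ.+-suc N₀ k)))
        ... | inj₁ (ℕ.s≤s h) = good k m h
        ... | inj₂ refl = Step.next (N₀ ℕ.+ k) (ℕₚ.≤-trans N₁≤N₀ (ℕₚ.m≤m+n N₀ k))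
                (ℕₚ.≤-trans room (ℕₚ.*-monoʳ-≤ 199 (ℕₚ.m≤m+n N₀ k))) (good k)

        good-all : ∀ n → Good n
        good-all n m l = good n m (ℕₚ.≤-trans l (ℕₚ.m≤n+m n N₀))

        -- 4 · 0.2487³ ≈ 0.06153 against 2.6² · 0.009 = 0.06084: the margin 0.0006 u⁹ in `turan-gap`
        -- is what y ≤ 0.009 leaves.
        turan : ∀ n → N₁ ℕ.≤ n → Pos (# 4 * (δ n * δ (suc n) ^ 2) - ε (suc n) ^ 2 * ρ n)
        turan n N₁≤n h = Pos-* (#Pos 5) (Pos-^ 9 (z-pos (suc n)))
            (≤-trans (use turan-gap {u} {δ n} {δ (suc n)} {ε (suc n)} {ρ n} lower upper (^0≤ 9 (z-nonneg (suc n)))) (≤≡ (*-monoʳ (#0≤ 10000) h) (*-zero (# 10000))))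
          where
          module B = At n N₁≤n (good-all n)
          module B⁺ = At (suc n) (ℕₚ.m≤n⇒m≤1+n N₁≤n) (good-all (suc n))
          u : A
          u = z (suc n)
          lower : # 2487 * # 2487 * # 2487 * u ^ 9 ≤ # 10000 * # 10000 * # 10000 * (δ n * δ (suc n) ^ 2)
          lower = use turan-lower {z n} {u} B.δ-lower B⁺.δ-lower
            (^-mono 3 (z-nonneg (suc n)) (z-anti (good-all (suc n)) (ℕₚ.n≤1+n n) ℕₚ.≤-refl)) B.δ-nonneg (^0≤ 3 (z-nonneg (suc n))) B⁺.δ-nonneg
          upper : # 25000 * (ε (suc n) ^ 2 * ρ n) ≤ # 1521 * u ^ 9
          upper = use turan-upper {ε (suc n)} {u} (use square-upper (upp bound) (low bound)) (ρ-nonneg n) (ρ≤1 n) (^0≤ 9 (z-nonneg (suc n))) B⁺.y-small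
            where
            bound : Within (# 13 * u ^ 5) (# 5 * ε (suc n))
            bound = Local.ε-here (good-all (suc n) (suc n) ℕₚ.≤-refl)

  -- The ratios of a tested sequence satisfy the hypotheses

  module Ratios where
    open import Data.Bool using (true)
    open import Data.Nat as ℕ using (ℕ; zero; suc; _∸_)
    open import Relation.Binary.PropositionalEquality hiding ([_])
    open import Data.List using ([]; _∷_)
    import Data.Nat.Properties as ℕₚ
    open import Data.Product using (_,_; proj₁; proj₂)
    open import Data.Sum using (inj₁; inj₂)
    open import Data.Empty using (⊥-elim)
    open import Relation.Nullary using (Dec; yes; no)
    open Partitions using (sumTo; divisor-sum; divisor-sum-≥)
    open Tests
    open TestResults
    open TestedSequences
    open Sums
    open Weights
    open DivisorSumBounds using (divisor-sum-bounds; #-sum)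
    open Differences
    open ≡-Reasoning

    infixl 6 _⊕_
    infixl 7 _⊗_
    infixr 8 _⊗^_
    -- Reflected arithmetic on natural numbers, so that a tested inequality is carried into the ring
    -- in one step.
    data Term : Set where
      val : ℕ → Term
      _⊕_ _⊗_ : Term → Term → Term
      _⊗^_ : Term → ℕ → Term

    inℕ : Term → ℕ
    inℕ (val n) = n
    inℕ (s ⊕ t) = inℕ s ℕ.+ inℕ t
    inℕ (s ⊗ t) = inℕ s ℕ.* inℕ t
    inℕ (s ⊗^ n) = inℕ s ℕ.^ n

    inA : Term → A
    inA (val n) = # n
    inA (s ⊕ t) = inA s + inA t
    inA (s ⊗ t) = inA s * inA t
    inA (s ⊗^ n) = inA s ^ n

    #-^ : ∀ x n → # (x ℕ.^ n) ≡ # x ^ n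
    #-^ x zero = #-1
    #-^ x (suc n) = trans (#-* x (x ℕ.^ n)) (cong (# x *_) (#-^ x n))

    cast : ∀ t → # (inℕ t) ≡ inA t
    cast (val n) = refl
    cast (s ⊕ t) = trans (#-+ (inℕ s) (inℕ t)) (cong₂ _+_ (cast s) (cast t))
    cast (s ⊗ t) = trans (#-* (inℕ s) (inℕ t)) (cong₂ _*_ (cast s) (cast t))
    cast (s ⊗^ n) = trans (#-^ (inℕ s) n) (cong (_^ n) (cast s))

    cast-≤ : ∀ s t → inℕ s ℕ.≤ inℕ t → inA s ≤ inA t
    cast-≤ s t h = ≡≤ (sym (cast s)) (≤≡ (#mono h) (cast t))

    #-∸ : ∀ {m n} → n ℕ.≤ m → # (m ∸ n) ≡ # m - # n
    #-∸ {m} {n} h = trans (ring (# (m ∸ n) ∷ # n ∷ []) (var 0) (var 1 :+ var 0 :- var 1) refl)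
      (cong (_- # n) (trans (sym (#-+ n (m ∸ n))) (cong # (ℕₚ.m+[n∸m]≡n h))))

    #-∸-≤ : ∀ m n → # m - # n ≤ # (m ∸ n)
    #-∸-≤ m n = use shift (≤≡ (#mono (ℕₚ.m≤n+m∸n m n)) (#-+ n (m ∸ n)))
      where
      shift : Certificate 3 λ x y z →
        x :≤ y :+ z ⇒ ⊢ x :- y :≤ z
      shift = cert 0 ((1 , 0 ∷ []) ∷ []) refl

    -- Reciprocals of positive integers are all the division that the ratios of values of `f`
    -- require.
    module Quotients (recip : ℕ → A) (recip-law : ∀ n → # (suc n) * recip n ≡ # 1) (s : TestedSequence) where

      open TestedSequence s

      P : ℕ → A
      P m = # (f m)

      Pos-P : ∀ m → Pos (P m)
      Pos-P m h = #Pos 0 (≤-trans (#mono (positive m)) h)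

      P-nonneg : ∀ m → # 0 ≤ P m
      P-nonneg m = #0≤ (f m)

      inverse : ℕ → A
      inverse m = recip (f m ∸ 1)

      P-inverse : ∀ m → P m * inverse m ≡ # 1
      P-inverse m = trans (cong (λ v → # v * inverse m) (sym (ℕₚ.m+[n∸m]≡n (positive m)))) (recip-law (f m ∸ 1))

      ρ : ℕ → A
      ρ zero = # 0
      ρ (suc m) = P m * inverse (suc m)

      P-ρ : ∀ m → P (suc m) * ρ (suc m) ≡ P m
      P-ρ m = trans (ring (P (suc m) ∷ P m ∷ inverse (suc m) ∷ []) (var 0 :* (var 1 :* var 2)) (var 1 :* (var 0 :* var 2)) refl)
        (trans (cong (P m *_) (P-inverse (suc m))) (*-one (P m)))

      ρ-zero : ρ 0 ≡ # 0
      ρ-zero = refl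

      ρ-nonneg : ∀ m → # 0 ≤ ρ m
      ρ-nonneg zero = ≤-refl
      ρ-nonneg (suc m) = *-cancelˡ (Pos-P (suc m)) (≡≤ (*-zero _) (≤≡ (P-nonneg m) (sym (P-ρ m))))

      ρ≤1 : ∀ m → ρ m ≤ # 1
      ρ≤1 zero = #0≤ 1
      ρ≤1 (suc m) = *-cancelˡ (Pos-P (suc m)) (≡≤ (P-ρ m) (≤≡ (#mono (monotone m)) (sym (*-one _))))

      -- Strict growth gives P(m+1) (1 - ρ(m+1)) ≥ 1. It starts at m = 1 because p 0 = p 1;
      -- positivity is what allows cancelling powers of z.
      gap-pos : ∀ m → 1 ℕ.≤ m → Pos (# 1 - ρ (suc m))
      gap-pos m h le = #Pos 0 (≤-trans (use margin (≡≤ (sym (#suc (f m))) (#mono (strict m h))) (reflexive (P-ρ m)))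
          (≤≡ (*-monoʳ (P-nonneg (suc m)) le) (*-zero _)))
        where
        margin : Certificate 3 λ x y r →
          x :+ con 1 :≤ y ⇒ y :* r :≤ x ⇒ ⊢ con 1 :≤ y :* (con 1 :- r)
        margin = cert 0 ((1 , 0 ∷ []) ∷ (1 , 1 ∷ []) ∷ []) refl

      weight : ∀ m → Dec (m₀ ℕ.≤ m) → A
      weight m (yes _) = (# 1 - ρ m) * recip 24
      weight m (no _) = # 2 * recip 24

      w : ℕ → A
      w m = weight m (m₀ ℕ.≤? m)

      recip-25 : ∀ x → # 25 * (x * recip 24) ≡ x
      recip-25 x = trans (ring (x ∷ recip 24 ∷ []) (con 25 :* (var 0 :* var 1)) (var 0 :* (con 25 :* var 1)) refl)
        (trans (cong (x *_) (recip-law 24)) (*-one x))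

      Pos-recip : ∀ n → Pos (recip n)
      Pos-recip n h = #Pos 0 (≡≤ (sym (recip-law n)) (≤≡ (*-monoʳ (#0≤ (suc n)) h) (*-zero _)))

      open Products ρ ρ-zero ρ-nonneg ρ≤1

      z : ℕ → A
      z m = # 25 * w m

      z-high : ∀ m → m₀ ℕ.≤ m → z m + ρ m ≡ # 1
      z-high m h with m₀ ℕ.≤? m
      ... | yes _ = trans (cong (_+ ρ m) (recip-25 (# 1 - ρ m))) (ring (ρ m ∷ []) (con 1 :- var 0 :+ var 0) (con 1) refl)
      ... | no ¬h = ⊥-elim (¬h h)

      z-low : ∀ m → m ℕ.< m₀ → z m ≡ # 2
      z-low m l with m₀ ℕ.≤? m
      ... | yes h = ⊥-elim (ℕₚ.<⇒≱ l h)
      ... | no _ = recip-25 (# 2)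

      predecessor : ∀ {k m} → 1 ℕ.≤ k → k ℕ.≤ m → suc (m ∸ 1) ≡ m
      predecessor {m = suc m} _ _ = refl
      predecessor {suc k} {zero} _ ()

      1≤m₀ : 1 ℕ.≤ m₀
      1≤m₀ = ℕₚ.≤-trans (ℕ.s≤s ℕ.z≤n) 2≤m₀

      w-pos : ∀ m → Pos (w m)
      w-pos m with m₀ ℕ.≤? m
      ... | no _ = Pos-* (#Pos 1) (Pos-recip 24)
      ... | yes h = Pos-* (subst (λ v → Pos (# 1 - ρ v)) (predecessor 1≤m₀ h)
                      (gap-pos (m ∸ 1) (ℕₚ.≤-pred (ℕₚ.≤-trans 2≤m₀ (ℕₚ.≤-trans h (ℕₚ.≤-reflexive (sym (predecessor 1≤m₀ h)))))))) (Pos-recip 24)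

      R-P : ∀ n k → k ℕ.≤ n → P n * R n k ≡ P (n ∸ k)
      R-P n zero _ = *-one (P n)
      R-P n (suc k) l = begin
        P n * (R n k * ρ (n ∸ k))       ≡⟨ sym (*-assoc _ _ _) ⟩
        P n * R n k * ρ (n ∸ k)         ≡⟨ cong (_* ρ (n ∸ k)) (R-P n k (ℕₚ.≤-trans (ℕₚ.n≤1+n k) l)) ⟩
        P (n ∸ k) * ρ (n ∸ k)           ≡⟨ cong (λ v → P v * ρ v) (ℕₚ.+-∸-assoc 1 l) ⟩
        P (suc (n ∸ suc k)) * ρ (suc (n ∸ suc k)) ≡⟨ P-ρ (n ∸ suc k) ⟩
        P (n ∸ suc k)                   ∎

      -- The recurrence divided by f n, since R n k = f(n-k) / f n.
      renewal : ∀ n → sum (suc n) (λ k → # (divisor-sum k) * R n k) ≡ # n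
      renewal n = *-cancel-≡ (Pos-P n) (begin
        P n * sum (suc n) (λ k → # (divisor-sum k) * R n k)
          ≡⟨ sym (sum-*ˡ (suc n) (P n) _) ⟩
        sum (suc n) (λ k → P n * (# (divisor-sum k) * R n k))
          ≡⟨ sum-cong (suc n) (λ k l → trans (ring (P n ∷ # (divisor-sum k) ∷ R n k ∷ []) (var 0 :* (var 1 :* var 2)) (var 1 :* (var 0 :* var 2)) refl)
               (trans (cong (# (divisor-sum k) *_) (R-P n k (ℕₚ.≤-pred l))) (sym (#-* (divisor-sum k) (f (n ∸ k)))))) ⟩
        sum (suc n) (λ k → # (divisor-sum k ℕ.* f (n ∸ k)))
          ≡⟨ sym (#-sum (suc n) (λ k → divisor-sum k ℕ.* f (n ∸ k))) ⟩
        # (sumTo (suc n) (λ k → divisor-sum k ℕ.* f (n ∸ k)))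
          ≡⟨ cong # (sym (recurrence n)) ⟩
        # (n ℕ.* f n)
          ≡⟨ trans (#-* n (f n)) (*-comm _ _) ⟩
        P n * # n ∎)

      z-fraction : ∀ m → m₀ ℕ.≤ m → P m * z m ≡ # (f m ∸ f (m ∸ 1))
      z-fraction m h = trans (cong (P m *_) z≡) (trans (cong (λ v → P m * (# 1 - ρ v)) (sym m≡))
        (trans (ring (P m ∷ ρ (suc (m ∸ 1)) ∷ []) (var 0 :* (con 1 :- var 1)) (var 0 :- var 0 :* var 1) refl)
          (trans (cong (λ v → P m - v) (trans (cong (λ v → P v * ρ (suc (m ∸ 1))) (sym m≡)) (P-ρ (m ∸ 1))))
            (sym (#-∸ (subst (λ v → f (m ∸ 1) ℕ.≤ f v) m≡ (monotone (m ∸ 1))))))))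
        where
        m≡ = predecessor 1≤m₀ h
        z≡ : z m ≡ # 1 - ρ m
        z≡ = trans (ring (z m ∷ ρ m ∷ []) (var 0) (var 0 :+ var 1 :- var 1) refl) (cong (_- ρ m) (z-high m h))

      z-small : ∀ c m → m₀ ℕ.≤ m → 1000 ℕ.* (f m ∸ f (m ∸ 1)) ℕ.≤ c ℕ.* f m → # 1000 * z m ≤ # c
      z-small c m h t = *-cancelˡ (Pos-P m) (≡≤ (trans (ring (P m ∷ z m ∷ []) (var 0 :* (con 1000 :* var 1)) (con 1000 :* (var 0 :* var 1)) refl)
          (cong (# 1000 *_) (z-fraction m h)))
        (≤≡ (cast-≤ (val 1000 ⊗ val (f m ∸ f (m ∸ 1))) (val c ⊗ val (f m)) t) (*-comm _ _)))

      tenth : Certificate 1 λ z →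
        con 1000 :* z :≤ con 70 ⇒ ⊢ con 100 :* z :≤ con 7
      tenth = cert 9 ((1 , 0 ∷ []) ∷ []) refl

      z-m₀ : # 100 * z m₀ ≤ # 7
      z-m₀ = use tenth (z-small 70 m₀ ℕₚ.≤-refl small-start)

      z-N₁ : # 1000 * z N₁ ≤ # 9
      z-N₁ = z-small 9 N₁ (ℕₚ.≤-trans m₀≤M₀ M₀≤N₁) small-end

      low-cap : ∀ m → 2 ℕ.≤ m → m ℕ.≤ m₀ → # 1000 * ρ m ≤ # 991
      low-cap (suc (suc m)) (ℕ.s≤s (ℕ.s≤s _)) l = *-cancelˡ (Pos-P (suc (suc m)))
        (≡≤ (trans (ring (P (suc (suc m)) ∷ ρ (suc (suc m)) ∷ []) (var 0 :* (con 1000 :* var 1)) (con 1000 :* (var 0 :* var 1)) refl) (cong (# 1000 *_) (P-ρ (suc m))))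
          (≤≡ (cast-≤ (val 1000 ⊗ val (f (suc m))) (val 991 ⊗ val (f (suc (suc m)))) (≤ᵇ-sound _ _ (capped m l))) (*-comm _ _)))

      h : A
      h = # 991 * recip 999

      h-value : # 1000 * h ≡ # 991
      h-value = trans (ring (recip 999 ∷ []) (con 1000 :* (con 991 :* var 0)) (con 991 :* (con 1000 :* var 0)) refl)
        (trans (cong (# 991 *_) (recip-law 999)) (*-one _))

      ^-* : ∀ x y n → (x * y) ^ n ≡ x ^ n * y ^ n
      ^-* x y zero = trans (sym #-1) (trans (sym (*-one (# 1))) (cong₂ _*_ #-1 #-1))
      ^-* x y (suc n) = trans (cong (x * y *_) (^-* x y n)) (*-interchange x y (x ^ n) (y ^ n))

      monotone-≤ : ∀ {i j} → i ℕ.≤ j → f i ℕ.≤ f j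
      monotone-≤ {i} {zero} ℕ.z≤n = ℕₚ.≤-refl
      monotone-≤ {i} {suc j} l with ℕₚ.m≤n⇒m<n∨m≡n l
      ... | inj₂ refl = ℕₚ.≤-refl
      ... | inj₁ (ℕ.s≤s l′) = ℕₚ.≤-trans (monotone-≤ l′) (monotone j)

      jump-arith : Certificate 8 λ a R x b y z9 H T →
        a :* R :≤ b ⇒ b :≤ x ⇒ con 512 :* x :* (a :^ 8 :* T) :≤ y ⇒ y :≤ a :^ 9 :* z9 :* (T :* H) ⇒ con 0 :≤ a :^ 8 ⇒ con 0 :≤ T ⇒
        ⊢ a :^ 9 :* T :* (R :* con 512) :≤ a :^ 9 :* T :* (z9 :* H)
      jump-arith = cert 0 ((512 , 0 ∷ 4 ∷ 5 ∷ []) ∷ (512 , 1 ∷ 4 ∷ 5 ∷ []) ∷ (1 , 2 ∷ []) ∷ (1 , 3 ∷ []) ∷ []) refl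

      -- R M₀ j is f(M₀-j) / f M₀, at most f m₀ / f M₀ by monotonicity; for j beyond `M₀` it is 0.
      jump : ∀ j → M₀ ∸ j ℕ.< m₀ → R M₀ j * # 512 ≤ z M₀ ^ 9 * h ^ M₀
      jump j l with j ℕ.≤? M₀
      ... | no ¬j≤ = ≡≤ (trans (cong (_* # 512) (R-end M₀ j (ℕₚ.≰⇒> ¬j≤))) (zero-* _))
            (*0≤ (^0≤ 9 (pos⇒0≤ (Pos-* (#Pos 24) (w-pos M₀)))) (^0≤ M₀ (*0≤ (#0≤ 991) (pos⇒0≤ (Pos-recip 999)))))
      ... | yes j≤ = *-cancelˡ (Pos-* (Pos-^ 9 (Pos-P M₀)) (Pos-^ M₀ (#Pos 999)))
            (use jump-arith (reflexive (R-P M₀ j j≤)) (#mono (monotone-≤ (ℕₚ.<⇒≤ l)))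
              (cast-≤ (val 512 ⊗ val (f m₀) ⊗ (val (f M₀) ⊗^ 8 ⊗ val 1000 ⊗^ M₀)) (val (f M₀ ∸ f (M₀ ∸ 1)) ⊗^ 9 ⊗ val 991 ⊗^ M₀) jump-test)
              (reflexive value) (^0≤ 8 (P-nonneg M₀)) (^0≤ M₀ (#0≤ 1000)))
        where
        value : # (f M₀ ∸ f (M₀ ∸ 1)) ^ 9 * # 991 ^ M₀ ≡ P M₀ ^ 9 * z M₀ ^ 9 * (# 1000 ^ M₀ * h ^ M₀)
        value = cong₂ _*_ (trans (cong (_^ 9) (sym (z-fraction M₀ m₀≤M₀))) (^-* (P M₀) (z M₀) 9)) (trans (cong (_^ M₀) (sym h-value)) (^-* (# 1000) h M₀))

      inputs : RenewalData
      inputs = record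
        { σ = divisor-sum
        ; ρ = ρ
        ; w = w
        ; ρ-zero = ρ-zero
        ; ρ-nonneg = ρ-nonneg
        ; ρ≤1 = ρ≤1
        ; σ-zero = refl
        ; σ-≥ = divisor-sum-≥
        ; hi = λ j → proj₂ (divisor-sum-bounds j)
        ; lo = λ j → proj₁ (divisor-sum-bounds j)
        ; renewal = renewal
        ; w-pos = w-pos
        ; m₀ = m₀
        ; M₀ = M₀
        ; N₁ = N₁
        ; 2≤m₀ = 2≤m₀
        ; m₀≤M₀ = m₀≤M₀
        ; M₀≤N₁ = M₀≤N₁
        ; z-high = z-high
        ; z-low = z-low
        ; z-m₀ = z-m₀
        ; z-N₁ = z-N₁
        ; low-cap = low-cap
        ; h = h
        ; h-value = h-value
        ; jump = jump
        }

      δ ε : ℕ → A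
      δ = Inputs.δ inputs
      ε = Inputs.ε inputs

      cross : ∀ m → P (suc (suc m)) * P (suc m) * δ (suc (suc m)) ≡ P (suc m) * P (suc m) - P (suc (suc m)) * P m
      cross m = trans (ring (P (suc (suc m)) ∷ P (suc m) ∷ ρ (suc (suc m)) ∷ ρ (suc m) ∷ [])
          (var 0 :* var 1 :* (var 2 :- var 3)) ((var 0 :* var 2) :* var 1 :- var 0 :* (var 1 :* var 3)) refl)
        (cong₂ (λ u v → u * P (suc m) - P (suc (suc m)) * v) (P-ρ (suc m)) (P-ρ m))

      here-arith : Certificate 6 λ a b d D Y z3 →
        a :* b :* d :≤ D ⇒ con 50 :* D :* (a :* a) :≤ con 19 :* (Y :* Y :* Y) :* b ⇒ Y :* Y :* Y :≤ a :* a :* a :* z3 ⇒ con 0 :≤ a :* a ⇒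
        con 0 :≤ b ⇒ ⊢ a :* a :* a :* b :* (con 50 :* d) :≤ a :* a :* a :* b :* (con 19 :* z3)
      here-arith = cert 0 ((50 , 0 ∷ 3 ∷ []) ∷ (1 , 1 ∷ []) ∷ (19 , 2 ∷ 4 ∷ []) ∷ []) refl

      prev-arith : Certificate 7 λ a b c d D Y z3 →
        b :* c :* d :≤ D ⇒ con 50 :* D :* (a :* a :* a) :≤ con 19 :* (Y :* Y :* Y) :* (b :* c) ⇒ Y :* Y :* Y :≤ a :* a :* a :* z3 ⇒
        con 0 :≤ a :* a :* a ⇒ con 0 :≤ b :* c ⇒ ⊢ a :* a :* a :* (b :* c) :* (con 50 :* d) :≤ a :* a :* a :* (b :* c) :* (con 19 :* z3)
      prev-arith = cert 0 ((50 , 0 ∷ 3 ∷ []) ∷ (1 , 1 ∷ []) ∷ (19 , 2 ∷ 4 ∷ []) ∷ []) refl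

      change-arith : Certificate 7 λ a b c e E Y z5 →
        a :* b :* c :* e :≤ E ⇒ con 5 :* E :* (a :* a :* a :* a) :≤ con 13 :* (Y :* Y :* Y :* Y :* Y) :* (b :* c) ⇒
        Y :* Y :* Y :* Y :* Y :≤ a :* a :* a :* a :* a :* z5 ⇒ con 0 :≤ a :* a :* a :* a ⇒ con 0 :≤ b :* c ⇒
        ⊢ a :* a :* a :* a :* a :* (b :* c) :* (con 5 :* e) :≤ a :* a :* a :* a :* a :* (b :* c) :* (con 13 :* z5)
      change-arith = cert 0 ((5 , 0 ∷ 3 ∷ []) ∷ (1 , 1 ∷ []) ∷ (13 , 2 ∷ 4 ∷ []) ∷ []) refl

      nonneg-lower : Certificate 2 λ d z →
        con 0 :≤ d ⇒ con 0 :≤ z ⇒ ⊢ con 0 :- con 19 :* z :≤ con 50 :* d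
      nonneg-lower = cert 0 ((50 , 0 ∷ []) ∷ (19 , 1 ∷ []) ∷ []) refl

      flip-sign : Certificate 2 λ e z →
        con 5 :* (con 0 :- e) :≤ con 13 :* z ⇒ ⊢ con 0 :- con 13 :* z :≤ con 5 :* e
      flip-sign = cert 0 ((1 , 0 ∷ []) ∷ []) refl

      falling : Certificate 4 λ u y a b →
        u :+ a :≤ con 1 ⇒ con 1 :≤ y :+ b ⇒ con 0 :≤ a :- b ⇒ ⊢ u :≤ y
      falling = cert 0 ((1 , 0 ∷ []) ∷ (1 , 1 ∷ []) ∷ (1 , 2 ∷ []) ∷ []) refl

      below-two : Certificate 2 λ u a →
        u :+ a :≤ con 1 ⇒ con 0 :≤ a ⇒ ⊢ u :≤ con 2
      below-two = cert 0 ((1 , []) ∷ (1 , 0 ∷ []) ∷ (1 , 1 ∷ []) ∷ []) refl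

      module _ (d : ℕ) (m₀≤m : m₀ ℕ.≤ 3 ℕ.+ d) (m≤N₀ : 3 ℕ.+ d ℕ.≤ N₀) where
        private
          fa fb fc fd δ₁ δ₀ y : ℕ
          fa = f (3 ℕ.+ d)
          fb = f (2 ℕ.+ d)
          fc = f (1 ℕ.+ d)
          fd = f d
          δ₁ = fb ℕ.* fb ∸ fa ℕ.* fc
          δ₀ = fc ℕ.* fc ∸ fb ℕ.* fd
          y = fa ∸ fb
          a b c : A
          a = # fa
          b = # fb
          c = # fc

          t₁ = both {fa ℕ.* fc ℕ.≤ᵇ fb ℕ.* fb} (locally d m₀≤m m≤N₀)
          t₂ = both {fb ℕ.* fd ℕ.≤ᵇ fc ℕ.* fc} (proj₂ t₁)
          t₃ = both {fb ℕ.≤ᵇ fa} (proj₂ t₂)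
          t₄ = both {50 ℕ.* δ₁ ℕ.* (fa ℕ.* fa) ℕ.≤ᵇ 19 ℕ.* cube y ℕ.* fb} (proj₂ t₃)
          t₅ = both {50 ℕ.* δ₀ ℕ.* (fa ℕ.* fa ℕ.* fa) ℕ.≤ᵇ 19 ℕ.* cube y ℕ.* (fb ℕ.* fc)} (proj₂ t₄)
          t₆ = both {5 ℕ.* (fc ℕ.* δ₁ ∸ fa ℕ.* δ₀) ℕ.* (fa ℕ.* fa ℕ.* fa ℕ.* fa) ℕ.≤ᵇ 13 ℕ.* fifth y ℕ.* (fb ℕ.* fc)} (proj₂ t₅)

          0≤a : # 0 ≤ a
          0≤a = P-nonneg (3 ℕ.+ d)

          δ₁-value : a * b * δ (3 ℕ.+ d) ≡ # δ₁
          δ₁-value = trans (cross (suc d)) (sym (trans (#-∸ (≤ᵇ-sound _ _ (proj₁ t₁))) (cong₂ _-_ (#-* fb fb) (#-* fa fc))))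

          δ₀-value : b * c * δ (2 ℕ.+ d) ≡ # δ₀
          δ₀-value = trans (cross d) (sym (trans (#-∸ (≤ᵇ-sound _ _ (proj₁ t₂))) (cong₂ _-_ (#-* fc fc) (#-* fb fd))))

          yᴬ : A
          yᴬ = # y

          az≡y : a * z (3 ℕ.+ d) ≡ yᴬ
          az≡y = z-fraction (3 ℕ.+ d) m₀≤m

          Y³ : yᴬ * yᴬ * yᴬ ≤ a * a * a * z (3 ℕ.+ d) ^ 3
          Y³ = reflexive (trans (cong (λ v → v * v * v) (sym az≡y)) (ring (a ∷ z (3 ℕ.+ d) ∷ []) (var 0 :* var 1 :* (var 0 :* var 1) :* (var 0 :* var 1)) (var 0 :* var 0 :* var 0 :* var 1 :^ 3) refl))

          Y⁵ : yᴬ * yᴬ * yᴬ * yᴬ * yᴬ ≤ a * a * a * a * a * z (3 ℕ.+ d) ^ 5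
          Y⁵ = reflexive (trans (cong (λ v → v * v * v * v * v) (sym az≡y)) (ring (a ∷ z (3 ℕ.+ d) ∷ [])
            (var 0 :* var 1 :* (var 0 :* var 1) :* (var 0 :* var 1) :* (var 0 :* var 1) :* (var 0 :* var 1)) (var 0 :* var 0 :* var 0 :* var 0 :* var 0 :* var 1 :^ 5) refl))

          pa : Pos a
          pa = Pos-P (3 ℕ.+ d)
          pb : Pos b
          pb = Pos-P (2 ℕ.+ d)
          pc : Pos c
          pc = Pos-P (1 ℕ.+ d)

          δ₁-nonneg : # 0 ≤ δ (3 ℕ.+ d)
          δ₁-nonneg = *-cancelˡ (Pos-* pa pb) (≡≤ (*-zero _) (≤≡ (#0≤ δ₁) (sym δ₁-value)))

          δ₀-nonneg : # 0 ≤ δ (2 ℕ.+ d)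
          δ₀-nonneg = *-cancelˡ (Pos-* pb pc) (≡≤ (*-zero _) (≤≡ (#0≤ δ₀) (sym δ₀-value)))

          z-nn : # 0 ≤ z (3 ℕ.+ d)
          z-nn = Inputs.z-nonneg inputs (3 ℕ.+ d)

          ε-value : a * b * c * ε (3 ℕ.+ d) ≡ # (fc ℕ.* δ₁) - # (fa ℕ.* δ₀)
          ε-value = trans (ring (a ∷ b ∷ c ∷ δ (3 ℕ.+ d) ∷ δ (2 ℕ.+ d) ∷ [])
              (var 0 :* var 1 :* var 2 :* (var 3 :- var 4)) (var 2 :* (var 0 :* var 1 :* var 3) :- var 0 :* (var 1 :* var 2 :* var 4)) refl)
            (trans (cong₂ (λ u v → c * u - a * v) δ₁-value δ₀-value) (cong₂ _-_ (sym (#-* fc δ₁)) (sym (#-* fa δ₀))))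

          quartic : Term
          quartic = val fa ⊗ val fa ⊗ val fa ⊗ val fa

          change : ∀ {e} E → a * b * c * e ≤ # E → 5 ℕ.* E ℕ.* (fa ℕ.* fa ℕ.* fa ℕ.* fa) ℕ.≤ 13 ℕ.* fifth y ℕ.* (fb ℕ.* fc) → # 5 * e ≤ # 13 * z (3 ℕ.+ d) ^ 5
          change {e} E h t = *-cancelˡ (Pos-* (Pos-* (Pos-* (Pos-* (Pos-* pa pa) pa) pa) pa) (Pos-* pb pc))
            (use change-arith {a} {b} {c} {e} {# E} {yᴬ} h
              (cast-≤ (val 5 ⊗ val E ⊗ quartic) (val 13 ⊗ (val y ⊗ val y ⊗ val y ⊗ val y ⊗ val y) ⊗ (val fb ⊗ val fc)) t)
              Y⁵ (*0≤ (*0≤ (*0≤ 0≤a 0≤a) 0≤a) 0≤a) (*0≤ (P-nonneg (2 ℕ.+ d)) (P-nonneg (1 ℕ.+ d))))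

          decreasing : z (3 ℕ.+ d) ≤ z (2 ℕ.+ d)
          decreasing = go (m₀ ℕ.≤? 2 ℕ.+ d)
            where
            go : Dec (m₀ ℕ.≤ 2 ℕ.+ d) → z (3 ℕ.+ d) ≤ z (2 ℕ.+ d)
            go (yes h) = use falling (reflexive (z-high (3 ℕ.+ d) m₀≤m)) (reflexive (sym (z-high (2 ℕ.+ d) h))) δ₁-nonneg
            go (no ¬h) = ≤≡ (use below-two (reflexive (z-high (3 ℕ.+ d) m₀≤m)) (ρ-nonneg (3 ℕ.+ d))) (sym (z-low (2 ℕ.+ d) (ℕₚ.≰⇒> ¬h)))

          here-high : # 50 * δ (3 ℕ.+ d) ≤ # 19 * z (3 ℕ.+ d) ^ 3
          here-high = *-cancelˡ (Pos-* (Pos-* (Pos-* pa pa) pa) pb)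
            (use here-arith {a} {b} {δ (3 ℕ.+ d)} {# δ₁} {yᴬ} {z (3 ℕ.+ d) ^ 3} (reflexive δ₁-value)
              (cast-≤ (val 50 ⊗ val δ₁ ⊗ (val fa ⊗ val fa)) (val 19 ⊗ (val y ⊗ val y ⊗ val y) ⊗ val fb) (≤ᵇ-sound _ _ (proj₁ t₄)))
              Y³ (*0≤ 0≤a 0≤a) (P-nonneg (2 ℕ.+ d)))

          prev-high : # 50 * δ (2 ℕ.+ d) ≤ # 19 * z (3 ℕ.+ d) ^ 3
          prev-high = *-cancelˡ (Pos-* (Pos-* (Pos-* pa pa) pa) (Pos-* pb pc))
            (use prev-arith {a} {b} {c} {δ (2 ℕ.+ d)} {# δ₀} {yᴬ} {z (3 ℕ.+ d) ^ 3} (reflexive δ₀-value)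
              (cast-≤ (val 50 ⊗ val δ₀ ⊗ (val fa ⊗ val fa ⊗ val fa)) (val 19 ⊗ (val y ⊗ val y ⊗ val y) ⊗ (val fb ⊗ val fc)) (≤ᵇ-sound _ _ (proj₁ t₅)))
              Y³ (*0≤ (*0≤ 0≤a 0≤a) 0≤a) (*0≤ (P-nonneg (2 ℕ.+ d)) (P-nonneg (1 ℕ.+ d))))

          -- A truncated difference is at least the true one, so each of the two tests bounds one
          -- sign of ε.
          change-high : # 5 * ε (3 ℕ.+ d) ≤ # 13 * z (3 ℕ.+ d) ^ 5
          change-high = change (fc ℕ.* δ₁ ∸ fa ℕ.* δ₀) (≡≤ ε-value (#-∸-≤ (fc ℕ.* δ₁) (fa ℕ.* δ₀))) (≤ᵇ-sound _ _ (proj₁ t₆))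

          change-low : # 5 * (# 0 - ε (3 ℕ.+ d)) ≤ # 13 * z (3 ℕ.+ d) ^ 5
          change-low = change (fa ℕ.* δ₀ ∸ fc ℕ.* δ₁)
            (≡≤ (trans (ring (a * b * c ∷ ε (3 ℕ.+ d) ∷ []) (var 0 :* (con 0 :- var 1)) (con 0 :- var 0 :* var 1) refl)
                (trans (cong (λ v → # 0 - v) ε-value) (ring (# (fc ℕ.* δ₁) ∷ # (fa ℕ.* δ₀) ∷ []) (con 0 :- (var 0 :- var 1)) (var 1 :- var 0) refl)))
              (#-∸-≤ (fa ℕ.* δ₀) (fc ℕ.* δ₁)))
            (≤ᵇ-sound _ _ (proj₂ t₆))

        local-high : Inputs.Local inputs (3 ℕ.+ d)
        local-high = record
          { z-dec  = decreasing
          ; δ-here = within (use nonneg-lower {δ (3 ℕ.+ d)} {z (3 ℕ.+ d) ^ 3} δ₁-nonneg (^0≤ 3 z-nn)) here-high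
          ; δ-prev = within (use nonneg-lower {δ (2 ℕ.+ d)} {z (3 ℕ.+ d) ^ 3} δ₀-nonneg (^0≤ 3 z-nn)) prev-high
          ; ε-here = within (use flip-sign {ε (3 ℕ.+ d)} {z (3 ℕ.+ d) ^ 5} change-low) change-high
          }

      small-δ-upp : Certificate 2 λ u v →
        u :≤ con 1 ⇒ con 0 :≤ v ⇒ ⊢ con 50 :* (u :- v) :≤ con 19 :* con 2 :^ 3
      small-δ-upp = cert 0 ((102 , []) ∷ (50 , 0 ∷ []) ∷ (50 , 1 ∷ []) ∷ []) refl

      small-δ-low : Certificate 2 λ u v →
        con 0 :≤ u ⇒ v :≤ con 1 ⇒ ⊢ con 0 :- con 19 :* con 2 :^ 3 :≤ con 50 :* (u :- v)
      small-δ-low = cert 0 ((102 , []) ∷ (50 , 0 ∷ []) ∷ (50 , 1 ∷ []) ∷ []) refl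

      small-ε-upp : Certificate 3 λ u v x →
        u :≤ con 1 ⇒ con 0 :≤ v ⇒ x :≤ con 1 ⇒ ⊢ con 5 :* (u :- v :- (v :- x)) :≤ con 13 :* con 2 :^ 5
      small-ε-upp = cert 0 ((406 , []) ∷ (5 , 0 ∷ []) ∷ (10 , 1 ∷ []) ∷ (5 , 2 ∷ []) ∷ []) refl

      small-ε-low : Certificate 3 λ u v x →
        con 0 :≤ u ⇒ v :≤ con 1 ⇒ con 0 :≤ x ⇒ ⊢ con 0 :- con 13 :* con 2 :^ 5 :≤ con 5 :* (u :- v :- (v :- x))
      small-ε-low = cert 0 ((406 , []) ∷ (5 , 0 ∷ []) ∷ (10 , 1 ∷ []) ∷ (5 , 2 ∷ []) ∷ []) refl

      -- With z = 2 the bounds 19 · 8 and 13 · 32 follow from 0 ≤ ρ ≤ 1.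
      local-low : ∀ m → m ℕ.< m₀ → Inputs.Local inputs m
      local-low m l = record
        { z-dec  = reflexive (trans (z-low m l) (sym (z-low (m ∸ 1) (ℕₚ.≤-<-trans (ℕₚ.m∸n≤m m 1) l))))
        ; δ-here = within-≡ᵇ (within (use small-δ-low (ρ-nonneg m) (ρ≤1 (m ∸ 1))) (use small-δ-upp (ρ≤1 m) (ρ-nonneg (m ∸ 1)))) (cong (λ v → # 19 * v ^ 3) (sym (z-low m l)))
        ; δ-prev = within-≡ᵇ (within (use small-δ-low (ρ-nonneg (m ∸ 1)) (ρ≤1 (m ∸ 1 ∸ 1))) (use small-δ-upp (ρ≤1 (m ∸ 1)) (ρ-nonneg (m ∸ 1 ∸ 1)))) (cong (λ v → # 19 * v ^ 3) (sym (z-low m l)))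
        ; ε-here = within-≡ᵇ (within (use small-ε-low (ρ-nonneg m) (ρ≤1 (m ∸ 1)) (ρ-nonneg (m ∸ 1 ∸ 1))) (use small-ε-upp (ρ≤1 m) (ρ-nonneg (m ∸ 1)) (ρ≤1 (m ∸ 1 ∸ 1)))) (cong (λ v → # 13 * v ^ 5) (sym (z-low m l)))
        }

      base : Inputs.Good inputs N₀
      base m m≤N₀ = go (m₀ ℕ.≤? m)
        where
        go : Dec (m₀ ℕ.≤ m) → Inputs.Local inputs m
        go (no ¬h) = local-low m (ℕₚ.≰⇒> ¬h)
        go (yes h) = subst (Inputs.Local inputs) m≡ (local-high (m ∸ 3) (subst (m₀ ℕ.≤_) (sym m≡) h) (subst (ℕ._≤ N₀) (sym m≡) m≤N₀))
          where
          m≡ : 3 ℕ.+ (m ∸ 3) ≡ m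
          m≡ = ℕₚ.m+[n∸m]≡n (ℕₚ.≤-trans 3≤m₀ h)

      Pos-cancelˡ : ∀ {c x} → # 0 ≤ c → Pos (c * x) → Pos x
      Pos-cancelˡ {c} 0c p h = p (≤≡ (*-monoʳ 0c h) (*-zero c))

      four-term : A → A → A
      four-term u v = # 4 * (# 1 - u) * (# 1 - v) - (# 1 - u * v) * (# 1 - u * v)

      slack : Certificate 2 λ X G →
        X :+ con 1 :≤ G ⇒ ⊢ con 1 :≤ G :- X
      slack = cert 0 ((1 , 0 ∷ []) ∷ []) refl

      -- The tested expression is b² c² times the claim; uv = ad/(bc) is obtained by multiplying the
      -- two laws and cancelling bc.
      from-values : ∀ {a b c d u v} → Pos b → Pos c → u * (b * b) ≡ c * a → v * (c * c) ≡ d * b →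
        Pos (# 4 * ((b * b - a * c) * (c * c - b * d)) - (b * c - a * d) * (b * c - a * d)) → Pos (four-term u v)
      from-values {a} {b} {c} {d} {u} {v} pb pc ub vc p = Pos-cancelˡ (*0≤ (*0≤ 0b 0b) (*0≤ 0c 0c)) (subst Pos value p)
        where
        0b = pos⇒0≤ pb
        0c = pos⇒0≤ pc
        uv : b * c * (a * d) ≡ b * c * (u * v * (b * c))
        uv = begin
          b * c * (a * d)  ≡⟨ ring (a ∷ b ∷ c ∷ d ∷ []) (var 1 :* var 2 :* (var 0 :* var 3)) (var 2 :* var 0 :* (var 3 :* var 1)) refl ⟩
          c * a * (d * b)  ≡⟨ cong₂ _*_ (sym ub) (sym vc) ⟩
          u * (b * b) * (v * (c * c))  ≡⟨ ring (b ∷ c ∷ u ∷ v ∷ []) (var 2 :* (var 0 :* var 0) :* (var 3 :* (var 1 :* var 1))) (var 0 :* var 1 :* (var 2 :* var 3 :* (var 0 :* var 1))) refl ⟩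
          b * c * (u * v * (b * c))  ∎
        value : # 4 * ((b * b - a * c) * (c * c - b * d)) - (b * c - a * d) * (b * c - a * d) ≡ b * b * (c * c) * four-term u v
        value = begin
          # 4 * ((b * b - a * c) * (c * c - b * d)) - (b * c - a * d) * (b * c - a * d)
            ≡⟨ cong₂ (λ x y → # 4 * ((b * b - x) * (c * c - y)) - (b * c - a * d) * (b * c - a * d))
                 (trans (*-comm a c) (sym ub)) (trans (*-comm b d) (sym vc)) ⟩
          # 4 * ((b * b - u * (b * b)) * (c * c - v * (c * c))) - (b * c - a * d) * (b * c - a * d)
            ≡⟨ cong (λ x → # 4 * ((b * b - u * (b * b)) * (c * c - v * (c * c))) - (b * c - x) * (b * c - x)) (*-cancel-≡ (Pos-* pb pc) uv) ⟩
          # 4 * ((b * b - u * (b * b)) * (c * c - v * (c * c))) - (b * c - u * v * (b * c)) * (b * c - u * v * (b * c))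
            ≡⟨ ring (b ∷ c ∷ u ∷ v ∷ [])
                 (con 4 :* ((var 0 :* var 0 :- var 2 :* (var 0 :* var 0)) :* (var 1 :* var 1 :- var 3 :* (var 1 :* var 1)))
                   :- (var 0 :* var 1 :- var 2 :* var 3 :* (var 0 :* var 1)) :* (var 0 :* var 1 :- var 2 :* var 3 :* (var 0 :* var 1)))
                 (var 0 :* var 0 :* (var 1 :* var 1) :* (con 4 :* (con 1 :- var 2) :* (con 1 :- var 3) :- (con 1 :- var 2 :* var 3) :* (con 1 :- var 2 :* var 3))) refl ⟩
          b * b * (c * c) * four-term u v ∎

      from-ratios : ∀ {a b c u v} → # 0 ≤ b → # 0 ≤ c → u * b ≡ a → v * c ≡ b →
        Pos (# 4 * ((b - a) * (c - b) ^ 2) - ((c - b) - (b - a)) ^ 2 * b) → Pos (four-term u v)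
      from-ratios {c = c} {u} {v} 0b 0c refl refl p = Pos-cancelˡ (*0≤ 0b (*0≤ 0c 0c)) (subst Pos
        (ring (c ∷ u ∷ v ∷ [])
          (con 4 :* ((var 2 :* var 0 :- var 1 :* (var 2 :* var 0)) :* (var 0 :- var 2 :* var 0) :^ 2)
            :- ((var 0 :- var 2 :* var 0) :- (var 2 :* var 0 :- var 1 :* (var 2 :* var 0))) :^ 2 :* (var 2 :* var 0))
          (var 2 :* var 0 :* (var 0 :* var 0) :* (con 4 :* (con 1 :- var 1) :* (con 1 :- var 2) :- (con 1 :- var 1 :* var 2) :* (con 1 :- var 1 :* var 2))) refl) p)

      module Turan (u : ℕ → A) (u-law : ∀ n → u (suc n) * (P (suc n) * P (suc n)) ≡ P (suc (suc n)) * P n) where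

        u-ρ : ∀ n → u (suc n) * ρ (suc (suc n)) ≡ ρ (suc n)
        u-ρ n = *-cancel-≡ (Pos-* (Pos-P (suc (suc n))) (Pos-P (suc n))) (begin
          P (suc (suc n)) * P (suc n) * (u (suc n) * ρ (suc (suc n)))
            ≡⟨ ring (P (suc (suc n)) ∷ P (suc n) ∷ u (suc n) ∷ ρ (suc (suc n)) ∷ []) (var 0 :* var 1 :* (var 2 :* var 3)) (var 2 :* (var 0 :* var 3 :* var 1)) refl ⟩
          u (suc n) * (P (suc (suc n)) * ρ (suc (suc n)) * P (suc n))
            ≡⟨ cong (λ v → u (suc n) * (v * P (suc n))) (P-ρ (suc n)) ⟩
          u (suc n) * (P (suc n) * P (suc n))
            ≡⟨ u-law n ⟩
          P (suc (suc n)) * P n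
            ≡⟨ cong (P (suc (suc n)) *_) (sym (P-ρ n)) ⟩
          P (suc (suc n)) * (P (suc n) * ρ (suc n))
            ≡⟨ sym (*-assoc _ _ _) ⟩
          P (suc (suc n)) * P (suc n) * ρ (suc n) ∎)

        tested-turan : ∀ {fa fb fc fd} → turanTest fa fb fc fd ≡ true →
          Pos (# 4 * ((# fb * # fb - # fa * # fc) * (# fc * # fc - # fb * # fd)) - (# fb * # fc - # fa * # fd) * (# fb * # fc - # fa * # fd))
        tested-turan {fa} {fb} {fc} {fd} e h = #Pos 0 (≤-trans (use slack {# lhsᴺ} {# rhsᴺ} (≡≤ (sym (#suc lhsᴺ)) (#mono (≤ᵇ-sound (suc lhsᴺ) rhsᴺ (proj₂ t₃))))) (≡≤ value h))
          where
          lhsᴺ = square (fb ℕ.* fc ∸ fa ℕ.* fd)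
          rhsᴺ = 4 ℕ.* ((fb ℕ.* fb ∸ fa ℕ.* fc) ℕ.* (fc ℕ.* fc ∸ fb ℕ.* fd))
          t₁ = both {fa ℕ.* fc ℕ.≤ᵇ fb ℕ.* fb} e
          t₂ = both {fb ℕ.* fd ℕ.≤ᵇ fc ℕ.* fc} (proj₂ t₁)
          t₃ = both {fa ℕ.* fd ℕ.≤ᵇ fb ℕ.* fc} (proj₂ t₂)
          difference : ∀ i j k l → (k ℕ.* l ℕ.≤ᵇ i ℕ.* j) ≡ true → # (i ℕ.* j ∸ k ℕ.* l) ≡ # i * # j - # k * # l
          difference i j k l t = trans (#-∸ (≤ᵇ-sound (k ℕ.* l) (i ℕ.* j) t)) (cong₂ _-_ (#-* i j) (#-* k l))
          value : # rhsᴺ - # lhsᴺ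
            ≡ # 4 * ((# fb * # fb - # fa * # fc) * (# fc * # fc - # fb * # fd)) - (# fb * # fc - # fa * # fd) * (# fb * # fc - # fa * # fd)
          value = cong₂ _-_
            (trans (#-* 4 _) (cong (# 4 *_) (trans (#-* (fb ℕ.* fb ∸ fa ℕ.* fc) _)
              (cong₂ _*_ (difference fb fb fa fc (proj₁ t₁)) (difference fc fc fb fd (proj₁ t₂))))))
            (trans (#-* (fb ℕ.* fc ∸ fa ℕ.* fd) _) (cong (λ v → v * v) (difference fb fc fa fd (proj₁ t₃))))

        conclusion : ∀ n → 95 ℕ.≤ n → Pos (four-term (u n) (u (suc n)))
        conclusion (suc m) (ℕ.s≤s l) = go (3 ℕ.+ m ℕ.≤? N₀)
          where
          go : Dec (3 ℕ.+ m ℕ.≤ N₀) → Pos (four-term (u (suc m)) (u (suc (suc m))))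
          go (yes b) = from-values {P m} {P (1 ℕ.+ m)} {P (2 ℕ.+ m)} {P (3 ℕ.+ m)} (Pos-P (1 ℕ.+ m)) (Pos-P (2 ℕ.+ m)) (u-law m) (u-law (suc m))
            (tested-turan {f m} {f (1 ℕ.+ m)} {f (2 ℕ.+ m)} {f (3 ℕ.+ m)} (early m l b))
          go (no ¬b) = from-ratios {ρ (suc m)} {ρ (2 ℕ.+ m)} {ρ (3 ℕ.+ m)} (ρ-nonneg (2 ℕ.+ m)) (ρ-nonneg (3 ℕ.+ m)) (u-ρ m) (u-ρ (suc m))
            (Inputs.Induction.turan inputs N₀ N₁≤N₀ room base (2 ℕ.+ m) (ℕₚ.≤-trans (late (suc m) (ℕₚ.≰⇒> ¬b)) (ℕₚ.n≤1+n (suc m))))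

-- The ordered ring of rational numbers

module Rationals where
  open import Data.Nat as ℕ using (ℕ; zero; suc)
  import Data.Nat.Properties as ℕₚ
  open import Data.Integer as ℤ using (ℤ; +_)
  import Data.Integer.Properties as ℤₚ
  open import Data.Rational using (ℚ; 0ℚ; 1ℚ; _/_; -_; toℚᵘ; _≤_; _+_; _*_; positive; nonNegative)
  import Data.Rational.Properties as ℚₚ
  open import Data.Rational.Unnormalised as ℚᵘ using (mkℚᵘ; *≡*)
  import Data.Rational.Unnormalised.Properties as ℚᵘₚ
  open import Relation.Nullary using (¬_)
  open import Relation.Binary.PropositionalEquality
  open import Defs using (_÷ℕ_)
  open OrderedRings

  *-nonneg′ : ∀ {x y} → 0ℚ ≤ x → 0ℚ ≤ y → 0ℚ ≤ x * y
  *-nonneg′ {x} {y} hx hy = ℚₚ.nonNegative⁻¹ (x * y) {{ℚₚ.nonNeg*nonNeg⇒nonNeg x {{nonNegative hx}} y {{nonNegative hy}}}}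

  *-cancel′ : ∀ {x y} → ¬ (x ≤ 0ℚ) → 0ℚ ≤ x * y → 0ℚ ≤ y
  *-cancel′ {x} {y} h k = ℚₚ.*-cancelˡ-≤-pos x {{positive (ℚₚ.≰⇒> h)}} (subst (_≤ x * y) (sym (ℚₚ.*-zeroʳ x)) k)

  rationals : OrderedRing
  rationals = record
    { A = ℚ
    ; _+_ = _+_
    ; _*_ = _*_
    ; -_ = -_
    ; 0# = 0ℚ
    ; 1# = 1ℚ
    ; isCommutativeRing = ℚₚ.+-*-isCommutativeRing
    ; _≤_ = _≤_
    ; ≤-refl = ℚₚ.≤-refl
    ; ≤-trans = ℚₚ.≤-trans
    ; ≤-antisym = ℚₚ.≤-antisym
    ; ≤-total = ℚₚ.≤-total
    ; +-mono-≤ = ℚₚ.+-mono-≤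
    ; *-nonneg = *-nonneg′
    ; 0≤1 = ℚₚ.nonNegative⁻¹ 1ℚ
    ; *-cancel = *-cancel′
    ; 1≰0 = λ h → ℚₚ.<-irrefl refl (ℚₚ.<-≤-trans (ℚₚ.positive⁻¹ 1ℚ) h)
    }

  open Ordered rationals using (#; #-0; #-suc; #-*)

  from-suc : ∀ n → + suc n / 1 ≡ 1ℚ + + n / 1
  from-suc n = ℚₚ.toℚᵘ-injective (ℚᵘₚ.≃-trans (ℚₚ.toℚᵘ-fromℚᵘ (mkℚᵘ (+ suc n) 0)) (ℚᵘₚ.≃-sym
    (ℚᵘₚ.≃-trans (ℚₚ.toℚᵘ-homo-+ 1ℚ (+ n / 1)) (ℚᵘₚ.≃-trans (ℚᵘₚ.+-congʳ (toℚᵘ 1ℚ) (ℚₚ.toℚᵘ-fromℚᵘ (mkℚᵘ (+ n) 0)))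
      (*≡* (cong (ℤ._* + 1) (cong (ℤ._+_ (+ 1)) (ℤₚ.*-identityʳ (+ n)))))))))

  #-value : ∀ n → # n ≡ + n / 1
  #-value zero = #-0
  #-value (suc n) = trans (#-suc n) (trans (cong (λ v → 1ℚ + v) (#-value n)) (sym (from-suc n)))

  quotient : ∀ a d → (+ a / suc d) * # (suc d) ≡ # a
  quotient a d = trans (cong ((+ a / suc d) *_) (#-value (suc d))) (trans (ℚₚ.toℚᵘ-injective
    (ℚᵘₚ.≃-trans (ℚₚ.toℚᵘ-homo-* (+ a / suc d) (+ suc d / 1)) (ℚᵘₚ.≃-trans
      (ℚᵘₚ.*-cong (ℚₚ.toℚᵘ-fromℚᵘ (mkℚᵘ (+ a) d)) (ℚₚ.toℚᵘ-fromℚᵘ (mkℚᵘ (+ suc d) 0)))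
      (ℚᵘₚ.≃-trans (*≡* (trans (ℤₚ.*-identityʳ _) (cong (λ v → + a ℤ.* + v) (sym (ℕₚ.*-identityʳ (suc d))))))
        (ℚᵘₚ.≃-sym (ℚₚ.toℚᵘ-fromℚᵘ (mkℚᵘ (+ a) 0))))))) (sym (#-value a)))

  reciprocal : ℕ → ℚ
  reciprocal n = + 1 / suc n

  reciprocal-law : ∀ n → # (suc n) * reciprocal n ≡ # 1
  reciprocal-law n = trans (ℚₚ.*-comm (# (suc n)) (reciprocal n)) (quotient 1 n)

  ÷-law : ∀ a b → 1 ℕ.≤ b → (a ÷ℕ b) * # b ≡ # a
  ÷-law a (suc d) _ = quotient a d

  ratio-law : (f : ℕ → ℕ) → (∀ n → 1 ℕ.≤ f n) → ∀ n →
    ((f (suc (suc n)) ℕ.* f n) ÷ℕ (f (suc n) ℕ.^ 2)) * (# (f (suc n)) * # (f (suc n))) ≡ # (f (suc (suc n))) * # (f n)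
  ratio-law f f-pos n = trans (cong (((f (suc (suc n)) ℕ.* f n) ÷ℕ (f (suc n) ℕ.^ 2)) *_)
      (sym (trans (cong (λ v → # (f (suc n) ℕ.* v)) (ℕₚ.*-identityʳ (f (suc n)))) (#-* (f (suc n)) (f (suc n))))))
    (trans (÷-law _ (f (suc n) ℕ.^ 2) (ℕₚ.*-mono-≤ (f-pos (suc n)) (ℕₚ.≤-trans (f-pos (suc n)) (ℕₚ.≤-reflexive (sym (ℕₚ.*-identityʳ _))))))
      (#-* (f (suc (suc n))) (f n)))

-- The theorem for partition numbers

open import Defs
open import Data.Nat using (ℕ; suc; _≥_)
open import Data.Rational using (ℚ; 0ℚ; 1ℚ; _+_; _-_; _*_; _<_; _/_)
open import Data.Integer using (+_)
import Data.Rational.Properties as ℚₚ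
open import Relation.Binary.PropositionalEquality
open OrderedRings
open Partitions
open TestResults
open TestedSequences
open Rationals
open Ordered rationals using (#-0; #-1)

partition-numbers : TestedSequence
partition-numbers = record
  { f = p
  ; positive = p-positive
  ; monotone = p-mono
  ; strict = p-strict
  ; recurrence = p-recurrence
  ; locally = local-holds
  ; early = turan-holds
  ; capped = cap-holds
  ; jump-test = jump-holds
  ; small-start = small-m₀
  ; small-end = small-N₁
  }

theorem1p3 : ∀ (n : ℕ) → n ≥ 95 →
    0ℚ < (+ 4 / 1) * (1ℚ - u n) * (1ℚ - u (suc n)) - (1ℚ - u n * u (suc n)) * (1ℚ - u n * u (suc n))
theorem1p3 n h = subst₂ _<_ #-0
  (cong₂ (λ x y → x * (y - u n) * (y - u (suc n)) - (y - u n * u (suc n)) * (y - u n * u (suc n))) (#-value 4) #-1)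
  (ℚₚ.≰⇒> (Analysis.Ratios.Quotients.Turan.conclusion rationals reciprocal reciprocal-law partition-numbers u (ratio-law p p-positive) n h))
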